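{- Let $k\ge 1$ and let $\lambda$ be a strict partition with $k$-abacus representation $(\alpha^{(1)},\dots,\alpha^{(k)})$. Then $$RQ^{(k)}_\lambda(X)=Q_{\alpha^{(k)}}(X)\prod_{1\le i\le\lfloor k/2\rfloor}Q_{\mu_i}(X).$$ Here, for $i<k/2$, $\mu_i$ is the underlying shape of the folded diagram $\alpha^{(i)}\diamond\alpha^{(k-i)}$, and for $i=k/2$ (when $k$ is even), $\mu_i$ is the underlying shape of $\alpha^{(k/2)}\diamond\varnothing$.
   Context: Conventions. Diagrams are drawn in French convention, with rows numbered from the bottom. A strict partition $\lambda=(\lambda_1>\cdots>\lambda_\ell>0)$ is identified with its shifted diagram $\{(c,r):1\le r\le \ell,\ r\le c\le r+\lambda_r-1\}$. The diagonal value of a cell is $\mathrm{diag}(c,r)=c-r+1$, and the main diagonal consists of the cells of value $1$. A subset $R\subseteq\lambda$ is removable if $\lambda\setminus R$ is a shifted diagram. Ribbons. A single ribbon is a nonempty edge-connected skew-shifted diagram whose cells lie on distinct diagonals. Its head $H(R)$ and tail $T(R)$ are its cells of largest and smallest diagonal value. A double ribbon in $\lambda$ is a union $R\cup S$ of disjoint single ribbons with $|R|\ge|S|$ such that $T(R)$ is on the main diagonal of $\lambda$, $T(S)$ is on the main diagonal of $\lambda\setminus R$, and $R\cup S$ is skew-shifted. Its head is $H(R)$. A $k$-ribbon is a single or double ribbon with $k$ cells. A $k$-core is a shifted diagram with no removable $k$-ribbon. Strips. A horizontal (resp. vertical) $k$-ribbon strip $\lambda\setminus\lambda^{(0)}$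 is given by a chain $\lambda^{(0)}\subset\cdots\subset\lambda^{(t)}=\lambda$ such that each $R_i=\lambda^{(i)}\setminus\lambda^{(i-1)}$ is a removable $k$-ribbon of $\lambda^{(i)}$, and $H(R_i)$ is in a column strictly right of (resp. a row strictly above) $H(R_{i-1})$. Semi-standard shifted $k$-ribbon tableau of shape $\lambda$. This is a chain $\lambda^{(0)}\subseteq\lambda^{(1')}\subseteq\lambda^{(1)}\subseteq\lambda^{(2')}\subseteq\cdots\subseteq\lambda^{(m)}=\lambda$, together with the ribbon decompositions of the strips, such that: - $\lambda^{(0)}$ is a $k$-core; - $\lambda^{(i')}\setminus\lambda^{(i-1)}$ is a vertical $k$-ribbon strip, whose ribbons are labelled $i'$; - $\lambda^{(i)}\setminus\lambda^{(i')}$ is a horizontal $k$-ribbon strip, whose ribbons are labelled $i$. The ribbon Q-function is $RQ^{(k)}_\lambda(X)=\sum_S X^{|S|}$, summed over these tableaux, where $X^{|S|}=\prod_i x_i^{\#\{\text{ribbons labelled } i \text{ or } i'\}}$. Schur Q-functions. A semi-standard shifted tableau of skew-shifted shape $\lambda\setminus\mu$ is a filling by the marked alphabet $1'<1<2'<2<\cdots$ such that: - rows weakly increase left to right and columns weakly increase bottom to top; - no marked letter is repeated in a row; - no unmarked letter is repeated in a column. Define $Q_{\lambda\setminus\mu}(X)=\sum_S X^{|S|}$, with $X^{|S|}=\prod_i x_i^{\#\{\text{cells containing } i \text{ or } i'\}}$, and $Q_\lambda=Q_{\lambda\setminus\varnothing}$. For an ordinary (unshifted) partition $\gamma$ with $\ell$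 rows, let $\gamma+\delta_\ell$ be the strict partition with parts $\gamma_j+\ell-j+1$ and $\delta_\ell=(\ell,\ell-1,\dots,1)$. Then set $Q_\gamma:=Q_{(\gamma+\delta_\ell)\setminus\delta_\ell}$; the skew-shifted diagram $(\gamma+\delta_\ell)\setminus\delta_\ell$ is a translate of the Young diagram of $\gamma$. Abacus representation. $\alpha^{(i)}$ is the strict partition with parts $(p-i)/k+1$, where $p$ runs over the parts of $\lambda$ with $p\equiv i\pmod k$. Combination. For strict partitions $\alpha$ and $\beta$ with $a$ and $b$ rows, let $n=\min(a,b)$. Then $\alpha\diamond\beta=(C,\{x=y\})$, where $$C=\{(y-(a-n),x-(a-n)):(x,y)\in\alpha,\ x>a-n\}\cup\{(x-(b-n),y-(b-n)):(x,y)\in\beta,\ x>b-n\}.$$ The set $C$ is a translate of a Young diagram, whose partition is the underlying shape. -}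

module Defs where

open import Data.Nat using (ℕ; zero; suc; _+_; _*_; _∸_; _≤_; _<_; _>_; _≥_; _⊓_; NonZero)
open import Data.Nat.DivMod using (_/_; _%_)
open import Data.Nat.Properties using (_≟_)
open import Data.Integer as ℤ using (ℤ; +_)
open import Data.Bool using (Bool; true; false)
open import Data.Maybe using (Maybe; just; nothing)
open import Data.List using (List; []; _∷_; length; map; filter; zipWith)
open import Data.List.Relation.Unary.All using (All)
open import Data.List.Relation.Unary.Linked using (Linked)
open import Data.List.Relation.Unary.Unique.Propositional using (Unique)
open import Data.List.Membership.Propositional using (_∈_; _∉_)
open import Data.Product using (Σ; ∃; ∃-syntax; _×_; _,_; proj₁; proj₂)
open import Data.Sum using (_⊎_)
open import Data.Unit using (⊤)
open import Relation.Nullary using (¬_)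
open import Relation.Binary.PropositionalEquality using (_≡_; _≢_)

Iff : Set → Set → Set
Iff A B = (A → B) × (B → A)

record Enumerates {A : Set} (P : A → Set) (n : ℕ) : Set where
  field
    elems    : List A
    unique   : Unique elems
    sound    : ∀ x → x ∈ elems → P x
    complete : ∀ x → P x → x ∈ elems
    size     : length elems ≡ n

nth : {A : Set} → List A → ℕ → Maybe A
nth []       _       = nothing
nth (x ∷ xs) zero    = just x
nth (x ∷ xs) (suc i) = nth xs i

-- part r (1-indexed) of a partition; 0 if r = 0 or r > length
part : List ℕ → ℕ → ℕ
part []       _             = 0
part (p ∷ ps) zero          = 0
part (p ∷ ps) (suc zero)    = p
part (p ∷ ps) (suc (suc r)) = part ps (suc r)

StrictPartition : List ℕ → Set
StrictPartition la = All (λ p → 0 < p) la × Linked _>_ la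

IsPartition : List ℕ → Set
IsPartition ga = All (λ p → 0 < p) ga × Linked _≥_ ga

-- Cells (column c, row r), French convention, rows numbered from bottom

Cell : Set
Cell = ℕ × ℕ

col row : Cell → ℕ
col = proj₁
row = proj₂

-- diag (c , r) = c - r + 1  (cells of shifted diagrams have c ≥ r)
diag : Cell → ℕ
diag (c , r) = suc (c ∸ r)

CellSet : Set₁
CellSet = Cell → Set

Dg : List ℕ → CellSet
Dg la (c , r) = 1 ≤ r × r ≤ c × c < r + part la r

Diff : List ℕ → List ℕ → CellSet
Diff la mu x = Dg la x × ¬ Dg mu x

SkewShifted : CellSet → Set
SkewShifted D = Σ (List ℕ) λ la → Σ (List ℕ) λ mu →
  StrictPartition la × StrictPartition mu × (∀ x → Dg mu x → Dg la x) ×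
  (∀ x → Iff (D x) (Diff la mu x))

data Adj : Cell → Cell → Set where
  right : ∀ {c r} → Adj (c , r) (suc c , r)
  left  : ∀ {c r} → Adj (suc c , r) (c , r)
  up    : ∀ {c r} → Adj (c , r) (c , suc r)
  down  : ∀ {c r} → Adj (c , suc r) (c , r)

-- path of edge-adjacent cells staying inside D (start cell assumed in D)
data Path (D : CellSet) : Cell → Cell → Set where
  stop : ∀ {x} → Path D x x
  step : ∀ {x y z} → Adj x y → D y → Path D y z → Path D x z

EdgeConnected : CellSet → Set
EdgeConnected D = ∀ x y → D x → D y → Path D x y

DistinctDiagonals : CellSet → Set
DistinctDiagonals D = ∀ x y → D x → D y → diag x ≡ diag y → x ≡ y

SingleRibbon : CellSet → Set
SingleRibbon D = (∃ λ x → D x) × EdgeConnected D × SkewShifted D × DistinctDiagonals D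

IsHead IsTail : CellSet → Cell → Set
IsHead D h = D h × (∀ x → D x → diag x ≤ diag h)
IsTail D t = D t × (∀ x → D x → diag t ≤ diag x)

inL : List Cell → CellSet
inL R x = x ∈ R

DoubleRibbonWitness : List ℕ → CellSet → List Cell → List Cell → Set
DoubleRibbonWitness la D R S =
  SingleRibbon (inL R) × SingleRibbon (inL S) ×
  Unique R × Unique S × (∀ x → x ∈ R → x ∉ S) ×
  (∀ x → Iff (D x) (x ∈ R ⊎ x ∈ S)) ×
  length S ≤ length R ×
  (∃ λ t → IsTail (inL R) t × diag t ≡ 1 × Dg la t) ×
  (∃ λ t → IsTail (inL S) t × diag t ≡ 1 × Dg la t × t ∉ R) ×
  SkewShifted D

DoubleRibbon : List ℕ → CellSet → Set
DoubleRibbon la D = Σ (List Cell) λ R → Σ (List Cell) λ S → DoubleRibbonWitness la D R S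

KRibbon : ℕ → List ℕ → CellSet → Set
KRibbon k la D = (∀ x → D x → Dg la x) × (SingleRibbon D ⊎ DoubleRibbon la D) × Enumerates D k

RibbonHead : List ℕ → CellSet → Cell → Set
RibbonHead la D h =
  (SingleRibbon D × IsHead D h) ⊎
  (Σ (List Cell) λ R → Σ (List Cell) λ S → DoubleRibbonWitness la D R S × IsHead (inL R) h)

-- k-core: no removable k-ribbon. A removable R ⊆ la is one with la \ R a
-- shifted diagram mu, i.e. R = la \ mu.
KCore : ℕ → List ℕ → Set
KCore k la = ∀ mu → StrictPartition mu → (∀ x → Dg mu x → Dg la x) →
  ¬ KRibbon k la (Diff la mu)

-- Marked alphabet 1' < 1 < 2' < 2 < ...

record Label : Set where
  constructor lab
  field
    idx    : ℕ      -- the letter i (must be ≥ 1)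
    marked : Bool
open Label public

code : Label → ℕ
code (lab i true)  = 2 * i
code (lab i false) = suc (2 * i)

_≤L_ : Label → Label → Set
l ≤L l' = code l ≤ code l'

-- exponent vector: wAt w i = exponent of x_i (i ≥ 1), 0 beyond w
wAt : List ℕ → ℕ → ℕ
wAt w zero = 0
wAt w (suc i) with nth w i
... | just m  = m
... | nothing = 0

-- Semi-standard shifted k-ribbon tableaux.
-- Encoded as (λ^(0) , steps) where steps lists, in chain order, the shapes
-- after adding each ribbon together with the label of that ribbon.

Step : Set
Step = List ℕ × Label

HeadOK : Maybe (List ℕ × List ℕ × Label) → List ℕ → List ℕ → Label → Set
HeadOK nothing ν cur l = ⊤
HeadOK (just (μp , νp , lp)) ν cur l =
  lp ≤L l ×
  (lp ≡ l → ∀ h hp → RibbonHead ν (Diff ν cur) h → RibbonHead νp (Diff νp μp) hp →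
     HeadRel (marked l) hp h)
  where
  HeadRel : Bool → Cell → Cell → Set
  HeadRel true  hp h = row hp < row h   -- vertical strip (label i')
  HeadRel false hp h = col hp < col h   -- horizontal strip (label i)

ValidSteps : ℕ → List ℕ → Maybe (List ℕ × List ℕ × Label) → List Step → List ℕ → Set
ValidSteps k cur prev [] la = cur ≡ la
ValidSteps k cur prev ((ν , l) ∷ rest) la =
  StrictPartition ν × (∀ x → Dg cur x → Dg ν x) × KRibbon k ν (Diff ν cur) ×
  1 ≤ idx l × HeadOK prev ν cur l × ValidSteps k ν (just (cur , ν , l)) rest la

RibbonTableau : ℕ → List ℕ → List ℕ × List Step → Set
RibbonTableau k la (ν₀ , steps) = StrictPartition ν₀ × KCore k ν₀ × ValidSteps k ν₀ nothing steps la

countLabels : ℕ → List Label → ℕ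
countLabels i ls = length (filter (λ l → idx l ≟ i) ls)

RibbonTabW : ℕ → List ℕ → List ℕ → List ℕ × List Step → Set
RibbonTabW k la w (ν₀ , steps) =
  RibbonTableau k la (ν₀ , steps) × (∀ i → countLabels i (map proj₂ steps) ≡ wAt w i)

-- Semi-standard shifted tableaux of skew-shifted shape la \ mu.
-- A filling is the list of rows (row 1 first), row r listing left to right
-- the labels of the cells (c , r), r + mu_r ≤ c < r + la_r.

Filling : Set
Filling = List (List Label)

rowAt : Filling → ℕ → List Label
rowAt f zero = []
rowAt f (suc r) with nth f r
... | just xs = xs
... | nothing = []

At : List ℕ → Filling → Cell → Label → Set
At mu f (c , r) l = 1 ≤ r × r + part mu r ≤ c × nth (rowAt f r) (c ∸ (r + part mu r)) ≡ just l

ShTab : List ℕ → List ℕ → Filling → Set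
ShTab la mu f =
  length f ≡ length la ×
  (∀ r → length (rowAt f r) ≡ part la r ∸ part mu r) ×
  (∀ x l → At mu f x l → 1 ≤ idx l) ×
  (∀ c c' r l l' → At mu f (c , r) l → At mu f (c' , r) l' → c ≤ c' → l ≤L l') ×
  (∀ c r r' l l' → At mu f (c , r) l → At mu f (c , r') l' → r ≤ r' → l ≤L l') ×
  (∀ c c' r l → At mu f (c , r) l → At mu f (c' , r) l → c ≢ c' → marked l ≡ false) ×
  (∀ c r r' l → At mu f (c , r) l → At mu f (c , r') l → r ≢ r' → marked l ≡ true)

countF : ℕ → Filling → ℕ
countF i [] = 0
countF i (xs ∷ f) = countLabels i xs + countF i f

delta : ℕ → List ℕ
delta zero = []
delta (suc n) = suc n ∷ delta n

plusDelta : List ℕ → List ℕ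
plusDelta ga = zipWith _+_ ga (delta (length ga))

-- tableaux for Q_γ, γ an ordinary partition: shape (γ + δ_ℓ) \ δ_ℓ
QTab : List ℕ → Filling → Set
QTab ga = ShTab (plusDelta ga) (delta (length ga))

QTabs : (ℕ → List ℕ) → ℕ → List Filling → Set
QTabs μ i [] = ⊤
QTabs μ i (f ∷ fs) = QTab (μ i) f × QTabs μ (suc i) fs

countFs : ℕ → List Filling → ℕ
countFs i [] = 0
countFs i (f ∷ fs) = countF i f + countFs i fs

-- tuples (f0 , f1 , ... , fm) contributing to the coefficient of x^w in
-- Q_{αk} · ∏_{i=1}^{m} Q_{μ i}
ProductTabW : List ℕ → (ℕ → List ℕ) → ℕ → List ℕ → List Filling → Set
ProductTabW αk μ m w fs = Σ Filling λ f0 → Σ (List Filling) λ rest →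
  fs ≡ f0 ∷ rest × ShTab αk [] f0 × length rest ≡ m × QTabs μ 1 rest ×
  (∀ i → countFs i fs ≡ wAt w i)

abacus : (k : ℕ) .{{_ : NonZero k}} → List ℕ → ℕ → List ℕ
abacus k la i = map (λ p → (p ∸ i) / k + 1) (filter (λ p → p % k ≟ i % k) la)

Comb : List ℕ → List ℕ → ℤ × ℤ → Set
Comb α β (X , Y) =
  (Σ ℕ λ x → Σ ℕ λ y → Dg α (x , y) × a ∸ n < x ×
     X ≡ (+ y) ℤ.- (+ (a ∸ n)) × Y ≡ (+ x) ℤ.- (+ (a ∸ n))) ⊎
  (Σ ℕ λ x → Σ ℕ λ y → Dg β (x , y) × b ∸ n < x ×
     X ≡ (+ x) ℤ.- (+ (b ∸ n)) × Y ≡ (+ y) ℤ.- (+ (b ∸ n)))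
  where
  a = length α
  b = length β
  n = a ⊓ b

YoungCell : List ℕ → Cell → Set
YoungCell ga (x , y) = 1 ≤ y × 1 ≤ x × x ≤ part ga y

UnderlyingShape : List ℕ → List ℕ → List ℕ → Set
UnderlyingShape α β ga = IsPartition ga × Σ ℤ λ dx → Σ ℤ λ dy →
  ∀ X Y → Iff (Comb α β (X , Y))
              (Σ ℕ λ x → Σ ℕ λ y → YoungCell ga (x , y) × X ≡ (+ x) ℤ.+ dx × Y ≡ (+ y) ℤ.+ dy)

{-# OPTIONS --safe #-}
module Submission where

-- A removable k-ribbon is a move on the abacus, and the diagonal of its head is the key p of the move: a bead passes
-- from p - k to p (0 being a source of beads), or two beads with sum k and maximum p are created.  As the heads of a
-- strip compare like their keys, a ribbon tableau is a set of labelled keys, to be carried out in the order of the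
-- labels, with keys decreasing for primed and increasing for unprimed labels.  The case k = 1 is the standardisation
-- of shifted fillings, also of skew ones.
--
-- Whether such a set is a tableau can be tested on each position separately, in terms of the two keys that fill and
-- vacate it.  Hence the multiples of k and the pairs of runners j and k - j are independent.  On such a pair the
-- positions form one path: it descends the runner j, passes from j to k - j, and ascends the runner k - j.
-- Exchanging beads and gaps on the runner j turns the path into the abacus of a skew shifted shape, a translate of the
-- Young diagram underlying α⁽ʲ⁾ ⋄ α⁽ᵏ⁻ʲ⁾.  Only the marks have to be corrected: if one letter moves along two
-- consecutive edges of the path, the position in between determines the mark of the one with the larger key.  So
-- on a maximal run of consecutive edges exactly one mark is free, and reversing the runner j carries it from one end
-- of the run to the other.

open import Defs
open import Data.Nat using (ℕ; _*_; _∸_; _≤_; _<_; NonZero)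
open import Data.Nat.DivMod using (_/_)
open import Data.List using (List; [])
open import Data.Product using (∃-syntax; _×_)
open import Relation.Binary.PropositionalEquality using (_≡_)
open import Data.Bool using (Bool; true; false; T; _∧_; _∨_; if_then_else_; not)
open import Data.Bool.Properties using (not-involutive)
open import Data.Empty using (⊥; ⊥-elim)
open import Data.Fin using (Fin; zero; suc)
open import Data.List using (_∷_; _++_; map; length; filter; concatMap; applyUpTo; applyDownFrom)
open import Data.List.Properties using (length-++; length-map; length-applyUpTo; length-filter; map-++; filter-++)
open import Data.List.Membership.Propositional using (_∈_; _∉_)
open import Data.List.Membership.Propositional.Properties
open import Data.List.Relation.Unary.All as All using (All; []; _∷_)
open import Data.List.Relation.Unary.AllPairs as AllPairs using (AllPairs; []; _∷_)
import Data.List.Relation.Unary.AllPairs.Properties as AP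
open import Data.List.Relation.Unary.Any using (here; there)
open import Data.List.Relation.Unary.Linked using (Linked; []; [-]; _∷_)
import Data.List.Relation.Unary.Linked.Properties as LP
open import Data.List.Relation.Unary.Unique.Propositional using (Unique)
open import Data.Maybe using (Maybe; just; nothing; fromMaybe)
open import Data.Maybe.Properties using (just-injective)
open import Data.Nat
open import Data.Nat.Divisibility using (n∣m*n)
open import Data.Nat.DivMod
open import Data.Nat.Properties
open import Data.Product using (Σ; ∃; _,_; proj₁; proj₂)
open import Data.Sum using (_⊎_; inj₁; inj₂)
open import Data.Unit using (tt)
open import Data.Vec using ([]; _∷_)
open import Function using (_∘_; id; case_of_)
open import Relation.Binary using (tri<; tri≈; tri>)
open import Relation.Binary.PropositionalEquality
open import Relation.Nullary
open import Relation.Nullary.Decidable using (_×-dec_; _⊎-dec_; map′)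
import Data.Integer as ℤ
import Data.Integer.Properties as ℤP

-- The identity of series is proved coefficientwise: for each exponent vector `w` the words `WordW`
-- form a finite decidable set, which is related one to one to the ribbon tableaux and to the tuples
-- of fillings.
--
-- A position can be tested alone because within one letter it meets at most four entries, always in
-- the order vacating, filling (primed), filling, vacating (unprimed). If it is both filled and
-- vacated, an occupied position needs the vacating key first, hence primed, and an empty one needs
-- it last, hence unprimed; the filling key may carry either mark. Exchanging beads and gaps
-- exchanges filling and vacating, so on a reversed runner the position binds the mark of the other
-- key.
--
-- A ribbon tableau contains its k-core, whereas its word does not, so the core must be shown to be
-- determined. Along the unfolded path of a pair of runners every bar carries one bead one step
-- further. Hence the number of beads is conserved, and a configuration from which nothing can be
-- removed has its beads packed at the lower end.

module LinearArithmetic where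

  open import Data.List.Relation.Unary.All.Properties using (++⁺)
  open import Data.Vec using (Vec; lookup; zipWith; replicate; tabulate) renaming (map to mapV)
  open import Data.Vec.N-ary using (N-ary; _$ⁿ_)

  -- Fourier-Motzkin elimination for linear arithmetic over the naturals

  data Expr (n : ℕ) : Set where
    var  : Fin n → Expr n
    con  : ℕ → Expr n
    _:+_ : Expr n → Expr n → Expr n

  ⟦_⟧ : ∀ {n} → Expr n → Vec ℕ n → ℕ
  ⟦ var i ⟧ ρ  = lookup ρ i
  ⟦ con c ⟧ ρ  = c
  ⟦ e :+ f ⟧ ρ = ⟦ e ⟧ ρ + ⟦ f ⟧ ρ

  data Atom (n : ℕ) : Set where
    _:≤_ _:<_ _:=_ : Expr n → Expr n → Atom n
    :⊥ : Atom n

  ⟦_⟧ᵃ : ∀ {n} → Atom n → Vec ℕ n → Set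
  ⟦ e :≤ f ⟧ᵃ ρ = ⟦ e ⟧ ρ ≤ ⟦ f ⟧ ρ
  ⟦ e :< f ⟧ᵃ ρ = ⟦ e ⟧ ρ < ⟦ f ⟧ ρ
  ⟦ e := f ⟧ᵃ ρ = ⟦ e ⟧ ρ ≡ ⟦ f ⟧ ρ
  ⟦ :⊥ ⟧ᵃ ρ     = ⊥

  data Sequent (n : ℕ) : Set where
    _:⇒_ : Atom n → Sequent n → Sequent n
    ⊢_   : Atom n → Sequent n

  infixl 6 _:+_
  infix 5 _:≤_ _:<_ _:=_
  infixr 3 _:⇒_
  infix 4 ⊢_

  ⟦_⟧ˢ : ∀ {n} → Sequent n → Vec ℕ n → Set
  ⟦ a :⇒ s ⟧ˢ ρ = ⟦ a ⟧ᵃ ρ → ⟦ s ⟧ˢ ρ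
  ⟦ ⊢ a ⟧ˢ ρ    = ⟦ a ⟧ᵃ ρ

  -- the affine form c + Σ aᵢ xᵢ
  Affine : ℕ → Set
  Affine n = ℕ × Vec ℕ n

  dot : ∀ {n} → Vec ℕ n → Vec ℕ n → ℕ
  dot [] []             = 0
  dot (a ∷ as) (x ∷ xs) = a * x + dot as xs

  eval : ∀ {n} → Affine n → Vec ℕ n → ℕ
  eval (c , as) ρ = c + dot as ρ

  Ineq : ℕ → Set
  Ineq n = Affine n × Affine n

  Holds : ∀ {n} → Vec ℕ n → Ineq n → Set
  Holds ρ (l , r) = eval l ρ ≤ eval r ρ

  _⊞_ : ∀ {n} → Affine n → Affine n → Affine n
  (c , as) ⊞ (d , bs) = c + d , zipWith _+_ as bs

  _⊠_ : ∀ {n} → ℕ → Affine n → Affine n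
  m ⊠ (c , as) = m * c , mapV (m *_) as

  rearrange : ∀ a b c d → (a + b) + (c + d) ≡ (a + c) + (b + d)
  rearrange a b c d = begin
    (a + b) + (c + d) ≡⟨ +-assoc a b (c + d) ⟩
    a + (b + (c + d)) ≡⟨ cong (a +_) (trans (sym (+-assoc b c d)) (trans (cong (_+ d) (+-comm b c)) (+-assoc c b d))) ⟩
    a + (c + (b + d)) ≡⟨ sym (+-assoc a c (b + d)) ⟩
    (a + c) + (b + d) ∎
    where open ≡-Reasoning

  dot-+ : ∀ {n} (as bs ρ : Vec ℕ n) → dot (zipWith _+_ as bs) ρ ≡ dot as ρ + dot bs ρ
  dot-+ [] [] [] = refl
  dot-+ (a ∷ as) (b ∷ bs) (x ∷ ρ) =
    trans (cong₂ _+_ (*-distribʳ-+ x a b) (dot-+ as bs ρ)) (rearrange (a * x) (b * x) (dot as ρ) (dot bs ρ))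

  dot-* : ∀ {n} m (as ρ : Vec ℕ n) → dot (mapV (m *_) as) ρ ≡ m * dot as ρ
  dot-* m [] [] = sym (*-zeroʳ m)
  dot-* m (a ∷ as) (x ∷ ρ) =
    trans (cong₂ _+_ (*-assoc m a x) (dot-* m as ρ)) (sym (*-distribˡ-+ m (a * x) (dot as ρ)))

  eval-⊞ : ∀ {n} (l r : Affine n) ρ → eval (l ⊞ r) ρ ≡ eval l ρ + eval r ρ
  eval-⊞ (c , as) (d , bs) ρ =
    trans (cong (c + d +_) (dot-+ as bs ρ)) (rearrange c d (dot as ρ) (dot bs ρ))

  eval-⊠ : ∀ {n} m (l : Affine n) ρ → eval (m ⊠ l) ρ ≡ m * eval l ρ
  eval-⊠ m (c , as) ρ = trans (cong (m * c +_) (dot-* m as ρ)) (sym (*-distribˡ-+ m c (dot as ρ)))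

  dot-zero : ∀ {n} (ρ : Vec ℕ n) → dot (replicate n 0) ρ ≡ 0
  dot-zero [] = refl
  dot-zero (x ∷ ρ) = dot-zero ρ

  unit : ∀ {n} → Fin n → Vec ℕ n
  unit {suc n} zero    = 1 ∷ replicate n 0
  unit {suc n} (suc i) = 0 ∷ unit i

  dot-unit : ∀ {n} (i : Fin n) ρ → dot (unit i) ρ ≡ lookup ρ i
  dot-unit zero (x ∷ ρ) = trans (cong₂ _+_ (*-identityˡ x) (dot-zero ρ)) (+-identityʳ x)
  dot-unit (suc i) (x ∷ ρ) = dot-unit i ρ

  affine : ∀ {n} → Expr n → Affine n
  affine (var i)  = 0 , unit i
  affine (con c)  = c , replicate _ 0
  affine (e :+ f) = affine e ⊞ affine f

  affine-correct : ∀ {n} (e : Expr n) ρ → eval (affine e) ρ ≡ ⟦ e ⟧ ρ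
  affine-correct (var i) ρ = dot-unit i ρ
  affine-correct (con c) ρ = trans (cong (c +_) (dot-zero ρ)) (+-identityʳ c)
  affine-correct (e :+ f) ρ =
    trans (eval-⊞ (affine e) (affine f) ρ) (cong₂ _+_ (affine-correct e ρ) (affine-correct f ρ))

  -- p x + l ≤ q x + r, where x is the variable to be eliminated
  Solved : ℕ → Set
  Solved n = ℕ × ℕ × Ineq n

  HoldsAt : ∀ {n} → ℕ → Vec ℕ n → Solved n → Set
  HoldsAt x ρ (p , q , l , r) = p * x + eval l ρ ≤ q * x + eval r ρ

  -- Truncated subtraction removes the common multiple of x, so one of the two coefficients is zero
  -- and every inequality becomes an upper bound for x, a lower bound for x, or free of x.
  solve : ∀ {n} → Ineq (suc n) → Solved n
  solve ((c , a ∷ as) , (d , b ∷ bs)) = a ∸ b , b ∸ a , (c , as) , (d , bs)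

  swap-in : ∀ c m n → c + (m + n) ≡ m + (c + n)
  swap-in c m n = trans (sym (+-assoc c m n)) (trans (cong (_+ n) (+-comm c m)) (+-assoc m c n))

  solve-sound : ∀ {n} (i : Ineq (suc n)) x ρ → Holds (x ∷ ρ) i → HoldsAt x ρ (solve i)
  solve-sound ((c , a ∷ as) , (d , b ∷ bs)) x ρ h =
    +-cancelˡ-≤ (a ⊓ b * x) _ _ (≤-trans (≤-reflexive (eq a b (c + dot as ρ)))
      (≤-trans (≤-reflexive (sym (swap-in c (a * x) (dot as ρ)))) (≤-trans h
        (≤-trans (≤-reflexive (swap-in d (b * x) (dot bs ρ)))
          (≤-reflexive (sym (trans (cong (λ m → m * x + ((b ∸ a) * x + (d + dot bs ρ))) (⊓-comm a b))
            (eq b a (d + dot bs ρ)))))))))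
    where
    eq : ∀ a b e → a ⊓ b * x + ((a ∸ b) * x + e) ≡ a * x + e
    eq a b e = trans (sym (+-assoc (a ⊓ b * x) _ e))
      (cong (_+ e) (trans (sym (*-distribʳ-+ x (a ⊓ b) (a ∸ b))) (cong (_* x) (m⊓n+n∸m≡n′ a b))))
      where
      m⊓n+n∸m≡n′ : ∀ a b → a ⊓ b + (a ∸ b) ≡ a
      m⊓n+n∸m≡n′ zero b = 0∸n≡0 b
      m⊓n+n∸m≡n′ (suc a) zero = refl
      m⊓n+n∸m≡n′ (suc a) (suc b) = cong suc (m⊓n+n∸m≡n′ a b)

  -- An upper and a lower bound for x are each multiplied by the coefficient in the other and added,
  -- so that x cancels. Other pairs contribute nothing.
  resolve : ∀ {n} → Solved n → Solved n → List (Ineq n)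
  resolve (suc p , zero , l , r) (zero , suc q , l′ , r′) =
    (((suc q ⊠ l) ⊞ (suc p ⊠ l′)) , ((suc q ⊠ r) ⊞ (suc p ⊠ r′))) ∷ []
  resolve _ _ = []

  resolve-sound : ∀ {n} (s t : Solved n) x ρ → HoldsAt x ρ s → HoldsAt x ρ t → All (Holds ρ) (resolve s t)
  resolve-sound (suc p , zero , l , r) (zero , suc q , l′ , r′) x ρ h h′ =
    subst₂ _≤_ (sym (ev l l′)) (sym (ev r r′))
      (+-cancelˡ-≤ (Q * (P * x)) _ _ (≤-trans (≤-reflexive lhs) (≤-trans (+-mono-≤ (*-monoʳ-≤ Q h) (*-monoʳ-≤ P h′)) (≤-reflexive rhs)))) ∷ []
    where
    P = suc p
    Q = suc q
    ev : ∀ l l′ → eval ((Q ⊠ l) ⊞ (P ⊠ l′)) ρ ≡ Q * eval l ρ + P * eval l′ ρ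
    ev l l′ = trans (eval-⊞ (Q ⊠ l) (P ⊠ l′) ρ) (cong₂ _+_ (eval-⊠ Q l ρ) (eval-⊠ P l′ ρ))
    lhs : Q * (P * x) + (Q * eval l ρ + P * eval l′ ρ) ≡ Q * (P * x + eval l ρ) + P * eval l′ ρ
    lhs = trans (sym (+-assoc (Q * (P * x)) _ _)) (cong (_+ P * eval l′ ρ) (sym (*-distribˡ-+ Q (P * x) (eval l ρ))))
    rhs : Q * eval r ρ + P * (Q * x + eval r′ ρ) ≡ Q * (P * x) + (Q * eval r ρ + P * eval r′ ρ)
    rhs = trans (cong (Q * eval r ρ +_) (trans (*-distribˡ-+ P (Q * x) (eval r′ ρ))
            (cong (_+ P * eval r′ ρ) (trans (sym (*-assoc P Q x)) (trans (cong (_* x) (*-comm P Q)) (*-assoc Q P x))))))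
          (swap-in (Q * eval r ρ) (Q * (P * x)) (P * eval r′ ρ))
  resolve-sound (zero , _ , _) _ x ρ h h′ = []
  resolve-sound (suc _ , suc _ , _) _ x ρ h h′ = []
  resolve-sound (suc _ , zero , _) (zero , zero , _) x ρ h h′ = []
  resolve-sound (suc _ , zero , _) (suc _ , _ , _) x ρ h h′ = []

  keep : ∀ {n} → Solved n → List (Ineq n)
  keep (zero , zero , i) = i ∷ []
  keep _ = []

  keep-sound : ∀ {n} (s : Solved n) x ρ → HoldsAt x ρ s → All (Holds ρ) (keep s)
  keep-sound (zero , zero , i) x ρ h = h ∷ []
  keep-sound (zero , suc _ , i) x ρ h = []
  keep-sound (suc _ , _ , i) x ρ h = []

  concat-sound : ∀ {A B : Set} {P : A → Set} {Q : B → Set} (f : A → List B) → (∀ a → P a → All Q (f a)) →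
    ∀ {as} → All P as → All Q (concatMap f as)
  concat-sound f h [] = []
  concat-sound f h (p ∷ ps) = ++⁺ (h _ p) (concat-sound f h ps)

  mapSolve : ∀ {n} → List (Ineq (suc n)) → List (Solved n)
  mapSolve [] = []
  mapSolve (i ∷ is) = solve i ∷ mapSolve is

  mapSolve-sound : ∀ {n} (is : List (Ineq (suc n))) x ρ → All (Holds (x ∷ ρ)) is → All (HoldsAt x ρ) (mapSolve is)
  mapSolve-sound [] x ρ [] = []
  mapSolve-sound (i ∷ is) x ρ (h ∷ hs) = solve-sound i x ρ h ∷ mapSolve-sound is x ρ hs

  _⊑_ : ∀ {n} → Vec ℕ n → Vec ℕ n → Bool
  [] ⊑ [] = true
  (a ∷ as) ⊑ (b ∷ bs) = (a ≤ᵇ b) ∧ (as ⊑ bs)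

  -- The variables being ≥ 0, some inequalities are trivial.
  prune : ∀ {n} → List (Ineq n) → List (Ineq n)
  prune [] = []
  prune (i@((c , as) , (d , bs)) ∷ is) = if (c ≤ᵇ d) ∧ (as ⊑ bs) then prune is else i ∷ prune is

  prune-sound : ∀ {n} (is : List (Ineq n)) ρ → All (Holds ρ) is → All (Holds ρ) (prune is)
  prune-sound [] ρ [] = []
  prune-sound (i@((c , as) , (d , bs)) ∷ is) ρ (h ∷ hs) with (c ≤ᵇ d) ∧ (as ⊑ bs)
  ... | true  = prune-sound is ρ hs
  ... | false = h ∷ prune-sound is ρ hs

  -- The lower bound 0 ≤ x, to be resolved against every upper bound of the eliminated variable.
  nonneg : ∀ {n} → Solved n
  nonneg {n} = 0 , 1 , (0 , replicate n 0) , (0 , replicate n 0)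

  nonneg-sound : ∀ {n} x (ρ : Vec ℕ n) → HoldsAt x ρ nonneg
  nonneg-sound {n} x ρ = m≤n+m (eval (0 , replicate n 0) ρ) (1 * x)

  eliminate : ∀ {n} → List (Ineq (suc n)) → List (Ineq n)
  eliminate {n} is = concatMap keep ss ++ concatMap (λ s → concatMap (resolve s) ss) ss
    where
    ss : List (Solved n)
    ss = nonneg ∷ mapSolve is

  eliminate-sound : ∀ {n} (is : List (Ineq (suc n))) x ρ → All (Holds (x ∷ ρ)) is → All (Holds ρ) (eliminate is)
  eliminate-sound {n} is x ρ hs =
    ++⁺ (concat-sound keep (λ s → keep-sound s x ρ) ss)
        (concat-sound _ (λ s h → concat-sound (resolve s) (λ t → resolve-sound s t x ρ h) ss) ss)
    where
    ss : All (HoldsAt x ρ) (nonneg ∷ mapSolve is)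
    ss = nonneg-sound x ρ ∷ mapSolve-sound is x ρ hs

  contradictory : List (Ineq 0) → Bool
  contradictory [] = false
  contradictory (((c , _) , (d , _)) ∷ is) = (d <ᵇ c) ∨ contradictory is

  contradictory-sound : ∀ is → T (contradictory is) → ¬ All (Holds []) is
  contradictory-sound (((c , []) , (d , [])) ∷ is) t (h ∷ hs) with d <ᵇ c in eq
  ... | true  = <⇒≱ (<ᵇ⇒< d c (subst T (sym eq) tt)) (subst₂ _≤_ (+-identityʳ c) (+-identityʳ d) h)
  ... | false = contradictory-sound is t hs

  refutable : ∀ n → List (Ineq n) → Bool
  refutable zero is    = contradictory is
  refutable (suc n) is = refutable n (prune (eliminate is))

  refutable-sound : ∀ n is (ρ : Vec ℕ n) → T (refutable n is) → ¬ All (Holds ρ) is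
  refutable-sound zero is [] t hs = contradictory-sound is t hs
  refutable-sound (suc n) is (x ∷ ρ) t hs = refutable-sound n (prune (eliminate is)) ρ t (prune-sound (eliminate is) ρ (eliminate-sound is x ρ hs))

  ineqs : ∀ {n} → Atom n → List (Ineq n)
  ineqs (e :≤ f) = (affine e , affine f) ∷ []
  ineqs (e :< f) = (affine (con 1 :+ e) , affine f) ∷ []
  ineqs (e := f) = (affine e , affine f) ∷ (affine f , affine e) ∷ []
  ineqs :⊥       = (affine (con 1) , affine (con 0)) ∷ []

  holds≤ : ∀ {n} (e f : Expr n) ρ → ⟦ e ⟧ ρ ≤ ⟦ f ⟧ ρ → Holds ρ (affine e , affine f)
  holds≤ e f ρ = subst₂ _≤_ (sym (affine-correct e ρ)) (sym (affine-correct f ρ))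

  ineqs-sound : ∀ {n} (a : Atom n) ρ → ⟦ a ⟧ᵃ ρ → All (Holds ρ) (ineqs a)
  ineqs-sound (e :≤ f) ρ h = holds≤ e f ρ h ∷ []
  ineqs-sound (e :< f) ρ h = holds≤ (con 1 :+ e) f ρ h ∷ []
  ineqs-sound (e := f) ρ h = holds≤ e f ρ (≤-reflexive h) ∷ holds≤ f e ρ (≤-reflexive (sym h)) ∷ []

  -- The goal is negated and joined to the hypotheses. Integrality enters only by reading e < f as 1
  -- + e ≤ f; otherwise just rational consequences are found.
  decide : ∀ {n} → List (Ineq n) → Sequent n → Bool
  decide is (a :⇒ s)     = decide (ineqs a ++ is) s
  decide is (⊢ (e :≤ f)) = refutable _ (ineqs (f :< e) ++ is)
  decide is (⊢ (e :< f)) = refutable _ (ineqs (f :≤ e) ++ is)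
  decide is (⊢ (e := f)) = refutable _ (ineqs (e :< f) ++ is) ∧ refutable _ (ineqs (f :< e) ++ is)
  decide is (⊢ :⊥)       = refutable _ is

  T-∧ˡ : ∀ a {b} → T (a ∧ b) → T a
  T-∧ˡ true t = tt

  T-∧ʳ : ∀ a {b} → T (a ∧ b) → T b
  T-∧ʳ true t = t

  decide-sound : ∀ {n} is (s : Sequent n) ρ → T (decide is s) → All (Holds ρ) is → ⟦ s ⟧ˢ ρ
  decide-sound is (a :⇒ s) ρ t hs h = decide-sound (ineqs a ++ is) s ρ t (++⁺ (ineqs-sound a ρ h) hs)
  decide-sound is (⊢ (e :≤ f)) ρ t hs =
    ≮⇒≥ λ h → refutable-sound _ _ ρ t (++⁺ (ineqs-sound (f :< e) ρ h) hs)
  decide-sound is (⊢ (e :< f)) ρ t hs =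
    ≰⇒> λ h → refutable-sound _ _ ρ t (++⁺ (ineqs-sound (f :≤ e) ρ h) hs)
  decide-sound is (⊢ (e := f)) ρ t hs = ≤-antisym
    (≮⇒≥ λ h → refutable-sound _ _ ρ (T-∧ʳ (refutable _ (ineqs (e :< f) ++ is)) t) (++⁺ (ineqs-sound (f :< e) ρ h) hs))
    (≮⇒≥ λ h → refutable-sound _ _ ρ (T-∧ˡ (refutable _ (ineqs (e :< f) ++ is)) t) (++⁺ (ineqs-sound (e :< f) ρ h) hs))
  decide-sound is (⊢ :⊥) ρ t hs = ⊥-elim (refutable-sound _ _ ρ t hs)

  -- The hidden argument reduces to the unit type once the check succeeds. Truncated differences,
  -- products and counts enter as variables, with their characteristic equations among the
  -- hypotheses.
  lia : ∀ {n} (ρ : Vec ℕ n) (f : N-ary n (Expr n) (Sequent n)) {_ : T (decide [] (f $ⁿ tabulate var))} →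
    ⟦ f $ⁿ tabulate var ⟧ˢ ρ
  lia ρ f {t} = decide-sound [] (f $ⁿ tabulate var) ρ t []

open LinearArithmetic using (lia; var; con; _:+_; _:≤_; _:<_; _:=_; :⊥; _:⇒_; ⊢_)

-- Counting by correspondence

-- A bijection between subsets, presented as a relation: proofs of `P` and `Q` never have to be
-- compared, and auxiliary data that are not determined can be hidden in `Rel`.
record Correspondence {A B : Set} (P : A → Set) (Q : B → Set) : Set₁ where
  field
    Rel        : A → B → Set
    total      : ∀ x → P x → ∃ λ y → Q y × Rel x y
    cototal    : ∀ y → Q y → ∃ λ x → P x × Rel x y
    functional : ∀ {x y y′} → P x → Q y → Q y′ → Rel x y → Rel x y′ → y ≡ y′
    injective  : ∀ {x x′ y} → P x → P x′ → Q y → Rel x y → Rel x′ y → x ≡ x′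

transfer : ∀ {A B : Set} {P : A → Set} {Q : B → Set} {c} → Correspondence P Q → Enumerates P c → Enumerates Q c
transfer {A} {B} {P} {Q} {c} C E = record
  { elems    = image elems sound
  ; unique   = image-unique elems sound unique
  ; sound    = λ y y∈ → let (x , x∈ , Px , Qy , r) = image⁻ elems sound y∈ in Qy
  ; complete = λ y Qy → let (x , Px , r) = cototal y Qy in image⁺ elems sound (complete x Px) Qy r
  ; size     = trans (image-length elems sound) size
  }
  where
  open Correspondence C
  open Enumerates E
  image : (xs : List A) → (∀ x → x ∈ xs → P x) → List B
  image [] h = []
  image (x ∷ xs) h = proj₁ (total x (h x (here refl))) ∷ image xs (λ z z∈ → h z (there z∈))
  image-length : ∀ xs h → length (image xs h) ≡ length xs
  image-length [] h = refl
  image-length (x ∷ xs) h = cong suc (image-length xs _)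
  image⁻ : ∀ xs h {y} → y ∈ image xs h → ∃ λ x → x ∈ xs × P x × Q y × Rel x y
  image⁻ (x ∷ xs) h (here refl) with total x (h x (here refl))
  ... | y , Qy , r = x , here refl , h x (here refl) , Qy , r
  image⁻ (x ∷ xs) h (there y∈) with image⁻ xs _ y∈
  ... | x′ , x′∈ , rest = x′ , there x′∈ , rest
  image⁺ : ∀ xs h {x y} → x ∈ xs → Q y → Rel x y → y ∈ image xs h
  image⁺ (x ∷ xs) h (here refl) Qy r with total x (h x (here refl))
  ... | y′ , Qy′ , r′ = here (functional (h x (here refl)) Qy Qy′ r r′)
  image⁺ (x ∷ xs) h (there x∈) Qy r = there (image⁺ xs _ x∈ Qy r)
  image-unique : ∀ xs h → Unique xs → Unique (image xs h)
  image-unique [] h [] = []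
  image-unique (x ∷ xs) h (x∉ ∷ u) = All.tabulate distinct ∷ image-unique xs _ u
    where
    distinct : ∀ {y} → y ∈ image xs _ → proj₁ (total x (h x (here refl))) ≢ y
    distinct {y} y∈ refl with total x (h x (here refl)) | image⁻ xs _ y∈
    ... | _ , Qy , r | x′ , x′∈ , Px′ , _ , r′ = All.lookup x∉ x′∈ (injective (h x (here refl)) Px′ Qy r r′)

∈-delete : ∀ {A : Set} {x : A} as {bs z} → z ∈ as ++ x ∷ bs → z ≢ x → z ∈ as ++ bs
∈-delete [] (here refl) z≢x = ⊥-elim (z≢x refl)
∈-delete [] (there z∈) z≢x = z∈
∈-delete (a ∷ as) (here refl) z≢x = here refl
∈-delete (a ∷ as) (there z∈) z≢x = there (∈-delete as z∈ z≢x)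

unique-⊆-length : ∀ {A : Set} {xs ys : List A} → Unique xs → (∀ {z} → z ∈ xs → z ∈ ys) → length xs ≤ length ys
unique-⊆-length {xs = []} u h = z≤n
unique-⊆-length {xs = x ∷ xs} (x∉ ∷ u) h with ∈-∃++ (h (here refl))
... | as , bs , refl = ≤-trans (s≤s (unique-⊆-length u λ z∈ → ∈-delete as (h (there z∈)) (λ z≡x → All.lookup x∉ z∈ (sym z≡x))))
  (≤-reflexive (trans (cong suc (length-++ as)) (sym (trans (length-++ as) (+-suc _ _)))))

unique-length : ∀ {A : Set} {xs ys : List A} → Unique xs → Unique ys →
  (∀ {z} → z ∈ xs → z ∈ ys) → (∀ {z} → z ∈ ys → z ∈ xs) → length xs ≡ length ys
unique-length u v h g = ≤-antisym (unique-⊆-length u h) (unique-⊆-length v g)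

unique-map : ∀ {A B : Set} (f : A → B) {xs : List A} → (∀ {x y} → x ∈ xs → y ∈ xs → f x ≡ f y → x ≡ y) →
  Unique xs → Unique (map f xs)
unique-map f inj [] = []
unique-map f {x ∷ xs} inj (x∉ ∷ u) =
  All.tabulate (λ y∈ fx≡y → let (z , z∈ , y≡) = ∈-map⁻ f y∈ in All.lookup x∉ z∈ (inj (here refl) (there z∈) (trans fx≡y y≡)))
  ∷ unique-map f (λ a b → inj (there a) (there b)) u

-- Each head belongs to the other list, so different heads would have to precede one another in both
-- directions.
allPairs-extensional : ∀ {A : Set} {R : A → A → Set} → (∀ {x y} → R x y → ¬ R y x) → ∀ {xs ys : List A} →
  AllPairs R xs → AllPairs R ys → (∀ {z} → z ∈ xs → z ∈ ys) → (∀ {z} → z ∈ ys → z ∈ xs) → xs ≡ ys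
allPairs-extensional asym {[]} {[]} _ _ _ _ = refl
allPairs-extensional asym {[]} {y ∷ ys} _ _ _ g with g (here refl)
... | ()
allPairs-extensional asym {x ∷ xs} {[]} _ _ h _ with h (here refl)
... | ()
allPairs-extensional {R = R} asym {x ∷ xs} {y ∷ ys} (rx ∷ sx) (ry ∷ sy) h g with heads (h (here refl)) (g (here refl))
  where
  heads : x ∈ y ∷ ys → y ∈ x ∷ xs → x ≡ y
  heads (here e) _ = e
  heads (there x∈) (here e) = sym e
  heads (there x∈) (there y∈) = ⊥-elim (asym (All.lookup ry x∈) (All.lookup rx y∈))
... | refl = cong (x ∷_) (allPairs-extensional asym sx sy
    (λ z∈ → tail (h (there z∈)) (All.lookup rx z∈)) (λ z∈ → tail (g (there z∈)) (All.lookup ry z∈)))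
  where
  tail : ∀ {z zs} → z ∈ x ∷ zs → R x z → z ∈ zs
  tail (here refl) r = ⊥-elim (asym r r)
  tail (there z∈) r = z∈

-- Labelled keys and their reading order

2*-injective : ∀ {i j} → 2 * i ≡ 2 * j → i ≡ j
2*-injective {i} {j} = *-cancelˡ-≡ i j 2

code-injective : ∀ {l l′} → code l ≡ code l′ → l ≡ l′
code-injective {lab i true} {lab j true} e = cong (λ n → lab n true) (2*-injective e)
code-injective {lab i true} {lab j false} e = ⊥-elim (even≢odd i j e)
code-injective {lab i false} {lab j true} e = ⊥-elim (even≢odd j i (sym e))
code-injective {lab i false} {lab j false} e = cong (λ n → lab n false) (2*-injective (suc-injective e))

_≟ᴸ_ : (l l′ : Label) → Dec (l ≡ l′)
l ≟ᴸ l′ with code l ≟ code l′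
... | yes e = yes (code-injective e)
... | no n = no λ e → n (cong code e)

Entry : Set
Entry = Label × ℕ

_≟ᴱ_ : (e e′ : Entry) → Dec (e ≡ e′)
(l , p) ≟ᴱ (l′ , p′) with l ≟ᴸ l′ | p ≟ p′
... | yes refl | yes refl = yes refl
... | no n | _ = no λ { refl → n refl }
... | yes _ | no n = no λ { refl → n refl }

open import Data.List.Membership.DecPropositional _≟ᴱ_ using () renaming (_∈?_ to _∈ᴱ?_) public

Toward : Bool → ℕ → ℕ → Set
Toward true p p′  = p′ < p
Toward false p p′ = p < p′

infix 4 _≺_
_≺_ : Entry → Entry → Set
(l , p) ≺ (l′ , p′) = code l < code l′ ⊎ (l ≡ l′ × Toward (marked l) p p′)

toward-trans : ∀ b {p q r} → Toward b p q → Toward b q r → Toward b p r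
toward-trans true h g = <-trans g h
toward-trans false h g = <-trans h g

toward-irrefl : ∀ b {p} → ¬ Toward b p p
toward-irrefl true = <-irrefl refl
toward-irrefl false = <-irrefl refl

≺-trans : ∀ {e f g} → e ≺ f → f ≺ g → e ≺ g
≺-trans (inj₁ h) (inj₁ g) = inj₁ (<-trans h g)
≺-trans (inj₁ h) (inj₂ (refl , _)) = inj₁ h
≺-trans (inj₂ (refl , _)) (inj₁ g) = inj₁ g
≺-trans {l , _} (inj₂ (refl , h)) (inj₂ (refl , g)) = inj₂ (refl , toward-trans (marked l) h g)

≺-irrefl : ∀ {e} → ¬ e ≺ e
≺-irrefl (inj₁ h) = <-irrefl refl h
≺-irrefl {l , _} (inj₂ (_ , h)) = toward-irrefl (marked l) h

≺-asym : ∀ {e f} → e ≺ f → ¬ f ≺ e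
≺-asym h g = ≺-irrefl (≺-trans h g)

Sorted : List Entry → Set
Sorted = AllPairs _≺_

sorted-extensional : ∀ {xs ys} → Sorted xs → Sorted ys →
  (∀ {z} → z ∈ xs → z ∈ ys) → (∀ {z} → z ∈ ys → z ∈ xs) → xs ≡ ys
sorted-extensional = allPairs-extensional ≺-asym

sorted-unique : ∀ {xs} → Sorted xs → Unique xs
sorted-unique = AllPairs.map λ { h refl → ≺-irrefl h }

-- All entries with the letters i, ..., i + n - 1 in reading order, where ds lists the keys
-- decreasingly and as the same keys increasingly. A finite set of entries is sorted by sifting such
-- a list.
alphabet : ℕ → ℕ → List ℕ → List ℕ → List Entry
alphabet i zero ds as = []
alphabet i (suc n) ds as = map (lab i true ,_) ds ++ map (lab i false ,_) as ++ alphabet (suc i) n ds as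

∈-alphabet⁻ : ∀ i n ds as {l p} → (l , p) ∈ alphabet i n ds as → i ≤ idx l × idx l < i + n × (p ∈ ds ⊎ p ∈ as)
∈-alphabet⁻ i (suc n) ds as e∈ with ∈-++⁻ (map (lab i true ,_) ds) e∈
... | inj₁ e∈ds with ∈-map⁻ (lab i true ,_) e∈ds
...   | p , p∈ , refl = ≤-refl , lia (i ∷ n ∷ []) (λ i n → ⊢ i :< i :+ (con 1 :+ n)) , inj₁ p∈
∈-alphabet⁻ i (suc n) ds as e∈ | inj₂ e∈′ with ∈-++⁻ (map (lab i false ,_) as) e∈′
... | inj₁ e∈as with ∈-map⁻ (lab i false ,_) e∈as
...   | p , p∈ , refl = ≤-refl , lia (i ∷ n ∷ []) (λ i n → ⊢ i :< i :+ (con 1 :+ n)) , inj₂ p∈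
∈-alphabet⁻ i (suc n) ds as {l} e∈ | inj₂ e∈′ | inj₂ e∈″ with ∈-alphabet⁻ (suc i) n ds as e∈″
... | h , g , p∈ = <⇒≤ h , ≤-trans g (≤-reflexive (sym (+-suc i n))) , p∈

∈-alphabet⁺ : ∀ i n ds as {l p} → i ≤ idx l → idx l < i + n → p ∈ ds → p ∈ as → (l , p) ∈ alphabet i n ds as
∈-alphabet⁺ i zero ds as {l} h g _ _ = ⊥-elim (lia (i ∷ idx l ∷ []) (λ i j → i :≤ j :⇒ j :< i :+ con 0 :⇒ ⊢ :⊥) h g)
∈-alphabet⁺ i (suc n) ds as {lab j b} h g p∈ds p∈as with i ≟ j
∈-alphabet⁺ i (suc n) ds as {lab j true} h g p∈ds p∈as | yes refl = ∈-++⁺ˡ (∈-map⁺ (lab i true ,_) p∈ds)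
∈-alphabet⁺ i (suc n) ds as {lab j false} h g p∈ds p∈as | yes refl =
  ∈-++⁺ʳ (map (lab i true ,_) ds) (∈-++⁺ˡ (∈-map⁺ (lab i false ,_) p∈as))
... | no i≢j = ∈-++⁺ʳ (map (lab i true ,_) ds) (∈-++⁺ʳ (map (lab i false ,_) as)
    (∈-alphabet⁺ (suc i) n ds as (≤∧≢⇒< h i≢j) (≤-trans g (≤-reflexive (+-suc i n))) p∈ds p∈as))

alphabet-sorted : ∀ i n {ds as} → AllPairs _>_ ds → AllPairs _<_ as → Sorted (alphabet i n ds as)
alphabet-sorted i zero d a = []
alphabet-sorted i (suc n) {ds} {as} d a =
  AP.++⁺ (AP.map⁺ (AllPairs.map (λ h → inj₂ (refl , h)) d))
    (AP.++⁺ (AP.map⁺ (AllPairs.map (λ h → inj₂ (refl , h)) a)) (alphabet-sorted (suc i) n d a)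
      (All.tabulate λ x∈ → All.tabulate λ y∈ → unmarkedFirst x∈ y∈))
    (All.tabulate λ x∈ → All.tabulate λ y∈ → markedFirst x∈ y∈)
  where
  later : ∀ b {l p} → (l , p) ∈ alphabet (suc i) n ds as → code (lab i b) < code l
  later b {lab j b′} e∈ = go b b′ (proj₁ (∈-alphabet⁻ (suc i) n ds as e∈))
    where
    go : ∀ b b′ → suc i ≤ j → code (lab i b) < code (lab j b′)
    go true true h = lia (i ∷ j ∷ []) (λ i j → con 1 :+ i :≤ j :⇒ ⊢ con 1 :+ (i :+ (i :+ con 0)) :≤ j :+ (j :+ con 0)) h
    go true false h = lia (i ∷ j ∷ []) (λ i j → con 1 :+ i :≤ j :⇒ ⊢ con 1 :+ (i :+ (i :+ con 0)) :≤ con 1 :+ (j :+ (j :+ con 0))) h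
    go false true h = lia (i ∷ j ∷ []) (λ i j → con 1 :+ i :≤ j :⇒ ⊢ con 2 :+ (i :+ (i :+ con 0)) :≤ j :+ (j :+ con 0)) h
    go false false h = lia (i ∷ j ∷ []) (λ i j → con 1 :+ i :≤ j :⇒ ⊢ con 2 :+ (i :+ (i :+ con 0)) :≤ con 1 :+ (j :+ (j :+ con 0))) h
  unmarkedFirst : ∀ {x y} → x ∈ map (lab i false ,_) as → y ∈ alphabet (suc i) n ds as → x ≺ y
  unmarkedFirst x∈ y∈ with ∈-map⁻ (lab i false ,_) x∈
  ... | p , _ , refl = inj₁ (later false y∈)
  markedFirst : ∀ {x y} → x ∈ map (lab i true ,_) ds → y ∈ map (lab i false ,_) as ++ alphabet (suc i) n ds as → x ≺ y
  markedFirst x∈ y∈ with ∈-map⁻ (lab i true ,_) x∈ | ∈-++⁻ (map (lab i false ,_) as) y∈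
  ... | p , _ , refl | inj₂ y∈′ = inj₁ (later true y∈′)
  ... | p , _ , refl | inj₁ y∈′ with ∈-map⁻ (lab i false ,_) y∈′
  ...   | p′ , _ , refl = inj₁ (n<1+n _)

fullAlphabet : ℕ → ℕ → List Entry
fullAlphabet m K = alphabet 1 m (applyDownFrom suc K) (applyUpTo suc K)

fullAlphabet-sorted : ∀ m K → Sorted (fullAlphabet m K)
fullAlphabet-sorted m K = alphabet-sorted 1 m
  (AP.applyDownFrom⁺₁ suc K (λ h _ → s≤s h)) (AP.applyUpTo⁺₁ suc K (λ h _ → s≤s h))

∈-fullAlphabet⁺ : ∀ m K {l p} → 1 ≤ idx l → idx l ≤ m → 1 ≤ p → p ≤ K → (l , p) ∈ fullAlphabet m K
∈-fullAlphabet⁺ m K {p = suc p} h g _ f = ∈-alphabet⁺ 1 m _ _ h (s≤s g) (∈-applyDownFrom⁺ suc f) (∈-applyUpTo⁺ suc f)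

∈-fullAlphabet⁻ : ∀ m K {l p} → (l , p) ∈ fullAlphabet m K → 1 ≤ idx l × idx l ≤ m × 1 ≤ p × p ≤ K
∈-fullAlphabet⁻ m K e∈ with ∈-alphabet⁻ 1 m _ _ e∈
... | h , s≤s g , inj₁ p∈ with ∈-applyDownFrom⁻ suc p∈
...   | q , q< , refl = h , g , s≤s z≤n , q<
∈-fullAlphabet⁻ m K e∈ | h , s≤s g , inj₂ p∈ with ∈-applyUpTo⁻ suc p∈
... | q , q< , refl = h , g , s≤s z≤n , q<

-- Strict partitions, seen through their indicator function and their tail counts

bit : Bool → ℕ
bit true = 1
bit false = 0

bit≤1 : ∀ b → bit b ≤ 1
bit≤1 true = ≤-refl
bit≤1 false = z≤n

bit-not : ∀ b → bit (not b) + bit b ≡ 1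
bit-not true = refl
bit-not false = refl

bit-injective : ∀ {a b} → bit a ≡ bit b → a ≡ b
bit-injective {true} {true} _ = refl
bit-injective {false} {false} _ = refl

occ : List ℕ → ℕ → Bool
occ [] x = false
occ (p ∷ ps) x = (x ≡ᵇ p) ∨ occ ps x

occ⇒∈ : ∀ la {x} → occ la x ≡ true → x ∈ la
occ⇒∈ (p ∷ ps) {x} h with x ≡ᵇ p | proof (x ≟ p)
... | true | ofʸ refl = here refl
... | false | _ = there (occ⇒∈ ps h)

∈⇒occ : ∀ la {x} → x ∈ la → occ la x ≡ true
∈⇒occ (p ∷ ps) {x} h with x ≡ᵇ p | proof (x ≟ p)
∈⇒occ (p ∷ ps) {x} h | true | _ = refl
∈⇒occ (p ∷ ps) {x} (here e) | false | ofⁿ n = ⊥-elim (n e)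
∈⇒occ (p ∷ ps) {x} (there h) | false | ofⁿ n = ∈⇒occ ps h

-- the number of parts ≥ d, which is the number of cells on the diagonal d
cnt : List ℕ → ℕ → ℕ
cnt [] d = 0
cnt (p ∷ ps) d = if d ≤ᵇ p then suc (cnt ps d) else cnt ps d

top : List ℕ → ℕ
top [] = 0
top (p ∷ ps) = p

Decreasing : List ℕ → Set
Decreasing = AllPairs _>_

strict⇒decreasing : ∀ {la} → StrictPartition la → Decreasing la
strict⇒decreasing (_ , h) = LP.Linked⇒AllPairs (λ a b → <-trans b a) h

∈⇒≤top : ∀ {la x} → Decreasing la → x ∈ la → x ≤ top la
∈⇒≤top (h ∷ hs) (here refl) = ≤-refl
∈⇒≤top (h ∷ hs) (there x∈) = <⇒≤ (All.lookup h x∈)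

cnt-≡0 : ∀ {la d} → All (_< d) la → cnt la d ≡ 0
cnt-≡0 {[]} [] = refl
cnt-≡0 {p ∷ ps} {d} (h ∷ hs) with d ≤ᵇ p | proof (d ≤? p)
... | true | ofʸ d≤p = ⊥-elim (<⇒≱ h d≤p)
... | false | _ = cnt-≡0 hs

cnt-top : ∀ {la d} → Decreasing la → top la < d → cnt la d ≡ 0
cnt-top h d> = cnt-≡0 (All.tabulate λ x∈ → ≤-<-trans (∈⇒≤top h x∈) d>)

occ-top : ∀ {la x} → Decreasing la → top la < x → occ la x ≡ false
occ-top {la} {x} h x> with occ la x in eq
... | false = refl
... | true = ⊥-elim (<⇒≱ x> (∈⇒≤top h (occ⇒∈ la eq)))

cnt-step : ∀ {la} → Decreasing la → ∀ d → cnt la d ≡ bit (occ la d) + cnt la (suc d)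
cnt-step [] d = refl
cnt-step {p ∷ ps} (h ∷ hs) d with d ≡ᵇ p | proof (d ≟ p) | d ≤ᵇ p | proof (d ≤? p) | d <ᵇ p | proof (suc d ≤? p)
... | true | ofʸ refl | _ | _ | true | ofʸ q = ⊥-elim (1+n≰n q)
... | true | ofʸ refl | false | ofⁿ q | _ | _ = ⊥-elim (q ≤-refl)
... | true | ofʸ refl | true | _ | false | _ = cong suc (trans (cnt-≡0 h) (sym (cnt-≡0 (All.map (λ q → m≤n⇒m≤1+n q) h))))
... | false | ofⁿ n | true | ofʸ q | false | ofⁿ q′ = ⊥-elim (q′ (≤∧≢⇒< q n))
... | false | ofⁿ n | false | ofⁿ q | true | ofʸ q′ = ⊥-elim (q (<⇒≤ q′))
... | false | ofⁿ n | true | _ | true | _ = trans (cong suc (cnt-step hs d)) (sym (+-suc _ _))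
... | false | ofⁿ n | false | _ | false | _ = cnt-step hs d

cnt≤length : ∀ la d → cnt la d ≤ length la
cnt≤length [] d = z≤n
cnt≤length (p ∷ ps) d with d ≤ᵇ p
... | true = s≤s (cnt≤length ps d)
... | false = m≤n⇒m≤1+n (cnt≤length ps d)

cnt-1 : ∀ {la} → All (0 <_) la → cnt la 1 ≡ length la
cnt-1 [] = refl
cnt-1 {p ∷ ps} (h ∷ hs) with 0 <ᵇ p | proof (1 ≤? p)
... | true | _ = cong suc (cnt-1 hs)
... | false | ofⁿ n = ⊥-elim (n h)

-- Together with `≤cnt⇒≤part` this makes `cnt la` the conjugate of `part la`, so membership in the
-- diagram can be tested on the diagonal as well as in the row.
≤part⇒≤cnt : ∀ {la} → Decreasing la → ∀ r d → 1 ≤ r → 1 ≤ d → d ≤ part la r → r ≤ cnt la d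
≤part⇒≤cnt {p ∷ ps} (h ∷ hs) (suc zero) d _ _ g with d ≤ᵇ p | proof (d ≤? p)
... | true | _ = s≤s z≤n
... | false | ofⁿ n = ⊥-elim (n g)
≤part⇒≤cnt {p ∷ ps} (h ∷ hs) (suc (suc r)) d _ 1≤d g with d ≤ᵇ p | proof (d ≤? p) | ≤part⇒≤cnt hs (suc r) d (s≤s z≤n) 1≤d g
... | true | _ | ih = s≤s ih
... | false | ofⁿ n | ih = ⊥-elim (<⇒≱ (≤-trans (s≤s z≤n) ih) (≤-reflexive (cnt-≡0 (All.map (λ q → <-trans q (≰⇒> n)) h))))
≤part⇒≤cnt {[]} [] (suc _) d _ 1≤d g = ⊥-elim (<⇒≱ 1≤d g)

≤cnt⇒≤part : ∀ {la} → Decreasing la → ∀ r d → 1 ≤ r → r ≤ cnt la d → d ≤ part la r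
≤cnt⇒≤part {[]} [] (suc r) d _ ()
≤cnt⇒≤part {p ∷ ps} (h ∷ hs) (suc r) d 1≤r g with d ≤ᵇ p | proof (d ≤? p)
... | false | ofⁿ n = ⊥-elim (<⇒≱ 1≤r (≤-trans g (≤-reflexive (cnt-≡0 (All.map (λ q → <-trans q (≰⇒> n)) h)))))
≤cnt⇒≤part {p ∷ ps} (h ∷ hs) (suc zero) d 1≤r g | true | ofʸ q = q
≤cnt⇒≤part {p ∷ ps} (h ∷ hs) (suc (suc r)) d 1≤r (s≤s g) | true | ofʸ q = ≤cnt⇒≤part hs (suc r) d (s≤s z≤n) g

Dg⇒cnt : ∀ {la} → Decreasing la → ∀ {c r} → Dg la (c , r) → r ≤ cnt la (diag (c , r))
Dg⇒cnt {la} h {c} {r} (1≤r , r≤c , c<) = ≤part⇒≤cnt h r (suc (c ∸ r)) 1≤r (s≤s z≤n)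
  (lia (c ∷ r ∷ (c ∸ r) ∷ part la r ∷ []) (λ c r e m → e :+ r := c :⇒ c :< r :+ m :⇒ ⊢ con 1 :+ e :≤ m) (m∸n+n≡m r≤c) c<)

cnt⇒Dg : ∀ {la} → Decreasing la → ∀ {c r} → 1 ≤ r → r ≤ c → r ≤ cnt la (diag (c , r)) → Dg la (c , r)
cnt⇒Dg {la} h {c} {r} 1≤r r≤c g = 1≤r , r≤c ,
  lia (c ∷ r ∷ (c ∸ r) ∷ part la r ∷ []) (λ c r e m → e :+ r := c :⇒ con 1 :+ e :≤ m :⇒ ⊢ c :< r :+ m)
    (m∸n+n≡m r≤c) (≤cnt⇒≤part h r (suc (c ∸ r)) 1≤r g)

occ-extensional : ∀ {la la′} → StrictPartition la → StrictPartition la′ →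
  (∀ x → 1 ≤ x → occ la x ≡ occ la′ x) → la ≡ la′
occ-extensional {la} {la′} s s′ h = allPairs-extensional (λ a b → <-asym a b) (strict⇒decreasing s) (strict⇒decreasing s′)
  (λ {x} x∈ → occ⇒∈ la′ (trans (sym (h x (All.lookup (proj₁ s) x∈))) (∈⇒occ la x∈)))
  (λ {x} x∈ → occ⇒∈ la (trans (h x (All.lookup (proj₁ s′) x∈)) (∈⇒occ la′ x∈)))

fromBits : (ℕ → Bool) → ℕ → List ℕ
fromBits b zero = []
fromBits b (suc n) = if b (suc n) then suc n ∷ fromBits b n else fromBits b n

∈-fromBits⁻ : ∀ b n {x} → x ∈ fromBits b n → 1 ≤ x × x ≤ n × b x ≡ true
∈-fromBits⁻ b (suc n) x∈ with b (suc n) in eq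
∈-fromBits⁻ b (suc n) (here refl) | true = s≤s z≤n , ≤-refl , eq
∈-fromBits⁻ b (suc n) (there x∈) | true = let (h , g , e) = ∈-fromBits⁻ b n x∈ in h , m≤n⇒m≤1+n g , e
... | false = let (h , g , e) = ∈-fromBits⁻ b n x∈ in h , m≤n⇒m≤1+n g , e

∈-fromBits⁺ : ∀ b n {x} → 1 ≤ x → x ≤ n → b x ≡ true → x ∈ fromBits b n
∈-fromBits⁺ b zero h g e = ⊥-elim (<⇒≱ h g)
∈-fromBits⁺ b (suc n) {x} h g e with x ≟ suc n
∈-fromBits⁺ b (suc n) {x} h g e | yes refl rewrite e = here refl
... | no ne with b (suc n)
...   | true = there (∈-fromBits⁺ b n h (s≤s⁻¹ (≤∧≢⇒< g ne)) e)
...   | false = ∈-fromBits⁺ b n h (s≤s⁻¹ (≤∧≢⇒< g ne)) e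

fromBits-decreasing : ∀ b n → Decreasing (fromBits b n)
fromBits-decreasing b zero = []
fromBits-decreasing b (suc n) with b (suc n)
... | true = All.tabulate (λ x∈ → s≤s (proj₁ (proj₂ (∈-fromBits⁻ b n x∈)))) ∷ fromBits-decreasing b n
... | false = fromBits-decreasing b n

fromBits-strict : ∀ b n → StrictPartition (fromBits b n)
fromBits-strict b n = All.tabulate (λ x∈ → proj₁ (∈-fromBits⁻ b n x∈)) , LP.AllPairs⇒Linked (fromBits-decreasing b n)

occ-fromBits : ∀ b n {x} → 1 ≤ x → (n < x → b x ≡ false) → occ (fromBits b n) x ≡ b x
occ-fromBits b n {x} 1≤x out with occ (fromBits b n) x in eq | b x in eq′
... | true | true = refl
... | false | false = refl
... | true | false = trans (sym (proj₂ (proj₂ (∈-fromBits⁻ b n (occ⇒∈ (fromBits b n) eq))))) eq′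
... | false | true with x ≤? n
...   | yes x≤n = trans (sym eq) (∈⇒occ (fromBits b n) (∈-fromBits⁺ b n 1≤x x≤n eq′))
...   | no x≰n = sym (out (≰⇒> x≰n))

-- The recursion is solved from the right, beginning beyond M. In this way statements about single
-- parts become statements about the lengths of diagonals.
tail-unique : (f g : ℕ → ℕ) (b : ℕ → Bool) (M : ℕ) → (∀ d → 1 ≤ d → f d ≡ bit (b d) + f (suc d)) →
  (∀ d → 1 ≤ d → g d ≡ bit (b d) + g (suc d)) → (∀ d → M < d → f d ≡ g d) → ∀ d → 1 ≤ d → f d ≡ g d
tail-unique f g b M hf hg far d = go (suc M) d (m≤n+m (suc M) d)
  where
  go : ∀ n d → suc M ≤ d + n → 1 ≤ d → f d ≡ g d
  go zero d h _ = far d (≤-trans h (≤-reflexive (+-identityʳ d)))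
  go (suc n) d h 1≤d = trans (hf d 1≤d) (trans (cong (bit (b d) +_) (go n (suc d) (≤-trans h (≤-reflexive (+-suc d n))) (s≤s z≤n))) (sym (hg d 1≤d)))

-- Moves on the abacus

-- In k x and x + k are the keys of the moves filling and vacating the position x: a bar with key p
-- moves p ∸ k to p if k ≤ p (a bead at 0 being always available), and creates p and k ∸ p if p < k < 2 p.
In : ℕ → ℕ → ℕ
In k x = if k <ᵇ x + x then x else k ∸ x

act : ℕ → ℕ → ℕ → Bool → Maybe Bool
act I O p b = if p ≡ᵇ I then (if b then nothing else just true)
              else if p ≡ᵇ O then (if b then just false else nothing)
              else just b

data ActView (I O p : ℕ) : Bool → Bool → Set where
  fill   : p ≡ I → ActView I O p false true
  vacate : p ≢ I → p ≡ O → ActView I O p true false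
  idle   : ∀ {b} → p ≢ I → p ≢ O → ActView I O p b b

act-view : ∀ I O p b b′ → act I O p b ≡ just b′ → ActView I O p b b′
act-view I O p b b′ e with p ≡ᵇ I | proof (p ≟ I)
act-view I O p false true refl | true | ofʸ h = fill h
... | false | ofⁿ n with p ≡ᵇ O | proof (p ≟ O)
act-view I O p true false refl | false | ofⁿ n | true | ofʸ h = vacate n h
act-view I O p b b′ refl | false | ofⁿ n | false | ofⁿ n′ = idle n n′

act-make : ∀ {I O p b b′} → ActView I O p b b′ → act I O p b ≡ just b′
act-make {I} {O} {p} v with p ≡ᵇ I | proof (p ≟ I) | p ≡ᵇ O | proof (p ≟ O)
act-make (fill h) | true | _ | _ | _ = refl
act-make (fill h) | false | ofⁿ n | _ | _ = ⊥-elim (n h)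
act-make (vacate n h) | true | ofʸ h′ | _ | _ = ⊥-elim (n h′)
act-make (vacate n h) | false | _ | true | _ = refl
act-make (vacate n h) | false | _ | false | ofⁿ n′ = ⊥-elim (n′ h)
act-make (idle n n′) | true | ofʸ h | _ | _ = ⊥-elim (n h)
act-make (idle n n′) | false | _ | true | ofʸ h = ⊥-elim (n′ h)
act-make (idle n n′) | false | _ | false | _ = refl

In-big : ∀ {k x} → k < x + x → In k x ≡ x
In-big {k} {x} h with k <ᵇ x + x | proof (k <? x + x)
... | true | _ = refl
... | false | ofⁿ n = ⊥-elim (n h)

In-small : ∀ {k x} → x + x ≤ k → In k x ≡ k ∸ x
In-small {k} {x} h with k <ᵇ x + x | proof (k <? x + x)
... | true | ofʸ g = ⊥-elim (<⇒≱ g h)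
... | false | _ = refl

-- The bound k < p + p makes p the larger of two created beads and excludes the pair of equal beads
-- k/2. For k ≥ 1 it holds whenever k ≤ p, so it restricts creations only.
Bar : ℕ → ℕ → (ℕ → Bool) → (ℕ → Bool) → Set
Bar k p s t = k < p + p × (∀ x → 1 ≤ x → act (In k x) (x + k) p (s x) ≡ just (t x))

bar-target : ∀ {k p s t} → Bar k p s t → s p ≡ false × t p ≡ true
bar-target {k} {p} {s} {t} (key , h) = go (s p) (t p) (act-view _ _ p _ _ (h p (positive key)))
  where
  positive : k < p + p → 1 ≤ p
  positive h = lia (k ∷ p ∷ []) (λ k p → k :< p :+ p :⇒ ⊢ con 1 :≤ p) h
  go : ∀ a b → ActView (In k p) (p + k) p a b → a ≡ false × b ≡ true
  go _ _ (fill _) = refl , refl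
  go _ _ (vacate n _) = ⊥-elim (n (sym (In-big key)))
  go _ _ (idle n _) = ⊥-elim (n (sym (In-big key)))

-- Both bars fill the position p, and a position is filled by one key only.
bar-unique : ∀ {k p p′ s t} → Bar k p s t → Bar k p′ s t → p ≡ p′
bar-unique {k} {p} {p′} {s} {t} B B′ = go (s p) (t p) (bar-target B) (act-view _ _ p′ _ _ (proj₂ B′ p (lia (k ∷ p ∷ []) (λ k p → k :< p :+ p :⇒ ⊢ con 1 :≤ p) (proj₁ B))))
  where
  go : ∀ a b → a ≡ false × b ≡ true → ActView (In k p) (p + k) p′ a b → p ≡ p′
  go _ _ _ (fill e) = sym (trans e (In-big (proj₁ B)))
  go _ _ (refl , ()) (idle _ _)

-- Cells in diagonal coordinates: la has the cells `cellAt d m` with m < `cnt la d`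

cellAt : ℕ → ℕ → Cell
cellAt d m = d + m , suc m

diag-cellAt : ∀ {d} m → 1 ≤ d → diag (cellAt d m) ≡ d
diag-cellAt {suc e} m _ = cong suc (m+n∸n≡m e m)

cellAt-surjective : ∀ {c r} → 1 ≤ r → r ≤ c → ∃ λ d → ∃ λ m → 1 ≤ d × (c , r) ≡ cellAt d m
cellAt-surjective {c} {suc m} _ h = suc (c ∸ suc m) , m , s≤s z≤n , cong (_, suc m) (sym (trans (sym (+-suc _ m)) (m∸n+n≡m h)))

cellAt-injectiveʳ : ∀ {d d′ m m′} → cellAt d m ≡ cellAt d′ m′ → m ≡ m′
cellAt-injectiveʳ e = suc-injective (cong proj₂ e)

module Pair {ν cur : List ℕ} (hν : Decreasing ν) (hcur : Decreasing cur) where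

  Diff⁻ : ∀ {x} → Diff ν cur x → ∃ λ d → ∃ λ m → 1 ≤ d × x ≡ cellAt d m × cnt cur d ≤ m × m < cnt ν d
  Diff⁻ {c , r} (g@(1≤r , r≤c , _) , n) with cellAt-surjective 1≤r r≤c
  ... | d , m , 1≤d , refl = d , m , 1≤d , refl ,
    ≮⇒≥ (λ h → n (cnt⇒Dg hcur 1≤r r≤c (≤-trans h (≤-reflexive (cong (cnt cur) (sym (diag-cellAt m 1≤d))))))) ,
    ≤-trans (Dg⇒cnt hν g) (≤-reflexive (cong (cnt ν) (diag-cellAt m 1≤d)))

  Dg-cellAt⁺ : ∀ {la} → Decreasing la → ∀ {d m} → 1 ≤ d → m < cnt la d → Dg la (cellAt d m)
  Dg-cellAt⁺ {la} h {d} {m} 1≤d m< = cnt⇒Dg h (s≤s z≤n) (+-monoˡ-≤ m 1≤d) (≤-trans m< (≤-reflexive (cong (cnt la) (sym (diag-cellAt m 1≤d)))))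

  Dg-cellAt⁻ : ∀ {la} → Decreasing la → ∀ {d m} → 1 ≤ d → Dg la (cellAt d m) → m < cnt la d
  Dg-cellAt⁻ {la} h {d} {m} 1≤d g = ≤-trans (Dg⇒cnt h g) (≤-reflexive (cong (cnt la) (diag-cellAt m 1≤d)))

  Diff⁺ : ∀ {d m} → 1 ≤ d → cnt cur d ≤ m → m < cnt ν d → Diff ν cur (cellAt d m)
  Diff⁺ 1≤d h g = Dg-cellAt⁺ hν 1≤d g , λ f → <⇒≱ (Dg-cellAt⁻ hcur 1≤d f) h

  ⊆⇒cnt≤ : (∀ x → Dg cur x → Dg ν x) → ∀ d → 1 ≤ d → cnt cur d ≤ cnt ν d
  ⊆⇒cnt≤ sub d 1≤d with cnt cur d in eq
  ... | zero = z≤n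
  ... | suc m = Dg-cellAt⁻ hν 1≤d (sub _ (Dg-cellAt⁺ hcur 1≤d (≤-reflexive (sym eq))))

  cnt≤⇒⊆ : (∀ d → 1 ≤ d → cnt cur d ≤ cnt ν d) → ∀ x → Dg cur x → Dg ν x
  cnt≤⇒⊆ h (c , r) g@(1≤r , r≤c , _) = cnt⇒Dg hν 1≤r r≤c (≤-trans (Dg⇒cnt hcur g) (h _ (s≤s z≤n)))

inSeg : ℕ → ℕ → ℕ → Bool
inSeg a n d = (a ≤ᵇ d) ∧ (d <ᵇ a + n)

inSeg-true : ∀ {a n d} → a ≤ d → d < a + n → inSeg a n d ≡ true
inSeg-true {a} {n} {d} h g with a ≤ᵇ d | proof (a ≤? d) | d <ᵇ a + n | proof (d <? a + n)
... | true | _ | true | _ = refl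
... | false | ofⁿ f | _ | _ = ⊥-elim (f h)
... | true | _ | false | ofⁿ f = ⊥-elim (f g)

inSeg-below : ∀ {a n d} → d < a → inSeg a n d ≡ false
inSeg-below {a} {n} {d} h with a ≤ᵇ d | proof (a ≤? d)
... | true | ofʸ f = ⊥-elim (<⇒≱ h f)
... | false | _ = refl

inSeg-above : ∀ {a n d} → a + n ≤ d → inSeg a n d ≡ false
inSeg-above {a} {n} {d} h with a ≤ᵇ d | d <ᵇ a + n | proof (d <? a + n)
... | _ | true | ofʸ f = ⊥-elim (<⇒≱ f h)
... | true | false | _ = refl
... | false | false | _ = refl

data SegView (a n d : ℕ) : Bool → Set where
  within : a ≤ d → d < a + n → SegView a n d true
  below  : d < a → SegView a n d false
  above  : a + n ≤ d → SegView a n d false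

segView : ∀ a n d → SegView a n d (inSeg a n d)
segView a n d with a ≤? d | d <? a + n
... | yes h | yes g = subst (SegView a n d) (sym (inSeg-true h g)) (within h g)
... | yes h | no g = subst (SegView a n d) (sym (inSeg-above {a} (≮⇒≥ g))) (above (≮⇒≥ g))
... | no h | _ = subst (SegView a n d) (sym (inSeg-below {a} {n} (≰⇒> h))) (below (≰⇒> h))

-- Single ribbons

transport : ∀ {D D′} → (∀ x → Iff (D x) (D′ x)) → SingleRibbon D → SingleRibbon D′
transport {D} {D′} i ((x , Dx) , conn , (la , mu , sl , sm , sub , j) , dis) =
  (x , proj₁ (i x) Dx) , (λ x y Dx Dy → path (conn x y (proj₂ (i x) Dx) (proj₂ (i y) Dy))) ,
  (la , mu , sl , sm , sub , λ x → (proj₁ (j x) ∘ proj₂ (i x)) , (proj₁ (i x) ∘ proj₂ (j x))) ,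
  λ x y Dx Dy → dis x y (proj₂ (i x) Dx) (proj₂ (i y) Dy)
  where
  path : ∀ {x y} → Path D x y → Path D′ x y
  path stop = stop
  path (step a Dy p) = step a (proj₁ (i _) Dy) (path p)

-- A single ribbon, described by the diagonals on which it has a cell.
AddsSegment : ℕ → ℕ → List ℕ → List ℕ → Set
AddsSegment a n cur ν = 1 ≤ a × 1 ≤ n × (∀ d → 1 ≤ d → cnt ν d ≡ cnt cur d + bit (inSeg a n d))

module Segment {a n ν cur} (sν : StrictPartition ν) (scur : StrictPartition cur) (seg : AddsSegment a n cur ν) where

  private
    hν : Decreasing ν
    hν = strict⇒decreasing sν
    hcur : Decreasing cur
    hcur = strict⇒decreasing scur
    Q : ℕ → ℕ
    Q = cnt cur
    1≤a : 1 ≤ a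
    1≤a = proj₁ seg
    D : CellSet
    D = Diff ν cur
  open Pair hν hcur public

  spine : ℕ → Cell
  spine d = cellAt d (Q d)

  spine∈ : ∀ {d} → a ≤ d → d < a + n → D (spine d)
  spine∈ {d} h g = Diff⁺ (≤-trans 1≤a h) ≤-refl
    (≤-reflexive (sym (trans (proj₂ (proj₂ seg) d (≤-trans 1≤a h)) (trans (cong (λ b → Q d + bit b) (inSeg-true h g)) (+-comm (Q d) 1)))))

  ∈spine : ∀ {x} → D x → ∃ λ d → a ≤ d × d < a + n × x ≡ spine d
  ∈spine Dx with Diff⁻ Dx
  ... | d , m , 1≤d , refl , Q≤ , <P with inSeg a n d | segView a n d | proj₂ (proj₂ seg) d 1≤d
  ...   | _ | within h g | e = d , h , g , cong (cellAt d) (lia (m ∷ Q d ∷ cnt ν d ∷ []) (λ m q p → q :≤ m :⇒ m :< p :⇒ p := q :+ con 1 :⇒ ⊢ m := q) Q≤ <P e)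
  ...   | _ | below _ | e = ⊥-elim (lia (m ∷ Q d ∷ cnt ν d ∷ []) (λ m q p → q :≤ m :⇒ m :< p :⇒ p := q :+ con 0 :⇒ ⊢ :⊥) Q≤ <P e)
  ...   | _ | above _ | e = ⊥-elim (lia (m ∷ Q d ∷ cnt ν d ∷ []) (λ m q p → q :≤ m :⇒ m :< p :⇒ p := q :+ con 0 :⇒ ⊢ :⊥) Q≤ <P e)

  diag-spine : ∀ {d} → a ≤ d → diag (spine d) ≡ d
  diag-spine {d} h = diag-cellAt (Q d) (≤-trans 1≤a h)

  -- Whether d is a part of `cur` decides if the ribbon continues along a row or along a column:
  -- `cnt cur` drops from d to d + 1 exactly at the parts.
  adjacent : ∀ d → Adj (spine d) (spine (suc d)) × Adj (spine (suc d)) (spine d)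
  adjacent d with occ cur d | cnt-step hcur d
  ... | false | e rewrite e = right , left
  ... | true | e rewrite e | +-suc d (Q (suc d)) = down , up

  forward : ∀ j {d} → a ≤ d → d + j < a + n → Path D (spine d) (spine (d + j))
  forward zero {d} h g rewrite +-identityʳ d = stop
  forward (suc j) {d} h g = step (proj₁ (adjacent d)) (spine∈ (m≤n⇒m≤1+n h) (≤-<-trans (m≤m+n (suc d) j) g′))
    (subst (Path D (spine (suc d)) ∘ spine) (sym (+-suc d j)) (forward j (m≤n⇒m≤1+n h) g′))
    where
    g′ : suc d + j < a + n
    g′ = subst (_< a + n) (+-suc d j) g

  backward : ∀ j {d} → a ≤ d → d + j < a + n → Path D (spine (d + j)) (spine d)
  backward zero {d} h g rewrite +-identityʳ d = stop
  backward (suc j) {d} h g rewrite +-suc d j =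
    step (proj₂ (adjacent (d + j))) (spine∈ (≤-trans h (m≤m+n d j)) (<⇒≤ g)) (backward j h (<⇒≤ g))

  connected : EdgeConnected D
  connected x y Dx Dy with ∈spine Dx | ∈spine Dy
  ... | d , h , g , refl | d′ , h′ , g′ , refl with ≤-total d d′
  ...   | inj₁ d≤ = subst (Path D (spine d) ∘ spine) (m+[n∸m]≡n d≤) (forward (d′ ∸ d) h (subst (_< a + n) (sym (m+[n∸m]≡n d≤)) g′))
  ...   | inj₂ d≥ = subst (λ z → Path D (spine z) (spine d′)) (m+[n∸m]≡n d≥) (backward (d ∸ d′) h′ (subst (_< a + n) (sym (m+[n∸m]≡n d≥)) g))

  subset : ∀ x → Dg cur x → Dg ν x
  subset = cnt≤⇒⊆ λ d 1≤d → ≤-trans (m≤m+n (Q d) _) (≤-reflexive (sym (proj₂ (proj₂ seg) d 1≤d)))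

  ribbon : SingleRibbon D
  ribbon = (spine a , spine∈ ≤-refl (≤-trans (≤-reflexive (+-comm 1 a)) (+-monoʳ-≤ a (proj₁ (proj₂ seg))))) , connected ,
    (ν , cur , sν , scur , subset , λ x → id , id) , distinct
    where
    distinct : DistinctDiagonals D
    distinct x y Dx Dy e with ∈spine Dx | ∈spine Dy
    ... | d , h , g , refl | d′ , h′ , g′ , refl = cong spine (trans (sym (diag-spine h)) (trans e (diag-spine h′)))

  cells : List Cell
  cells = map spine (applyUpTo (a +_) n)

  cells-unique : Unique cells
  cells-unique = unique-map spine
    (λ x∈ y∈ e → let (i , _ , ei) = ∈-applyUpTo⁻ (a +_) x∈ ; (j , _ , ej) = ∈-applyUpTo⁻ (a +_) y∈ in
      trans (sym (diag-spine (≤-trans (m≤m+n a i) (≤-reflexive (sym ei))))) (trans (cong diag e) (diag-spine (≤-trans (m≤m+n a j) (≤-reflexive (sym ej))))))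
    (AP.applyUpTo⁺₁ (a +_) n (λ h _ e → <⇒≢ h (+-cancelˡ-≡ a _ _ e)))

  cells⁻ : ∀ {x} → x ∈ cells → D x
  cells⁻ x∈ with ∈-map⁻ spine x∈
  ... | d , d∈ , refl with ∈-applyUpTo⁻ (a +_) d∈
  ...   | i , i< , refl = spine∈ (m≤m+n a i) (+-monoʳ-< a i<)

  cells⁺ : ∀ {x} → D x → x ∈ cells
  cells⁺ Dx with ∈spine Dx
  ... | d , h , g , refl = ∈-map⁺ spine (subst (_∈ applyUpTo (a +_) n) (m+[n∸m]≡n h)
    (∈-applyUpTo⁺ (a +_) (+-cancelˡ-< a _ _ (subst (_< a + n) (sym (m+[n∸m]≡n h)) g))))

  cells-length : length cells ≡ n
  cells-length = trans (length-map spine (applyUpTo (a +_) n)) (length-applyUpTo (a +_) n)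

  cells-ribbon : SingleRibbon (inL cells)
  cells-ribbon = transport (λ x → cells⁺ , cells⁻) ribbon

argmin : ∀ {A : Set} (f : A → ℕ) x xs → ∃ λ y → y ∈ x ∷ xs × (∀ {z} → z ∈ x ∷ xs → f y ≤ f z)
argmin f x [] = x , here refl , λ { (here refl) → ≤-refl }
argmin f x (x′ ∷ xs) with argmin f x′ xs
... | y , y∈ , h with ≤-total (f x) (f y)
...   | inj₁ le = x , here refl , λ { (here refl) → ≤-refl ; (there z∈) → ≤-trans le (h z∈) }
...   | inj₂ ge = y , there y∈ , λ { (here refl) → ge ; (there z∈) → h z∈ }

argmax : ∀ {A : Set} (f : A → ℕ) x xs → ∃ λ y → y ∈ x ∷ xs × (∀ {z} → z ∈ x ∷ xs → f z ≤ f y)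
argmax f x [] = x , here refl , λ { (here refl) → ≤-refl }
argmax f x (x′ ∷ xs) with argmax f x′ xs
... | y , y∈ , h with ≤-total (f x) (f y)
...   | inj₁ le = y , there y∈ , λ { (here refl) → le ; (there z∈) → h z∈ }
...   | inj₂ ge = x , here refl , λ { (here refl) → ≤-refl ; (there z∈) → ≤-trans (h z∈) ge }

adjacent-diag : ∀ {x y} → Adj x y → row x ≤ col x → row y ≤ col y → diag y ≡ suc (diag x) ⊎ diag x ≡ suc (diag y)
adjacent-diag right h g = inj₁ (cong suc (+-∸-assoc 1 h))
adjacent-diag left h g = inj₂ (cong suc (+-∸-assoc 1 g))
adjacent-diag (up {c} {r}) h g = inj₂ (cong suc (sym (trans (sym (+-∸-assoc 1 g)) refl)))
adjacent-diag (down {c} {r}) h g = inj₁ (cong suc (sym (trans (sym (+-∸-assoc 1 h)) refl)))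

-- A discrete intermediate value theorem: adjacent cells lie on neighbouring diagonals, so a path
-- skips none. The condition on rows and columns keeps the subtraction in `diag` from truncating.
path-diagonals : ∀ {D x y} → (∀ z → D z → row z ≤ col z) → D x → Path D x y →
  ∀ z → (diag x ≤ z × z ≤ diag y) ⊎ (diag y ≤ z × z ≤ diag x) → ∃ λ w → D w × diag w ≡ z
path-diagonals {x = x} ok Dx stop z (inj₁ (h , g)) = x , Dx , ≤-antisym h g
path-diagonals {x = x} ok Dx stop z (inj₂ (h , g)) = x , Dx , ≤-antisym h g
path-diagonals {x = x} ok Dx (step {y = y} a Dy p) z between with diag x ≟ z
... | yes e = x , Dx , e
... | no ne = path-diagonals ok Dy p z (closer between (adjacent-diag a (ok x Dx) (ok y Dy)))
  where
  closer : ∀ {t} → (diag x ≤ z × z ≤ t) ⊎ (t ≤ z × z ≤ diag x) → diag y ≡ suc (diag x) ⊎ diag x ≡ suc (diag y) →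
    (diag y ≤ z × z ≤ t) ⊎ (t ≤ z × z ≤ diag y)
  closer (inj₁ (h , g)) (inj₁ e) = inj₁ (≤-trans (≤-reflexive e) (≤∧≢⇒< h ne) , g)
  closer (inj₁ (h , g)) (inj₂ e) = inj₁ (≤-trans (≤-trans (n≤1+n _) (≤-reflexive (sym e))) h , g)
  closer (inj₂ (h , g)) (inj₁ e) = inj₂ (h , ≤-trans g (≤-trans (n≤1+n _) (≤-reflexive (sym e))))
  closer (inj₂ (h , g)) (inj₂ e) = inj₂ (h , s≤s⁻¹ (≤-trans (≤∧≢⇒< g (λ q → ne (sym q))) (≤-reflexive e)))

Interval : List Cell → Set
Interval L = ∃ λ a → 1 ≤ a × 1 ≤ length L × (∀ d → a ≤ d → d < a + length L → ∃ λ x → x ∈ L × diag x ≡ d) ×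
  (∀ {x} → x ∈ L → a ≤ diag x × diag x < a + length L)

-- Connectedness leaves no gap between the extreme diagonals, and since the diagonals are distinct
-- their number is the number of cells.
ribbon-interval : ∀ L → Unique L → SingleRibbon (inL L) → Interval L
ribbon-interval [] u ((_ , ()) , _)
ribbon-interval (x ∷ xs) u (_ , conn , (la , mu , _ , _ , _ , j) , dis) with argmin diag x xs | argmax diag x xs
... | y , y∈ , ymin | z , z∈ , zmax = diag y , s≤s z≤n , s≤s z≤n ,
  (λ d h g → mem d h (subst (d <_) sum g)) , λ {w} w∈ → ymin w∈ , subst (diag w <_) (sym sum) (s≤s (zmax w∈))
  where
  L : List Cell
  L = x ∷ xs
  ok : ∀ w → w ∈ L → row w ≤ col w
  ok w w∈ = proj₁ (proj₂ (proj₁ (proj₁ (j w) w∈)))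
  mem : ∀ d → diag y ≤ d → d < suc (diag z) → ∃ λ w → w ∈ L × diag w ≡ d
  mem d h (s≤s g) = path-diagonals ok y∈ (conn y z y∈ z∈) d (inj₁ (h , g))
  range : List ℕ
  range = applyUpTo (diag y +_) (suc (diag z) ∸ diag y)
  yz : diag y ≤ suc (diag z)
  yz = m≤n⇒m≤1+n (ymin z∈)
  length≡ : length L ≡ suc (diag z) ∸ diag y
  length≡ = trans (sym (length-map diag L)) (trans (unique-length
    (unique-map diag (λ {a} {b} a∈ b∈ e → dis a b a∈ b∈ e) u)
    (AP.applyUpTo⁺₁ (diag y +_) _ (λ h _ e → <⇒≢ h (+-cancelˡ-≡ (diag y) _ _ e)))
    (λ d∈ → let (w , w∈ , e) = ∈-map⁻ diag d∈ in subst (_∈ range) (trans (m+[n∸m]≡n (ymin w∈)) (sym e))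
      (∈-applyUpTo⁺ (diag y +_) (+-cancelˡ-< (diag y) _ _ (subst₂ _<_ (sym (m+[n∸m]≡n (ymin w∈))) (sym (m+[n∸m]≡n yz)) (s≤s (zmax w∈))))))
    (λ d∈ → let (i , i< , e) = ∈-applyUpTo⁻ (diag y +_) d∈
                (w , w∈ , e′) = mem _ (m≤m+n (diag y) i) (subst (diag y + i <_) (m+[n∸m]≡n yz) (+-monoʳ-< (diag y) i<))
            in subst (_∈ map diag L) (trans e′ (sym e)) (∈-map⁺ diag w∈)))
    (length-applyUpTo (diag y +_) _))
  sum : diag y + length L ≡ suc (diag z)
  sum = trans (cong (diag y +_) length≡) (m+[n∸m]≡n yz)

-- k-ribbons are bars

-- The same bar seen through the diagonals that gain cells. A single ribbon occupies a, ..., p; a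
-- double one occupies 1, ..., p and once more 1, ..., q. In both cases p is the diagonal of the
-- head.
data BarShape (k p : ℕ) (cur ν : List ℕ) : Set where
  single : ∀ a → 1 ≤ a → a + k ≡ suc p →
    (∀ d → 1 ≤ d → cnt ν d ≡ cnt cur d + bit (inSeg a k d)) → BarShape k p cur ν
  double : ∀ q → 1 ≤ q → q < p → p + q ≡ k →
    (∀ d → 1 ≤ d → cnt ν d ≡ cnt cur d + (bit (inSeg 1 p d) + bit (inSeg 1 q d))) → BarShape k p cur ν

bit-step : ∀ {ν cur} → Decreasing ν → Decreasing cur → ∀ {x g g′} → cnt ν x ≡ cnt cur x + g →
  cnt ν (suc x) ≡ cnt cur (suc x) + g′ → bit (occ ν x) + g′ ≡ bit (occ cur x) + g
bit-step {ν} {cur} hν hcur {x} {g} {g′} e e′ =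
  lia (cnt ν x ∷ cnt cur x ∷ cnt ν (suc x) ∷ cnt cur (suc x) ∷ bit (occ ν x) ∷ bit (occ cur x) ∷ g ∷ g′ ∷ [])
    (λ P Q P′ Q′ b c g g′ → P := b :+ P′ :⇒ Q := c :+ Q′ :⇒ P := Q :+ g :⇒ P′ := Q′ :+ g′ :⇒ ⊢ b :+ g′ := c :+ g)
    (cnt-step hν x) (cnt-step hcur x) e e′

-- Here g and g′ tell whether the diagonals x and x + 1 gain a cell; the bit at x changes by their
-- difference.
step-view : ∀ {I O p} b c {g g′} → bit b + bit g′ ≡ bit c + bit g →
  (p ≡ I → g ≡ true × g′ ≡ false) → (p ≢ I → p ≡ O → g ≡ false × g′ ≡ true) → (p ≢ I → p ≢ O → g ≡ g′) → ActView I O p c b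
step-view {I} {O} {p} b c e hI hO hid with p ≟ I | p ≟ O
step-view true false e hI hO hid | yes h | _ = fill h
step-view false c e hI hO hid | yes h | _ with hI h
step-view false false () hI hO hid | yes h | _ | refl , refl
step-view false true () hI hO hid | yes h | _ | refl , refl
step-view true true e hI hO hid | yes h | _ with hI h
step-view true true () hI hO hid | yes h | _ | refl , refl
step-view false true e hI hO hid | no n | yes h = vacate n h
step-view true c e hI hO hid | no n | yes h with hO n h
step-view true false () hI hO hid | no n | yes h | refl , refl
step-view true true () hI hO hid | no n | yes h | refl , refl
step-view false false e hI hO hid | no n | yes h with hO n h
step-view false false () hI hO hid | no n | yes h | refl , refl
step-view b c {g} e hI hO hid | no n | no n′ with hid n n′
... | refl with bit-injective {b} {c} (+-cancelʳ-≡ (bit g) _ _ e)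
...   | refl = idle n n′

In-other : ∀ {k p x} → 1 ≤ x → k ≤ p → p ≢ x → p ≢ In k x
In-other {k} {p} {x} 1≤x k≤p n with k <ᵇ x + x | proof (k <? x + x)
... | true | _ = n
... | false | ofⁿ f = λ e → lia (k ∷ x ∷ (k ∸ x) ∷ p ∷ []) (λ k x d p → x :+ x :≤ k :⇒ d :+ x := k :⇒ p := d :⇒ k :≤ p :⇒ con 1 :≤ x :⇒ ⊢ :⊥)
        (≮⇒≥ f) (m∸n+n≡m (≤-trans (m≤m+n x x) (≮⇒≥ f))) e k≤p 1≤x

seg-same : ∀ a n x → suc x ≢ a → suc x ≢ a + n → inSeg a n x ≡ inSeg a n (suc x)
seg-same a n x ne ne′ with inSeg a n x | segView a n x | inSeg a n (suc x) | segView a n (suc x)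
... | _ | within _ _ | _ | within _ _ = refl
... | _ | below _ | _ | below _ = refl
... | _ | above _ | _ | above _ = refl
... | _ | below _ | _ | above _ = refl
... | _ | above _ | _ | below _ = refl
... | _ | within h _ | _ | below h′ = ⊥-elim (<⇒≱ h′ (m≤n⇒m≤1+n h))
... | _ | within _ h | _ | above h′ = ⊥-elim (ne′ (≤-antisym h h′))
... | _ | below h | _ | within h′ _ = ⊥-elim (ne (≤-antisym h h′))
... | _ | above h | _ | within _ h′ = ⊥-elim (<⇒≱ h′ (m≤n⇒m≤1+n h))

-- A bit is the difference of two consecutive diagonals, so a segment changes bits at its ends only:
-- its last diagonal becomes a bead, and the position before its first one loses its bead. For a
-- segment that begins at 1 this position is 0, which is not recorded.
shape⇒bar : ∀ {k p ν cur} → 1 ≤ k → Decreasing ν → Decreasing cur → BarShape k p cur ν → Bar k p (occ cur) (occ ν)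
shape⇒bar {k} {p} {ν} {cur} 1≤k hν hcur (single a 1≤a sum e) = key , λ x 1≤x → act-make
  (step-view (occ ν x) (occ cur x) (bit-step hν hcur (e x 1≤x) (e (suc x) (s≤s z≤n)))
    (λ pI → case p≡x x 1≤x pI of λ { refl → inSeg-true a≤p (≤-reflexive (sym sum)) , inSeg-above {a} (≤-reflexive sum) })
    (λ _ pO → let xa = out x pO in inSeg-below {a} (≤-reflexive xa) , inSeg-true (≤-reflexive (sym xa)) (≤-trans (≤-reflexive (cong suc xa)) (≤-trans (≤-reflexive (+-comm 1 a)) (+-monoʳ-≤ a 1≤k))))
    (λ nI nO → seg-same a k x (λ xa → nO (in′ x xa)) (λ xp → nI (trans (suc-injective (trans (sym sum) (sym xp))) (sym (In-big (subst (λ z → k < z + z) (suc-injective (trans (sym sum) (sym xp))) key)))))))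
  where
  k≤p : k ≤ p
  k≤p = lia (a ∷ k ∷ p ∷ []) (λ a k p → con 1 :≤ a :⇒ a :+ k := con 1 :+ p :⇒ ⊢ k :≤ p) 1≤a sum
  key : k < p + p
  key = lia (k ∷ p ∷ []) (λ k p → k :≤ p :⇒ con 1 :≤ k :⇒ ⊢ k :< p :+ p) k≤p 1≤k
  a≤p : a ≤ p
  a≤p = lia (a ∷ k ∷ p ∷ []) (λ a k p → con 1 :≤ k :⇒ a :+ k := con 1 :+ p :⇒ ⊢ a :≤ p) 1≤k sum
  p≡x : ∀ x → 1 ≤ x → p ≡ In k x → p ≡ x
  p≡x x 1≤x pI with p ≟ x
  ... | yes h = h
  ... | no n = ⊥-elim (In-other 1≤x k≤p n pI)
  out : ∀ x → p ≡ x + k → suc x ≡ a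
  out x h = lia (a ∷ k ∷ p ∷ x ∷ []) (λ a k p x → a :+ k := con 1 :+ p :⇒ p := x :+ k :⇒ ⊢ con 1 :+ x := a) sum h
  in′ : ∀ x → suc x ≡ a → p ≡ x + k
  in′ x h = lia (a ∷ k ∷ p ∷ x ∷ []) (λ a k p x → a :+ k := con 1 :+ p :⇒ con 1 :+ x := a :⇒ ⊢ p := x :+ k) sum h
shape⇒bar {k} {p} {ν} {cur} 1≤k hν hcur (double q 1≤q q<p sum e) = key , λ x 1≤x → act-make (view x 1≤x)
  where
  key : k < p + p
  key = subst (_< p + p) sum (+-monoʳ-< p q<p)
  In-q : In k q ≡ p
  In-q = trans (In-small {k} {q} (lia (k ∷ p ∷ q ∷ []) (λ k p q → p :+ q := k :⇒ q :< p :⇒ ⊢ q :+ q :≤ k) sum q<p)) (trans (cong (_∸ q) (sym sum)) (m+n∸n≡m p q))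
  p<k : p < k
  p<k = subst (p <_) sum (≤-trans (≤-reflexive (+-comm 1 p)) (+-monoʳ-≤ p 1≤q))
  idle′ : ∀ x → 1 ≤ x → x ≢ p → x ≢ q → p ≢ In k x
  idle′ x 1≤x np nq with k <ᵇ x + x | proof (k <? x + x)
  ... | true | _ = λ h → np (sym h)
  ... | false | ofⁿ f = λ h → nq (lia (k ∷ p ∷ q ∷ x ∷ (k ∸ x) ∷ []) (λ k p q x d → p :+ q := k :⇒ d :+ x := k :⇒ p := d :⇒ ⊢ x := q)
                          sum (m∸n+n≡m (≤-trans (m≤m+n x x) (≮⇒≥ f))) h)
  equation : ∀ x → 1 ≤ x → bit (occ ν x) + (bit (inSeg 1 p (suc x)) + bit (inSeg 1 q (suc x))) ≡ bit (occ cur x) + (bit (inSeg 1 p x) + bit (inSeg 1 q x))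
  equation x 1≤x = bit-step hν hcur (e x 1≤x) (e (suc x) (s≤s z≤n))
  filled : ∀ b c n {I O} → p ≡ I → bit b + n ≡ bit c + suc n → ActView I O p c b
  filled true false n h _ = fill h
  filled true true n h e = ⊥-elim (m≢1+m+n n (sym (trans (cong suc (+-identityʳ n)) (sym (suc-injective e)))))
  filled false false n h e = ⊥-elim (m≢1+m+n n (trans e (cong suc (sym (+-identityʳ n)))))
  filled false true n h e = ⊥-elim (m≢1+m+n n (trans e (cong suc (sym (+-comm n 1)))))
  view : ∀ x → 1 ≤ x → ActView (In k x) (x + k) p (occ cur x) (occ ν x)
  view x 1≤x with x ≟ p
  ... | yes refl = filled (occ ν p) (occ cur p) 0 (sym (In-big key)) (subst₂ (λ m n → bit (occ ν p) + m ≡ bit (occ cur p) + n)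
          (cong₂ (λ b c → bit b + bit c) (inSeg-above {1} {p} ≤-refl) (inSeg-above {1} {q} (s≤s (<⇒≤ q<p))))
          (cong₂ (λ b c → bit b + bit c) (inSeg-true {1} {p} 1≤x ≤-refl) (inSeg-above {1} {q} q<p)) (equation x 1≤x))
  ... | no np with x ≟ q
  ...   | yes refl = filled (occ ν q) (occ cur q) 1 (sym In-q) (subst₂ (λ m n → bit (occ ν q) + m ≡ bit (occ cur q) + n)
          (cong₂ (λ b c → bit b + bit c) (inSeg-true {1} {p} {suc q} (s≤s z≤n) (s≤s q<p)) (inSeg-above {1} {q} ≤-refl))
          (cong₂ (λ b c → bit b + bit c) (inSeg-true {1} {p} 1≤x (m≤n⇒m≤1+n q<p)) (inSeg-true {1} {q} 1≤x ≤-refl)) (equation x 1≤x))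
  ...   | no nq with bit-injective {occ ν x} {occ cur x} (+-cancelʳ-≡ (bit (inSeg 1 p x) + bit (inSeg 1 q x)) _ _
              (subst₂ (λ b c → bit (occ ν x) + (bit b + bit c) ≡ bit (occ cur x) + (bit (inSeg 1 p x) + bit (inSeg 1 q x)))
                (sym (same p np)) (sym (same q nq)) (equation x 1≤x)))
    where
    same : ∀ q → x ≢ q → inSeg 1 q x ≡ inSeg 1 q (suc x)
    same q n = seg-same 1 q x (λ h → <⇒≢ 1≤x (sym (suc-injective h))) (λ h → n (suc-injective h))
  ...     | eq = subst (ActView (In k x) (x + k) p (occ cur x)) (sym eq) (idle (idle′ x 1≤x np nq) (λ h → <⇒≱ p<k (≤-trans (m≤n+m k x) (≤-reflexive (sym h)))))

-- For k ≤ p a bead has moved, for p < k two beads were created. `tail-unique` sums the changes of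
-- the bits up to the gains of the diagonals.
bar⇒shape : ∀ {k p ν cur} → 1 ≤ k → Decreasing ν → Decreasing cur → Bar k p (occ cur) (occ ν) → BarShape k p cur ν
bar⇒shape {k} {p} {ν} {cur} 1≤k hν hcur (key , h) with k ≤? p
... | yes k≤p = single a (s≤s z≤n) sum
        (tail-unique (cnt ν) (λ d → cnt cur d + bit (inSeg a k d)) (occ ν) M (λ d _ → cnt-step hν d) recur
          (λ d M<d → trans (cnt-top hν (m⊔n≤o⇒m≤o (suc (top ν)) (suc (top cur)) (≤-trans (s≤s (m≤m⊔n _ p)) M<d))) (sym (cong₂ _+_ (cnt-top hcur (m⊔n≤o⇒n≤o (suc (top ν)) (suc (top cur)) (≤-trans (s≤s (m≤m⊔n _ p)) M<d)))
             (cong bit (inSeg-above {a} (≤-trans (≤-reflexive sum) (≤-trans (s≤s (m≤n⊔m (top ν ⊔ top cur) p)) M<d))))))))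
  where
  a M : ℕ
  a = suc (p ∸ k)
  M = top ν ⊔ top cur ⊔ p
  sum : a + k ≡ suc p
  sum = cong suc (m∸n+n≡m k≤p)
  out : ∀ x → p ≡ x + k → suc x ≡ a
  out x h = lia (a ∷ k ∷ p ∷ x ∷ []) (λ a k p x → a :+ k := con 1 :+ p :⇒ p := x :+ k :⇒ ⊢ con 1 :+ x := a) sum h
  in′ : ∀ x → suc x ≡ a → p ≡ x + k
  in′ x h = lia (a ∷ k ∷ p ∷ x ∷ []) (λ a k p x → a :+ k := con 1 :+ p :⇒ con 1 :+ x := a :⇒ ⊢ p := x :+ k) sum h
  recur : ∀ d → 1 ≤ d → cnt cur d + bit (inSeg a k d) ≡ bit (occ ν d) + (cnt cur (suc d) + bit (inSeg a k (suc d)))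
  recur d 1≤d = trans (cong (_+ bit (inSeg a k d)) (cnt-step hcur d))
    (lia (bit (occ cur d) ∷ bit (occ ν d) ∷ cnt cur (suc d) ∷ bit (inSeg a k d) ∷ bit (inSeg a k (suc d)) ∷ [])
      (λ c b q g g′ → b :+ g′ := c :+ g :⇒ ⊢ c :+ q :+ g := b :+ (q :+ g′)) (go (act-view _ _ p _ _ (h d 1≤d))))
    where
    go : ∀ {c b} → ActView (In k d) (d + k) p c b → bit b + bit (inSeg a k (suc d)) ≡ bit c + bit (inSeg a k d)
    go (fill pI) with p ≟ d
    ... | no n = ⊥-elim (In-other 1≤d k≤p n pI)
    ... | yes refl rewrite inSeg-true {a} {k} {d} (lia (a ∷ k ∷ p ∷ []) (λ a k p → con 1 :≤ k :⇒ a :+ k := con 1 :+ p :⇒ ⊢ a :≤ p) 1≤k sum) (≤-reflexive (sym sum))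
                         | inSeg-above {a} {k} {suc d} (≤-reflexive sum) = refl
    go (vacate _ pO) rewrite inSeg-below {a} {k} {d} (≤-reflexive (out d pO))
      | inSeg-true {a} {k} {suc d} (≤-reflexive (sym (out d pO))) (≤-trans (≤-reflexive (cong suc (out d pO))) (≤-trans (≤-reflexive (+-comm 1 a)) (+-monoʳ-≤ a 1≤k))) = refl
    go {c} (idle nI nO) = cong (λ g → bit c + bit g) (sym (seg-same a k d (λ xa → nO (in′ d xa))
      (λ xp → nI (trans (suc-injective (trans (sym sum) (sym xp))) (sym (In-big (subst (λ z → k < z + z) (suc-injective (trans (sym sum) (sym xp))) key)))))))
... | no k≰p = double q 1≤q q<p sum
        (tail-unique (cnt ν) (λ d → cnt cur d + (bit (inSeg 1 p d) + bit (inSeg 1 q d))) (occ ν) M (λ d _ → cnt-step hν d) recur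
          (λ d M<d → trans (cnt-top hν (m⊔n≤o⇒m≤o (suc (top ν)) (suc (top cur)) (≤-trans (s≤s (m≤m⊔n _ p)) M<d))) (sym (cong₂ _+_ (cnt-top hcur (m⊔n≤o⇒n≤o (suc (top ν)) (suc (top cur)) (≤-trans (s≤s (m≤m⊔n _ p)) M<d)))
             (cong₂ (λ b c → bit b + bit c) (inSeg-above {1} {p} (far d M<d)) (inSeg-above {1} {q} (≤-trans (s≤s (<⇒≤ q<p)) (far d M<d))))))))
  where
  q M : ℕ
  q = k ∸ p
  M = top ν ⊔ top cur ⊔ p
  far : ∀ d → M < d → suc p ≤ d
  far d M<d = ≤-trans (s≤s (m≤n⊔m (top ν ⊔ top cur) p)) M<d
  p<k : p < k
  p<k = ≰⇒> k≰p
  sum : p + q ≡ k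
  sum = m+[n∸m]≡n (<⇒≤ p<k)
  1≤q : 1 ≤ q
  1≤q = m<n⇒0<n∸m p<k
  q<p : q < p
  q<p = lia (k ∷ p ∷ q ∷ []) (λ k p q → k :< p :+ p :⇒ p :+ q := k :⇒ ⊢ q :< p) key sum
  recur : ∀ d → 1 ≤ d → cnt cur d + (bit (inSeg 1 p d) + bit (inSeg 1 q d)) ≡ bit (occ ν d) + (cnt cur (suc d) + (bit (inSeg 1 p (suc d)) + bit (inSeg 1 q (suc d))))
  recur d 1≤d = trans (cong (_+ (bit (inSeg 1 p d) + bit (inSeg 1 q d))) (cnt-step hcur d))
    (lia (bit (occ cur d) ∷ bit (occ ν d) ∷ cnt cur (suc d) ∷ (bit (inSeg 1 p d) + bit (inSeg 1 q d)) ∷ (bit (inSeg 1 p (suc d)) + bit (inSeg 1 q (suc d))) ∷ [])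
      (λ c b q g g′ → b :+ g′ := c :+ g :⇒ ⊢ c :+ q :+ g := b :+ (q :+ g′)) (go (act-view _ _ p _ _ (h d 1≤d))))
    where
    same : ∀ q → d ≢ q → inSeg 1 q (suc d) ≡ inSeg 1 q d
    same q n = sym (seg-same 1 q d (λ h → <⇒≢ 1≤d (sym (suc-injective h))) (λ h → n (suc-injective h)))
    small : d + d ≤ k → p ≡ k ∸ d → q ≡ d
    small f e = lia (k ∷ p ∷ q ∷ d ∷ (k ∸ d) ∷ []) (λ k p q x d → p :+ q := k :⇒ d :+ x := k :⇒ p := d :⇒ ⊢ q := x) sum (m∸n+n≡m (≤-trans (m≤m+n d d) f)) e
    filled : p ≡ In k d → d ≡ p ⊎ d ≡ q
    filled e with k <ᵇ d + d | proof (k <? d + d)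
    ... | true | _ = inj₁ (sym e)
    ... | false | ofⁿ f = inj₂ (sym (small (≮⇒≥ f) e))
    go : ∀ {c b} → ActView (In k d) (d + k) p c b → bit b + (bit (inSeg 1 p (suc d)) + bit (inSeg 1 q (suc d))) ≡ bit c + (bit (inSeg 1 p d) + bit (inSeg 1 q d))
    go (fill pI) with filled pI
    ... | inj₁ e rewrite same q (λ e′ → <⇒≢ q<p (trans (sym e′) e)) | inSeg-above {1} {p} {suc d} (s≤s (≤-reflexive (sym e))) | inSeg-true {1} {p} {d} 1≤d (s≤s (≤-reflexive e)) = refl
    ... | inj₂ e rewrite same p (λ e′ → <⇒≢ q<p (trans (sym e) e′)) | inSeg-above {1} {q} {suc d} (s≤s (≤-reflexive (sym e))) | inSeg-true {1} {q} {d} 1≤d (s≤s (≤-reflexive e)) =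
      trans (cong suc (+-identityʳ _)) (+-comm 1 _)
    go (vacate _ pO) = ⊥-elim (<⇒≱ p<k (≤-trans (m≤n+m k d) (≤-reflexive (sym pO))))
    go {c} (idle nI nO) = cong₂ (λ g g′ → bit c + (bit g + bit g′))
      (same p (λ e → nI (trans (sym e) (sym (In-big (subst (λ z → k < z + z) (sym e) key))))))
      (same q λ e → nI (trans (p-from e) (sym (In-small {k} {d} (small′ e)))))
      where
      small′ : d ≡ q → d + d ≤ k
      small′ e = lia (k ∷ p ∷ q ∷ d ∷ []) (λ k p q d → p :+ q := k :⇒ d := q :⇒ q :< p :⇒ ⊢ d :+ d :≤ k) sum e q<p
      p-from : d ≡ q → p ≡ k ∸ d
      p-from refl = sym (trans (cong (_∸ q) (sym sum)) (m+n∸n≡m p q))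

double-extent : ∀ L (i : Interval L) → (∃ λ t → IsTail (inL L) t × diag t ≡ 1) → proj₁ i ≡ 1
double-extent L (a , 1≤a , _ , _ , bd) (t , (t∈ , _) , e) = ≤-antisym (≤-trans (proj₁ (bd t∈)) (≤-reflexive e)) 1≤a

-- Cells are counted diagonal by diagonal. A single ribbon has exactly one cell on each diagonal of
-- an interval. In a double ribbon both intervals begin at 1, and a diagonal gains as many cells as
-- there are intervals containing it.
kribbon⇒shape : ∀ {k ν cur} → StrictPartition ν → StrictPartition cur → (∀ x → Dg cur x → Dg ν x) →
  KRibbon k ν (Diff ν cur) → ∃ λ p → BarShape k p cur ν
kribbon⇒shape {k} {ν} {cur} sν scur sub (_ , inj₁ R , E) with ribbon-interval (Enumerates.elems E) (Enumerates.unique E) (transport (λ x → complete x , sound x) R)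
  where open Enumerates E
... | a , 1≤a , 1≤n , mem , bd = a + k ∸ 1 , single a 1≤a (sym (m+[n∸m]≡n (≤-trans 1≤a (m≤m+n a k)))) count
  where
  open Enumerates E
  hν : Decreasing ν
  hν = strict⇒decreasing sν
  hcur : Decreasing cur
  hcur = strict⇒decreasing scur
  open Pair hν hcur
  two : ∀ {d m m′} → 1 ≤ d → cnt cur d ≤ m → m < cnt ν d → cnt cur d ≤ m′ → m′ < cnt ν d → m ≡ m′
  two {d} {m} {m′} 1≤d h g h′ g′ = cellAt-injectiveʳ (proj₂ (proj₂ (proj₂ R)) _ _ (Diff⁺ 1≤d h g) (Diff⁺ 1≤d h′ g′) (trans (diag-cellAt m 1≤d) (sym (diag-cellAt m′ 1≤d))))
  outside : ∀ d → 1 ≤ d → (∀ {x} → x ∈ elems → diag x ≢ d) → cnt ν d ≡ cnt cur d + 0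
  outside d 1≤d n with cnt cur d <? cnt ν d
  ... | yes lt = ⊥-elim (n (complete _ (Diff⁺ 1≤d ≤-refl lt)) (diag-cellAt _ 1≤d))
  ... | no nlt = trans (≤-antisym (≮⇒≥ nlt) (⊆⇒cnt≤ sub d 1≤d)) (sym (+-identityʳ _))
  count : ∀ d → 1 ≤ d → cnt ν d ≡ cnt cur d + bit (inSeg a k d)
  count d 1≤d with inSeg a k d | segView a k d
  ... | _ | below h = outside d 1≤d λ x∈ e → <⇒≱ h (≤-trans (proj₁ (bd x∈)) (≤-reflexive e))
  ... | _ | above h = outside d 1≤d λ x∈ e → <⇒≱ (subst₂ _<_ e (cong (a +_) size) (proj₂ (bd x∈))) h
  ... | _ | within h g with mem d h (subst (λ n → d < a + n) (sym size) g)
  ...   | x , x∈ , e with Diff⁻ (sound x x∈)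
  ...     | d′ , m , 1≤d′ , refl , Q≤ , <P with trans (sym (diag-cellAt m 1≤d′)) e
  ...       | refl with suc (cnt cur d) <? cnt ν d
  ...         | yes lt = ⊥-elim (m≢1+m+n (cnt cur d) (trans (two {m = cnt cur d} 1≤d ≤-refl (<⇒≤ lt) (n≤1+n _) lt) (cong suc (sym (+-identityʳ _)))))
  ...         | no nlt = lia (cnt cur d ∷ cnt ν d ∷ m ∷ []) (λ q p m → p :≤ con 1 :+ q :⇒ q :≤ m :⇒ m :< p :⇒ ⊢ p := q :+ con 1) (≮⇒≥ nlt) Q≤ <P
kribbon⇒shape {k} {ν} {cur} sν scur sub (_ , inj₂ (R , S , rR , rS , uR , uS , disj , cover , S≤R , (t , tR , t1 , _) , (t′ , tS , t1′ , _ , _) , _) , E)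
  with ribbon-interval R uR rR | ribbon-interval S uS rS
... | iR@(_ , _ , 1≤R , memR , bdR) | iS@(_ , _ , 1≤S , memS , bdS) with double-extent R iR (t , tR , t1) | double-extent S iS (t′ , tS , t1′)
...   | refl | refl = length R , double (length S) 1≤S S<R sum count
  where
  open Enumerates E
  hν : Decreasing ν
  hν = strict⇒decreasing sν
  hcur : Decreasing cur
  hcur = strict⇒decreasing scur
  open Pair hν hcur
  uRS : Unique (R ++ S)
  uRS = AP.++⁺ uR uS (All.tabulate λ x∈ → All.tabulate λ y∈ e → disj _ x∈ (subst (_∈ S) (sym e) y∈))
  sum : length R + length S ≡ k
  sum = trans (sym (length-++ R)) (trans (unique-length uRS unique
    (λ {z} z∈ → complete z (proj₂ (cover z) (∈-++⁻ R z∈)))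
    (λ {z} z∈ → case proj₁ (cover z) (sound z z∈) of λ { (inj₁ h) → ∈-++⁺ˡ h ; (inj₂ h) → ∈-++⁺ʳ R h })) size)
  onD : ∀ {x} → x ∈ R ⊎ x ∈ S → Diff ν cur x
  onD {x} = proj₂ (cover x)
  at : ∀ {d m} → 1 ≤ d → cnt cur d ≤ m → m < cnt ν d → cellAt d m ∈ R ⊎ cellAt d m ∈ S
  at 1≤d h g = proj₁ (cover _) (Diff⁺ 1≤d h g)
  sameR : ∀ {d m m′} → 1 ≤ d → cellAt d m ∈ R → cellAt d m′ ∈ R → m ≡ m′
  sameR {d} {m} {m′} 1≤d h g = cellAt-injectiveʳ {d} {d} (proj₂ (proj₂ (proj₂ rR)) _ _ h g (trans (diag-cellAt m 1≤d) (sym (diag-cellAt m′ 1≤d))))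
  sameS : ∀ {d m m′} → 1 ≤ d → cellAt d m ∈ S → cellAt d m′ ∈ S → m ≡ m′
  sameS {d} {m} {m′} 1≤d h g = cellAt-injectiveʳ {d} {d} (proj₂ (proj₂ (proj₂ rS)) _ _ h g (trans (diag-cellAt m 1≤d) (sym (diag-cellAt m′ 1≤d))))
  level : ∀ {x d} → Diff ν cur x → diag x ≡ d → ∃ λ m → x ≡ cellAt d m × cnt cur d ≤ m × m < cnt ν d
  level Dx e with Diff⁻ Dx
  ... | d′ , m , 1≤d′ , refl , h , g with trans (sym (diag-cellAt m 1≤d′)) e
  ...   | refl = m , refl , h , g
  n≢1+n : ∀ {n} → n ≢ suc n
  n≢1+n ()
  n≢2+n : ∀ {n} → n ≢ suc (suc n)
  n≢2+n ()
  seg1 : ∀ {n d} → d ≤ n → 1 ≤ d → bit (inSeg 1 n d) ≡ 1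
  seg1 h 1≤d = cong bit (inSeg-true 1≤d (s≤s h))
  seg0 : ∀ {n d} → n < d → bit (inSeg 1 n d) ≡ 0
  seg0 {n} h = cong bit (inSeg-above {1} {n} h)
  goal : ∀ d {m n} → bit (inSeg 1 (length R) d) ≡ m → bit (inSeg 1 (length S) d) ≡ n → cnt ν d ≡ cnt cur d + (m + n) →
    cnt ν d ≡ cnt cur d + (bit (inSeg 1 (length R) d) + bit (inSeg 1 (length S) d))
  goal d refl refl h = h
  count : ∀ d → 1 ≤ d → cnt ν d ≡ cnt cur d + (bit (inSeg 1 (length R) d) + bit (inSeg 1 (length S) d))
  count d 1≤d with d ≤? length R | d ≤? length S
  ... | no f | yes g = ⊥-elim (f (≤-trans g S≤R))
  ... | no f | no g = goal d (seg0 (≰⇒> f)) (seg0 (≰⇒> g)) none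
    where
    none : cnt ν d ≡ cnt cur d + 0
    none with cnt cur d <? cnt ν d
    ... | no nlt = trans (≤-antisym (≮⇒≥ nlt) (⊆⇒cnt≤ sub d 1≤d)) (sym (+-identityʳ _))
    ... | yes lt with at 1≤d ≤-refl lt
    ...   | inj₁ h = ⊥-elim (f (s≤s⁻¹ (subst (_< suc (length R)) (diag-cellAt _ 1≤d) (proj₂ (bdR h)))))
    ...   | inj₂ h = ⊥-elim (g (s≤s⁻¹ (subst (_< suc (length S)) (diag-cellAt _ 1≤d) (proj₂ (bdS h)))))
  ... | yes f | no g = goal d (seg1 f 1≤d) (seg0 (≰⇒> g)) one
    where
    inR : ∀ {m} → cellAt d m ∈ R ⊎ cellAt d m ∈ S → cellAt d m ∈ R
    inR (inj₁ h) = h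
    inR {m} (inj₂ h) = ⊥-elim (g (s≤s⁻¹ (subst (_< suc (length S)) (diag-cellAt m 1≤d) (proj₂ (bdS h)))))
    one : cnt ν d ≡ cnt cur d + 1
    one with memR d 1≤d (s≤s f)
    ... | x , x∈ , e with level (onD (inj₁ x∈)) e
    ...   | m , refl , h , g′ with suc (cnt cur d) <? cnt ν d
    ...     | yes lt = ⊥-elim (n≢1+n (sameR {d} 1≤d (inR (at 1≤d ≤-refl (<⇒≤ lt))) (inR (at 1≤d (n≤1+n _) lt))))
    ...     | no nlt = lia (cnt cur d ∷ cnt ν d ∷ m ∷ []) (λ q p m → p :≤ con 1 :+ q :⇒ q :≤ m :⇒ m :< p :⇒ ⊢ p := q :+ con 1) (≮⇒≥ nlt) h g′
  ... | yes f | yes g = goal d (seg1 f 1≤d) (seg1 g 1≤d) two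
    where
    -- Of three cells on one diagonal two would belong to the same ribbon.
    pigeon : suc (suc (cnt cur d)) < cnt ν d → ⊥
    pigeon lt with at {d} 1≤d ≤-refl (<⇒≤ (<⇒≤ lt)) | at {d} 1≤d (n≤1+n _) (<⇒≤ lt) | at {d} 1≤d (m≤n⇒m≤1+n (n≤1+n _)) lt
    ... | inj₁ x | inj₁ y | _ = n≢1+n (sameR {d} 1≤d x y)
    ... | inj₂ x | inj₂ y | _ = n≢1+n (sameS {d} 1≤d x y)
    ... | inj₁ x | inj₂ y | inj₁ z = n≢2+n (sameR {d} 1≤d x z)
    ... | inj₁ x | inj₂ y | inj₂ z = n≢1+n (sameS {d} 1≤d y z)
    ... | inj₂ x | inj₁ y | inj₁ z = n≢1+n (sameR {d} 1≤d y z)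
    ... | inj₂ x | inj₁ y | inj₂ z = n≢2+n (sameS {d} 1≤d x z)
    two : cnt ν d ≡ cnt cur d + 2
    two with memR d 1≤d (s≤s f) | memS d 1≤d (s≤s g)
    ... | x , x∈ , e | y , y∈ , e′ with level (onD (inj₁ x∈)) e | level (onD (inj₂ y∈)) e′
    ...   | m , refl , h , i | m′ , refl , h′ , i′ with <-cmp m m′
    ...     | tri≈ _ refl _ = ⊥-elim (disj _ x∈ y∈)
    ...     | tri< lt _ _ = lia (cnt cur d ∷ cnt ν d ∷ m ∷ m′ ∷ []) (λ q p m n → p :≤ con 2 :+ q :⇒ q :≤ m :⇒ m :< n :⇒ n :< p :⇒ ⊢ p := q :+ con 2) (≮⇒≥ pigeon) h lt i′
    ...     | tri> _ _ lt = lia (cnt cur d ∷ cnt ν d ∷ m′ ∷ m ∷ []) (λ q p m n → p :≤ con 2 :+ q :⇒ q :≤ m :⇒ m :< n :⇒ n :< p :⇒ ⊢ p := q :+ con 2) (≮⇒≥ pigeon) h′ lt i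
  -- If the lengths were equal, their common last diagonal d would gain two cells and the next one
  -- none, so the bit at d would grow by two.
  S<R : length S < length R
  S<R with length S ≟ length R
  ... | no ne = ≤∧≢⇒< S≤R ne
  ... | yes e = ⊥-elim (lia (cnt ν d ∷ cnt cur d ∷ cnt ν (suc d) ∷ cnt cur (suc d) ∷ bit (occ ν d) ∷ bit (occ cur d) ∷ [])
      (λ P Q P′ Q′ b c → P := b :+ P′ :⇒ Q := c :+ Q′ :⇒ P := Q :+ con 2 :⇒ P′ := Q′ :+ con 0 :⇒ b :≤ con 1 :⇒ ⊢ :⊥)
      (cnt-step hν d) (cnt-step hcur d)
      (trans (count d 1≤R) (cong₂ (λ m n → cnt cur d + (m + n)) (seg1 ≤-refl 1≤R) (seg1 (≤-reflexive (sym e)) 1≤R)))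
      (trans (count (suc d) (s≤s z≤n)) (cong₂ (λ m n → cnt cur (suc d) + (m + n)) (seg0 {length R} ≤-refl) (seg0 {length S} (s≤s (≤-reflexive e)))))
      (bit≤1 (occ ν d)))
    where
    d : ℕ
    d = length R

-- The added cell h₀ of the largest diagonal p is the head of every decomposition of the bar.

module Head {k p ν cur} (sν : StrictPartition ν) (scur : StrictPartition cur) (sh : BarShape k p cur ν) (1≤k : 1 ≤ k) where
  private
    hν : Decreasing ν
    hν = strict⇒decreasing sν
    hcur : Decreasing cur
    hcur = strict⇒decreasing scur
  open Pair hν hcur

  h₀ : Cell
  h₀ = cellAt p (cnt cur p)

  1≤p : 1 ≤ p
  1≤p = go sh
    where
    go : BarShape k p cur ν → 1 ≤ p
    go (single a 1≤a e _) = lia (a ∷ k ∷ p ∷ []) (λ a k p → con 1 :≤ a :⇒ con 1 :≤ k :⇒ a :+ k := con 1 :+ p :⇒ ⊢ con 1 :≤ p) 1≤a 1≤k e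
    go (double q 1≤q q<p _ _) = ≤-trans (s≤s z≤n) q<p

  gain-p : cnt ν p ≡ suc (cnt cur p)
  gain-p = go sh
    where
    go : BarShape k p cur ν → cnt ν p ≡ suc (cnt cur p)
    go (single a 1≤a e c) = trans (c p 1≤p) (trans (cong (λ b → cnt cur p + bit b) (inSeg-true
      (lia (a ∷ k ∷ p ∷ []) (λ a k p → con 1 :≤ k :⇒ a :+ k := con 1 :+ p :⇒ ⊢ a :≤ p) 1≤k e) (≤-reflexive (sym e)))) (+-comm _ 1))
    go (double q 1≤q q<p e c) = trans (c p 1≤p) (trans (cong₂ (λ b b′ → cnt cur p + (bit b + bit b′)) (inSeg-true 1≤p ≤-refl) (inSeg-above {1} {q} q<p)) (+-comm _ 1))

  gain-above : ∀ {d} → p < d → cnt ν d ≡ cnt cur d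
  gain-above {d} p<d = go sh
    where
    go : BarShape k p cur ν → cnt ν d ≡ cnt cur d
    go (single a 1≤a e c) = trans (c d (≤-trans (s≤s z≤n) p<d)) (trans (cong (λ b → cnt cur d + bit b) (inSeg-above {a} (≤-trans (≤-reflexive e) p<d))) (+-identityʳ _))
    go (double q 1≤q q<p e c) = trans (c d (≤-trans (s≤s z≤n) p<d)) (trans (cong₂ (λ b b′ → cnt cur d + (bit b + bit b′)) (inSeg-above {1} {p} p<d) (inSeg-above {1} {q} (<⇒≤ (≤-trans (s≤s q<p) p<d)))) (+-identityʳ _))

  h₀∈ : Diff ν cur h₀
  h₀∈ = Diff⁺ 1≤p ≤-refl (≤-reflexive (sym gain-p))

  diag≤p : ∀ x → Diff ν cur x → diag x ≤ p
  diag≤p x Dx with Diff⁻ Dx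
  ... | d , m , 1≤d , refl , h , g = subst (_≤ p) (sym (diag-cellAt m 1≤d)) (≮⇒≥ λ p<d → <⇒≱ (≤-<-trans h g) (≤-reflexive (gain-above p<d)))

  on-p : ∀ x → Diff ν cur x → diag x ≡ p → x ≡ h₀
  on-p x Dx e with Diff⁻ Dx
  ... | d , m , 1≤d , refl , h , g with trans (sym (diag-cellAt m 1≤d)) e
  ...   | refl = cong (cellAt p) (≤-antisym (s≤s⁻¹ (≤-trans g (≤-reflexive gain-p))) h)

  -- In a double ribbon both parts start on the main diagonal and R is at least as long as S, so R
  -- reaches the last diagonal of the union, where only one cell is added.
  head-unique : ∀ h → RibbonHead ν (Diff ν cur) h → h ≡ h₀
  head-unique h (inj₁ (_ , Dh , max)) = on-p h Dh (≤-antisym (diag≤p h Dh) (subst (_≤ diag h) (diag-cellAt _ 1≤p) (max h₀ h₀∈)))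
  head-unique h (inj₂ (R , S , (rR , rS , uR , uS , disj , cover , S≤R , (t , tR , t1 , _) , (t′ , tS , t1′ , _ , _) , _) , h∈ , max))
    with ribbon-interval R uR rR | ribbon-interval S uS rS
  ... | iR@(_ , _ , _ , memR , bdR) | iS@(_ , _ , _ , memS , bdS) with double-extent R iR (t , tR , t1) | double-extent S iS (t′ , tS , t1′)
  ...   | refl | refl = on-p h Dh (≤-antisym (diag≤p h Dh) (p≤ (proj₁ (cover h₀) h₀∈)))
    where
    Dh : Diff ν cur h
    Dh = proj₂ (cover h) (inj₁ h∈)
    p≤ : h₀ ∈ R ⊎ h₀ ∈ S → p ≤ diag h
    p≤ (inj₁ h₀∈R) = subst (_≤ diag h) (diag-cellAt _ 1≤p) (max h₀ h₀∈R)
    p≤ (inj₂ h₀∈S) with memR p 1≤p (≤-trans (subst (_< suc (length S)) (diag-cellAt _ 1≤p) (proj₂ (bdS h₀∈S))) (s≤s S≤R))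
    ... | x , x∈ , e = subst (_≤ diag h) e (max x x∈)

-- A head is returned as well, because the condition on heads in a tableau quantifies over all heads
-- and can be exploited only when one is at hand.
shape⇒kribbon : ∀ {k p ν cur} → 1 ≤ k → StrictPartition ν → StrictPartition cur → BarShape k p cur ν →
  (∀ x → Dg cur x → Dg ν x) × KRibbon k ν (Diff ν cur) × (∃ λ h → RibbonHead ν (Diff ν cur) h)
shape⇒kribbon {k} {p} {ν} {cur} 1≤k sν scur sh@(single a 1≤a e c) =
  subset , ((λ x → proj₁) , inj₁ ribbon ,
    record { elems = cells ; unique = cells-unique ; sound = λ x → cells⁻ ; complete = λ x → cells⁺ ; size = cells-length }) ,
  H.h₀ , inj₁ (ribbon , H.h₀∈ , λ x Dx → subst (diag x ≤_) (sym (diag-cellAt _ H.1≤p)) (H.diag≤p x Dx))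
  where
  open Segment sν scur (1≤a , 1≤k , c)
  module H = Head sν scur sh 1≤k
shape⇒kribbon {k} {p} {ν} {cur} 1≤k sν scur sh@(double q 1≤q q<p e c) =
  sub , ((λ x → proj₁) , inj₂ (R.cells , S.cells , witness) ,
    record { elems = R.cells ++ S.cells ; unique = AP.++⁺ R.cells-unique S.cells-unique (All.tabulate λ x∈ → All.tabulate λ y∈ h → disjoint _ x∈ (subst (_∈ S.cells) (sym h) y∈))
           ; sound = λ x x∈ → proj₂ (cover x) (∈-++⁻ R.cells x∈)
           ; complete = λ x Dx → case proj₁ (cover x) Dx of λ { (inj₁ h) → ∈-++⁺ˡ h ; (inj₂ h) → ∈-++⁺ʳ R.cells h }
           ; size = trans (length-++ R.cells) (trans (cong₂ _+_ R.cells-length S.cells-length) e) }) ,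
  H.h₀ , inj₂ (R.cells , S.cells , witness , h₀∈R , λ x x∈ → subst (diag x ≤_) (sym (diag-cellAt _ H.1≤p)) (H.diag≤p x (proj₂ (cover x) (inj₁ x∈))))
  where
  module H = Head sν scur sh 1≤k
  1≤p : 1 ≤ p
  1≤p = H.1≤p
  hν : Decreasing ν
  hν = strict⇒decreasing sν
  hcur : Decreasing cur
  hcur = strict⇒decreasing scur
  -- The indicator of an intermediate shape ρ, which is `cur` with the part q added. The inner
  -- ribbon S leads from `cur` to ρ, the outer ribbon R from ρ to ν.
  b : ℕ → Bool
  b x = (x ≡ᵇ q) ∨ occ cur x
  M : ℕ
  M = top cur + q
  ρ : List ℕ
  ρ = fromBits b M
  sρ : StrictPartition ρ
  sρ = fromBits-strict b M
  vacant : occ cur q ≡ false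
  vacant with occ cur q | bit-step hν hcur (c q 1≤q) (c (suc q) (s≤s z≤n))
  ... | false | _ = refl
  ... | true | h rewrite inSeg-true {1} {p} {q} 1≤q (m≤n⇒m≤1+n q<p) | inSeg-true {1} {q} {q} 1≤q ≤-refl
      | inSeg-true {1} {p} {suc q} (s≤s z≤n) (s≤s q<p) | inSeg-above {1} {q} {suc q} ≤-refl with occ ν q
  vacant | true | () | true
  vacant | true | () | false
  far : ∀ x → M < x → b x ≡ false
  far x M<x with x ≡ᵇ q | proof (x ≟ q)
  ... | true | ofʸ refl = ⊥-elim (<⇒≱ M<x (m≤n+m q (top cur)))
  ... | false | _ = occ-top hcur (≤-<-trans (m≤m+n (top cur) q) M<x)
  occ-ρ : ∀ d → 1 ≤ d → bit (occ ρ d) + bit (inSeg 1 q (suc d)) ≡ bit (occ cur d) + bit (inSeg 1 q d)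
  occ-ρ d 1≤d rewrite occ-fromBits b M {d} 1≤d (far d) with d ≡ᵇ q | proof (d ≟ q)
  ... | true | ofʸ refl rewrite vacant | inSeg-true {1} {q} {q} 1≤q ≤-refl | inSeg-above {1} {q} {suc q} ≤-refl = refl
  ... | false | ofⁿ n = cong (λ g → bit (occ cur d) + bit g) (sym (seg-same 1 q d (λ h → <⇒≢ 1≤d (sym (suc-injective h))) (λ h → n (suc-injective h))))
  cnt-ρ : ∀ d → 1 ≤ d → cnt ρ d ≡ cnt cur d + bit (inSeg 1 q d)
  cnt-ρ = tail-unique (cnt ρ) (λ d → cnt cur d + bit (inSeg 1 q d)) (occ ρ) (top ρ + M)
    (λ d _ → cnt-step (strict⇒decreasing sρ) d)
    (λ d 1≤d → trans (cong (_+ bit (inSeg 1 q d)) (cnt-step hcur d))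
      (lia (bit (occ cur d) ∷ bit (occ ρ d) ∷ cnt cur (suc d) ∷ bit (inSeg 1 q d) ∷ bit (inSeg 1 q (suc d)) ∷ [])
        (λ c b q g g′ → b :+ g′ := c :+ g :⇒ ⊢ c :+ q :+ g := b :+ (q :+ g′)) (occ-ρ d 1≤d)))
    (λ d h → trans (cnt-top (strict⇒decreasing sρ) (≤-<-trans (m≤m+n (top ρ) M) h))
      (sym (cong₂ _+_ (cnt-top hcur (≤-<-trans (≤-trans (m≤m+n (top cur) q) (m≤n+m M (top ρ))) h))
        (cong bit (inSeg-above {1} {q} (≤-<-trans (≤-trans (m≤n+m q (top cur)) (m≤n+m M (top ρ))) h))))))
  module S = Segment sρ scur (s≤s z≤n , 1≤q , cnt-ρ)
  module R = Segment {1} {p} sν sρ (s≤s z≤n , 1≤p , λ d 1≤d → trans (c d 1≤d)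
    (trans (cong (cnt cur d +_) (+-comm (bit (inSeg 1 p d)) _)) (trans (sym (+-assoc (cnt cur d) _ _)) (cong (_+ bit (inSeg 1 p d)) (sym (cnt-ρ d 1≤d))))))
  sub : ∀ x → Dg cur x → Dg ν x
  sub x g = R.subset x (S.subset x g)
  open Pair hν hcur using (Diff⁻; Diff⁺)
  cover : ∀ x → Iff (Diff ν cur x) (x ∈ R.cells ⊎ x ∈ S.cells)
  cover x = to , from
    where
    to : Diff ν cur x → x ∈ R.cells ⊎ x ∈ S.cells
    to Dx with Diff⁻ Dx
    ... | d , m , 1≤d , refl , h , g with m <? cnt ρ d
    ...   | yes lt = inj₂ (S.cells⁺ (S.Diff⁺ 1≤d h lt))
    ...   | no nlt = inj₁ (R.cells⁺ (R.Diff⁺ 1≤d (≮⇒≥ nlt) g))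
    from : x ∈ R.cells ⊎ x ∈ S.cells → Diff ν cur x
    from (inj₁ h) with R.cells⁻ h
    ... | g , n = g , λ f → n (S.subset x f)
    from (inj₂ h) with S.cells⁻ h
    ... | g , n = R.subset x g , n
  disjoint : ∀ x → x ∈ R.cells → x ∉ S.cells
  disjoint x h g = proj₂ (R.cells⁻ h) (proj₁ (S.cells⁻ g))
  h₀∈R : H.h₀ ∈ R.cells
  h₀∈R = subst (λ m → cellAt p m ∈ R.cells) (trans (cnt-ρ p 1≤p) (trans (cong (λ g → cnt cur p + bit g) (inSeg-above {1} {q} q<p)) (+-identityʳ _)))
    (R.cells⁺ (R.spine∈ 1≤p ≤-refl))
  R-tail : R.spine 1 ∈ R.cells
  R-tail = R.cells⁺ (R.spine∈ ≤-refl (s≤s 1≤p))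
  S-tail : S.spine 1 ∈ S.cells
  S-tail = S.cells⁺ (S.spine∈ ≤-refl (s≤s 1≤q))
  witness : DoubleRibbonWitness ν (Diff ν cur) R.cells S.cells
  witness = R.cells-ribbon , S.cells-ribbon , R.cells-unique , S.cells-unique , disjoint , cover ,
    subst₂ _≤_ (sym S.cells-length) (sym R.cells-length) (<⇒≤ q<p) ,
    (R.spine 1 , (R-tail , λ x _ → s≤s (≤-trans (≤-reflexive (m+n∸n≡m 0 (cnt ρ 1))) z≤n)) , R.diag-spine ≤-refl , proj₁ (R.cells⁻ R-tail)) ,
    (S.spine 1 , (S-tail , λ x _ → s≤s (≤-trans (≤-reflexive (m+n∸n≡m 0 (cnt cur 1))) z≤n)) , S.diag-spine ≤-refl ,
      R.subset _ (proj₁ (S.cells⁻ S-tail)) , λ h → disjoint _ h S-tail) ,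
    (ν , cur , sν , scur , sub , λ x → id , id)

-- Runs of single positions and chains of shapes

data Run (I O : ℕ) : Bool → List Entry → Bool → Set where
  []  : ∀ {b} → Run I O b [] b
  _∷_ : ∀ {b b′ b″ l p ws} → ActView I O p b b′ → Run I O b′ ws b″ → Run I O b ((l , p) ∷ ws) b″

run? : ∀ I O b ws b″ → Dec (Run I O b ws b″)
run? I O true [] true = yes []
run? I O true [] false = no λ ()
run? I O false [] true = no λ ()
run? I O false [] false = yes []
run? I O b ((l , p) ∷ ws) b″ with act I O p b in eq
... | nothing = no λ { (v ∷ r) → case trans (sym eq) (act-make v) of λ () }
... | just b′ with run? I O b′ ws b″
...   | yes r = yes (act-view I O p b b′ eq ∷ r)
...   | no n = no λ { (v ∷ r) → n (subst (λ c → Run I O c ws b″) (just-inj (trans (sym (act-make v)) eq)) r) }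
  where
  just-inj : ∀ {a b : Bool} → just a ≡ just b → a ≡ b
  just-inj refl = refl

next : ℕ → ℕ → (ℕ → Bool) → ℕ → Bool
next k p s x = if p ≡ᵇ In k x then true else if p ≡ᵇ x + k then false else s x

next-view : ∀ {k p s x b} → ActView (In k x) (x + k) p (s x) b → b ≡ next k p s x
next-view {k} {p} {s} {x} = go (s x) refl
  where
  go : ∀ a {b} → s x ≡ a → ActView (In k x) (x + k) p a b → b ≡ next k p s x
  go a e v with p ≡ᵇ In k x | proof (p ≟ In k x) | p ≡ᵇ x + k | proof (p ≟ x + k)
  go _ e (fill h) | true | _ | _ | _ = refl
  go _ e (fill h) | false | ofⁿ n | _ | _ = ⊥-elim (n h)
  go _ e (vacate n h) | true | ofʸ f | _ | _ = ⊥-elim (n f)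
  go _ e (vacate n h) | false | _ | true | _ = refl
  go _ e (vacate n h) | false | _ | false | ofⁿ f = ⊥-elim (f h)
  go _ e (idle n n′) | true | ofʸ f | _ | _ = ⊥-elim (n f)
  go _ e (idle n n′) | false | _ | true | ofʸ f = ⊥-elim (n′ f)
  go _ e (idle n n′) | false | _ | false | _ = sym e

data Chain (k : ℕ) (la : List ℕ) : List ℕ → List Step → List Entry → Set where
  done : Chain k la la [] []
  link : ∀ {cur ν l p steps ws} → StrictPartition ν → Bar k p (occ cur) (occ ν) → Chain k la ν steps ws →
    Chain k la cur ((ν , l) ∷ steps) ((l , p) ∷ ws)

chain⇒run : ∀ {k la cur steps ws} → Chain k la cur steps ws → ∀ x → 1 ≤ x → Run (In k x) (x + k) (occ cur x) ws (occ la x)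
chain⇒run done x 1≤x = []
chain⇒run (link _ (_ , h) c) x 1≤x = act-view _ _ _ _ _ (h x 1≤x) ∷ chain⇒run c x 1≤x

chain-labels : ∀ {k la cur steps ws} → Chain k la cur steps ws → map proj₂ steps ≡ map proj₁ ws
chain-labels done = refl
chain-labels (link {l = l} _ _ c) = cong (l ∷_) (chain-labels c)

chain-keys : ∀ {k la cur steps ws} → Chain k la cur steps ws → All (λ e → k < proj₂ e + proj₂ e) ws
chain-keys done = []
chain-keys (link _ (key , _) c) = key ∷ chain-keys c

run-head : ∀ {I O b l p ws b″} → Run I O b ((l , p) ∷ ws) b″ → ∃ λ b′ → ActView I O p b b′ × Run I O b′ ws b″
run-head (v ∷ r) = _ , v , r

-- All positions read the same word, and for each of them the next bit is forced to be `next`. These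
-- bits form the next shape of the chain.
run⇒chain : ∀ {k la cur} ws → StrictPartition la → StrictPartition cur → All (λ e → k < proj₂ e + proj₂ e) ws →
  (∀ x → 1 ≤ x → Run (In k x) (x + k) (occ cur x) ws (occ la x)) → ∃ λ steps → Chain k la cur steps ws
run⇒chain {k} {la} {cur} [] sla scur _ r with occ-extensional scur sla (λ x 1≤x → empty (r x 1≤x))
  where
  empty : ∀ {I O b b′} → Run I O b [] b′ → b ≡ b′
  empty [] = refl
... | refl = [] , done
run⇒chain {k} {la} {cur} ((l , p) ∷ ws) sla scur (key ∷ keys) r =
  let (steps , c) = run⇒chain ws sla sν keys rest in (ν , l) ∷ steps , link sν (key , λ x 1≤x → act-make (bar x 1≤x)) c
  where
  -- Beyond M a position is neither a part of `cur` nor filled by the key p, so the next shape is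
  -- finite.
  M : ℕ
  M = top cur + (k + p)
  t : ℕ → Bool
  t = next k p (occ cur)
  ν : List ℕ
  ν = fromBits t M
  sν : StrictPartition ν
  sν = fromBits-strict t M
  far : ∀ x → M < x → t x ≡ false
  far x M<x with k <ᵇ x + x | proof (k <? x + x)
  ... | false | ofⁿ n = ⊥-elim (lia (k ∷ p ∷ x ∷ top cur ∷ []) (λ k p x c → x :+ x :≤ k :⇒ c :+ (k :+ p) :< x :⇒ ⊢ :⊥) (≮⇒≥ n) M<x)
  ... | true | _ with p ≡ᵇ x | proof (p ≟ x)
  ...   | true | ofʸ refl = ⊥-elim (<⇒≱ M<x (≤-trans (m≤n+m p k) (m≤n+m (k + p) (top cur))))
  ...   | false | _ with p ≡ᵇ x + k
  ...     | true = refl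
  ...     | false = occ-top (strict⇒decreasing scur) (≤-<-trans (m≤m+n (top cur) (k + p)) M<x)
  t≡ : ∀ x → 1 ≤ x → t x ≡ occ ν x
  t≡ x 1≤x = sym (occ-fromBits t M 1≤x (far x))
  bar : ∀ x → 1 ≤ x → ActView (In k x) (x + k) p (occ cur x) (occ ν x)
  bar x 1≤x with run-head (r x 1≤x)
  ... | b , v , _ = subst (ActView _ _ p (occ cur x)) (trans (next-view {s = occ cur} v) (t≡ x 1≤x)) v
  rest : ∀ x → 1 ≤ x → Run (In k x) (x + k) (occ ν x) ws (occ la x)
  rest x 1≤x with run-head (r x 1≤x)
  ... | b , v , r′ = subst (λ c → Run _ _ c ws _) (trans (next-view {s = occ cur} v) (t≡ x 1≤x)) r′

chain-functional : ∀ {k la cur steps ws ws′} → Chain k la cur steps ws → Chain k la cur steps ws′ → ws ≡ ws′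
chain-functional done done = refl
chain-functional (link _ B c) (link _ B′ c′) = cong₂ _∷_ (cong (_ ,_) (bar-unique B B′)) (chain-functional c c′)

chain-injective : ∀ {k la cur steps steps′ ws} → Chain k la cur steps ws → Chain k la cur steps′ ws → steps ≡ steps′
chain-injective done done = refl
chain-injective {k} {cur = cur} (link {p = p} s B c) (link s′ B′ c′) with occ-extensional s s′ (λ x 1≤x →
  trans (next-view {k} {p} {occ cur} {x} (act-view _ _ _ _ _ (proj₂ B x 1≤x))) (sym (next-view {k} {p} {occ cur} {x} (act-view _ _ _ _ _ (proj₂ B′ x 1≤x)))))
... | refl = cong (_ ∷_) (chain-injective c c′)

-- Comparing the heads of consecutive ribbons with their keys

cnt-antitone : ∀ {la} → Decreasing la → ∀ {d e} → d ≤ e → cnt la e ≤ cnt la d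
cnt-antitone {la} h {d} {e} d≤e = subst (λ z → cnt la z ≤ cnt la d) (m+[n∸m]≡n d≤e) (go (e ∸ d))
  where
  go : ∀ n → cnt la (d + n) ≤ cnt la d
  go zero = ≤-reflexive (cong (cnt la) (+-identityʳ d))
  go (suc n) = ≤-trans (subst (λ z → cnt la z ≤ cnt la (d + n)) (sym (+-suc d n))
    (≤-trans (m≤n+m _ (bit (occ la (d + n)))) (≤-reflexive (sym (cnt-step h (d + n)))))) (go n)

cnt-lipschitz : ∀ {la} → Decreasing la → ∀ {d e} → d ≤ e → d + cnt la d ≤ e + cnt la e
cnt-lipschitz {la} h {d} {e} d≤e = subst (λ z → d + cnt la d ≤ z + cnt la z) (m+[n∸m]≡n d≤e) (go (e ∸ d))
  where
  go : ∀ n → d + cnt la d ≤ (d + n) + cnt la (d + n)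
  go zero = ≤-reflexive (cong (λ z → z + cnt la z) (sym (+-identityʳ d)))
  go (suc n) = subst (λ z → d + cnt la d ≤ z + cnt la z) (sym (+-suc d n))
    (lia ((d + cnt la d) ∷ (d + n) ∷ cnt la (d + n) ∷ bit (occ la (d + n)) ∷ cnt la (suc (d + n)) ∷ [])
      (λ a z c b c′ → a :≤ z :+ c :⇒ c := b :+ c′ :⇒ b :≤ con 1 :⇒ ⊢ a :≤ con 1 :+ z :+ c′) (go n) (cnt-step h (d + n)) (bit≤1 _))

module _ {cur} (h : Decreasing cur) {p p′} (full : occ cur p ≡ true) (free : occ cur p′ ≡ false) where

  private
    stepFull : cnt cur p ≡ suc (cnt cur (suc p))
    stepFull = trans (cnt-step h p) (cong (λ b → bit b + cnt cur (suc p)) full)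
    stepFree : cnt cur p′ ≡ cnt cur (suc p′)
    stepFree = trans (cnt-step h p′) (cong (λ b → bit b + cnt cur (suc p′)) free)
    p≢p′ : p ≢ p′
    p≢p′ refl with trans (sym full) free
    ... | ()

  -- Let p be the key of the ribbon just added and p′ that of the next one. The old head lies in row
  -- `cnt cur p`, the new one in row `cnt cur p′` + 1, so the rows increase exactly under the
  -- hypothesis. The bits at p and p′ turn weak monotonicity of `cnt` into a strict comparison.
  row-key : cnt cur p ≤ cnt cur p′ → p′ < p
  row-key g with <-cmp p′ p
  ... | tri< lt _ _ = lt
  ... | tri≈ _ e _ = ⊥-elim (p≢p′ (sym e))
  ... | tri> _ _ gt = ⊥-elim (<⇒≱ (≤-trans (s≤s (cnt-antitone h gt)) (≤-reflexive (sym stepFull))) g)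

  -- The two heads lie in the columns p + `cnt cur p` - 1 and p′ + `cnt cur p′`.
  col-key : p + cnt cur p ≤ p′ + cnt cur p′ → p < p′
  col-key g with <-cmp p p′
  ... | tri< lt _ _ = lt
  ... | tri≈ _ e _ = ⊥-elim (p≢p′ e)
  ... | tri> _ _ gt = ⊥-elim (<⇒≱ (≤-trans (≤-reflexive (cong (λ c → suc (p′ + c)) stepFree)) (cnt-lipschitz h gt)) g)

-- Between two consecutive bars the target of the first is occupied and that of the second is free,
-- which is what `row-key` and `col-key` ask for.
headOK⇒≺ : ∀ {k μ cur ν p p′ l l′} → 1 ≤ k → StrictPartition μ → StrictPartition cur → StrictPartition ν →
  BarShape k p μ cur → BarShape k p′ cur ν → HeadOK (just (μ , cur , l)) ν cur l′ → (l , p) ≺ (l′ , p′)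
headOK⇒≺ {k} {μ} {cur} {ν} {p} {p′} {l} {l′} 1≤k sμ scur sν sh sh′ (le , rel) with <-cmp (code l) (code l′)
... | tri< lt _ _ = inj₁ lt
... | tri> _ _ gt = ⊥-elim (<⇒≱ gt le)
... | tri≈ _ e _ with code-injective {l} {l′} e
...   | refl with proj₂ (proj₂ (shape⇒kribbon 1≤k scur sμ sh)) | proj₂ (proj₂ (shape⇒kribbon 1≤k sν scur sh′))
...     | hp , Hp | h , Hh = inj₂ (refl , toward l (le , rel))
  where
  module A = Head scur sμ sh 1≤k
  module B = Head sν scur sh′ 1≤k
  full : occ cur p ≡ true
  full = proj₂ (bar-target {k} {p} {occ μ} {occ cur} (shape⇒bar 1≤k (strict⇒decreasing scur) (strict⇒decreasing sμ) sh))
  free : occ cur p′ ≡ false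
  free = proj₁ (bar-target {k} {p′} {occ cur} {occ ν} (shape⇒bar 1≤k (strict⇒decreasing sν) (strict⇒decreasing scur) sh′))
  toward : ∀ l → HeadOK (just (μ , cur , l)) ν cur l → Toward (marked l) p p′
  toward (lab i true) (_ , rel) = row-key (strict⇒decreasing scur) full free
    (s≤s⁻¹ (subst₂ _<_ (trans (cong row (A.head-unique hp Hp)) (sym A.gain-p)) (cong row (B.head-unique h Hh)) (rel refl h hp Hh Hp)))
  toward (lab i false) (_ , rel) = col-key (strict⇒decreasing scur) full free
    (≤-trans (≤-reflexive (trans (cong (p +_) A.gain-p) (+-suc p _))) (subst₂ _<_ (cong col (A.head-unique hp Hp)) (cong col (B.head-unique h Hh)) (rel refl h hp Hh Hp)))

≺⇒headOK : ∀ {k μ cur ν p p′ l l′} → 1 ≤ k → StrictPartition μ → StrictPartition cur → StrictPartition ν →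
  BarShape k p μ cur → BarShape k p′ cur ν → (l , p) ≺ (l′ , p′) → HeadOK (just (μ , cur , l)) ν cur l′
≺⇒headOK {l = l} 1≤k sμ scur sν sh sh′ (inj₁ h) = <⇒≤ h , λ { refl → ⊥-elim (<-irrefl refl h) }
≺⇒headOK {k} {μ} {cur} {ν} {p} {p′} {lab i true} 1≤k sμ scur sν sh sh′ (inj₂ (refl , tw)) = ≤-refl , λ _ h hp Hh Hp →
  subst₂ _<_ (sym (trans (cong row (A.head-unique hp Hp)) (sym A.gain-p))) (sym (cong row (B.head-unique h Hh)))
    (s≤s (cnt-antitone (strict⇒decreasing scur) (<⇒≤ tw)))
  where
  module A = Head scur sμ sh 1≤k
  module B = Head sν scur sh′ 1≤k
≺⇒headOK {k} {μ} {cur} {ν} {p} {p′} {lab i false} 1≤k sμ scur sν sh sh′ (inj₂ (refl , tw)) = ≤-refl , λ _ h hp Hh Hp →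
  subst₂ _<_ (sym (cong col (A.head-unique hp Hp))) (sym (cong col (B.head-unique h Hh)))
    (≤-trans (≤-reflexive (sym (trans (cong (p +_) A.gain-p) (+-suc p _)))) (cnt-lipschitz (strict⇒decreasing scur) (<⇒≤ tw)))
  where
  module A = Head scur sμ sh 1≤k
  module B = Head sν scur sh′ 1≤k

-- Ribbon tableaux as sorted lists of moves

module Tableaux {k : ℕ} (1≤k : 1 ≤ k) {la : List ℕ} (sla : StrictPartition la) where

  record Last (μ cur : List ℕ) (e : Entry) : Set where
    constructor last
    field
      strict : StrictPartition μ
      shape  : BarShape k (proj₂ e) μ cur

  steps⇒chain′ : ∀ {μ cur l p} steps → StrictPartition cur → Last μ cur (l , p) →
    ValidSteps k cur (just (μ , cur , l)) steps la →
    ∃ λ ws → Chain k la cur steps ws × Linked _≺_ ((l , p) ∷ ws) × All (λ e → 1 ≤ idx (proj₁ e)) ws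
  steps⇒chain′ [] scur _ refl = [] , done , [-] , []
  steps⇒chain′ ((ν , l′) ∷ steps) scur (last sμ sh) (sν , sub , K , 1≤l , ok , v) with kribbon⇒shape sν scur sub K
  ... | p′ , sh′ with steps⇒chain′ steps sν (last scur sh′) v
  ...   | ws , c , lk , ls = (l′ , p′) ∷ ws , link sν (shape⇒bar 1≤k (strict⇒decreasing sν) (strict⇒decreasing scur) sh′) c ,
      headOK⇒≺ 1≤k sμ scur sν sh sh′ ok ∷ lk , 1≤l ∷ ls

  steps⇒chain : ∀ {cur} steps → StrictPartition cur → ValidSteps k cur nothing steps la →
    ∃ λ ws → Chain k la cur steps ws × Sorted ws × All (λ e → 1 ≤ idx (proj₁ e)) ws
  steps⇒chain [] scur refl = [] , done , [] , []
  steps⇒chain ((ν , l′) ∷ steps) scur (sν , sub , K , 1≤l , ok , v) with kribbon⇒shape sν scur sub K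
  ... | p′ , sh′ with steps⇒chain′ steps sν (last scur sh′) v
  ...   | ws , c , lk , ls = (l′ , p′) ∷ ws , link sν (shape⇒bar 1≤k (strict⇒decreasing sν) (strict⇒decreasing scur) sh′) c ,
      LP.Linked⇒AllPairs ≺-trans lk , 1≤l ∷ ls

  chain⇒steps′ : ∀ {μ cur l p steps ws} → StrictPartition cur → Last μ cur (l , p) → Chain k la cur steps ws →
    Linked _≺_ ((l , p) ∷ ws) → All (λ e → 1 ≤ idx (proj₁ e)) ws → ValidSteps k cur (just (μ , cur , l)) steps la
  chain⇒steps′ scur _ done _ _ = refl
  chain⇒steps′ scur (last sμ sh) (link sν B c) (lt ∷ lk) (1≤l ∷ ls)
    with bar⇒shape 1≤k (strict⇒decreasing sν) (strict⇒decreasing scur) B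
  ... | sh′ with shape⇒kribbon 1≤k sν scur sh′
  ...   | sub , K , _ = sν , sub , K , 1≤l , ≺⇒headOK 1≤k sμ scur sν sh sh′ lt , chain⇒steps′ sν (last scur sh′) c lk ls

  chain⇒steps : ∀ {cur steps ws} → StrictPartition cur → Chain k la cur steps ws → Sorted ws →
    All (λ e → 1 ≤ idx (proj₁ e)) ws → ValidSteps k cur nothing steps la
  chain⇒steps scur done _ _ = refl
  chain⇒steps scur (link sν B c) srt (1≤l ∷ ls)
    with bar⇒shape 1≤k (strict⇒decreasing sν) (strict⇒decreasing scur) B
  ... | sh′ with shape⇒kribbon 1≤k sν scur sh′
  ...   | sub , K , _ = sν , sub , K , 1≤l , tt , chain⇒steps′ sν (last scur sh′) c (LP.AllPairs⇒Linked srt) ls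

  -- If the positions filled by p are occupied and the one vacated by p is free, the bar can be
  -- undone. The shape `mu` is the result, and its complement in ν would be a removable ribbon.
  core⇒noBar : ∀ {ν} → StrictPartition ν → KCore k ν → ∀ p → k < p + p →
    (∀ x → 1 ≤ x → In k x ≡ p → occ ν x ≡ true) → (∀ x → 1 ≤ x → x + k ≡ p → occ ν x ≡ false) → ⊥
  core⇒noBar {ν} sν core p key full free = core mu smu (proj₁ rib) (proj₁ (proj₂ rib))
    where
    M : ℕ
    M = top ν + p
    s : ℕ → Bool
    s x = if p ≡ᵇ In k x then false else if p ≡ᵇ x + k then true else occ ν x
    mu : List ℕ
    mu = fromBits s M
    smu : StrictPartition mu
    smu = fromBits-strict s M
    far : ∀ x → M < x → s x ≡ false
    far x M<x with p ≡ᵇ In k x | p ≡ᵇ x + k | proof (p ≟ x + k)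
    ... | true | _ | _ = refl
    ... | false | true | ofʸ e = ⊥-elim (<⇒≱ M<x (≤-trans (m≤m+n x k) (≤-trans (≤-reflexive (sym e)) (m≤n+m p (top ν)))))
    ... | false | false | _ = occ-top (strict⇒decreasing sν) (≤-<-trans (m≤m+n (top ν) p) M<x)
    view : ∀ x → 1 ≤ x → ActView (In k x) (x + k) p (s x) (occ ν x)
    view x 1≤x with p ≡ᵇ In k x | proof (p ≟ In k x) | p ≡ᵇ x + k | proof (p ≟ x + k)
    ... | true | ofʸ e | _ | _ rewrite full x 1≤x (sym e) = fill e
    ... | false | ofⁿ n | true | ofʸ e rewrite free x 1≤x (sym e) = vacate n e
    ... | false | ofⁿ n | false | ofⁿ n′ = idle n n′
    bar : Bar k p (occ mu) (occ ν)
    bar = key , λ x 1≤x → act-make (subst (λ b → ActView _ _ p b (occ ν x)) (sym (occ-fromBits s M 1≤x (far x))) (view x 1≤x))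
    rib : (∀ x → Dg mu x → Dg ν x) × KRibbon k ν (Diff ν mu) × (∃ λ h → RibbonHead ν (Diff ν mu) h)
    rib = shape⇒kribbon 1≤k sν smu (bar⇒shape {p = p} 1≤k (strict⇒decreasing sν) (strict⇒decreasing smu) bar)

  noBar⇒core : ∀ {ν} → StrictPartition ν → (∀ p s → Bar k p s (occ ν) → ⊥) → KCore k ν
  noBar⇒core sν h mu smu sub K with kribbon⇒shape sν smu sub K
  ... | p , sh = h p (occ mu) (shape⇒bar 1≤k (strict⇒decreasing sν) (strict⇒decreasing smu) sh)

  -- c is the indicator function of the k-core of la; the entries of ws record the labels and keys of the ribbons
  module _ (c : ℕ → Bool) (C : ℕ) (c-far : ∀ x → C < x → c x ≡ false)
    (c-core : KCore k (fromBits c C))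
    (core≡c : ∀ ν ws → StrictPartition ν → KCore k ν → All (λ e → k < proj₂ e + proj₂ e) ws →
      (∀ x → 1 ≤ x → Run (In k x) (x + k) (occ ν x) ws (occ la x)) → ∀ x → 1 ≤ x → occ ν x ≡ c x) where

    Word : List Entry → Set
    Word ws = Sorted ws × All (λ e → 1 ≤ idx (proj₁ e)) ws × All (λ e → k < proj₂ e + proj₂ e) ws ×
      (∀ x → 1 ≤ x → Run (In k x) (x + k) (c x) ws (occ la x))

    WordW : List ℕ → List Entry → Set
    WordW w ws = Word ws × (∀ i → countLabels i (map proj₁ ws) ≡ wAt w i)

    private
      sc : StrictPartition (fromBits c C)
      sc = fromBits-strict c C
      occ-c : ∀ x → 1 ≤ x → occ (fromBits c C) x ≡ c x
      occ-c x 1≤x = occ-fromBits c C 1≤x (c-far x)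

    -- The word forgets the starting shape of the chain, so that a word determines its tableau only
    -- thanks to `core≡c`.
    words≅tableaux : ∀ w → Correspondence (WordW w) (RibbonTabW k la w)
    words≅tableaux w = record
      { Rel = λ ws t → Chain k la (proj₁ t) (proj₂ t) ws
      ; total = total
      ; cototal = cototal
      ; functional = λ { {ws} {ν , ss} {ν′ , ss′} (ok , _) ((sν , cν , _) , _) ((sν′ , cν′ , _) , _) r r′ → functional ok sν cν sν′ cν′ r r′ }
      ; injective = λ _ _ _ r r′ → chain-functional r r′
      }
      where
      total : ∀ ws → WordW w ws → ∃ λ t → RibbonTabW k la w t × Chain k la (proj₁ t) (proj₂ t) ws
      total ws ((srt , ls , keys , r) , wt) with run⇒chain ws sla sc keys (λ x 1≤x → subst (λ b → Run _ _ b ws (occ la x)) (sym (occ-c x 1≤x)) (r x 1≤x))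
      ... | steps , ch = (fromBits c C , steps) , ((sc , c-core , chain⇒steps sc ch srt ls) , λ i → trans (cong (countLabels i) (chain-labels ch)) (wt i)) , ch
      cototal : ∀ t → RibbonTabW k la w t → ∃ λ ws → WordW w ws × Chain k la (proj₁ t) (proj₂ t) ws
      cototal (ν , steps) ((sν , cν , v) , wt) with steps⇒chain steps sν v
      ... | ws , ch , srt , ls = ws , ((srt , ls , chain-keys ch , λ x 1≤x → subst (λ b → Run _ _ b ws (occ la x)) (core≡c ν ws sν cν (chain-keys ch) (chain⇒run ch) x 1≤x) (chain⇒run ch x 1≤x)) ,
        λ i → trans (cong (countLabels i) (sym (chain-labels ch))) (wt i)) , ch
      functional : ∀ {ws ν ss ν′ ss′} → Word ws → StrictPartition ν → KCore k ν → StrictPartition ν′ → KCore k ν′ →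
        Chain k la ν ss ws → Chain k la ν′ ss′ ws → (ν , ss) ≡ (ν′ , ss′)
      functional (_ , _ , keys , _) sν cν sν′ cν′ r r′
        with occ-extensional sν sν′ (λ x 1≤x → trans (core≡c _ _ sν cν keys (chain⇒run r) x 1≤x) (sym (core≡c _ _ sν′ cν′ keys (chain⇒run r′) x 1≤x)))
      ... | refl = cong (_ ,_) (chain-injective r r′)

-- Runs, letter by letter

∈ᵇ : List Entry → Entry → Bool
∈ᵇ ws e = does (e ∈ᴱ? ws)

∈ᵇ⇒∈ : ∀ ws {e} → ∈ᵇ ws e ≡ true → e ∈ ws
∈ᵇ⇒∈ ws {e} h with does (e ∈ᴱ? ws) | proof (e ∈ᴱ? ws)
... | true | ofʸ e∈ = e∈

∈⇒∈ᵇ : ∀ ws {e} → e ∈ ws → ∈ᵇ ws e ≡ true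
∈⇒∈ᵇ ws {e} h with does (e ∈ᴱ? ws) | proof (e ∈ᴱ? ws)
... | true | _ = refl
... | false | ofⁿ n = ⊥-elim (n h)

sift : (Entry → Bool) → List Entry → List Entry
sift χ [] = []
sift χ (x ∷ xs) = if χ x then x ∷ sift χ xs else sift χ xs

∈-sift⁺ : ∀ χ {e xs} → e ∈ xs → χ e ≡ true → e ∈ sift χ xs
∈-sift⁺ χ {xs = x ∷ xs} (here refl) h rewrite h = here refl
∈-sift⁺ χ {xs = x ∷ xs} (there e∈) h with χ x
... | true = there (∈-sift⁺ χ e∈ h)
... | false = ∈-sift⁺ χ e∈ h

∈-sift⁻ : ∀ χ {e xs} → e ∈ sift χ xs → e ∈ xs × χ e ≡ true
∈-sift⁻ χ {xs = x ∷ xs} e∈ with χ x in eq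
∈-sift⁻ χ {xs = x ∷ xs} (here refl) | true = here refl , eq
∈-sift⁻ χ {xs = x ∷ xs} (there e∈) | true = there (proj₁ (∈-sift⁻ χ e∈)) , proj₂ (∈-sift⁻ χ {xs = xs} e∈)
∈-sift⁻ χ {xs = x ∷ xs} e∈ | false = there (proj₁ (∈-sift⁻ χ e∈)) , proj₂ (∈-sift⁻ χ {xs = xs} e∈)

sift-sorted : ∀ χ {xs} → Sorted xs → Sorted (sift χ xs)
sift-sorted χ {[]} [] = []
sift-sorted χ {x ∷ xs} (h ∷ hs) with χ x
... | true = All.tabulate (λ z∈ → All.lookup h (proj₁ (∈-sift⁻ χ z∈))) ∷ sift-sorted χ hs
... | false = sift-sorted χ hs

-- the entry of a letter at a key: just true if primed, just false if unprimed
mark : Bool → Bool → Maybe Bool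
mark true  _     = just true
mark false true  = just false
mark false false = nothing

entry : (Entry → Bool) → ℕ → ℕ → Maybe Bool
entry χ i p = mark (χ (lab i true , p)) (χ (lab i false , p))

-- The effect of one letter on a position: bit before, entry of the filling key, entry of the
-- vacating key, bit after. In `pass` the mark of the vacating key must be the bit, that of the
-- filling key is arbitrary.
data Step₁ : Bool → Maybe Bool → Maybe Bool → Bool → Set where
  stay  : ∀ {b} → Step₁ b nothing nothing b
  enter : ∀ {m} → Step₁ false (just m) nothing true
  leave : ∀ {m} → Step₁ true nothing (just m) false
  pass  : ∀ {b m} → Step₁ b (just m) (just b) b

pick : Bool → Entry → List Entry → List Entry
pick b e es = if b then e ∷ es else es

module Vertex {I O : ℕ} (I<O : I < O) where

  view-I : ∀ {b b′} → ActView I O I b b′ → b ≡ false × b′ ≡ true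
  view-I (fill _) = refl , refl
  view-I (vacate n _) = ⊥-elim (n refl)
  view-I (idle n _) = ⊥-elim (n refl)

  view-O : ∀ {b b′} → ActView I O O b b′ → b ≡ true × b′ ≡ false
  view-O (fill h) = ⊥-elim (<⇒≢ I<O (sym h))
  view-O (vacate _ _) = refl , refl
  view-O (idle _ n) = ⊥-elim (n refl)

  into : ActView I O I false true
  into = fill refl

  outof : ActView I O O true false
  outof = vacate (λ h → <⇒≢ I<O (sym h)) refl

  -- The four possible entries in reading order: the smaller key I stands inside, since primed keys
  -- descend and unprimed keys ascend.
  Block : ℕ → (a b c d : Bool) → List Entry → List Entry
  Block i a b c d rest = pick a (lab i true , O) (pick b (lab i true , I) (pick c (lab i false , I) (pick d (lab i false , O) rest)))

  pick-tail : ∀ a {e rest x x″} → Run I O x (pick a e rest) x″ → ∃ λ x′ → Run I O x′ rest x″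
  pick-tail true (_ ∷ r) = _ , r
  pick-tail false r = _ , r

  block-tail : ∀ {i} a b c d {rest x x″} → Run I O x (Block i a b c d rest) x″ → ∃ λ x′ → Run I O x′ rest x″
  block-tail a b c d r = pick-tail d (proj₂ (pick-tail c (proj₂ (pick-tail b (proj₂ (pick-tail a r))))))

  -- The two entries of I are neighbours in the block, so the second would fill an occupied
  -- position. The entries of O stand at the two ends and are not excluded here, but at the position
  -- which the key O fills.
  no-double : ∀ {i} a d {rest x x″} → ¬ Run I O x (Block i a true true d rest) x″
  no-double true d (v ∷ r) = no-double false d r
  no-double false d (v ∷ (v′ ∷ r)) with view-I v | view-I v′
  ... | _ , refl | () , _

  Alternative : Bool → Bool → Set
  Alternative a b = a ≡ true → b ≡ true → ⊥

  block⇒ : ∀ {i} a b c d {rest x x″} → Alternative a d → Alternative b c → Run I O x (Block i a b c d rest) x″ →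
    ∃ λ x′ → Step₁ x (mark b c) (mark a d) x′ × Run I O x′ rest x″
  block⇒ true _ _ true n _ _ = ⊥-elim (n refl refl)
  block⇒ _ true true _ _ n _ = ⊥-elim (n refl refl)
  block⇒ false false false false _ _ r = _ , stay , r
  block⇒ true false false false _ _ (v ∷ r) with view-O v
  ... | refl , refl = _ , leave , r
  block⇒ false false false true _ _ (v ∷ r) with view-O v
  ... | refl , refl = _ , leave , r
  block⇒ false true false false _ _ (v ∷ r) with view-I v
  ... | refl , refl = _ , enter , r
  block⇒ false false true false _ _ (v ∷ r) with view-I v
  ... | refl , refl = _ , enter , r
  block⇒ true true false false _ _ (v ∷ (v′ ∷ r)) with view-O v | view-I v′
  ... | refl , refl | _ , refl = _ , pass , r
  block⇒ true false true false _ _ (v ∷ (v′ ∷ r)) with view-O v | view-I v′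
  ... | refl , refl | _ , refl = _ , pass , r
  block⇒ false true false true _ _ (v ∷ (v′ ∷ r)) with view-I v | view-O v′
  ... | refl , refl | _ , refl = _ , pass , r
  block⇒ false false true true _ _ (v ∷ (v′ ∷ r)) with view-I v | view-O v′
  ... | refl , refl | _ , refl = _ , pass , r

  ⇒block : ∀ {i} a b c d {rest x x′ x″} → Alternative a d → Alternative b c →
    Step₁ x (mark b c) (mark a d) x′ → Run I O x′ rest x″ → Run I O x (Block i a b c d rest) x″
  ⇒block true _ _ true n _ _ _ = ⊥-elim (n refl refl)
  ⇒block _ true true _ _ n _ _ = ⊥-elim (n refl refl)
  ⇒block false false false false _ _ stay r = r
  ⇒block true false false false _ _ leave r = outof ∷ r
  ⇒block false false false true _ _ leave r = outof ∷ r
  ⇒block false true false false _ _ enter r = into ∷ r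
  ⇒block false false true false _ _ enter r = into ∷ r
  ⇒block true true false false _ _ pass r = outof ∷ (into ∷ r)
  ⇒block true false true false _ _ pass r = outof ∷ (into ∷ r)
  ⇒block false true false true _ _ pass r = into ∷ (outof ∷ r)
  ⇒block false false true true _ _ pass r = into ∷ (outof ∷ r)

  data Letters (f g : ℕ → Maybe Bool) : ℕ → ℕ → Bool → Bool → Set where
    end  : ∀ {i b} → Letters f g i zero b b
    _then_ : ∀ {i n b b′ b″} → Step₁ b (f i) (g i) b′ → Letters f g (suc i) n b′ b″ → Letters f g i (suc n) b b″

  canonical : (Entry → Bool) → ℕ → ℕ → List Entry
  canonical χ i n = sift χ (alphabet i n (O ∷ I ∷ []) (I ∷ O ∷ []))

  canonical-no-double : ∀ χ i n {x x″} → Run I O x (canonical χ i n) x″ → ∀ j → i ≤ j → j < i + n →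
    Alternative (χ (lab j true , I)) (χ (lab j false , I))
  canonical-no-double χ i zero r j h g = ⊥-elim (<⇒≱ g (≤-trans (≤-reflexive (+-identityʳ i)) h))
  canonical-no-double χ i (suc n) r j h g with i ≟ j
  ... | no ne = canonical-no-double χ (suc i) n
      (proj₂ (block-tail (χ (lab i true , O)) (χ (lab i true , I)) (χ (lab i false , I)) (χ (lab i false , O)) r))
      j (≤∧≢⇒< h ne) (≤-trans g (≤-reflexive (+-suc i n)))
  ... | yes refl = go (χ (lab i true , I)) (χ (lab i false , I)) r
    where
    go : ∀ b c {x x″} → Run I O x (Block i (χ (lab i true , O)) b c (χ (lab i false , O)) (canonical χ (suc i) n)) x″ → Alternative b c
    go true true r _ _ = no-double (χ (lab i true , O)) (χ (lab i false , O)) r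

  letters⇒ : ∀ χ i n {x x″} → (∀ j → i ≤ j → j < i + n → Alternative (χ (lab j true , O)) (χ (lab j false , O))) →
    Run I O x (canonical χ i n) x″ → Letters (λ j → entry χ j I) (λ j → entry χ j O) i n x x″
  letters⇒ χ i zero h [] = end
  letters⇒ χ i (suc n) h r with block⇒ (χ (lab i true , O)) (χ (lab i true , I)) (χ (lab i false , I)) (χ (lab i false , O))
      (h i ≤-refl i<) (canonical-no-double χ i (suc n) r i ≤-refl i<) r
    where
    i< : i < i + suc n
    i< = ≤-trans (s≤s (m≤m+n i n)) (≤-reflexive (sym (+-suc i n)))
  ... | x′ , s , r′ = s then letters⇒ χ (suc i) n (λ j a b → h j (<⇒≤ a) (≤-trans b (≤-reflexive (sym (+-suc i n))))) r′

  ⇒letters : ∀ χ i n {x x″} → (∀ j → i ≤ j → j < i + n → Alternative (χ (lab j true , O)) (χ (lab j false , O))) →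
    (∀ j → i ≤ j → j < i + n → Alternative (χ (lab j true , I)) (χ (lab j false , I))) →
    Letters (λ j → entry χ j I) (λ j → entry χ j O) i n x x″ → Run I O x (canonical χ i n) x″
  ⇒letters χ i zero h h′ end = []
  ⇒letters χ i (suc n) h h′ (s then r) =
    ⇒block (χ (lab i true , O)) (χ (lab i true , I)) (χ (lab i false , I)) (χ (lab i false , O)) (h i ≤-refl i<) (h′ i ≤-refl i<) s
      (⇒letters χ (suc i) n (λ j a b → h j (<⇒≤ a) (≤-trans b (≤-reflexive (sym (+-suc i n)))))
        (λ j a b → h′ j (<⇒≤ a) (≤-trans b (≤-reflexive (sym (+-suc i n))))) r)
    where
    i< : i < i + suc n
    i< = ≤-trans (s≤s (m≤m+n i n)) (≤-reflexive (sym (+-suc i n)))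

  private
    on : Entry → Bool
    on (l , p) = (p ≡ᵇ I) ∨ (p ≡ᵇ O)

    on-view : ∀ e → (on e ≡ true × (proj₂ e ≡ I ⊎ proj₂ e ≡ O)) ⊎ (on e ≡ false × proj₂ e ≢ I × proj₂ e ≢ O)
    on-view (l , p) with p ≡ᵇ I | proof (p ≟ I) | p ≡ᵇ O | proof (p ≟ O)
    ... | true | ofʸ h | _ | _ = inj₁ (refl , inj₁ h)
    ... | false | _ | true | ofʸ h = inj₁ (refl , inj₂ h)
    ... | false | ofⁿ n | false | ofⁿ n′ = inj₂ (refl , n , n′)

    on⇒ : ∀ {e} → on e ≡ true → proj₂ e ≡ I ⊎ proj₂ e ≡ O
    on⇒ {e} h with on-view e
    ... | inj₁ (_ , r) = r
    ... | inj₂ (h′ , _) with trans (sym h) h′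
    ...   | ()

    ⇒on : ∀ {e} → proj₂ e ≡ I ⊎ proj₂ e ≡ O → on e ≡ true
    ⇒on {e} h with on-view e
    ... | inj₁ (r , _) = r
    ... | inj₂ (_ , n , n′) with h
    ...   | inj₁ g = ⊥-elim (n g)
    ...   | inj₂ g = ⊥-elim (n′ g)

    onlyOn : List Entry → List Entry
    onlyOn = sift on

  restrict : ∀ ws {x x″} → Run I O x ws x″ → Run I O x (onlyOn ws) x″
  restrict [] [] = []
  restrict ((l , p) ∷ ws) (v ∷ r) with on-view (l , p)
  ... | inj₁ (h , _) rewrite h = v ∷ restrict ws r
  restrict ((l , p) ∷ ws) (fill h ∷ r) | inj₂ (_ , n , _) = ⊥-elim (n h)
  restrict ((l , p) ∷ ws) (vacate _ h ∷ r) | inj₂ (_ , _ , n) = ⊥-elim (n h)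
  restrict ((l , p) ∷ ws) (idle _ _ ∷ r) | inj₂ (h , _ , _) rewrite h = restrict ws r

  unrestrict : ∀ ws {x x″} → Run I O x (onlyOn ws) x″ → Run I O x ws x″
  unrestrict [] r = r
  unrestrict ((l , p) ∷ ws) r with on-view (l , p)
  ... | inj₂ (h , n , n′) rewrite h = idle n n′ ∷ unrestrict ws r
  ... | inj₁ (h , _) rewrite h with r
  ...   | v ∷ r′ = v ∷ unrestrict ws r′

  -- Both lists are sorted and have the same members. On the right the entries are arranged in
  -- blocks, one for each letter.
  onlyOn≡canonical : ∀ m {ws} → Sorted ws → All (λ e → 1 ≤ idx (proj₁ e) × idx (proj₁ e) ≤ m) ws → onlyOn ws ≡ canonical (∈ᵇ ws) 1 m
  onlyOn≡canonical m {ws} srt ls = sorted-extensional (sift-sorted on srt)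
    (sift-sorted (∈ᵇ ws) (alphabet-sorted 1 m ((I<O ∷ []) ∷ [] ∷ []) ((I<O ∷ []) ∷ [] ∷ [])))
    to from
    where
    to : ∀ {z} → z ∈ onlyOn ws → z ∈ canonical (∈ᵇ ws) 1 m
    to {l , p} z∈ with ∈-sift⁻ on {xs = ws} z∈
    ... | z∈ws , h = ∈-sift⁺ (∈ᵇ ws) (∈-alphabet⁺ 1 m _ _ (proj₁ (All.lookup ls z∈ws)) (s≤s (proj₂ (All.lookup ls z∈ws))) (d (on⇒ {l , p} h)) (a (on⇒ {l , p} h))) (∈⇒∈ᵇ ws z∈ws)
      where
      d : p ≡ I ⊎ p ≡ O → p ∈ O ∷ I ∷ []
      d (inj₁ h) = there (here h)
      d (inj₂ h) = here h
      a : p ≡ I ⊎ p ≡ O → p ∈ I ∷ O ∷ []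
      a (inj₁ h) = here h
      a (inj₂ h) = there (here h)
    from : ∀ {z} → z ∈ canonical (∈ᵇ ws) 1 m → z ∈ onlyOn ws
    from {l , p} z∈ with ∈-sift⁻ (∈ᵇ ws) z∈
    ... | z∈a , h = ∈-sift⁺ on (∈ᵇ⇒∈ ws h) (⇒on {l , p} (key (proj₂ (proj₂ (∈-alphabet⁻ 1 m _ _ z∈a)))))
      where
      key : p ∈ O ∷ I ∷ [] ⊎ p ∈ I ∷ O ∷ [] → p ≡ I ⊎ p ≡ O
      key (inj₁ (here e)) = inj₂ e
      key (inj₁ (there (here e))) = inj₁ e
      key (inj₂ (here e)) = inj₁ e
      key (inj₂ (there (here e))) = inj₂ e

isJust : Maybe Bool → Bool
isJust (just _) = true
isJust nothing = false

after : Bool → Maybe Bool → Maybe Bool → Bool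
after b (just _) nothing  = true
after b nothing  (just _) = false
after b (just _) (just _) = b
after b nothing  nothing  = b

step₁-after : ∀ {b i o b′} → Step₁ b i o b′ → b′ ≡ after b i o
step₁-after stay = refl
step₁-after enter = refl
step₁-after leave = refl
step₁-after pass = refl

-- the bit after the letters s, …, s + n - 1
bitAt : (f g : ℕ → Maybe Bool) → ℕ → Bool → ℕ → Bool
bitAt f g s b zero = b
bitAt f g s b (suc n) = after (bitAt f g s b n) (f (s + n)) (g (s + n))

bitAt-shift : ∀ f g s b n → bitAt f g (suc s) (after b (f s) (g s)) n ≡ bitAt f g s b (suc n)
bitAt-shift f g s b zero rewrite +-identityʳ s = refl
bitAt-shift f g s b (suc n) rewrite bitAt-shift f g s b n | +-suc s n = refl

-- A run in which the intermediate bits are computed instead of quantified, so that two related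
-- families of entries can be compared letter by letter.
History : (f g : ℕ → Maybe Bool) → ℕ → Bool → Bool → Set
History f g m b b″ = (∀ i → i < m → Step₁ (bitAt f g 1 b i) (f (suc i)) (g (suc i)) (bitAt f g 1 b (suc i))) × bitAt f g 1 b m ≡ b″

module _ {I O : ℕ} (I<O : I < O) where
  open Vertex I<O

  letters⇒history′ : ∀ f g s n {b b″} → Letters f g s n b b″ →
    (∀ i → i < n → Step₁ (bitAt f g s b i) (f (s + i)) (g (s + i)) (bitAt f g s b (suc i))) × bitAt f g s b n ≡ b″
  letters⇒history′ f g s zero end = (λ _ ()) , refl
  letters⇒history′ f g s (suc n) {b} (_then_ {b′ = b′} st r) with step₁-after st | letters⇒history′ f g (suc s) n r
  ... | refl | h , e = steps , trans (sym (bitAt-shift f g s b n)) e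
    where
    steps : ∀ i → i < suc n → Step₁ (bitAt f g s b i) (f (s + i)) (g (s + i)) (bitAt f g s b (suc i))
    steps zero _ rewrite +-identityʳ s = st
    steps (suc i) (s≤s i<) with h i i<
    ... | q rewrite bitAt-shift f g s b i | +-suc s i = q

  history⇒letters′ : ∀ f g s n {b b″} →
    (∀ i → i < n → Step₁ (bitAt f g s b i) (f (s + i)) (g (s + i)) (bitAt f g s b (suc i))) → bitAt f g s b n ≡ b″ → Letters f g s n b b″
  history⇒letters′ f g s zero h refl = end
  history⇒letters′ f g s (suc n) {b} h e = first then history⇒letters′ f g (suc s) n rest (trans (bitAt-shift f g s b n) e)
    where
    first : Step₁ b (f s) (g s) (after b (f s) (g s))
    first with h 0 (s≤s z≤n)
    ... | q rewrite +-identityʳ s = q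
    rest : ∀ i → i < n → Step₁ (bitAt f g (suc s) (after b (f s) (g s)) i) (f (suc s + i)) (g (suc s + i)) (bitAt f g (suc s) (after b (f s) (g s)) (suc i))
    rest i i< with h (suc i) (s≤s i<)
    ... | q rewrite bitAt-shift f g s b i | +-suc s i = q

Letters≤ : ℕ → List Entry → Set
Letters≤ m ws = All (λ e → 1 ≤ idx (proj₁ e) × idx (proj₁ e) ≤ m) ws

NoDouble : List Entry → Set
NoDouble ws = ∀ i p → (lab i true , p) ∈ ws → (lab i false , p) ∈ ws → ⊥

run-no-double : ∀ {m ws I O b b″} → Sorted ws → Letters≤ m ws → I < O → Run I O b ws b″ →
  ∀ i → (lab i true , I) ∈ ws → (lab i false , I) ∈ ws → ⊥
run-no-double {m} {ws} srt ls I<O r i h h′ =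
  canonical-no-double (∈ᵇ ws) 1 m (subst (λ xs → Run _ _ _ xs _) (onlyOn≡canonical m srt ls) (restrict ws r))
    i (proj₁ (All.lookup ls h)) (s≤s (proj₂ (All.lookup ls h))) (∈⇒∈ᵇ ws h) (∈⇒∈ᵇ ws h′)
  where open Vertex I<O

run⇒history : ∀ {m ws I O b b″} → Sorted ws → Letters≤ m ws → NoDouble ws → I < O → Run I O b ws b″ →
  History (λ i → entry (∈ᵇ ws) i I) (λ i → entry (∈ᵇ ws) i O) m b b″
run⇒history {m} {ws} srt ls nd I<O r = letters⇒history′ I<O _ _ 1 m
  (letters⇒ (∈ᵇ ws) 1 m (λ j _ _ h h′ → nd j _ (∈ᵇ⇒∈ ws h) (∈ᵇ⇒∈ ws h′))
    (subst (λ xs → Run _ _ _ xs _) (onlyOn≡canonical m srt ls) (restrict ws r)))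
  where open Vertex I<O

history⇒run : ∀ {m ws I O b b″} → Sorted ws → Letters≤ m ws → NoDouble ws → I < O →
  History (λ i → entry (∈ᵇ ws) i I) (λ i → entry (∈ᵇ ws) i O) m b b″ → Run I O b ws b″
history⇒run {m} {ws} srt ls nd I<O (h , e) = unrestrict ws (subst (λ xs → Run _ _ _ xs _) (sym (onlyOn≡canonical m srt ls))
  (⇒letters (∈ᵇ ws) 1 m (λ j _ _ h h′ → nd j _ (∈ᵇ⇒∈ ws h) (∈ᵇ⇒∈ ws h′)) (λ j _ _ h h′ → nd j _ (∈ᵇ⇒∈ ws h) (∈ᵇ⇒∈ ws h′))
    (history⇒letters′ I<O _ _ 1 m h e)))
  where open Vertex I<O

-- Reversing the direction in which the marks of a strip are determined.  The entries u 0, u 1, … of a letter along a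
-- path of keys are linked by positions with bits σ 0, σ 1, …; where u n and u (n + 1) are both present, the
-- second is just (σ n).  After the flip, the first is just (not (σ n)), and the free mark of a run of consecutive
-- entries has travelled from its first to its last entry.

start : (ℕ → Maybe Bool) → ℕ → Maybe Bool
start u zero = u zero
start u (suc n) = if isJust (u n) then start u n else u (suc n)

flip : (ℕ → Bool) → (ℕ → Maybe Bool) → ℕ → Maybe Bool
flip σ u n = if isJust (u n) then (if isJust (u (suc n)) then just (not (σ n)) else start u n) else nothing

-- The entry at the upper end of the run of consecutive entries through n, as `start` gives the one
-- at its lower end. The first argument is fuel; it suffices when no entry is present from n + f on.
end : ℕ → (ℕ → Maybe Bool) → ℕ → Maybe Bool
end zero v n = v n
end (suc f) v n = if isJust (v (suc n)) then end f v (suc n) else v n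

unflip : ℕ → (ℕ → Bool) → (ℕ → Maybe Bool) → ℕ → Maybe Bool
unflip L σ v zero = if isJust (v 0) then end L v 0 else nothing
unflip L σ v (suc n) = if isJust (v (suc n)) then (if isJust (v n) then just (σ n) else end (L ∸ suc n) v (suc n)) else nothing

start-isJust : ∀ u n → isJust (u n) ≡ true → isJust (start u n) ≡ true
start-isJust u zero h = h
start-isJust u (suc n) h with isJust (u n) in eq
... | true = start-isJust u n eq
... | false = h

end-isJust : ∀ f v n → isJust (v n) ≡ true → isJust (end f v n) ≡ true
end-isJust zero v n h = h
end-isJust (suc f) v n h with isJust (v (suc n)) in eq
... | true = end-isJust f v (suc n) eq
... | false = h

flip-isJust : ∀ σ u n → isJust (flip σ u n) ≡ isJust (u n)
flip-isJust σ u n with isJust (u n) in eq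
... | false = refl
... | true with isJust (u (suc n))
...   | true = refl
...   | false = start-isJust u n eq

unflip-isJust : ∀ L σ v n → isJust (unflip L σ v n) ≡ isJust (v n)
unflip-isJust L σ v zero with isJust (v 0) in eq
... | false = refl
... | true = end-isJust L v 0 eq
unflip-isJust L σ v (suc n) with isJust (v (suc n)) in eq
... | false = refl
... | true with isJust (v n)
...   | true = refl
...   | false = end-isJust (L ∸ suc n) v (suc n) eq

Linked↑ Linked↓ : (ℕ → Bool) → (ℕ → Maybe Bool) → Set
Linked↑ σ u = ∀ n → isJust (u n) ≡ true → isJust (u (suc n)) ≡ true → u (suc n) ≡ just (σ n)
Linked↓ σ v = ∀ n → isJust (v n) ≡ true → isJust (v (suc n)) ≡ true → v n ≡ just (not (σ n))

flip-linked : ∀ σ u → Linked↓ σ (flip σ u)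
flip-linked σ u n h h′ rewrite flip-isJust σ u n | flip-isJust σ u (suc n) | h | h′ = refl

unflip-linked : ∀ L σ v → Linked↑ σ (unflip L σ v)
unflip-linked L σ v n h h′ rewrite unflip-isJust L σ v n | unflip-isJust L σ v (suc n) | h | h′ = refl

isJust-false : ∀ {m} → isJust m ≡ false → m ≡ nothing
isJust-false {nothing} _ = refl

module _ (L : ℕ) (σ : ℕ → Bool) where

  end-flip : ∀ u → (∀ n → L ≤ n → isJust (u n) ≡ false) → ∀ f n → L ≤ n + f → isJust (u n) ≡ true → end f (flip σ u) n ≡ start u n
  end-flip u far zero n h j with trans (sym j) (far n (≤-trans h (≤-reflexive (+-identityʳ n))))
  ... | ()
  end-flip u far (suc f) n h j rewrite flip-isJust σ u (suc n) with isJust (u (suc n)) in eq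
  ... | true rewrite end-flip u far f (suc n) (≤-trans h (≤-reflexive (+-suc n f))) eq | j = refl
  ... | false rewrite j = refl

  -- The first mark of a run comes back from its last entry, where `flip` has put it; all other
  -- marks of the run are forced by `Linked↑`.
  unflip-flip : ∀ u → (∀ n → L ≤ n → isJust (u n) ≡ false) → Linked↑ σ u → ∀ n → unflip L σ (flip σ u) n ≡ u n
  unflip-flip u far lk zero rewrite flip-isJust σ u 0 with isJust (u 0) in eq
  ... | false = sym (isJust-false eq)
  ... | true = end-flip u far L 0 ≤-refl eq
  unflip-flip u far lk (suc n) rewrite flip-isJust σ u (suc n) | flip-isJust σ u n with isJust (u (suc n)) in eq
  ... | false = sym (isJust-false eq)
  ... | true with isJust (u n) in eq′
  ...   | true = sym (lk n eq′ eq)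
  ...   | false rewrite end-flip u far (L ∸ suc n) (suc n) (m≤n+m∸n L (suc n)) eq | eq′ = refl

  private
    fuel : ∀ n → n < L → L ∸ n ≡ suc (L ∸ suc n)
    fuel n n<L = +-∸-assoc 1 n<L

  start-unflip : ∀ v → (∀ n → L ≤ n → isJust (v n) ≡ false) → ∀ n → isJust (v n) ≡ true → start (unflip L σ v) n ≡ end (L ∸ n) v n
  start-unflip v far zero j rewrite j = refl
  start-unflip v far (suc n) j rewrite unflip-isJust L σ v n with isJust (v n) in eq
  ... | false rewrite j = refl
  ... | true rewrite start-unflip v far n eq | fuel n (≰⇒> λ L≤n → case trans (sym eq) (far n L≤n) of λ ()) | j = refl

  flip-unflip : ∀ v → (∀ n → L ≤ n → isJust (v n) ≡ false) → Linked↓ σ v → ∀ n → flip σ (unflip L σ v) n ≡ v n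
  flip-unflip v far lk n rewrite unflip-isJust L σ v n | unflip-isJust L σ v (suc n) with isJust (v n) in eq
  ... | false = sym (isJust-false eq)
  ... | true with isJust (v (suc n)) in eq′
  ...   | true = sym (lk n eq eq′)
  ...   | false = trans (start-unflip v far n eq) (last (L ∸ n))
    where
    last : ∀ f → end f v n ≡ v n
    last zero = refl
    last (suc f) rewrite eq′ = refl

-- Standardisation of shifted fillings

bump : ℕ → (ℕ → ℕ) → ℕ → ℕ
bump p h d = if d ≡ᵇ p then suc (h d) else h d

bump-here : ∀ p h → bump p h p ≡ suc (h p)
bump-here p h with p ≡ᵇ p | proof (p ≟ p)
... | true | _ = refl
... | false | ofⁿ n = ⊥-elim (n refl)

bump-there : ∀ {p d} h → d ≢ p → bump p h d ≡ h d
bump-there {p} {d} h ne with d ≡ᵇ p | proof (d ≟ p)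
... | true | ofʸ e = ⊥-elim (ne e)
... | false | _ = refl

bump-≥ : ∀ p h d → h d ≤ bump p h d
bump-≥ p h d with d ≡ᵇ p
... | true = n≤1+n _
... | false = ≤-refl

-- h counts the beads of s from d on, up to a constant. Only this recursion is used, so that `cnt`,
-- its translates and the counts on a folded path can be treated alike.
IsTail′ : (ℕ → ℕ) → (ℕ → Bool) → Set
IsTail′ h s = ∀ d → 1 ≤ d → h d ≡ bit (s d) + h (suc d)

module _ {h s} (tl : IsTail′ h s) where

  tail-suc : ∀ d → 1 ≤ d → h (suc d) ≤ h d
  tail-suc d 1≤d = ≤-trans (m≤n+m _ (bit (s d))) (≤-reflexive (sym (tl d 1≤d)))

  tail-lip : ∀ d → 1 ≤ d → h d ≤ suc (h (suc d))
  tail-lip d 1≤d = ≤-trans (≤-reflexive (tl d 1≤d)) (+-monoˡ-≤ _ (bit≤1 (s d)))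

  tail-anti : ∀ n d → 1 ≤ d → h (d + n) ≤ h d
  tail-anti zero d _ = ≤-reflexive (cong h (+-identityʳ d))
  tail-anti (suc n) d 1≤d = ≤-trans (≤-reflexive (cong h (+-suc d n))) (≤-trans (tail-suc (d + n) (≤-trans 1≤d (m≤m+n d n))) (tail-anti n d 1≤d))

  tail-lipschitz : ∀ n d → 1 ≤ d → h d ≤ n + h (d + n)
  tail-lipschitz zero d _ = ≤-reflexive (cong h (sym (+-identityʳ d)))
  tail-lipschitz (suc n) d 1≤d = ≤-trans (tail-lipschitz n d 1≤d)
    (≤-trans (+-monoʳ-≤ n (tail-lip (d + n) (≤-trans 1≤d (m≤m+n d n)))) (≤-reflexive (trans (+-suc n _) (cong (λ z → suc (n + h z)) (sym (+-suc d n))))))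

  tail-full : ∀ {d} → 1 ≤ d → s d ≡ true → h d ≡ suc (h (suc d))
  tail-full {d} 1≤d e = trans (tl d 1≤d) (cong (λ b → bit b + h (suc d)) e)

  tail-free : ∀ {d} → 1 ≤ d → s d ≡ false → h d ≡ h (suc d)
  tail-free {d} 1≤d e = trans (tl d 1≤d) (cong (λ b → bit b + h (suc d)) e)

move : ℕ → (ℕ → Bool) → ℕ → Bool
move p s y = if y ≡ᵇ p then true else if suc y ≡ᵇ p then false else s y

move-view : ∀ {p s y b} → ActView y (suc y) p (s y) b → b ≡ move p s y
move-view {p} {s} {y} = go (s y) refl
  where
  go : ∀ a {b} → s y ≡ a → ActView y (suc y) p a b → b ≡ move p s y
  go a e v with y ≡ᵇ p | proof (y ≟ p) | suc y ≡ᵇ p | proof (suc y ≟ p)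
  go _ e (fill h) | true | _ | _ | _ = refl
  go _ e (fill h) | false | ofⁿ n | _ | _ = ⊥-elim (n (sym h))
  go _ e (vacate n h) | true | ofʸ f | _ | _ = ⊥-elim (n (sym f))
  go _ e (vacate n h) | false | _ | true | _ = refl
  go _ e (vacate n h) | false | _ | false | ofⁿ f = ⊥-elim (f (sym h))
  go _ e (idle n n′) | true | ofʸ f | _ | _ = ⊥-elim (n (sym f))
  go _ e (idle n n′) | false | _ | true | ofʸ f = ⊥-elim (n′ (sym f))
  go _ e (idle n n′) | false | _ | false | _ = sym e

-- For p = 1 the second condition is empty: the position 0 supplies beads without limit.
Movable : ℕ → (ℕ → Bool) → Set
Movable p s = s p ≡ false × (∀ q → 1 ≤ q → suc q ≡ p → s q ≡ true)

movable-view : ∀ {p s} → Movable p s → ∀ y → 1 ≤ y → ActView y (suc y) p (s y) (move p s y)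
movable-view {p} {s} (free , full) y 1≤y with y ≡ᵇ p | proof (y ≟ p) | suc y ≡ᵇ p | proof (suc y ≟ p)
... | true | ofʸ refl | _ | _ rewrite free = fill refl
... | false | ofⁿ n | true | ofʸ refl rewrite full y 1≤y refl = vacate (λ e → n (sym e)) refl
... | false | ofⁿ n | false | ofⁿ n′ = idle (λ e → n (sym e)) (λ e → n′ (sym e))

bump-tail : ∀ {p h s} → IsTail′ h s → 1 ≤ p → Movable p s → IsTail′ (bump p h) (move p s)
bump-tail {p} {h} {s} tl 1≤p (free , full) d 1≤d with d ≡ᵇ p | proof (d ≟ p) | suc d ≡ᵇ p | proof (suc d ≟ p)
... | true | ofʸ refl | true | ofʸ e = ⊥-elim (1+n≢n e)
... | true | ofʸ refl | false | _ = cong suc (tail-free tl 1≤d free)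
... | false | _ | true | ofʸ refl = tail-full tl 1≤d (full d 1≤d refl)
... | false | _ | false | _ = tl d 1≤d

module Standard {t : ℕ → Bool} {ht : ℕ → ℕ} (tt′ : IsTail′ ht t) where

  Dom : (ℕ → ℕ) → ℕ → ℕ → Set
  Dom hs r p = 1 ≤ p × hs p < r × r ≤ ht p

  -- (r , p) is the cell of row r on the diagonal p
  Local : (ℕ → ℕ → Label) → (ℕ → ℕ) → Set
  Local F hs =
    (∀ r p → Dom hs r p → Dom hs r (suc p) → (F r p , p) ≺ (F r (suc p) , suc p)) ×
    (∀ r p → Dom hs r (suc p) → Dom hs (suc r) p → (F r (suc p) , suc p) ≺ (F (suc r) p , p))

  -- The word lists the cells of F in an order of addition: every entry is the next cell on its
  -- diagonal when its turn comes. Sortedness of the word is a separate condition.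
  data Std (F : ℕ → ℕ → Label) : (ℕ → ℕ) → List Entry → Set where
    done : ∀ {hs} → (∀ p → 1 ≤ p → hs p ≡ ht p) → Std F hs []
    cell : ∀ {hs p l ws} → 1 ≤ p → F (suc (hs p)) p ≡ l → Std F (bump p hs) ws → Std F hs ((l , p) ∷ ws)

  std-≤ : ∀ {F hs ws} → Std F hs ws → ∀ p → 1 ≤ p → hs p ≤ ht p
  std-≤ (done e) p 1≤p = ≤-reflexive (e p 1≤p)
  std-≤ {hs = hs} (cell {p = q} _ _ s) p 1≤p = ≤-trans (bump-≥ q hs p) (std-≤ s p 1≤p)

  dom-unbump : ∀ q hs {r p} → Dom (bump q hs) r p → Dom hs r p
  dom-unbump q hs (a , b , c) = a , ≤-trans (s≤s (bump-≥ q hs _)) b , c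

  dom-split : ∀ q {hs r p} → Dom hs r p → (p ≡ q × r ≡ suc (hs q)) ⊎ Dom (bump q hs) r p
  dom-split q {hs} {r} {p} (a , b , c) with p ≟ q
  ... | no ne = inj₂ (a , subst (_< r) (sym (bump-there hs ne)) b , c)
  ... | yes refl with r ≟ suc (hs p)
  ...   | yes e = inj₁ (refl , e)
  ...   | no ne = inj₂ (a , subst (_< r) (sym (bump-here p hs)) (≤∧≢⇒< b (λ e → ne (sym e))) , c)

  std-∈⁻ : ∀ {F hs ws} → Std F hs ws → ∀ {l p} → (l , p) ∈ ws → ∃ λ r → Dom hs r p × F r p ≡ l
  std-∈⁻ {hs = hs} (cell {p = q} 1≤p e s) (here refl) = suc (hs q) , (1≤p , ≤-refl , ≤-trans (≤-reflexive (sym (bump-here q hs))) (std-≤ s q 1≤p)) , e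
  std-∈⁻ {hs = hs} (cell {p = q} 1≤p e s) (there h) with std-∈⁻ s h
  ... | r , d , e′ = r , dom-unbump q hs d , e′

  std-∈⁺ : ∀ {F hs ws} → Std F hs ws → ∀ {r p} → Dom hs r p → (F r p , p) ∈ ws
  std-∈⁺ (done e) (a , b , c) = ⊥-elim (<⇒≱ b (≤-trans c (≤-reflexive (sym (e _ a)))))
  std-∈⁺ {hs = hs} (cell {p = q} 1≤p e s) d with dom-split q {hs} d
  ... | inj₁ (refl , refl) = here (cong (_, q) e)
  ... | inj₂ d′ = there (std-∈⁺ s d′)

  std-determined : ∀ {F F′ hs ws} → Std F hs ws → Std F′ hs ws → ∀ r p → Dom hs r p → F r p ≡ F′ r p
  std-determined (done e) _ r p (a , b , c) = ⊥-elim (<⇒≱ b (≤-trans c (≤-reflexive (sym (e p a)))))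
  std-determined {hs = hs} (cell {p = q} _ e s) (cell _ e′ s′) r p d with dom-split q {hs} d
  ... | inj₁ (refl , refl) = trans e (sym e′)
  ... | inj₂ d′ = std-determined s s′ r p d′

  std-cong : ∀ {F F′ hs ws} → (∀ r p → Dom hs r p → F r p ≡ F′ r p) → Std F hs ws → Std F′ hs ws
  std-cong h (done e) = done e
  std-cong {hs = hs} h (cell {p = q} 1≤p e s) = cell 1≤p
    (trans (sym (h _ _ (1≤p , ≤-refl , ≤-trans (≤-reflexive (sym (bump-here q hs))) (std-≤ s q 1≤p)))) e)
    (std-cong (λ r p d → h r p (dom-unbump q hs d)) s)

  module _ {F hs s} (ts : IsTail′ hs s) (loc : Local F hs) where

    -- The two cells are compared through the cell to the right of the first, which is also the one
    -- below the second; a skew shape that contains both contains it too.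
    diagonal : ∀ r p → Dom hs r p → Dom hs (suc r) p → (F r p , p) ≺ (F (suc r) p , p)
    diagonal r p d@(1≤p , a , b) d′@(_ , a′ , b′) = ≺-trans (proj₁ loc r p d m) (proj₂ loc r p m d′)
      where
      m : Dom hs r (suc p)
      m = s≤s z≤n , ≤-<-trans (tail-suc ts p 1≤p) a , s≤s⁻¹ (≤-trans b′ (tail-lip tt′ p 1≤p))

    diagonals : ∀ n r p → Dom hs r p → Dom hs (suc (r + n)) p → (F r p , p) ≺ (F (suc (r + n)) p , p)
    diagonals zero r p d d′ rewrite +-identityʳ r = diagonal r p d d′
    diagonals (suc n) r p d d′ = subst (λ z → (F r p , p) ≺ (F (suc z) p , p)) (sym (+-suc r n))
      (≺-trans (diagonals n r p d m) (diagonal _ p m d″))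
      where
      d″ : Dom hs (suc (suc (r + n))) p
      d″ = subst (λ z → Dom hs (suc z) p) (+-suc r n) d′
      m : Dom hs (suc (r + n)) p
      m = proj₁ d , ≤-trans (proj₁ (proj₂ d)) (≤-trans (m≤m+n r n) (n≤1+n _)) , ≤-trans (n≤1+n _) (proj₂ (proj₂ d″))

    diagonal-< : ∀ {r r′ p} → Dom hs r p → Dom hs r′ p → r < r′ → (F r p , p) ≺ (F r′ p , p)
    diagonal-< {r} {r′} {p} d d′ lt = subst (λ z → (F r p , p) ≺ (F z p , p)) (m+[n∸m]≡n lt)
      (diagonals (r′ ∸ suc r) r p d (subst (λ z → Dom hs z p) (sym (m+[n∸m]≡n lt)) d′))

  local-antitone : ∀ {F hs q} → Local F hs → Local F (bump q hs)
  local-antitone {hs = hs} {q = q} (h , v) = (λ r p d d′ → h r p (dom-unbump q hs d) (dom-unbump q hs d′)) , (λ r p d d′ → v r p (dom-unbump q hs d) (dom-unbump q hs d′))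

  -- The least cell of a filling is an inner corner, so the sorted cells can be added one after another.
  standardise : ∀ {F} ws {hs s} → IsTail′ hs s → (∀ p → 1 ≤ p → hs p ≤ ht p) → Local F hs → Sorted ws →
    (∀ {l p} → (l , p) ∈ ws → ∃ λ r → Dom hs r p × F r p ≡ l) → (∀ {r p} → Dom hs r p → (F r p , p) ∈ ws) →
    Std F hs ws × (∀ y → 1 ≤ y → Run y (suc y) (s y) ws (t y))
  standardise {F} [] {hs} {s} ts le loc _ into onto = done eq , λ y 1≤y → subst (Run y (suc y) (s y) []) (bits y 1≤y) []
    where
    eq : ∀ p → 1 ≤ p → hs p ≡ ht p
    eq p 1≤p with hs p <? ht p
    ... | no n = ≤-antisym (le p 1≤p) (≮⇒≥ n)
    ... | yes lt with onto (1≤p , lt , ≤-refl)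
    ...   | ()
    bits : ∀ y → 1 ≤ y → s y ≡ t y
    bits y 1≤y = bit-injective (+-cancelʳ-≡ (hs (suc y)) _ _ (trans (sym (ts y 1≤y)) (trans (eq y 1≤y) (trans (tt′ y 1≤y) (cong (bit (t y) +_) (sym (eq (suc y) (s≤s z≤n))))))))
  standardise {F} ((l , p) ∷ ws) {hs} {s} ts le loc (least ∷ srt) into onto with into (here refl)
  ... | r , d@(1≤p , hs<r , r≤ht) , refl = cell 1≤p (cong (λ z → F z p) (sym r≡)) (proj₁ rec) ,
      λ y 1≤y → movable-view movable y 1≤y ∷ proj₂ rec y 1≤y
    where
    minimal : ∀ {r′ p′} → Dom hs r′ p′ → ¬ (F r′ p′ , p′) ≺ (F r p , p)
    minimal d′ lt with onto d′
    ... | here e = ≺-irrefl (subst (_≺ (F r p , p)) e lt)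
    ... | there h = ≺-asym lt (All.lookup least h)
    -- If this failed, or `free`, or `full`, then a smaller cell would still be missing: the
    -- preceding cell on the diagonal, the cell below, or the cell to the left, respectively.
    r≡ : r ≡ suc (hs p)
    r≡ with r ≟ suc (hs p)
    ... | yes e = e
    ... | no ne = ⊥-elim (minimal d₀ (diagonal-< ts loc d₀ d (≤∧≢⇒< hs<r (λ e → ne (sym e)))))
      where
      d₀ : Dom hs (suc (hs p)) p
      d₀ = 1≤p , ≤-refl , ≤-trans hs<r r≤ht
    free : s p ≡ false
    free with s p in eq
    ... | false = refl
    ... | true = ⊥-elim (minimal lower (subst (λ z → (F (hs p) (suc p) , suc p) ≺ (F z p , p)) (sym r≡) (proj₂ loc (hs p) p lower (subst (λ z → Dom hs z p) r≡ d))))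
      where
      lower : Dom hs (hs p) (suc p)
      lower = s≤s z≤n , ≤-reflexive (sym (tail-full ts 1≤p eq)) , s≤s⁻¹ (≤-trans hs<r (≤-trans r≤ht (tail-lip tt′ p 1≤p)))
    full : ∀ q → 1 ≤ q → suc q ≡ p → s q ≡ true
    full q 1≤q refl with s q in eq
    ... | true = refl
    ... | false = ⊥-elim (minimal before (proj₁ loc r q before d))
      where
      before : Dom hs r q
      before = 1≤q , ≤-trans (s≤s (≤-reflexive (tail-free ts 1≤q eq))) hs<r , ≤-trans r≤ht (tail-suc tt′ q 1≤q)
    movable : Movable p s
    movable = free , full
    le′ : ∀ d → 1 ≤ d → bump p hs d ≤ ht d
    le′ d 1≤d with d ≟ p
    ... | yes refl = ≤-trans (≤-reflexive (bump-here p hs)) (≤-trans hs<r r≤ht)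
    ... | no ne = ≤-trans (≤-reflexive (bump-there hs ne)) (le d 1≤d)
    into′ : ∀ {l′ p′} → (l′ , p′) ∈ ws → ∃ λ r′ → Dom (bump p hs) r′ p′ × F r′ p′ ≡ l′
    into′ h with into (there h)
    ... | r′ , d′ , e with dom-split p {hs} d′
    ...   | inj₂ d″ = r′ , d″ , e
    ...   | inj₁ (refl , refl) = ⊥-elim (≺-irrefl (subst ((F r p , p) ≺_) (cong (_, p) (trans (sym e) (cong (λ z → F z p) (sym r≡)))) (All.lookup least h)))
    onto′ : ∀ {r′ p′} → Dom (bump p hs) r′ p′ → (F r′ p′ , p′) ∈ ws
    onto′ {r′} d′ with onto (dom-unbump p hs d′)
    ... | there h = h
    ... | here e with cong proj₂ e
    ...   | refl = ⊥-elim (≺-irrefl (subst ((F r p , p) ≺_) e (diagonal-< ts loc d (dom-unbump p hs d′)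
              (subst (_< r′) (trans (bump-here p hs) (sym r≡)) (proj₁ (proj₂ d′))))))
    rec : Std F (bump p hs) ws × (∀ y → 1 ≤ y → Run y (suc y) (move p s y) ws (t y))
    rec = standardise ws (bump-tail ts 1≤p movable) le′ (local-antitone {q = p} loc) srt into′ onto′

  -- The n-th entry with key p is the label of the n-th cell on the diagonal p; unrecorded cells get a junk label.
  fillingOf : (ℕ → ℕ) → List Entry → ℕ → ℕ → Label
  fillingOf hs [] r p = lab 1 true
  fillingOf hs ((l , q) ∷ ws) r p = if (p ≡ᵇ q) ∧ (r ≡ᵇ suc (hs q)) then l else fillingOf (bump q hs) ws r p

  fillingOf-here : ∀ hs l q ws → fillingOf hs ((l , q) ∷ ws) (suc (hs q)) q ≡ l
  fillingOf-here hs l q ws with q ≡ᵇ q | proof (q ≟ q) | hs q ≡ᵇ hs q | proof (hs q ≟ hs q)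
  ... | true | _ | true | _ = refl
  ... | false | ofⁿ n | _ | _ = ⊥-elim (n refl)
  ... | true | _ | false | ofⁿ n = ⊥-elim (n refl)

  fillingOf-there : ∀ hs l q ws {r p} → Dom (bump q hs) r p → fillingOf hs ((l , q) ∷ ws) r p ≡ fillingOf (bump q hs) ws r p
  fillingOf-there hs l q ws {r} {p} (_ , a , _) with p ≡ᵇ q | proof (p ≟ q) | r ≡ᵇ suc (hs q) | proof (r ≟ suc (hs q))
  ... | true | ofʸ refl | true | ofʸ refl = ⊥-elim (<-irrefl refl a)
  ... | false | _ | _ | _ = refl
  ... | true | _ | false | _ = refl

  -- The first cell added precedes all others because the word is sorted, and it is an inner corner,
  -- so none of the remaining cells is its left or lower neighbour. Hence `Local` survives when this
  -- cell is put in front.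
  unstandardise : ∀ ws {hs s} M → IsTail′ hs s → (∀ d → M < d → hs d ≡ ht d) → Sorted ws →
    All (λ e → 1 ≤ proj₂ e) ws → (∀ y → 1 ≤ y → Run y (suc y) (s y) ws (t y)) →
    Std (fillingOf hs ws) hs ws × Local (fillingOf hs ws) hs
  unstandardise [] {hs} {s} M ts far _ _ r = done eq , (λ r p (a , b , c) _ → ⊥-elim (<⇒≱ b (≤-trans c (≤-reflexive (sym (eq p a)))))) ,
    (λ r p (a , b , c) _ → ⊥-elim (<⇒≱ b (≤-trans c (≤-reflexive (sym (eq (suc p) a))))))
    where
    empty : ∀ {y b b′} → Run y (suc y) b [] b′ → b ≡ b′
    empty [] = refl
    eq : ∀ p → 1 ≤ p → hs p ≡ ht p
    eq = tail-unique hs ht s M ts (λ d 1≤d → trans (tt′ d 1≤d) (cong (λ b → bit b + ht (suc d)) (sym (empty (r d 1≤d))))) far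
  unstandardise ((l , q) ∷ ws) {hs} {s} M ts far (least ∷ srt) (1≤q ∷ keys) r = std , loc
    where
    heads : ∀ y → 1 ≤ y → ActView y (suc y) q (s y) (move q s y) × Run y (suc y) (move q s y) ws (t y)
    heads y 1≤y with run-head (r y 1≤y)
    ... | b , v , r′ = subst (ActView y (suc y) q (s y)) (move-view {s = s} v) v , subst (λ b → Run y (suc y) b ws (t y)) (move-view {s = s} v) r′
    movable : Movable q s
    movable = f (proj₁ (heads q 1≤q)) , λ p 1≤p e → g p e (proj₁ (heads p 1≤p))
      where
      f : ∀ {a b} → ActView q (suc q) q a b → a ≡ false
      f (fill _) = refl
      f (vacate n _) = ⊥-elim (n refl)
      f (idle n _) = ⊥-elim (n refl)
      g : ∀ p {a b} → suc p ≡ q → ActView p (suc p) q a b → a ≡ true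
      g p refl (fill h) = ⊥-elim (1+n≢n h)
      g p refl (vacate _ _) = refl
      g p refl (idle _ n) = ⊥-elim (n refl)
    F F′ : ℕ → ℕ → Label
    F = fillingOf hs ((l , q) ∷ ws)
    F′ = fillingOf (bump q hs) ws
    rec : Std F′ (bump q hs) ws × Local F′ (bump q hs)
    rec = unstandardise ws (M ⊔ q) (bump-tail ts 1≤q movable)
      (λ d M<d → trans (bump-there hs (λ e → <⇒≢ (≤-<-trans (m≤n⊔m M q) M<d) (sym e))) (far d (≤-<-trans (m≤m⊔n M q) M<d))) srt keys (λ y 1≤y → proj₂ (heads y 1≤y))
    std : Std F hs ((l , q) ∷ ws)
    std = cell 1≤q (fillingOf-here hs l q ws) (std-cong (λ r p d → sym (fillingOf-there hs l q ws d)) (proj₁ rec))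
    first : ∀ {r p} → Dom (bump q hs) r p → (F (suc (hs q)) q , q) ≺ (F r p , p)
    first {r} {p} d = subst₂ (λ a b → (a , q) ≺ (b , p)) (sym (fillingOf-here hs l q ws)) (sym (fillingOf-there hs l q ws d)) (All.lookup least (std-∈⁺ (proj₁ rec) d))
    later : ∀ {r p r′ p′} → Dom (bump q hs) r p → Dom (bump q hs) r′ p′ → (F′ r p , p) ≺ (F′ r′ p′ , p′) → (F r p , p) ≺ (F r′ p′ , p′)
    later {p = p} {p′ = p′} d d′ = subst₂ (λ a b → (a , p) ≺ (b , p′)) (sym (fillingOf-there hs l q ws d)) (sym (fillingOf-there hs l q ws d′))
    loc : Local F hs
    loc = horizontal , vertical
      where
      horizontal : ∀ r p → Dom hs r p → Dom hs r (suc p) → (F r p , p) ≺ (F r (suc p) , suc p)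
      horizontal r p d d′ with dom-split q {hs} d | dom-split q {hs} d′
      ... | inj₁ (refl , refl) | inj₁ (e , _) = ⊥-elim (1+n≢n e)
      ... | inj₁ (refl , refl) | inj₂ d″ = first d″
      ... | inj₂ d₁ | inj₂ d₂ = later d₁ d₂ (proj₁ (proj₂ rec) r p d₁ d₂)
      ... | inj₂ _ | inj₁ (refl , refl) = ⊥-elim (<⇒≱ (proj₁ (proj₂ d)) (≤-reflexive (sym (tail-full ts (proj₁ d) (proj₂ movable p (proj₁ d) refl)))))
      vertical : ∀ r p → Dom hs r (suc p) → Dom hs (suc r) p → (F r (suc p) , suc p) ≺ (F (suc r) p , p)
      vertical r p d d′ with dom-split q {hs} d | dom-split q {hs} d′
      ... | inj₁ (refl , refl) | inj₁ (e , _) = ⊥-elim (1+n≢n (sym e))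
      ... | inj₁ (refl , refl) | inj₂ d″ = first d″
      ... | inj₂ d₁ | inj₂ d₂ = later d₁ d₂ (proj₂ (proj₂ rec) r p d₁ d₂)
      ... | inj₂ _ | inj₁ (refl , refl) = ⊥-elim (<-irrefl (sym (tail-free ts (proj₁ d′) (proj₁ movable))) (proj₁ (proj₂ d)))

-- Lists by index, sorting, and the count of a letter

nth-length : ∀ {A : Set} (xs : List A) i {x} → nth xs i ≡ just x → i < length xs
nth-length (x ∷ xs) zero _ = s≤s z≤n
nth-length (x ∷ xs) (suc i) h = s≤s (nth-length xs i h)

nth-defined : ∀ {A : Set} (xs : List A) i → i < length xs → ∃ λ x → nth xs i ≡ just x
nth-defined (x ∷ xs) zero _ = x , refl
nth-defined (x ∷ xs) (suc i) (s≤s h) = nth-defined xs i h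

nth-beyond : ∀ {A : Set} (xs : List A) i → length xs ≤ i → nth xs i ≡ nothing
nth-beyond [] i h = refl
nth-beyond (x ∷ xs) (suc i) (s≤s h) = nth-beyond xs i h

nth-applyUpTo : ∀ {A : Set} (f : ℕ → A) n i → i < n → nth (applyUpTo f n) i ≡ just (f i)
nth-applyUpTo f (suc n) zero _ = refl
nth-applyUpTo f (suc n) (suc i) (s≤s h) = nth-applyUpTo (f ∘ suc) n i h

nth-extensional : ∀ {A : Set} (xs ys : List A) → length xs ≡ length ys → (∀ i → i < length xs → nth xs i ≡ nth ys i) → xs ≡ ys
nth-extensional [] [] _ _ = refl
nth-extensional (x ∷ xs) (y ∷ ys) e h with h 0 (s≤s z≤n)
... | refl = cong (x ∷_) (nth-extensional xs ys (suc-injective e) (λ i lt → h (suc i) (s≤s lt)))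

rowAt-just : ∀ f i {xs} → nth f i ≡ just xs → rowAt f (suc i) ≡ xs
rowAt-just f i h with nth f i
rowAt-just f i refl | just _ = refl

rowAt-nothing : ∀ f i → nth f i ≡ nothing → rowAt f (suc i) ≡ []
rowAt-nothing f i h with nth f i
rowAt-nothing f i refl | nothing = refl

part-0 : ∀ la → part la 0 ≡ 0
part-0 [] = refl
part-0 (_ ∷ _) = refl

part-beyond : ∀ la r → length la < r → part la r ≡ 0
part-beyond [] r _ = refl
part-beyond (p ∷ la) (suc (suc r)) (s≤s h) = part-beyond la (suc r) h
part-beyond (p ∷ la) (suc zero) (s≤s ())

bound : ∀ {A : Set} (f : A → ℕ) (xs : List A) → ∃ λ M → All (λ x → f x ≤ M) xs
bound f [] = 0 , []
bound f (x ∷ xs) with bound f xs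
... | M , h = f x ⊔ M , m≤m⊔n _ _ ∷ All.map (λ q → ≤-trans q (m≤n⊔m _ _)) h

-- Sorting is done by sifting the alphabet up to the largest letter and the largest key that occur.
sort : (xs : List Entry) → All (λ e → 1 ≤ idx (proj₁ e) × 1 ≤ proj₂ e) xs →
  ∃ λ ws → Sorted ws × (∀ {e} → e ∈ xs → e ∈ ws) × (∀ {e} → e ∈ ws → e ∈ xs)
sort xs h with bound (idx ∘ proj₁) xs | bound proj₂ xs
... | m , hm | K , hK = sift (∈ᵇ xs) (fullAlphabet m K) , sift-sorted (∈ᵇ xs) (fullAlphabet-sorted m K) ,
  (λ e∈ → ∈-sift⁺ (∈ᵇ xs) (∈-fullAlphabet⁺ m K (proj₁ (All.lookup h e∈)) (All.lookup hm e∈) (proj₂ (All.lookup h e∈)) (All.lookup hK e∈)) (∈⇒∈ᵇ xs e∈)) ,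
  λ e∈ → ∈ᵇ⇒∈ xs (proj₂ (∈-sift⁻ (∈ᵇ xs) {xs = fullAlphabet m K} e∈))

count : ℕ → List Entry → ℕ
count i ws = countLabels i (map proj₁ ws)

count-filter : ∀ i ws → count i ws ≡ length (filter (λ e → idx (proj₁ e) ≟ i) ws)
count-filter i [] = refl
count-filter i ((l , p) ∷ ws) with idx l ≡ᵇ i
... | true = cong suc (count-filter i ws)
... | false = count-filter i ws

countLabels-++ : ∀ i xs ys → countLabels i (xs ++ ys) ≡ countLabels i xs + countLabels i ys
countLabels-++ i xs ys = trans (cong length (filter-++ (λ l → idx l ≟ i) xs ys)) (length-++ (filter (λ l → idx l ≟ i) xs))

count-++ : ∀ i xs ys → count i (xs ++ ys) ≡ count i xs + count i ys
count-++ i xs ys = trans (cong (countLabels i) (map-++ proj₁ xs ys)) (countLabels-++ i (map proj₁ xs) (map proj₁ ys))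

count-same : ∀ i {xs ys} → Unique xs → Unique ys → (∀ {e} → e ∈ xs → e ∈ ys) → (∀ {e} → e ∈ ys → e ∈ xs) → count i xs ≡ count i ys
count-same i {xs} {ys} u v h g = trans (count-filter i xs) (trans (unique-length (AP.filter⁺ P? u) (AP.filter⁺ P? v)
  (λ e∈ → let (a , b) = ∈-filter⁻ P? {xs = xs} e∈ in ∈-filter⁺ P? (h a) b)
  (λ e∈ → let (a , b) = ∈-filter⁻ P? {xs = ys} e∈ in ∈-filter⁺ P? (g a) b)) (sym (count-filter i ys)))
  where
  P? : (e : Entry) → Dec (idx (proj₁ e) ≡ i)
  P? e = idx (proj₁ e) ≟ i

-- Fillings of a skew shifted shape la \ mu.  Its diagonals are numbered from N + 1 on, the room below being used
-- for positions that never move.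

≺⇒≤ : ∀ {l p l′ p′} → (l , p) ≺ (l′ , p′) → l ≤L l′
≺⇒≤ (inj₁ h) = <⇒≤ h
≺⇒≤ (inj₂ (refl , _)) = ≤-refl

≺⇒unmarked : ∀ {l p p′} → (l , p) ≺ (l , p′) → p < p′ → marked l ≡ false
≺⇒unmarked (inj₁ h) _ = ⊥-elim (<-irrefl refl h)
≺⇒unmarked {lab i false} (inj₂ _) _ = refl
≺⇒unmarked {lab i true} (inj₂ (_ , h)) g = ⊥-elim (<-asym h g)

≺⇒marked : ∀ {l p p′} → (l , p) ≺ (l , p′) → p′ < p → marked l ≡ true
≺⇒marked (inj₁ h) _ = ⊥-elim (<-irrefl refl h)
≺⇒marked {lab i true} (inj₂ _) _ = refl
≺⇒marked {lab i false} (inj₂ (_ , h)) g = ⊥-elim (<-asym h g)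

unmarked⇒≺ : ∀ {l l′ p p′} → l ≤L l′ → (l ≡ l′ → marked l ≡ false) → p < p′ → (l , p) ≺ (l′ , p′)
unmarked⇒≺ {l} {l′} le h g with code l ≟ code l′
... | no ne = inj₁ (≤∧≢⇒< le ne)
... | yes e with code-injective {l} {l′} e
...   | refl = inj₂ (refl , subst (λ b → Toward b _ _) (sym (h refl)) g)

marked⇒≺ : ∀ {l l′ p p′} → l ≤L l′ → (l ≡ l′ → marked l ≡ true) → p′ < p → (l , p) ≺ (l′ , p′)
marked⇒≺ {l} {l′} le h g with code l ≟ code l′
... | no ne = inj₁ (≤∧≢⇒< le ne)
... | yes e with code-injective {l} {l′} e
...   | refl = inj₂ (refl , subst (λ b → Toward b _ _) (sym (h refl)) g)

module Fillings {la mu} (hla : Decreasing la) (hmu : Decreasing mu) (N : ℕ)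
  {s t : ℕ → Bool} {hs ht : ℕ → ℕ} (ts : IsTail′ hs s) (tt′ : IsTail′ ht t)
  (hs≡ : ∀ d → 1 ≤ d → hs (d + N) ≡ cnt mu d) (ht≡ : ∀ d → 1 ≤ d → ht (d + N) ≡ cnt la d)
  (low : ∀ p → 1 ≤ p → p ≤ N → hs p ≡ ht p) (sub : ∀ d → 1 ≤ d → cnt mu d ≤ cnt la d) where

  open Standard {t} {ht} tt′

  InShape : ℕ → ℕ → Set
  InShape r d = 1 ≤ r × part mu r < d × d ≤ part la r

  dom⇒shape : ∀ {r} d → 1 ≤ d → Dom hs r (d + N) → InShape r d
  dom⇒shape {r} d 1≤d (_ , a , b) = 1≤r , ≰⇒> (λ h → <⇒≱ a (≤-trans (≤part⇒≤cnt hmu r d 1≤r 1≤d h) (≤-reflexive (sym (hs≡ d 1≤d))))) ,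
    ≤cnt⇒≤part hla r d 1≤r (≤-trans b (≤-reflexive (ht≡ d 1≤d)))
    where
    1≤r : 1 ≤ r
    1≤r = ≤-trans (s≤s z≤n) a

  shape⇒dom : ∀ {r} d → InShape r d → Dom hs r (d + N)
  shape⇒dom {r} d (1≤r , a , b) = ≤-trans 1≤d (m≤m+n d N) ,
    ≰⇒> (λ h → <⇒≱ a (≤cnt⇒≤part hmu r d 1≤r (≤-trans h (≤-reflexive (hs≡ d 1≤d))))) ,
    ≤-trans (≤part⇒≤cnt hla r d 1≤r 1≤d b) (≤-reflexive (sym (ht≡ d 1≤d)))
    where
    1≤d : 1 ≤ d
    1≤d = ≤-trans (s≤s z≤n) a

  dom-diagonal : ∀ {r p} → Dom hs r p → ∃ λ d → 1 ≤ d × p ≡ d + N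
  dom-diagonal {r} {p} (1≤p , a , b) with p ≤? N
  ... | yes h = ⊥-elim (<⇒≱ a (≤-trans b (≤-reflexive (sym (low p 1≤p h)))))
  ... | no n = p ∸ N , m<n⇒0<n∸m (≰⇒> n) , sym (m∸n+n≡m (<⇒≤ (≰⇒> n)))

  -- A relation, since a filling determines F on the cells of its shape only. The row r begins on
  -- the diagonal `part mu r` + 1.
  Reads : Filling → (ℕ → ℕ → Label) → Set
  Reads f F = ∀ r d → InShape r d → nth (rowAt f r) (d ∸ suc (part mu r)) ≡ just (F r (d + N))

  Lengths : Filling → Set
  Lengths f = ∀ r → length (rowAt f r) ≡ part la r ∸ part mu r

  at⇒shape : ∀ {f c r l} → Lengths f → At mu f (c , r) l → ∃ λ d → InShape r d × suc c ≡ r + d × nth (rowAt f r) (d ∸ suc (part mu r)) ≡ just l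
  at⇒shape {f} {c} {r} {l} len (1≤r , le , e) = suc (c ∸ r) , (1≤r , s≤s mu≤ , d≤) , sym (trans (+-suc r _) (cong suc (m+[n∸m]≡n r≤c))) , e′
    where
    r≤c : r ≤ c
    r≤c = ≤-trans (m≤m+n r _) le
    e′ : nth (rowAt f r) (c ∸ r ∸ part mu r) ≡ just l
    e′ = trans (cong (nth (rowAt f r)) (∸-+-assoc c r (part mu r))) e
    mu≤ : part mu r ≤ c ∸ r
    mu≤ = +-cancelˡ-≤ r _ _ (≤-trans le (≤-reflexive (sym (m+[n∸m]≡n r≤c))))
    d≤ : suc (c ∸ r) ≤ part la r
    d≤ = ≰⇒> λ h → <⇒≱ (nth-length (rowAt f r) _ e′) (≤-trans (≤-reflexive (len r)) (∸-monoˡ-≤ (part mu r) h))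

  shape⇒at : ∀ {f r e l} → InShape r (suc e) → nth (rowAt f r) (e ∸ part mu r) ≡ just l → At mu f (r + e , r) l
  shape⇒at {f} {r} {e} (1≤r , s≤s a , b) h = 1≤r , +-monoʳ-≤ r a , trans (cong (nth (rowAt f r)) ([m+n]∸[m+o]≡n∸o r e (part mu r))) h

  read : Filling → ℕ → ℕ → Label
  read f r p = fromMaybe (lab 1 true) (nth (rowAt f r) (p ∸ N ∸ suc (part mu r)))

  read-reads : ∀ {f} → Lengths f → Reads f (read f)
  read-reads {f} len r d (1≤r , a , b) rewrite m+n∸n≡m d N with nth-defined (rowAt f r) (d ∸ suc (part mu r))
      (≤-trans (≤-reflexive (sym (+-∸-assoc 1 a))) (≤-trans (∸-monoˡ-≤ (part mu r) b) (≤-reflexive (sym (len r)))))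
  ... | x , e rewrite e = refl

  rowOf : (ℕ → ℕ → Label) → ℕ → List Label
  rowOf F r = applyUpTo (λ i → F r (suc (part mu r + i) + N)) (part la r ∸ part mu r)

  write : (ℕ → ℕ → Label) → Filling
  write F = applyUpTo (λ i → rowOf F (suc i)) (length la)

  rowAt-write : ∀ F r → 1 ≤ r → rowAt (write F) r ≡ rowOf F r
  rowAt-write F (suc i) _ with i <? length la
  ... | yes h = rowAt-just (write F) i (nth-applyUpTo _ _ i h)
  ... | no n = trans (rowAt-nothing (write F) i (nth-beyond (write F) i (≤-trans (≤-reflexive (length-applyUpTo _ (length la))) (≮⇒≥ n))))
    (sym (cong (applyUpTo _) (trans (cong (_∸ part mu (suc i)) (part-beyond la (suc i) (s≤s (≮⇒≥ n)))) (0∸n≡0 (part mu (suc i))))))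

  write-lengths : ∀ F → Lengths (write F)
  write-lengths F zero = sym (trans (cong (_∸ part mu 0) (part-0 la)) (0∸n≡0 (part mu 0)))
  write-lengths F (suc r) = trans (cong length (rowAt-write F (suc r) (s≤s z≤n))) (length-applyUpTo _ _)

  write-reads : ∀ F → Reads (write F) F
  write-reads F r d (1≤r , a , b) rewrite rowAt-write F r 1≤r = trans (nth-applyUpTo _ _ (d ∸ suc (part mu r))
    (≤-trans (≤-reflexive (sym (+-∸-assoc 1 a))) (∸-monoˡ-≤ (part mu r) b)))
    (cong (λ z → just (F r (z + N))) (m+[n∸m]≡n a))

  reads-injective : ∀ {f f′ F F′} → ShTab la mu f → ShTab la mu f′ → Reads f F → Reads f′ F′ →
    (∀ r p → Dom hs r p → F r p ≡ F′ r p) → f ≡ f′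
  reads-injective {f} {f′} {F} {F′} (lf , len , _) (lf′ , len′ , _) rd rd′ same =
    nth-extensional f f′ (trans lf (sym lf′)) rows
    where
    row≡ : ∀ r → 1 ≤ r → rowAt f r ≡ rowAt f′ r
    row≡ r 1≤r = nth-extensional _ _ (trans (len r) (sym (len′ r))) entries
      where
      entries : ∀ i → i < length (rowAt f r) → nth (rowAt f r) i ≡ nth (rowAt f′ r) i
      entries i h = trans (subst (λ z → nth (rowAt f r) z ≡ just (F r (d + N))) (m+n∸m≡n (part mu r) i) (rd r d sh))
        (trans (cong just (same r (d + N) (shape⇒dom d sh))) (sym (subst (λ z → nth (rowAt f′ r) z ≡ just (F′ r (d + N))) (m+n∸m≡n (part mu r) i) (rd′ r d sh))))
        where
        d : ℕ
        d = suc (part mu r + i)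
        sh : InShape r d
        sh = 1≤r , s≤s (m≤m+n _ i) , lia (part mu r ∷ i ∷ part la r ∷ (part la r ∸ part mu r) ∷ []) (λ m i a x → i :< x :⇒ x :+ m := a :⇒ ⊢ con 1 :+ (m :+ i) :≤ a)
          (≤-trans h (≤-reflexive (len r))) (m∸n+n≡m (<⇒≤ (m<n⇒m<n′ (≤-trans h (≤-reflexive (len r))))))
          where
          m<n⇒m<n′ : i < part la r ∸ part mu r → part mu r < part la r
          m<n⇒m<n′ q = ≰⇒> λ z → <⇒≱ q (≤-trans (≤-reflexive (m≤n⇒m∸n≡0 z)) z≤n)
    rows : ∀ i → i < length f → nth f i ≡ nth f′ i
    rows i h with nth-defined f i h | nth-defined f′ i (≤-trans h (≤-reflexive (trans lf (sym lf′)))) | row≡ (suc i) (s≤s z≤n)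
    ... | x , e | x′ , e′ | q = trans e (trans (cong just (trans (sym (rowAt-just f i e)) (trans q (rowAt-just f′ i e′)))) (sym e′))

  Positive : (ℕ → ℕ → Label) → Set
  Positive F = ∀ r p → Dom hs r p → 1 ≤ idx (F r p)

  reads-at : ∀ {f} F → Reads f F → ∀ r e → InShape r (suc e) → At mu f (r + e , r) (F r (suc e + N))
  reads-at F rd r e sh = shape⇒at sh (rd r (suc e) sh)

  shtab⇒local : ∀ {f} F → ShTab la mu f → Reads f F → Local F hs × Positive F
  shtab⇒local {f} F (_ , len , pos , rows , cols , unm , mrk) rd = (horizontal , vertical) , positive
    where
    positive : Positive F
    positive r p D with dom-diagonal D
    ... | suc e , 1≤d , refl = pos _ _ (reads-at F rd r e (dom⇒shape (suc e) 1≤d D))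
    horizontal : ∀ r p → Dom hs r p → Dom hs r (suc p) → (F r p , p) ≺ (F r (suc p) , suc p)
    horizontal r p D D′ with dom-diagonal D
    ... | suc e , 1≤d , refl = unmarked⇒≺ (rows _ _ _ _ _ a a′ (+-monoʳ-≤ r (n≤1+n e)))
        (λ h → unm _ _ _ _ a (subst (At mu f (r + suc e , r)) (sym h) a′) (λ q → 1+n≢n (sym (+-cancelˡ-≡ r _ _ q)))) ≤-refl
      where
      a : At mu f (r + e , r) (F r (suc e + N))
      a = reads-at F rd r e (dom⇒shape (suc e) 1≤d D)
      a′ : At mu f (r + suc e , r) (F r (suc (suc e) + N))
      a′ = reads-at F rd r (suc e) (dom⇒shape (suc (suc e)) (s≤s z≤n) D′)
    vertical : ∀ r p → Dom hs r (suc p) → Dom hs (suc r) p → (F r (suc p) , suc p) ≺ (F (suc r) p , p)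
    vertical r p D D′ with dom-diagonal D′
    ... | suc e , 1≤d , refl = marked⇒≺ (cols _ _ _ _ _ a a′ (n≤1+n r))
        (λ h → mrk _ _ _ _ a (subst (At mu f (r + suc e , suc r)) (sym h) a′) (λ q → 1+n≢n (sym q))) ≤-refl
      where
      a : At mu f (r + suc e , r) (F r (suc (suc e) + N))
      a = reads-at F rd r (suc e) (dom⇒shape (suc (suc e)) (s≤s z≤n) D)
      a′ : At mu f (r + suc e , suc r) (F (suc r) (suc e + N))
      a′ = subst (λ c → At mu f (c , suc r) (F (suc r) (suc e + N))) (sym (+-suc r e)) (reads-at F rd (suc r) e (dom⇒shape (suc e) 1≤d D′))

  -- The conditions on a filling compare any two cells of a row or column, those of `Local` only
  -- neighbours; the cells in between belong to the skew shape.
  row-chain : ∀ {F} → Local F hs → ∀ n r p → Dom hs r p → Dom hs r (suc (p + n)) → (F r p , p) ≺ (F r (suc (p + n)) , suc (p + n))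
  row-chain {F} loc zero r p D D′ = subst (λ z → (F r p , p) ≺ (F r (suc z) , suc z)) (sym (+-identityʳ p))
    (proj₁ loc r p D (subst (λ z → Dom hs r (suc z)) (+-identityʳ p) D′))
  row-chain {F} loc (suc n) r p D D′ = subst (λ z → (F r p , p) ≺ (F r (suc z) , suc z)) (sym (+-suc p n))
    (≺-trans (row-chain loc n r p D M) (proj₁ loc r (suc (p + n)) M D″))
    where
    D″ : Dom hs r (suc (suc (p + n)))
    D″ = subst (λ z → Dom hs r (suc z)) (+-suc p n) D′
    M : Dom hs r (suc (p + n))
    M = s≤s z≤n , ≤-<-trans (subst (λ z → hs z ≤ hs p) (+-suc p n) (tail-anti ts (suc n) p (proj₁ D))) (proj₁ (proj₂ D)) ,
      ≤-trans (proj₂ (proj₂ D″)) (tail-suc tt′ (suc (p + n)) (s≤s z≤n))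

  column-chain : ∀ {F} → Local F hs → ∀ n r p → Dom hs r (p + suc n) → Dom hs (r + suc n) p → (F r (p + suc n) , p + suc n) ≺ (F (r + suc n) p , p)
  column-chain {F} loc zero r p D D′ rewrite +-comm p 1 | +-comm r 1 = proj₂ loc r p D D′
  column-chain {F} loc (suc n) r p D D′ = subst₂ (λ a b → (F r a , a) ≺ (F b p , p)) (sym (+-suc p (suc n))) (sym (+-suc r (suc n)))
    (≺-trans (proj₂ loc r (p + suc n) D₁ M) (column-chain loc n (suc r) p M D₂))
    where
    D₁ : Dom hs r (suc (p + suc n))
    D₁ = subst (Dom hs r) (+-suc p (suc n)) D
    D₂ : Dom hs (suc r + suc n) p
    D₂ = subst (λ z → Dom hs z p) (+-suc r (suc n)) D′
    1≤ : 1 ≤ p + suc n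
    1≤ = ≤-trans (s≤s z≤n) (m≤n+m (suc n) p)
    M : Dom hs (suc r) (p + suc n)
    M = 1≤ , s≤s (≤-trans (tail-lip ts (p + suc n) 1≤) (proj₁ (proj₂ D₁))) ,
      lia (r ∷ n ∷ ht p ∷ ht (p + suc n) ∷ []) (λ r n a b → con 1 :+ r :+ (con 1 :+ n) :≤ a :⇒ a :≤ con 1 :+ n :+ b :⇒ ⊢ con 1 :+ r :≤ b)
        (proj₂ (proj₂ D₂)) (tail-lipschitz tt′ (suc n) p (proj₁ D₂))

  local⇒shtab : ∀ {f F} → length f ≡ length la → Lengths f → Reads f F → Local F hs → Positive F → ShTab la mu f
  local⇒shtab {f} {F} lf len rd loc pos = lf , len , idx≥1 , rows , cols , unm , mrk
    where
    locate : ∀ {c r l} → At mu f (c , r) l → ∃ λ d → Dom hs r (d + N) × suc c ≡ r + d × F r (d + N) ≡ l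
    locate {c} {r} {l} a with at⇒shape {f} len a
    ... | d , sh , e , h = d , shape⇒dom d sh , e , just-injective (trans (sym (rd r d sh)) h)
    idx≥1 : ∀ x l → At mu f x l → 1 ≤ idx l
    idx≥1 (c , r) l a with locate a
    ... | d , D , e , refl = pos r _ D
    rowLess : ∀ {c c′ r l l′} → At mu f (c , r) l → At mu f (c′ , r) l′ → c < c′ → ∃ λ p → ∃ λ p′ → p < p′ × (l , p) ≺ (l′ , p′)
    rowLess {c} {c′} {r} a a′ lt with locate a | locate a′
    ... | d , D , e , refl | d′ , D′ , e′ , refl = d + N , d′ + N , +-monoˡ-< N d<d′ ,
        subst (λ z → (F r (d + N) , d + N) ≺ (F r z , z)) eq (row-chain loc (d′ ∸ suc d) r (d + N) D (subst (Dom hs r) (sym eq) D′))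
      where
      d<d′ : d < d′
      d<d′ = +-cancelˡ-< r _ _ (subst₂ _<_ e e′ (s≤s lt))
      eq : suc (d + N + (d′ ∸ suc d)) ≡ d′ + N
      eq = lia (d ∷ N ∷ (d′ ∸ suc d) ∷ d′ ∷ []) (λ d N x d′ → con 1 :+ d :+ x := d′ :⇒ ⊢ con 1 :+ (d :+ N :+ x) := d′ :+ N) (m+[n∸m]≡n d<d′)
    colLess : ∀ {c r r′ l l′} → At mu f (c , r) l → At mu f (c , r′) l′ → r < r′ → ∃ λ p → ∃ λ p′ → p′ < p × (l , p) ≺ (l′ , p′)
    colLess {c} {r} {r′} a a′ lt with locate a | locate a′
    ... | d , D , e , refl | d′ , D′ , e′ , refl = d + N , d′ + N , +-monoˡ-< N d′<d ,
        subst₂ (λ x y → (F r x , x) ≺ (F y (d′ + N) , d′ + N)) eqp eqr (column-chain loc n r (d′ + N) (subst (Dom hs r) (sym eqp) D) (subst (λ z → Dom hs z (d′ + N)) (sym eqr) D′))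
      where
      n : ℕ
      n = r′ ∸ suc r
      eqr : r + suc n ≡ r′
      eqr = trans (+-suc r n) (m+[n∸m]≡n lt)
      d′<d : d′ < d
      d′<d = lia (r ∷ r′ ∷ d ∷ d′ ∷ c ∷ []) (λ r r′ d d′ c → con 1 :+ c := r :+ d :⇒ con 1 :+ c := r′ :+ d′ :⇒ r :< r′ :⇒ ⊢ d′ :< d) e e′ lt
      eqp : d′ + N + suc n ≡ d + N
      eqp = lia (r ∷ r′ ∷ d ∷ d′ ∷ c ∷ n ∷ N ∷ []) (λ r r′ d d′ c n N → con 1 :+ c := r :+ d :⇒ con 1 :+ c := r′ :+ d′ :⇒ r :+ (con 1 :+ n) := r′ :⇒ ⊢ d′ :+ N :+ (con 1 :+ n) := d :+ N) e e′ eqr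
    same : ∀ {c r l l′} → At mu f (c , r) l → At mu f (c , r) l′ → l ≡ l′
    same (_ , _ , h) (_ , _ , g) = just-injective (trans (sym h) g)
    rows : ∀ c c′ r l l′ → At mu f (c , r) l → At mu f (c′ , r) l′ → c ≤ c′ → l ≤L l′
    rows c c′ r l l′ a a′ le with c ≟ c′
    ... | no ne = let (_ , _ , _ , h) = rowLess a a′ (≤∧≢⇒< le ne) in ≺⇒≤ h
    ... | yes refl = ≤-reflexive (cong code (same a a′))
    cols : ∀ c r r′ l l′ → At mu f (c , r) l → At mu f (c , r′) l′ → r ≤ r′ → l ≤L l′
    cols c r r′ l l′ a a′ le with r ≟ r′
    ... | no ne = let (_ , _ , _ , h) = colLess a a′ (≤∧≢⇒< le ne) in ≺⇒≤ h
    ... | yes refl = ≤-reflexive (cong code (same a a′))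
    unm : ∀ c c′ r l → At mu f (c , r) l → At mu f (c′ , r) l → c ≢ c′ → marked l ≡ false
    unm c c′ r l a a′ ne with <-cmp c c′
    ... | tri< lt _ _ = let (_ , _ , g , h) = rowLess a a′ lt in ≺⇒unmarked h g
    ... | tri≈ _ e _ = ⊥-elim (ne e)
    ... | tri> _ _ gt = let (_ , _ , g , h) = rowLess a′ a gt in ≺⇒unmarked h g
    mrk : ∀ c r r′ l → At mu f (c , r) l → At mu f (c , r′) l → r ≢ r′ → marked l ≡ true
    mrk c r r′ l a a′ ne with <-cmp r r′
    ... | tri< lt _ _ = let (_ , _ , g , h) = colLess a a′ lt in ≺⇒marked h g
    ... | tri≈ _ e _ = ⊥-elim (ne e)
    ... | tri> _ _ gt = let (_ , _ , g , h) = colLess a′ a gt in ≺⇒marked h g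

  rowEntries : ℕ → List Label → List Entry
  rowEntries p [] = []
  rowEntries p (l ∷ ls) = (l , p) ∷ rowEntries (suc p) ls

  entriesFrom : ℕ → Filling → List Entry
  entriesFrom r [] = []
  entriesFrom r (xs ∷ f) = rowEntries (suc (part mu r) + N) xs ++ entriesFrom (suc r) f

  count-rowEntries : ∀ i p xs → count i (rowEntries p xs) ≡ countLabels i xs
  count-rowEntries i p [] = refl
  count-rowEntries i p (l ∷ ls) with idx l ≡ᵇ i
  ... | true = cong suc (count-rowEntries i (suc p) ls)
  ... | false = count-rowEntries i (suc p) ls

  count-entries : ∀ i r f → count i (entriesFrom r f) ≡ countF i f
  count-entries i r [] = refl
  count-entries i r (xs ∷ f) = trans (count-++ i (rowEntries _ xs) (entriesFrom (suc r) f)) (cong₂ _+_ (count-rowEntries i _ xs) (count-entries i (suc r) f))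

  ∈-rowEntries⁻ : ∀ p xs {l q} → (l , q) ∈ rowEntries p xs → ∃ λ j → q ≡ p + j × nth xs j ≡ just l
  ∈-rowEntries⁻ p (x ∷ xs) (here refl) = 0 , sym (+-identityʳ p) , refl
  ∈-rowEntries⁻ p (x ∷ xs) (there h) with ∈-rowEntries⁻ (suc p) xs h
  ... | j , e , g = suc j , trans e (sym (+-suc p j)) , g

  ∈-rowEntries⁺ : ∀ p xs j {l} → nth xs j ≡ just l → (l , p + j) ∈ rowEntries p xs
  ∈-rowEntries⁺ p (x ∷ xs) zero refl = here (cong (x ,_) (+-identityʳ p))
  ∈-rowEntries⁺ p (x ∷ xs) (suc j) {l} h = there (subst (λ z → (l , z) ∈ rowEntries (suc p) xs) (sym (+-suc p j)) (∈-rowEntries⁺ (suc p) xs j h))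

  rowEntries-unique : ∀ p xs → Unique (rowEntries p xs)
  rowEntries-unique p [] = []
  rowEntries-unique p (x ∷ xs) = All.tabulate (λ { h refl → let (j , e , _) = ∈-rowEntries⁻ (suc p) xs h in m≢1+m+n p e }) ∷ rowEntries-unique (suc p) xs

  ∈-entries⁻ : ∀ r f {l q} → (l , q) ∈ entriesFrom r f → ∃ λ k → ∃ λ xs → nth f k ≡ just xs × (l , q) ∈ rowEntries (suc (part mu (r + k)) + N) xs
  ∈-entries⁻ r (xs ∷ f) {l} {q} h with ∈-++⁻ (rowEntries (suc (part mu r) + N) xs) h
  ... | inj₁ g = 0 , xs , refl , subst (λ z → (l , q) ∈ rowEntries (suc (part mu z) + N) xs) (sym (+-identityʳ r)) g
  ... | inj₂ g with ∈-entries⁻ (suc r) f g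
  ...   | k , ys , e , i = suc k , ys , e , subst (λ z → (l , q) ∈ rowEntries (suc (part mu z) + N) ys) (sym (+-suc r k)) i

  ∈-entries⁺ : ∀ r f k {xs e} → nth f k ≡ just xs → e ∈ rowEntries (suc (part mu (r + k)) + N) xs → e ∈ entriesFrom r f
  ∈-entries⁺ r (xs ∷ f) zero {e = x} refl h = ∈-++⁺ˡ (subst (λ z → x ∈ rowEntries (suc (part mu z) + N) xs) (+-identityʳ r) h)
  ∈-entries⁺ r (xs ∷ f) (suc k) {ys} {x} e h = ∈-++⁺ʳ _ (∈-entries⁺ (suc r) f k e (subst (λ z → x ∈ rowEntries (suc (part mu z) + N) ys) (+-suc r k) h))

  module _ {f} (F : ℕ → ℕ → Label) (tab : ShTab la mu f) (rd : Reads f F) where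

    private
      len : Lengths f
      len = proj₁ (proj₂ tab)

    entry-cell : ∀ k {xs l q} → nth f k ≡ just xs → (l , q) ∈ rowEntries (suc (part mu (suc k)) + N) xs → Dom hs (suc k) q × F (suc k) q ≡ l
    entry-cell k {xs} {l} e h with ∈-rowEntries⁻ _ xs h
    ... | j , refl , g = subst (λ z → Dom hs (suc k) z × F (suc k) z ≡ l) eq
        (shape⇒dom d sh , just-injective (trans (sym (rd (suc k) d sh)) (trans (cong₂ nth (rowAt-just f k e) (m+n∸m≡n (part mu (suc k)) j)) g)))
      where
      d : ℕ
      d = suc (part mu (suc k) + j)
      eq : d + N ≡ suc (part mu (suc k)) + N + j
      eq = lia (part mu (suc k) ∷ j ∷ N ∷ []) (λ m j N → ⊢ con 1 :+ (m :+ j) :+ N := con 1 :+ m :+ N :+ j)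
      sh : InShape (suc k) d
      sh = s≤s z≤n , s≤s (m≤m+n _ j) , lia (part mu (suc k) ∷ j ∷ part la (suc k) ∷ (part la (suc k) ∸ part mu (suc k)) ∷ []) (λ m i a x → i :< x :⇒ x :+ m := a :⇒ ⊢ con 1 :+ (m :+ i) :≤ a)
          lt (m∸n+n≡m {part la (suc k)} {part mu (suc k)} (<⇒≤ (≰⇒> λ z → <⇒≱ lt (≤-trans (≤-reflexive (m≤n⇒m∸n≡0 z)) z≤n))))
        where
        lt : j < part la (suc k) ∸ part mu (suc k)
        lt = ≤-trans (nth-length xs j g) (≤-reflexive (trans (cong length (sym (rowAt-just f k e))) (len (suc k))))

    cell-entry : ∀ {r p} → Dom hs r p → (F r p , p) ∈ entriesFrom 1 f
    cell-entry {r} {p} D with dom-diagonal D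
    ... | d , 1≤d , refl with dom⇒shape d 1≤d D
    ...   | sh@(s≤s {n = k} _ , a , b) with k <? length f
    ...     | no n = ⊥-elim (<⇒≱ a (≤-trans b (≤-trans (≤-reflexive (part-beyond la (suc k) (s≤s (≤-trans (≤-reflexive (sym (proj₁ tab))) (≮⇒≥ n))))) z≤n)))
    ...     | yes lt with nth-defined f k lt
    ...       | xs , e = ∈-entries⁺ 1 f k e (subst (λ z → (F (suc k) (d + N) , z) ∈ rowEntries (suc (part mu (suc k)) + N) xs) eq
                  (∈-rowEntries⁺ _ xs (d ∸ suc (part mu (suc k))) (trans (cong (λ ys → nth ys (d ∸ suc (part mu (suc k)))) (sym (rowAt-just f k e))) (rd (suc k) d sh))))
              where
              eq : suc (part mu (suc k)) + N + (d ∸ suc (part mu (suc k))) ≡ d + N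
              eq = lia (part mu (suc k) ∷ N ∷ d ∷ (d ∸ suc (part mu (suc k))) ∷ []) (λ m N d x → con 1 :+ m :+ x := d :⇒ ⊢ con 1 :+ m :+ N :+ x := d :+ N) (m+[n∸m]≡n a)

    -- Equal keys in different rows belong to cells of one diagonal, along which the entries
    -- increase strictly.
    entries-unique : Unique (entriesFrom 1 f)
    entries-unique = go 0 f (λ k e → e)
      where
      go : ∀ j g → (∀ k {xs} → nth g k ≡ just xs → nth f (j + k) ≡ just xs) → Unique (entriesFrom (suc j) g)
      go j [] h = []
      go j (xs ∷ g) h = AP.++⁺ (rowEntries-unique _ xs) (go (suc j) g λ k e → trans (cong (nth f) (sym (+-suc j k))) (h (suc k) e))
        (All.tabulate λ x∈ → All.tabulate λ y∈ → distinct x∈ y∈)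
        where
        distinct : ∀ {x y} → x ∈ rowEntries (suc (part mu (suc j)) + N) xs → y ∈ entriesFrom (suc (suc j)) g → x ≢ y
        distinct {l , p} x∈ y∈ refl with ∈-entries⁻ (suc (suc j)) g y∈
        ... | k , ys , e , y∈′ with entry-cell j (trans (cong (nth f) (sym (+-identityʳ j))) (h 0 refl)) x∈
                | entry-cell (j + suc k) (h (suc k) e) (subst (λ z → (l , p) ∈ rowEntries (suc (part mu (suc z)) + N) ys) (sym (+-suc j k)) y∈′)
        ...   | D , e₁ | D′ , e₂ = ≺-irrefl (subst₂ (λ a b → (a , p) ≺ (b , p)) e₁ e₂ (diagonal-< {F = F} ts (proj₁ (shtab⇒local F tab rd)) D D′
                  (s≤s (≤-trans (≤-reflexive (+-comm 1 j)) (+-monoʳ-≤ j (s≤s z≤n))))))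

    entries-cell : ∀ {l p} → (l , p) ∈ entriesFrom 1 f → ∃ λ r → Dom hs r p × F r p ≡ l
    entries-cell h with ∈-entries⁻ 1 f h
    ... | k , xs , e , g = suc k , entry-cell k e g

  Word : List Entry → Set
  Word ws = Sorted ws × All (λ e → 1 ≤ idx (proj₁ e)) ws × All (λ e → 1 ≤ proj₂ e) ws × (∀ y → 1 ≤ y → Run y (suc y) (s y) ws (t y))

  Records : Filling → List Entry → Set
  Records f ws = ∃ λ F → Reads f F × Std F hs ws

  cnt≤ht : ∀ p → 1 ≤ p → hs p ≤ ht p
  cnt≤ht p 1≤p with p ≤? N
  ... | yes h = ≤-reflexive (low p 1≤p h)
  ... | no n = subst (λ z → hs z ≤ ht z) (m∸n+n≡m (<⇒≤ (≰⇒> n)))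
      (≤-trans (≤-reflexive (hs≡ (p ∸ N) 1≤)) (≤-trans (sub (p ∸ N) 1≤) (≤-reflexive (sym (ht≡ (p ∸ N) 1≤)))))
    where
    1≤ : 1 ≤ p ∸ N
    1≤ = m<n⇒0<n∸m (≰⇒> n)

  far : ∀ d → top la + top mu + N < d → hs d ≡ ht d
  far d h = subst (λ z → hs z ≡ ht z) (m∸n+n≡m N≤) (trans (trans (hs≡ e 1≤e) (cnt-top hmu (≤-<-trans (m≤n+m (top mu) (top la)) big)))
      (sym (trans (ht≡ e 1≤e) (cnt-top hla (≤-<-trans (m≤m+n (top la) (top mu)) big)))))
    where
    e : ℕ
    e = d ∸ N
    N≤ : N ≤ d
    N≤ = ≤-trans (m≤n+m N (top la + top mu)) (<⇒≤ h)
    big : top la + top mu < e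
    big = +-cancelʳ-< N _ _ (≤-trans h (≤-reflexive (sym (m∸n+n≡m N≤))))
    1≤e : 1 ≤ e
    1≤e = ≤-trans (s≤s z≤n) big

  record⇒word : ∀ f → ShTab la mu f → ∃ λ ws → Word ws × Records f ws
  record⇒word f tab with shtab⇒local (read f) tab (read-reads (proj₁ (proj₂ tab)))
  ... | loc , pos with sort (entriesFrom 1 f) (All.tabulate λ e∈ → let (r , D , e) = entries-cell (read f) tab rd e∈ in subst (λ l → 1 ≤ idx l) e (pos r _ D) , proj₁ D)
    where
    rd : Reads f (read f)
    rd = read-reads (proj₁ (proj₂ tab))
  ...   | ws , srt , into , onto with standardise ws ts cnt≤ht loc srt (λ e∈ → entries-cell (read f) tab (read-reads (proj₁ (proj₂ tab))) (onto e∈)) (λ D → into (cell-entry (read f) tab (read-reads (proj₁ (proj₂ tab))) D))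
  ...     | std , run = ws , (srt , All.tabulate (λ e∈ → let (r , D , e) = std-∈⁻ std e∈ in subst (λ l → 1 ≤ idx l) e (pos r _ D)) ,
              All.tabulate (λ e∈ → let (r , D , e) = std-∈⁻ std e∈ in proj₁ D) , run) , read f , read-reads (proj₁ (proj₂ tab)) , std

  word⇒record : ∀ ws → Word ws → ∃ λ f → ShTab la mu f × Records f ws
  word⇒record ws (srt , ls , keys , run) with unstandardise ws (top la + top mu + N) ts far srt keys run
  ... | std , loc = write F , local⇒shtab (length-applyUpTo _ (length la)) (write-lengths F) (write-reads F) loc pos , F , write-reads F , std
    where
    F : ℕ → ℕ → Label
    F = fillingOf hs ws
    pos : Positive F
    pos r p D = All.lookup ls (std-∈⁺ std D)

  -- The entry is a cell on the diagonal p. This confines the keys of a word to diagonals on which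
  -- the shape has cells.
  word-moving : ∀ {ws l p} → Word ws → (l , p) ∈ ws → hs p < ht p
  word-moving {ws} (srt , ls , keys , run) h with unstandardise ws (top la + top mu + N) ts far srt keys run
  ... | std , _ with std-∈⁻ std h
  ...   | r , (_ , a , b) , _ = ≤-trans a b

  records-functional : ∀ {f ws ws′} → ShTab la mu f → Word ws → Word ws′ → Records f ws → Records f ws′ → ws ≡ ws′
  records-functional tab (srt , _) (srt′ , _) (F , rd , std) (F′ , rd′ , std′) = sorted-extensional srt srt′ (move′ std std′ same) (move′ std′ std λ r p D → sym (same r p D))
    where
    same : ∀ r p → Dom hs r p → F r p ≡ F′ r p
    same r p D with dom-diagonal D
    ... | d , 1≤d , refl = just-injective (trans (sym (rd r d (dom⇒shape d 1≤d D))) (rd′ r d (dom⇒shape d 1≤d D)))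
    move′ : ∀ {F F′ ws ws′} → Std F hs ws → Std F′ hs ws′ → (∀ r p → Dom hs r p → F r p ≡ F′ r p) → ∀ {z} → z ∈ ws → z ∈ ws′
    move′ a b same {l , p} h with std-∈⁻ a h
    ... | r , D , refl = subst (λ l → (l , p) ∈ _) (sym (same r p D)) (std-∈⁺ b D)

  records-injective : ∀ {f f′ ws} → ShTab la mu f → ShTab la mu f′ → Records f ws → Records f′ ws → f ≡ f′
  records-injective tab tab′ (F , rd , std) (F′ , rd′ , std′) = reads-injective tab tab′ rd rd′ (std-determined std std′)

  records-count : ∀ {f ws} → ShTab la mu f → Word ws → Records f ws → ∀ i → countF i f ≡ count i ws
  records-count {f} {ws} tab (srt , _) (F , rd , std) i = trans (sym (count-entries i 1 f)) (count-same i (entries-unique F tab rd) (sorted-unique srt)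
    (λ {z} h → let (r , D , e) = entries-cell F tab rd h in subst (λ l → (l , proj₂ z) ∈ ws) e (std-∈⁺ std D))
    (λ {z} h → let (r , D , e) = std-∈⁻ std h in subst (λ l → (l , proj₂ z) ∈ entriesFrom 1 f) e (cell-entry F tab rd D)))

-- The runners of the abacus, and the shape underlying α ⋄ β in terms of its diagonals

module CombinationShape where

  open import Algebra.Properties.AbelianGroup ℤP.+-0-abelianGroup using () renaming (∙-cancelˡ to ℤ-cancelˡ; ∙-cancelʳ to ℤ-cancelʳ)
  open ℤ using (ℤ; +_; _⊖_)

  module Abacus (k : ℕ) .{{_ : NonZero k}} {la} (sla : StrictPartition la) where

    -- For i = k the residue is 0 and the quotient is n + 1 rather than n; it is not 0 because p is
    -- positive.
    residue : ∀ {p i} → 1 ≤ p → 1 ≤ i → i ≤ k → p % k ≡ i % k → ∃ λ n → p ≡ i + n * k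
    residue {p} {i} 1≤p 1≤i i≤k e with i ≟ k
    ... | no ne = p / k , trans (m≡m%n+[m/n]*n p k) (cong (_+ p / k * k) (trans e (m<n⇒m%n≡m (≤∧≢⇒< i≤k ne))))
    ... | yes refl with p / k | trans (m≡m%n+[m/n]*n p k) (cong (_+ p / k * k) (trans e (n%n≡0 k)))
    ...   | zero | h = ⊥-elim (<⇒≱ 1≤p (≤-reflexive h))
    ...   | suc n | h = n , h

    module _ {i} (1≤i : 1 ≤ i) (i≤k : i ≤ k) where

      private
        f : ℕ → ℕ
        f p = (p ∸ i) / k + 1
        P? : (p : ℕ) → Dec (p % k ≡ i % k)
        P? p = p % k ≟ i % k

      f-runner : ∀ n → f (i + n * k) ≡ suc n
      f-runner n = trans (cong (λ z → z / k + 1) (m+n∸m≡n i (n * k))) (trans (cong (_+ 1) (m*n/n≡m n k)) (+-comm n 1))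

      runner-residue : ∀ n → (i + n * k) % k ≡ i % k
      runner-residue n = [m+kn]%n≡m%n i n k

      abacus-∈⁻ : ∀ {x} → x ∈ abacus k la i → ∃ λ n → x ≡ suc n × i + n * k ∈ la
      abacus-∈⁻ x∈ with ∈-map⁻ f x∈
      ... | p , p∈ , refl with ∈-filter⁻ P? {xs = la} p∈
      ...   | p∈la , e with residue (All.lookup (proj₁ sla) p∈la) 1≤i i≤k e
      ...     | n , refl = n , f-runner n , p∈la

      abacus-∈⁺ : ∀ n → i + n * k ∈ la → suc n ∈ abacus k la i
      abacus-∈⁺ n h = subst (_∈ abacus k la i) (f-runner n) (∈-map⁺ f (∈-filter⁺ P? h (runner-residue n)))

      abacus-strict : StrictPartition (abacus k la i)
      abacus-strict = All.tabulate (λ x∈ → let (n , e , _) = abacus-∈⁻ x∈ in subst (1 ≤_) (sym e) (s≤s z≤n)) ,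
        LP.AllPairs⇒Linked (go (filter P? la) (λ p∈ → ∈-filter⁻ P? {xs = la} p∈) (AP.filter⁺ P? (strict⇒decreasing sla)))
        where
        go : ∀ xs → (∀ {p} → p ∈ xs → p ∈ la × p % k ≡ i % k) → Decreasing xs → Decreasing (map f xs)
        go [] h [] = []
        go (p ∷ xs) h (gt ∷ ds) = All.tabulate (λ y∈ → smaller y∈) ∷ go xs (λ z → h (there z)) ds
          where
          smaller : ∀ {y} → y ∈ map f xs → y < f p
          smaller y∈ with ∈-map⁻ f y∈
          ... | q , q∈ , refl with residue (All.lookup (proj₁ sla) (proj₁ (h (here refl)))) 1≤i i≤k (proj₂ (h (here refl)))
                  | residue (All.lookup (proj₁ sla) (proj₁ (h (there q∈)))) 1≤i i≤k (proj₂ (h (there q∈)))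
          ...   | n , refl | m , refl = subst₂ _<_ (sym (f-runner m)) (sym (f-runner n)) (s≤s (*-cancelʳ-< k m n (+-cancelˡ-< i _ _ (All.lookup gt q∈))))

      occ-abacus : ∀ n → occ (abacus k la i) (suc n) ≡ occ la (i + n * k)
      occ-abacus n with occ (abacus k la i) (suc n) in eq | occ la (i + n * k) in eq′
      ... | true | true = refl
      ... | false | false = refl
      ... | false | true = trans (sym eq) (∈⇒occ (abacus k la i) (abacus-∈⁺ n (occ⇒∈ la eq′)))
      ... | true | false with abacus-∈⁻ (occ⇒∈ (abacus k la i) eq)
      ...   | m , refl , h = trans (sym (∈⇒occ la h)) eq′

  difference : ∀ m n p q → m + q ≡ n + p → + m ℤ.- + p ≡ + n ℤ.- + q
  difference m n p q e = trans (ℤP.m-n≡m⊖n m p) (trans (sym (ℤP.+-cancelˡ-⊖ q m p)) (trans (cong₂ _⊖_ (trans (+-comm q m) (trans e (+-comm n p))) (+-comm q p))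
    (trans (ℤP.+-cancelˡ-⊖ p n q) (sym (ℤP.m-n≡m⊖n n q)))))

  same-difference : ∀ {m n p} → + m ℤ.- + p ≡ + n ℤ.- + p → m ≡ n
  same-difference {m} {n} {p} e = ℤP.+-injective (ℤ-cancelʳ (ℤ.- + p) (+ m) (+ n) e)

  -- The translation in `UnderlyingShape` is arbitrary, but each of the two corners must lie in the
  -- quadrant spanned by the other, so the corners coincide.
  translation : ∀ {x x′ A dx} → 1 ≤ x → 1 ≤ x′ → + 1 ℤ.- + A ≡ + x′ ℤ.+ dx → + x ℤ.- + A ≡ + 1 ℤ.+ dx → dx ≡ ℤ.- + A
  translation {suc x} {suc x′} {A} {dx} _ _ e e′ = sym (ℤ-cancelˡ (+ 1) (ℤ.- + A) dx (subst (λ z → + suc z ℤ.- + A ≡ + 1 ℤ.+ dx) x≡0 e′))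
    where
    -- 1 - A = 1 + x′ + (1 + x - A - 1)
    dx≡ : dx ≡ + x ℤ.- + A
    dx≡ = ℤ-cancelˡ (+ 1) dx (+ x ℤ.- + A) (trans (sym e′) (ℤP.+-assoc (+ 1) (+ x) (ℤ.- + A)))
    sum : 1 ≡ suc x′ + x
    sum = same-difference {1} {suc x′ + x} {A} (trans e (trans (cong (λ z → + suc x′ ℤ.+ z) dx≡) (sym (ℤP.+-assoc (+ suc x′) (+ x) (ℤ.- + A)))))
    x≡0 : x ≡ 0
    x≡0 = m+n≡0⇒n≡0 x′ (suc-injective (sym sum))

  ≤-determined : ∀ m n → (∀ r → 1 ≤ r → r ≤ m → r ≤ n) → (∀ r → 1 ≤ r → r ≤ n → r ≤ m) → m ≡ n
  ≤-determined m n h g = ≤-antisym (one m n h) (one n m g)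
    where
    one : ∀ m n → (∀ r → 1 ≤ r → r ≤ m → r ≤ n) → m ≤ n
    one zero n h = z≤n
    one (suc m) n h = h (suc m) (s≤s z≤n) ≤-refl

  part-plusDelta : ∀ ga r → 1 ≤ r → r ≤ length ga → part (plusDelta ga) r + r ≡ part ga r + suc (length ga)
  part-plusDelta (g ∷ ga) (suc zero) _ _ = lia (g ∷ length ga ∷ []) (λ g l → ⊢ g :+ (con 1 :+ l) :+ con 1 := g :+ (con 2 :+ l))
  part-plusDelta (g ∷ ga) (suc (suc r)) _ (s≤s h) = trans (+-suc (part (plusDelta ga) (suc r)) (suc r)) (trans (cong suc (part-plusDelta ga (suc r) (s≤s z≤n) h)) (sym (+-suc (part ga (suc r)) (suc (length ga)))))

  length-plusDelta : ∀ ga → length (plusDelta ga) ≡ length ga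
  length-plusDelta [] = refl
  length-plusDelta (g ∷ ga) = cong suc (length-plusDelta ga)

  plusDelta-strict : ∀ {ga} → IsPartition ga → StrictPartition (plusDelta ga)
  plusDelta-strict {ga} (_ , lk) = positive ga , linked lk
    where
    positive : ∀ ga → All (0 <_) (plusDelta ga)
    positive [] = []
    positive (g ∷ ga) = ≤-trans (s≤s z≤n) (m≤n+m (suc (length ga)) g) ∷ positive ga
    linked : ∀ {ga} → Linked _≥_ ga → Linked _>_ (plusDelta ga)
    linked [] = []
    linked [-] = [-]
    linked (h ∷ hs) = +-mono-≤-< h ≤-refl ∷ linked hs

  delta-decreasing : ∀ n → Decreasing (delta n)
  delta-decreasing zero = []
  delta-decreasing (suc n) = All.tabulate (λ x∈ → s≤s (bounded n x∈)) ∷ delta-decreasing n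
    where
    bounded : ∀ n {x} → x ∈ delta n → x ≤ n
    bounded (suc n) (here refl) = ≤-refl
    bounded (suc n) (there h) = m≤n⇒m≤1+n (bounded n h)

  cnt-delta : ∀ n d → 1 ≤ d → cnt (delta n) d ≡ suc n ∸ d
  cnt-delta zero (suc d) _ = sym (0∸n≡0 d)
  cnt-delta (suc n) d 1≤d with d ≤ᵇ suc n | proof (d ≤? suc n)
  ... | true | ofʸ h = trans (cong suc (cnt-delta n d 1≤d)) (sym (+-∸-assoc 1 h))
  ... | false | ofⁿ h = trans (cnt-delta n d 1≤d) (trans (m≤n⇒m∸n≡0 (<⇒≤ (≰⇒> h))) (sym (m≤n⇒m∸n≡0 (≰⇒> h))))

  module Shape {α β γ} (sα : StrictPartition α) (sβ : StrictPartition β) (us : UnderlyingShape α β γ) where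

    a b ℓ A B : ℕ
    a = length α
    b = length β
    ℓ = length γ
    A = a ∸ (a ⊓ b)
    B = b ∸ (a ⊓ b)

    private
      hα : Decreasing α
      hα = strict⇒decreasing sα
      hβ : Decreasing β
      hβ = strict⇒decreasing sβ

    pγ : IsPartition γ
    pγ = proj₁ us

    AB : A + b ≡ B + a
    AB = lia (A ∷ B ∷ a ∷ b ∷ (a ⊓ b) ∷ []) (λ A B a b m → A :+ m := a :⇒ B :+ m := b :⇒ ⊢ A :+ b := B :+ a)
      (m∸n+n≡m (m⊓n≤m a b)) (m∸n+n≡m (m⊓n≤n a b))

    A0⊎B0 : (A ≡ 0 × a ≤ b) ⊎ (B ≡ 0 × b ≤ a)
    A0⊎B0 with ≤-total a b
    ... | inj₁ h = inj₁ (trans (cong (a ∸_) (m≤n⇒m⊓n≡m h)) (n∸n≡0 a) , h)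
    ... | inj₂ h = inj₂ (trans (cong (b ∸_) (m≥n⇒m⊓n≡n h)) (n∸n≡0 b) , h)

    -- the cells of the combination, moved so that its corner is (1 , 1)
    Fromα Fromβ : ℕ → ℕ → Set
    Fromα x y = ∃ λ x₀ → A < x₀ × x₀ + B ≡ y + A × Dg α (x₀ , x)
    Fromβ x y = ∃ λ x₀ → B < x₀ × x₀ + A ≡ x + B × Dg β (x₀ , y)

    Moved : ℕ → ℕ → Set
    Moved x y = Fromα x y ⊎ Fromβ x y

    moved⇒comb : ∀ {x y} → Moved x y → Comb α β (+ x ℤ.- + A , + y ℤ.- + B)
    moved⇒comb {x} {y} (inj₁ (x₀ , h , e , D)) = inj₁ (x₀ , x , D , h , refl , difference y x₀ B A (sym e))
    moved⇒comb {x} {y} (inj₂ (x₀ , h , e , D)) = inj₂ (x₀ , y , D , h , difference x x₀ A B (sym e) , refl)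

    comb⇒moved : ∀ {X Y} → Comb α β (X , Y) → ∃ λ x → ∃ λ y → 1 ≤ x × 1 ≤ y × Moved x y × X ≡ + x ℤ.- + A × Y ≡ + y ℤ.- + B
    comb⇒moved (inj₁ (x₀ , y₀ , D , h , refl , refl)) = y₀ , x₀ ∸ A + B , proj₁ D , ≤-trans (m<n⇒0<n∸m h) (m≤m+n _ B) , inj₁ (x₀ , h , e , D) , refl ,
        difference x₀ (x₀ ∸ A + B) A B e
      where
      e : x₀ + B ≡ x₀ ∸ A + B + A
      e = lia (x₀ ∷ (x₀ ∸ A) ∷ A ∷ B ∷ []) (λ x z A B → z :+ A := x :⇒ ⊢ x :+ B := z :+ B :+ A) (m∸n+n≡m (<⇒≤ h))
    comb⇒moved (inj₂ (x₀ , y₀ , D , h , refl , refl)) = x₀ ∸ B + A , y₀ , ≤-trans (m<n⇒0<n∸m h) (m≤m+n _ A) , proj₁ D , inj₂ (x₀ , h , e , D) ,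
        difference x₀ (x₀ ∸ B + A) B A e , refl
      where
      e : x₀ + A ≡ x₀ ∸ B + A + B
      e = lia (x₀ ∷ (x₀ ∸ B) ∷ A ∷ B ∷ []) (λ x z A B → z :+ B := x :⇒ ⊢ x :+ A := z :+ A :+ B) (m∸n+n≡m (<⇒≤ h))

    Dg-positive : ∀ {la x y} → Decreasing la → Dg la (x , y) → ∃ λ d → 1 ≤ d × suc x ≡ d + y × y ≤ cnt la d × 1 ≤ y
    Dg-positive {la} {x} {y} h D@(1≤y , y≤x , _) = diag (x , y) , s≤s z≤n , cong suc (sym (m∸n+n≡m y≤x)) , Dg⇒cnt h D , 1≤y

    Dg-make : ∀ {la} → Decreasing la → ∀ e y → 1 ≤ y → y ≤ cnt la (suc e) → Dg la (y + e , y)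
    Dg-make {la} h e y 1≤y g = cnt⇒Dg h 1≤y (m≤m+n y e) (≤-trans g (≤-reflexive (cong (λ z → cnt la (suc z)) (sym (m+n∸m≡n y e)))))

    cα1 : cnt α 1 ≡ a
    cα1 = cnt-1 (proj₁ sα)
    cβ1 : cnt β 1 ≡ b
    cβ1 = cnt-1 (proj₁ sβ)

    reach : ∀ {la} → Decreasing la → ∀ B {x y} → B < x → Dg la (x , y) → 1 ≤ cnt la (suc B)
    reach {la} h B {x} {y} lt D with Dg-positive h D
    ... | d , 1≤d , e , g , 1≤y with d ≤? suc B
    ...   | yes d≤ = lia (d ∷ B ∷ x ∷ y ∷ cnt la d ∷ cnt la (suc B) ∷ []) (λ d B x y c c′ → d :+ c :≤ con 1 :+ B :+ c′ :⇒ con 1 :+ x := d :+ y :⇒ y :≤ c :⇒ B :< x :⇒ ⊢ con 1 :≤ c′)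
              (cnt-lipschitz h d≤) e g lt
    ...   | no n = ≤-trans 1≤y (≤-trans g (cnt-antitone h (<⇒≤ (≰⇒> n))))

    nonempty : ∀ {la} → Decreasing la → ∀ {x y} → Dg la (x , y) → 1 ≤ length la
    nonempty {la} h D with Dg-positive h D
    ... | d , _ , _ , g , 1≤y = ≤-trans 1≤y (≤-trans g (cnt≤length la d))

    -- The corner of a nonempty combination comes from the strict partition with more rows, whose
    -- cells reach further; with equally many rows either would do.
    corner : ∀ {x y} → Moved x y → Moved 1 1
    corner {x} {y} m with A0⊎B0
    ... | inj₁ (A0 , a≤b) = inj₂ (suc B , ≤-refl , trans (cong (λ z → suc (B + z)) A0) (cong suc (+-identityʳ B)) , Dg-make hβ B 1 ≤-refl (go m))
      where
      go : Moved x y → 1 ≤ cnt β (suc B)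
      go (inj₂ (x₀ , h , e , D)) = reach hβ B h D
      go (inj₁ (x₀ , h , e , D)) = lia (a ∷ b ∷ A ∷ B ∷ cnt β 1 ∷ cnt β (suc B) ∷ []) (λ a b A B c c′ → con 1 :+ c :≤ con 1 :+ B :+ c′ :⇒ c := b :⇒ con 1 :≤ a :⇒ A :+ b := B :+ a :⇒ A := con 0 :⇒ ⊢ con 1 :≤ c′)
        (cnt-lipschitz hβ {1} {suc B} (s≤s z≤n)) cβ1 (nonempty hα D) AB A0
    ... | inj₂ (B0 , b≤a) = inj₁ (suc A , ≤-refl , trans (cong (λ z → suc (A + z)) B0) (cong suc (+-identityʳ A)) , Dg-make hα A 1 ≤-refl (go m))
      where
      go : Moved x y → 1 ≤ cnt α (suc A)
      go (inj₁ (x₀ , h , e , D)) = reach hα A h D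
      go (inj₂ (x₀ , h , e , D)) = lia (a ∷ b ∷ A ∷ B ∷ cnt α 1 ∷ cnt α (suc A) ∷ []) (λ a b A B c c′ → con 1 :+ c :≤ con 1 :+ A :+ c′ :⇒ c := a :⇒ con 1 :≤ b :⇒ A :+ b := B :+ a :⇒ B := con 0 :⇒ ⊢ con 1 :≤ c′)
        (cnt-lipschitz hα {1} {suc A} (s≤s z≤n)) cα1 (nonempty hβ D) AB B0

    -- A nonempty γ fixes the translation by comparing corners. For γ = [] there is no corner to
    -- compare, but then both sides are empty.
    young⇔moved : ∀ x y → 1 ≤ x → 1 ≤ y → (x ≤ part γ y → Moved x y) × (Moved x y → x ≤ part γ y)
    young⇔moved = go γ refl
      where
      dx dy : ℤ
      dx = proj₁ (proj₂ us)
      dy = proj₁ (proj₂ (proj₂ us))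
      iff : ∀ X Y → Iff (Comb α β (X , Y)) (Σ ℕ λ x → Σ ℕ λ y → YoungCell γ (x , y) × X ≡ (+ x) ℤ.+ dx × Y ≡ (+ y) ℤ.+ dy)
      iff = proj₂ (proj₂ (proj₂ us))
      go : ∀ γ′ → γ′ ≡ γ → ∀ x y → 1 ≤ x → 1 ≤ y → (x ≤ part γ y → Moved x y) × (Moved x y → x ≤ part γ y)
      go [] refl x y 1≤x 1≤y = (λ h → ⊥-elim (<⇒≱ 1≤x h)) , λ m → let (x′ , y′ , (_ , 1≤x′ , h) , _) = proj₁ (iff _ _) (moved⇒comb m) in ⊥-elim (<⇒≱ 1≤x′ h)
      go (g ∷ γ′) refl x y 1≤x 1≤y = to , from
        where
        base : YoungCell γ (1 , 1)
        base = ≤-refl , ≤-refl , All.lookup (proj₁ pγ) (here refl)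
        c₁ : ∃ λ x → ∃ λ y → 1 ≤ x × 1 ≤ y × Moved x y × + 1 ℤ.+ dx ≡ + x ℤ.- + A × + 1 ℤ.+ dy ≡ + y ℤ.- + B
        c₁ = comb⇒moved (proj₂ (iff _ _) (1 , 1 , base , refl , refl))
        c₂ : Σ ℕ λ x → Σ ℕ λ y → YoungCell γ (x , y) × + 1 ℤ.- + A ≡ (+ x) ℤ.+ dx × + 1 ℤ.- + B ≡ (+ y) ℤ.+ dy
        c₂ = proj₁ (iff _ _) (moved⇒comb (corner (proj₁ (proj₂ (proj₂ (proj₂ (proj₂ c₁)))))))
        dx≡ : dx ≡ ℤ.- + A
        dx≡ = let (u , v , 1≤u , 1≤v , _ , e , _) = c₁ ; (u′ , v′ , (_ , 1≤u′ , _) , e′ , _) = c₂ in translation 1≤u 1≤u′ e′ (sym e)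
        dy≡ : dy ≡ ℤ.- + B
        dy≡ = let (u , v , 1≤u , 1≤v , _ , _ , e) = c₁ ; (u′ , v′ , (1≤v′ , _ , _) , _ , e′) = c₂ in translation 1≤v 1≤v′ e′ (sym e)
        to : x ≤ part γ y → Moved x y
        to h with comb⇒moved (proj₂ (iff _ _) (x , y , (1≤y , 1≤x , h) , refl , refl))
        ... | x′ , y′ , _ , _ , m , e , e′ with same-difference {x} {x′} {A} (trans (cong (λ z → + x ℤ.+ z) (sym dx≡)) e) | same-difference {y} {y′} {B} (trans (cong (λ z → + y ℤ.+ z) (sym dy≡)) e′)
        ...   | refl | refl = m
        from : Moved x y → x ≤ part γ y
        from m with proj₁ (iff _ _) (moved⇒comb m)
        ... | x′ , y′ , (_ , _ , h) , e , e′ with same-difference {x} {x′} {A} (trans e (cong (λ z → + x′ ℤ.+ z) dx≡)) | same-difference {y} {y′} {B} (trans e′ (cong (λ z → + y′ ℤ.+ z) dy≡))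
        ...   | refl | refl = h

    Pγ : List ℕ
    Pγ = plusDelta γ

    sP : StrictPartition Pγ
    sP = plusDelta-strict pγ

    private
      hP : Decreasing Pγ
      hP = strict⇒decreasing sP

    ≤cnt⇒ : ∀ {d r} → 1 ≤ d → 1 ≤ r → r ≤ cnt Pγ d → r ≤ ℓ × d + r ≤ part γ r + suc ℓ
    ≤cnt⇒ {d} {r} 1≤d 1≤r h = r≤ℓ , ≤-trans (+-monoˡ-≤ r (≤cnt⇒≤part hP r d 1≤r h)) (≤-reflexive (part-plusDelta γ r 1≤r r≤ℓ))
      where
      r≤ℓ : r ≤ ℓ
      r≤ℓ = ≤-trans h (≤-trans (cnt≤length Pγ d) (≤-reflexive (length-plusDelta γ)))

    ⇒≤cnt : ∀ {d r} → 1 ≤ d → 1 ≤ r → r ≤ ℓ → d + r ≤ part γ r + suc ℓ → r ≤ cnt Pγ d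
    ⇒≤cnt {d} {r} 1≤d 1≤r r≤ℓ h = ≤part⇒≤cnt hP r d 1≤r 1≤d (+-cancelʳ-≤ r _ _ (≤-trans h (≤-reflexive (sym (part-plusDelta γ r 1≤r r≤ℓ)))))

    within-length : ∀ {x r} → 1 ≤ x → x ≤ part γ r → r ≤ ℓ
    within-length {x} {r} 1≤x h = ≮⇒≥ λ lt → <⇒≱ 1≤x (≤-trans h (≤-reflexive (part-beyond γ r lt)))

    -- beads right of the origin come from β
    cnt-right : ∀ d e → 1 ≤ d → d + b ≡ suc ℓ + a + e → cnt Pγ d ≡ cnt β (suc e)
    cnt-right d e 1≤d eq = ≤-determined _ _ to from
      where
      to : ∀ r → 1 ≤ r → r ≤ cnt Pγ d → r ≤ cnt β (suc e)
      -- The cells with d + r ≤ ℓ + 1 form the staircase; any other one is the cell of γ in row r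
      -- and column d + r - (ℓ + 1).
      to r 1≤r h with d + r ≤? suc ℓ | ≤cnt⇒ 1≤d 1≤r h
      ... | yes small | _ = lia (d ∷ b ∷ ℓ ∷ a ∷ e ∷ r ∷ cnt β 1 ∷ cnt β (suc e) ∷ [])
            (λ d b l a e r c c′ → d :+ b := con 1 :+ l :+ a :+ e :⇒ d :+ r :≤ con 1 :+ l :⇒ c := b :⇒ con 1 :+ c :≤ con 1 :+ e :+ c′ :⇒ ⊢ r :≤ c′)
            eq small cβ1 (cnt-lipschitz hβ {1} {suc e} (s≤s z≤n))
      ... | no big | r≤ℓ , g = go (proj₁ (young⇔moved x r 1≤x 1≤r) x≤)
        where
        x : ℕ
        x = d + r ∸ suc ℓ
        x+ : x + suc ℓ ≡ d + r
        x+ = m∸n+n≡m (<⇒≤ (≰⇒> big))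
        1≤x : 1 ≤ x
        1≤x = m<n⇒0<n∸m (≰⇒> big)
        x≤ : x ≤ part γ r
        x≤ = +-cancelʳ-≤ (suc ℓ) _ _ (≤-trans (≤-reflexive x+) g)
        go : Moved x r → r ≤ cnt β (suc e)
        -- The cell is supplied by α instead of β. Its column is then at most a, so r ≤ b - e, and
        -- `cnt β (e + 1)` is at least that large.
        go (inj₁ (x₀ , lt , e₁ , D)) with Dg-positive hα D
        ... | d′ , 1≤d′ , e₂ , g′ , _ = lia (x ∷ ℓ ∷ d ∷ r ∷ b ∷ a ∷ e ∷ cnt β 1 ∷ cnt β (suc e) ∷ [])
                  (λ x l d r b a e c c′ → x :+ (con 1 :+ l) := d :+ r :⇒ d :+ b := con 1 :+ l :+ a :+ e :⇒ x :≤ a :⇒ c := b :⇒ con 1 :+ c :≤ con 1 :+ e :+ c′ :⇒ ⊢ r :≤ c′)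
                  x+ eq (≤-trans g′ (cnt≤length α d′)) cβ1 (cnt-lipschitz hβ {1} {suc e} (s≤s z≤n))
        go (inj₂ (x₀ , lt , e₁ , D)) with Dg-positive hβ D
        ... | d′ , 1≤d′ , e₂ , g′ , _ = subst (λ z → r ≤ cnt β z) (lia (x ∷ ℓ ∷ d ∷ r ∷ b ∷ a ∷ e ∷ x₀ ∷ A ∷ B ∷ d′ ∷ []) (λ x l d r b a e x₀ A B d′ → x :+ (con 1 :+ l) := d :+ r :⇒ d :+ b := con 1 :+ l :+ a :+ e :⇒
                  x₀ :+ A := x :+ B :⇒ A :+ b := B :+ a :⇒ con 1 :+ x₀ := d′ :+ r :⇒ ⊢ d′ := con 1 :+ e) x+ eq e₁ AB e₂) g′
      from : ∀ r → 1 ≤ r → r ≤ cnt β (suc e) → r ≤ cnt Pγ d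
      from r 1≤r h with d + r ≤? suc ℓ
      ... | yes small = ⇒≤cnt 1≤d 1≤r (s≤s⁻¹ (≤-trans (+-monoˡ-≤ r 1≤d) small)) (≤-trans small (m≤n+m (suc ℓ) (part γ r)))
      ... | no big = ⇒≤cnt 1≤d 1≤r (within-length 1≤x x≤) (≤-trans (≤-reflexive (sym x+)) (+-monoˡ-≤ (suc ℓ) x≤))
        where
        x : ℕ
        x = d + r ∸ suc ℓ
        x+ : x + suc ℓ ≡ d + r
        x+ = m∸n+n≡m (<⇒≤ (≰⇒> big))
        1≤x : 1 ≤ x
        1≤x = m<n⇒0<n∸m (≰⇒> big)
        B< : B < r + e
        B< with A0⊎B0
        ... | inj₁ (A0 , _) = lia (x ∷ ℓ ∷ d ∷ r ∷ b ∷ a ∷ e ∷ A ∷ B ∷ []) (λ x l d r b a e A B → x :+ (con 1 :+ l) := d :+ r :⇒ d :+ b := con 1 :+ l :+ a :+ e :⇒ A :+ b := B :+ a :⇒ A := con 0 :⇒ con 1 :≤ x :⇒ ⊢ B :< r :+ e) x+ eq AB A0 1≤x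
        ... | inj₂ (B0 , _) = subst (_< r + e) (sym B0) (≤-trans 1≤r (m≤m+n r e))
        x≤ : x ≤ part γ r
        x≤ = proj₂ (young⇔moved x r 1≤x 1≤r) (inj₂ (r + e , B< ,
          lia (x ∷ ℓ ∷ d ∷ r ∷ b ∷ a ∷ e ∷ A ∷ B ∷ []) (λ x l d r b a e A B → x :+ (con 1 :+ l) := d :+ r :⇒ d :+ b := con 1 :+ l :+ a :+ e :⇒ A :+ b := B :+ a :⇒ ⊢ r :+ e :+ A := x :+ B) x+ eq AB ,
          Dg-make hβ e r 1≤r h))

    -- beads left of the origin are the gaps of α
    cnt-left : ∀ d t → 1 ≤ d → 1 ≤ t → d + b + t ≡ suc ℓ + a → cnt Pγ d + a ≡ cnt α (suc t) + t + b
    cnt-left d t 1≤d 1≤t eq = trans (cong (_+ a) (≤-determined (cnt Pγ d) E to from)) E+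
      where
      E : ℕ
      E = cnt α (suc t) + t + b ∸ a
      E+ : E + a ≡ cnt α (suc t) + t + b
      E+ = m∸n+n≡m (lia (a ∷ b ∷ t ∷ cnt α 1 ∷ cnt α (suc t) ∷ []) (λ a b t c c′ → c := a :⇒ con 1 :+ c :≤ con 1 :+ t :+ c′ :⇒ ⊢ a :≤ c′ :+ t :+ b) cα1 (cnt-lipschitz hα {1} {suc t} (s≤s z≤n)))
      to : ∀ r → 1 ≤ r → r ≤ cnt Pγ d → r ≤ E
      to r 1≤r h with d + r ≤? suc ℓ | ≤cnt⇒ 1≤d 1≤r h
      ... | yes small | _ = lia (d ∷ b ∷ ℓ ∷ a ∷ t ∷ r ∷ E ∷ cnt α (suc t) ∷ []) (λ d b l a t r E c → d :+ b :+ t := con 1 :+ l :+ a :⇒ d :+ r :≤ con 1 :+ l :⇒ E :+ a := c :+ t :+ b :⇒ ⊢ r :≤ E) eq small E+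
      ... | no big | r≤ℓ , g = go (proj₁ (young⇔moved x r 1≤x 1≤r) x≤)
        where
        x : ℕ
        x = d + r ∸ suc ℓ
        x+ : x + suc ℓ ≡ d + r
        x+ = m∸n+n≡m (<⇒≤ (≰⇒> big))
        1≤x : 1 ≤ x
        1≤x = m<n⇒0<n∸m (≰⇒> big)
        x≤ : x ≤ part γ r
        x≤ = +-cancelʳ-≤ (suc ℓ) _ _ (≤-trans (≤-reflexive x+) g)
        go : Moved x r → r ≤ E
        go (inj₁ (x₀ , lt , e₁ , D)) with Dg-positive hα D
        ... | d′ , 1≤d′ , e₂ , g′ , _ = lia (x ∷ ℓ ∷ d ∷ r ∷ b ∷ a ∷ t ∷ E ∷ cnt α (suc t) ∷ []) (λ x l d r b a t E c → x :+ (con 1 :+ l) := d :+ r :⇒ d :+ b :+ t := con 1 :+ l :+ a :⇒ E :+ a := c :+ t :+ b :⇒ x :≤ c :⇒ ⊢ r :≤ E)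
                  x+ eq E+ (subst (λ z → x ≤ cnt α z) d′≡ g′)
          where
          d′≡ : d′ ≡ suc t
          d′≡ = lia (x ∷ ℓ ∷ d ∷ r ∷ b ∷ a ∷ t ∷ x₀ ∷ A ∷ B ∷ d′ ∷ []) (λ x l d r b a t x₀ A B d′ → x :+ (con 1 :+ l) := d :+ r :⇒ d :+ b :+ t := con 1 :+ l :+ a :⇒
                  x₀ :+ B := r :+ A :⇒ A :+ b := B :+ a :⇒ con 1 :+ x₀ := d′ :+ x :⇒ ⊢ d′ := con 1 :+ t) x+ eq e₁ AB e₂
        -- The cells of β lie on the diagonals from the origin on, hence not on one t ≥ 1 steps to
        -- the left of it.
        go (inj₂ (x₀ , lt , e₁ , D)) = ⊥-elim (lia (x ∷ ℓ ∷ d ∷ r ∷ b ∷ a ∷ t ∷ x₀ ∷ A ∷ B ∷ []) (λ x l d r b a t x₀ A B → x :+ (con 1 :+ l) := d :+ r :⇒ d :+ b :+ t := con 1 :+ l :+ a :⇒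
                  x₀ :+ A := x :+ B :⇒ A :+ b := B :+ a :⇒ r :≤ x₀ :⇒ con 1 :≤ t :⇒ ⊢ :⊥) x+ eq e₁ AB (proj₁ (proj₂ D)) 1≤t)
      from : ∀ r → 1 ≤ r → r ≤ E → r ≤ cnt Pγ d
      from r 1≤r h with d + r ≤? suc ℓ
      ... | yes small = ⇒≤cnt 1≤d 1≤r (s≤s⁻¹ (≤-trans (+-monoˡ-≤ r 1≤d) small)) (≤-trans small (m≤n+m (suc ℓ) (part γ r)))
      ... | no big = ⇒≤cnt 1≤d 1≤r (within-length 1≤x x≤) (≤-trans (≤-reflexive (sym x+)) (+-monoˡ-≤ (suc ℓ) x≤))
        where
        x : ℕ
        x = d + r ∸ suc ℓ
        x+ : x + suc ℓ ≡ d + r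
        x+ = m∸n+n≡m (<⇒≤ (≰⇒> big))
        1≤x : 1 ≤ x
        1≤x = m<n⇒0<n∸m (≰⇒> big)
        A< : A < x + t
        A< with A0⊎B0
        ... | inj₂ (B0 , _) = lia (x ∷ ℓ ∷ d ∷ r ∷ b ∷ a ∷ t ∷ A ∷ B ∷ []) (λ x l d r b a t A B → x :+ (con 1 :+ l) := d :+ r :⇒ d :+ b :+ t := con 1 :+ l :+ a :⇒ A :+ b := B :+ a :⇒ B := con 0 :⇒ con 1 :≤ r :⇒ ⊢ A :< x :+ t) x+ eq AB B0 1≤r
        ... | inj₁ (A0 , _) = subst (_< x + t) (sym A0) (≤-trans 1≤x (m≤m+n x t))
        x≤ : x ≤ part γ r
        x≤ = proj₂ (young⇔moved x r 1≤x 1≤r) (inj₁ (x + t , A< ,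
          lia (x ∷ ℓ ∷ d ∷ r ∷ b ∷ a ∷ t ∷ A ∷ B ∷ []) (λ x l d r b a t A B → x :+ (con 1 :+ l) := d :+ r :⇒ d :+ b :+ t := con 1 :+ l :+ a :⇒ A :+ b := B :+ a :⇒ ⊢ x :+ t :+ B := r :+ A) x+ eq AB ,
          Dg-make hα t x 1≤x (lia (x ∷ ℓ ∷ d ∷ r ∷ b ∷ a ∷ t ∷ E ∷ cnt α (suc t) ∷ []) (λ x l d r b a t E c → x :+ (con 1 :+ l) := d :+ r :⇒ d :+ b :+ t := con 1 :+ l :+ a :⇒ E :+ a := c :+ t :+ b :⇒ r :≤ E :⇒ ⊢ x :≤ c) x+ eq E+ h)))

    cnt-total : cnt Pγ 1 ≡ ℓ
    cnt-total = trans (cnt-1 (proj₁ sP)) (length-plusDelta γ)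

    delta≤ : ∀ d → 1 ≤ d → cnt (delta ℓ) d ≤ cnt Pγ d
    delta≤ d 1≤d = subst (_≤ cnt Pγ d) (sym (cnt-delta ℓ d 1≤d)) (go (suc ℓ ∸ d) refl)
      where
      go : ∀ r → suc ℓ ∸ d ≡ r → r ≤ cnt Pγ d
      go zero _ = z≤n
      go (suc r) e = ⇒≤cnt 1≤d (s≤s z≤n) (s≤s⁻¹ (≤-trans (+-monoˡ-≤ (suc r) 1≤d) small)) (≤-trans small (m≤n+m (suc ℓ) _))
        where
        small : d + suc r ≤ suc ℓ
        small = ≤-reflexive (trans (cong (λ z → d + z) (sym e)) (m+[n∸m]≡n {d} {suc ℓ} (<⇒≤ (≰⇒> λ h → case trans (sym e) (m≤n⇒m∸n≡0 h) of λ ()))))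

open CombinationShape

-- Fillings encoded by words, for straight and for folded shapes

Word₁ : (s t : ℕ → Bool) → List Entry → Set
Word₁ s t ws = Sorted ws × All (λ e → 1 ≤ idx (proj₁ e)) ws × All (λ e → 1 ≤ proj₂ e) ws × (∀ y → 1 ≤ y → Run y (suc y) (s y) ws (t y))

-- The common interface of the straight shape on the multiples of k and of the folded shapes on the
-- pairs of runners; what follows sees fillings only through it.
record Encoding (Tab : Filling → Set) (s t : ℕ → Bool) : Set₁ where
  field
    Codes      : Filling → List Entry → Set
    encode     : ∀ f → Tab f → ∃ λ ws → Word₁ s t ws × Codes f ws
    decode     : ∀ ws → Word₁ s t ws → ∃ λ f → Tab f × Codes f ws
    functional : ∀ {f ws ws′} → Tab f → Word₁ s t ws → Word₁ s t ws′ → Codes f ws → Codes f ws′ → ws ≡ ws′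
    injective  : ∀ {f f′ ws} → Tab f → Tab f′ → Codes f ws → Codes f′ ws → f ≡ f′
    counts     : ∀ {f ws} → Tab f → Word₁ s t ws → Codes f ws → ∀ i → countF i f ≡ count i ws

shifted-encoding : ∀ {la} → StrictPartition la → Encoding (ShTab la []) (λ _ → false) (occ la)
shifted-encoding {la} sla = record
  { Codes = Records ; encode = record⇒word ; decode = word⇒record
  ; functional = records-functional ; injective = records-injective ; counts = records-count }
  where
  open Fillings {la} {[]} (strict⇒decreasing sla) [] 0 {λ _ → false} {occ la} {λ _ → 0} {cnt la} (λ _ _ → refl) (λ d _ → cnt-step (strict⇒decreasing sla) d)
    (λ _ _ → refl) (λ d _ → cong (cnt la) (+-identityʳ d)) (λ p h g → ⊥-elim (<⇒≱ h g)) (λ _ _ → z≤n)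

-- The shape of α ⋄ β on a single runner: the bead of β at e + 1 sits at o + e, the gap of α at t at o ∸ t.
module Folded {α β γ} (sα : StrictPartition α) (sβ : StrictPartition β) (us : UnderlyingShape α β γ) (K : ℕ) (top≤ : top α ≤ K) where

  open Shape sα sβ us

  -- The difference o - N = ℓ + 1 + a - b is the diagonal of γ + δ that corresponds to the part 1 of
  -- β. The summand b of N avoids a subtraction; K + 1 makes the path begin below the gaps for all
  -- parts of α, where every position is occupied.
  o N : ℕ
  o = ℓ + a + K + 2
  N = K + 1 + b

  s t : ℕ → Bool
  s y = y ≤ᵇ ℓ + N
  t y = if o ≤ᵇ y then occ β (suc (y ∸ o)) else not (occ α (o ∸ y))

  -- `ht y` counts the final beads from y on. Left of o these are the b parts of β and the gaps of α
  -- in between: of the t = o - y positions there, a - `cnt α (t + 1)` are parts of α and thus no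
  -- beads.
  hs ht : ℕ → ℕ
  hs y = suc (ℓ + N) ∸ y
  ht y = if o ≤ᵇ y then cnt β (suc (y ∸ o)) else cnt α (suc (o ∸ y)) + (o ∸ y) + b ∸ a

  t-right : ∀ e → t (o + e) ≡ occ β (suc e)
  t-right e with o ≤ᵇ o + e | proof (o ≤? o + e)
  ... | true | _ = cong (λ z → occ β (suc z)) (m+n∸m≡n o e)
  ... | false | ofⁿ n = ⊥-elim (n (m≤m+n o e))

  t-left : ∀ y n → y + suc n ≡ o → t y ≡ not (occ α (suc n))
  t-left y n e with o ≤ᵇ y | proof (o ≤? y)
  ... | true | ofʸ h = ⊥-elim (m+1+n≰m y (≤-trans (≤-reflexive e) h))
  ... | false | _ = cong (λ z → not (occ α z)) (trans (cong (_∸ y) (sym e)) (m+n∸m≡n y (suc n)))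

  ht-right : ∀ e → ht (o + e) ≡ cnt β (suc e)
  ht-right e with o ≤ᵇ o + e | proof (o ≤? o + e)
  ... | true | _ = cong (λ z → cnt β (suc z)) (m+n∸m≡n o e)
  ... | false | ofⁿ n = ⊥-elim (n (m≤m+n o e))

  private
    hα : Decreasing α
    hα = strict⇒decreasing sα
    hβ : Decreasing β
    hβ = strict⇒decreasing sβ

  ht-left : ∀ y n → y + n ≡ o → ht y + a ≡ cnt α (suc n) + n + b
  ht-left y n e with o ≤ᵇ y | proof (o ≤? y)
  ht-left y zero e | true | ofʸ h with trans (sym (+-identityʳ y)) e
  ... | refl = trans (cong (λ z → cnt β (suc z) + a) (n∸n≡0 o)) (trans (cong (_+ a) cβ1) (trans (+-comm b a) (cong (_+ b) (trans (sym cα1) (sym (+-identityʳ _))))))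
  ht-left y (suc n) e | true | ofʸ h = ⊥-elim (m+1+n≰m y (≤-trans (≤-reflexive e) h))
  ht-left y n e | false | _ = trans (cong (λ z → cnt α (suc z) + z + b ∸ a + a) (trans (cong (_∸ y) (sym e)) (m+n∸m≡n y n)))
    (m∸n+n≡m (lia (a ∷ b ∷ n ∷ cnt α 1 ∷ cnt α (suc n) ∷ []) (λ a b n c c′ → c := a :⇒ con 1 :+ c :≤ con 1 :+ n :+ c′ :⇒ ⊢ a :≤ c′ :+ n :+ b)
      cα1 (cnt-lipschitz hα {1} {suc n} (s≤s z≤n))))

  data Place (y : ℕ) : Set where
    onRight : ∀ e → y ≡ o + e → Place y
    onLeft  : ∀ n → y + suc n ≡ o → Place y

  place : ∀ y → Place y
  place y with o ≤? y
  ... | yes h = onRight (y ∸ o) (sym (m+[n∸m]≡n h))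
  ... | no h = onLeft (o ∸ suc y) (trans (+-suc y _) (m+[n∸m]≡n (≰⇒> h)))

  t-tail : IsTail′ ht t
  t-tail y 1≤y with place y
  ... | onRight e refl = trans (ht-right e) (trans (cnt-step hβ (suc e)) (cong₂ (λ x z → bit x + z) (sym (t-right e)) (sym (trans (cong ht (sym (+-suc o e))) (ht-right (suc e))))))
  ... | onLeft n eq = lia (ht y ∷ ht (suc y) ∷ a ∷ b ∷ n ∷ cnt α (suc n) ∷ cnt α (suc (suc n)) ∷ bit (occ α (suc n)) ∷ bit (t y) ∷ [])
      (λ h h′ a b n c c′ x x′ → h :+ a := c′ :+ (con 1 :+ n) :+ b :⇒ h′ :+ a := c :+ n :+ b :⇒ c := x :+ c′ :⇒ x′ :+ x := con 1 :⇒ ⊢ h := x′ :+ h′)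
      (ht-left y (suc n) eq) (ht-left (suc y) n (trans (sym (+-suc y n)) eq)) (cnt-step hα (suc n))
      (trans (cong (λ z → bit z + bit (occ α (suc n))) (t-left y n eq)) (bit-not (occ α (suc n))))

  s-tail : IsTail′ hs s
  s-tail y 1≤y with y ≤ᵇ ℓ + N | proof (y ≤? ℓ + N)
  ... | true | ofʸ h = +-∸-assoc 1 h
  ... | false | ofⁿ h = trans (m≤n⇒m∸n≡0 (≰⇒> h)) (sym (m≤n⇒m∸n≡0 (<⇒≤ (≰⇒> h))))

  hs≡ : ∀ d → 1 ≤ d → hs (d + N) ≡ cnt (delta ℓ) d
  hs≡ d 1≤d = trans ([m+n]∸[o+n]′ (suc ℓ) N d) (sym (cnt-delta ℓ d 1≤d))
    where
    [m+n]∸[o+n]′ : ∀ m n o → m + n ∸ (o + n) ≡ m ∸ o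
    [m+n]∸[o+n]′ m n o = trans (cong₂ _∸_ (+-comm m n) (+-comm o n)) ([m+n]∸[m+o]≡n∸o n m o)

  ht≡ : ∀ d → 1 ≤ d → ht (d + N) ≡ cnt Pγ d
  ht≡ d 1≤d with place (d + N)
  ... | onRight e eq = trans (trans (cong ht eq) (ht-right e)) (sym (cnt-right d e 1≤d
        (lia (d ∷ K ∷ b ∷ ℓ ∷ a ∷ e ∷ []) (λ d K b l a e → d :+ (K :+ con 1 :+ b) := l :+ a :+ K :+ con 2 :+ e :⇒ ⊢ d :+ b := con 1 :+ l :+ a :+ e) eq)))
  ... | onLeft n eq = +-cancelʳ-≡ a _ _ (trans (ht-left (d + N) (suc n) eq) (sym (cnt-left d (suc n) 1≤d (s≤s z≤n)
        (lia (d ∷ K ∷ b ∷ ℓ ∷ a ∷ n ∷ []) (λ d K b l a n → d :+ (K :+ con 1 :+ b) :+ (con 1 :+ n) := l :+ a :+ K :+ con 2 :⇒ ⊢ d :+ b :+ (con 1 :+ n) := con 1 :+ l :+ a) eq))))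

  ht-1 : ht 1 ≡ ℓ + N
  ht-1 = lia (ht 1 ∷ a ∷ b ∷ ℓ ∷ K ∷ cnt α (suc (ℓ + a + K + 1)) ∷ [])
      (λ h a b l K c → h :+ a := c :+ (l :+ a :+ K :+ con 1) :+ b :⇒ c := con 0 :⇒ ⊢ h := l :+ (K :+ con 1 :+ b))
      (ht-left 1 (ℓ + a + K + 1) (sym (+-suc (ℓ + a + K) 1)))
      (cnt-top hα (≤-<-trans top≤ (s≤s (≤-trans (m≤n+m K (ℓ + a)) (m≤m+n _ 1)))))

  -- `ht` falls from ℓ + N at 1 to ℓ at N + 1 and by at most one in each step, hence by exactly one.
  low : ∀ p → 1 ≤ p → p ≤ N → hs p ≡ ht p
  low (suc p) 1≤p p≤N = trans (cong (λ z → ℓ + z ∸ p) (sym (m∸n+n≡m p≤N)))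
     (lia (ht 1 ∷ ht (suc p) ∷ ht (1 + N) ∷ ℓ ∷ N ∷ p ∷ (N ∸ suc p) ∷ (ℓ + (N ∸ suc p + suc p) ∸ p) ∷ [])
      (λ h₁ h h₂ l N p x y → h₁ := l :+ N :⇒ h₂ := l :⇒ x :+ (con 1 :+ p) := N :⇒ h₁ :≤ p :+ h :⇒ h :≤ con 1 :+ x :+ h₂ :⇒ y :+ p := l :+ (x :+ (con 1 :+ p)) :⇒ ⊢ y := h)
      ht-1 (trans (ht≡ 1 ≤-refl) cnt-total) (m∸n+n≡m p≤N) (tail-lipschitz t-tail p 1 ≤-refl)
      (≤-trans (tail-lipschitz t-tail (suc (N ∸ suc p)) (suc p) 1≤p) (≤-reflexive (cong (λ z → suc (N ∸ suc p) + ht z) (trans (+-suc (suc p) _) (cong suc (m+[n∸m]≡n p≤N))))))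
      (m∸n+n≡m (≤-trans (n≤1+n p) (≤-trans (m≤n+m (suc p) (N ∸ suc p)) (m≤n+m _ ℓ)))))

  private
    module Fill = Fillings {Pγ} {delta ℓ} (strict⇒decreasing sP) (delta-decreasing ℓ) N {s} {t} {hs} {ht} s-tail t-tail hs≡ ht≡ low delta≤

  folded-encoding : Encoding (QTab γ) s t
  folded-encoding = record
    { Codes = Fill.Records ; encode = Fill.record⇒word ; decode = Fill.word⇒record
    ; functional = Fill.records-functional ; injective = Fill.records-injective ; counts = Fill.records-count }

  folded-moving : ∀ {ws l p} → Word₁ s t ws → (l , p) ∈ ws → hs p < ht p
  folded-moving = Fill.word-moving

-- Histories under exchange of beads and gaps, and under change of marks

after-dual : ∀ b f g f′ g′ → isJust f′ ≡ isJust g → isJust g′ ≡ isJust f → after (not b) f′ g′ ≡ not (after b f g)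
after-dual b (just _) (just _) (just _) (just _) _ _ = refl
after-dual b (just _) nothing nothing (just _) _ _ = refl
after-dual b nothing (just _) (just _) nothing _ _ = refl
after-dual b nothing nothing nothing nothing _ _ = refl

after-cong : ∀ b f g f′ g′ → isJust f′ ≡ isJust f → isJust g′ ≡ isJust g → after b f′ g′ ≡ after b f g
after-cong b (just _) (just _) (just _) (just _) _ _ = refl
after-cong b (just _) nothing (just _) nothing _ _ = refl
after-cong b nothing (just _) nothing (just _) _ _ = refl
after-cong b nothing nothing nothing nothing _ _ = refl

bitAt-dual : ∀ f g f′ g′ → (∀ i → isJust (f′ i) ≡ isJust (g i)) → (∀ i → isJust (g′ i) ≡ isJust (f i)) →
  ∀ s b n → bitAt f′ g′ s (not b) n ≡ not (bitAt f g s b n)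
bitAt-dual f g f′ g′ h h′ s b zero = refl
bitAt-dual f g f′ g′ h h′ s b (suc n) rewrite bitAt-dual f g f′ g′ h h′ s b n = after-dual _ (f (s + n)) (g (s + n)) (f′ (s + n)) (g′ (s + n)) (h _) (h′ _)

bitAt-cong : ∀ f g f′ g′ → (∀ i → isJust (f′ i) ≡ isJust (f i)) → (∀ i → isJust (g′ i) ≡ isJust (g i)) →
  ∀ s b n → bitAt f′ g′ s b n ≡ bitAt f g s b n
bitAt-cong f g f′ g′ h h′ s b zero = refl
bitAt-cong f g f′ g′ h h′ s b (suc n) rewrite bitAt-cong f g f′ g′ h h′ s b n = after-cong _ (f (s + n)) (g (s + n)) (f′ (s + n)) (g′ (s + n)) (h _) (h′ _)

bitAt-still : ∀ f g → (∀ i → isJust (f i) ≡ false) → (∀ i → isJust (g i) ≡ false) → ∀ s b n → bitAt f g s b n ≡ b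
bitAt-still f g h h′ s b zero = refl
bitAt-still f g h h′ s b (suc n) rewrite bitAt-still f g h h′ s b n | isJust-false (h (s + n)) | isJust-false (h′ (s + n)) = refl

history-still : ∀ {f g m b} → (∀ i → isJust (f i) ≡ false) → (∀ i → isJust (g i) ≡ false) → History f g m b b
history-still {f} {g} {m} {b} h h′ = (λ i _ → steps i) , bitAt-still f g h h′ 1 b m
  where
  steps : ∀ i → Step₁ (bitAt f g 1 b i) (f (suc i)) (g (suc i)) (bitAt f g 1 b (suc i))
  steps i rewrite isJust-false (h (suc i)) | isJust-false (h′ (suc i)) = stay

history-≗ : ∀ {f g f′ g′ m b b″} → (∀ i → 1 ≤ i → i ≤ m → f i ≡ f′ i) → (∀ i → 1 ≤ i → i ≤ m → g i ≡ g′ i) → History f g m b b″ → History f′ g′ m b b″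
history-≗ {f} {g} {f′} {g′} {m} {b} hf hg (h , e) = (λ i i< → subst₂ (λ a c → Step₁ a (f′ (suc i)) (g′ (suc i)) c) (same i (<⇒≤ i<)) (same (suc i) i<)
    (subst₂ (λ x y → Step₁ (bitAt f g 1 b i) x y (bitAt f g 1 b (suc i))) (hf (suc i) (s≤s z≤n) i<) (hg (suc i) (s≤s z≤n) i<) (h i i<))) , trans (sym (same m ≤-refl)) e
  where
  same : ∀ i → i ≤ m → bitAt f g 1 b i ≡ bitAt f′ g′ 1 b i
  same zero _ = refl
  same (suc i) i< rewrite same i (<⇒≤ i<) | hf (suc i) (s≤s z≤n) i< | hg (suc i) (s≤s z≤n) i< = refl

-- When beads and gaps are exchanged, the former filling key vacates. In `pass` its free mark
-- becomes a bound one and must agree with the negated bit.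
step-dual : ∀ {b f g b′ f′ g′} → Step₁ b f g b′ → isJust f′ ≡ isJust g → isJust g′ ≡ isJust f →
  (isJust f ≡ true → isJust g ≡ true → g′ ≡ just (not b)) → Step₁ (not b) f′ g′ (not b′)
step-dual {f′ = nothing} {nothing} stay _ _ _ = stay
step-dual {f′ = nothing} {just _} enter _ _ _ = leave
step-dual {f′ = just _} {nothing} leave _ _ _ = enter
step-dual {f′ = just _} {just _} pass _ _ h with h refl refl
... | refl = pass

step-cong : ∀ {b f g b′ f′} → Step₁ b f g b′ → isJust f′ ≡ isJust f → Step₁ b f′ g b′
step-cong {f′ = nothing} stay _ = stay
step-cong {f′ = just _} enter _ = enter
step-cong {f′ = nothing} leave _ = leave
step-cong {f′ = just _} pass _ = pass

step-mark : ∀ {b f g b′} → Step₁ b f g b′ → isJust f ≡ true → isJust g ≡ true → g ≡ just b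
step-mark pass _ _ = refl

history-dual : ∀ {f g f′ g′ m b b″} → History f g m b b″ → (∀ i → isJust (f′ i) ≡ isJust (g i)) → (∀ i → isJust (g′ i) ≡ isJust (f i)) →
  (∀ i → i < m → isJust (f (suc i)) ≡ true → isJust (g (suc i)) ≡ true → g′ (suc i) ≡ just (not (bitAt f g 1 b i))) →
  History f′ g′ m (not b) (not b″)
history-dual {f} {g} {f′} {g′} {m} {b} (h , e) hf hg mk =
  (λ i i< → subst₂ (λ a c → Step₁ a (f′ (suc i)) (g′ (suc i)) c) (sym (dual i)) (sym (dual (suc i))) (step-dual (h i i<) (hf (suc i)) (hg (suc i)) (mk i i<))) ,
  trans (dual m) (cong not e)
  where
  dual : ∀ n → bitAt f′ g′ 1 (not b) n ≡ not (bitAt f g 1 b n)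
  dual = bitAt-dual f g f′ g′ hf hg 1 b

-- No step constrains the mark of the filling key, so only its presence matters.
history-cong : ∀ {f g f′ m b b″} → History f g m b b″ → (∀ i → isJust (f′ i) ≡ isJust (f i)) → History f′ g m b b″
history-cong {f} {g} {f′} {m} {b} (h , e) hf =
  (λ i i< → subst₂ (λ a c → Step₁ a (f′ (suc i)) (g (suc i)) c) (sym (same i)) (sym (same (suc i))) (step-cong (h i i<) (hf (suc i)))) , trans (same m) e
  where
  same : ∀ n → bitAt f′ g 1 b n ≡ bitAt f g 1 b n
  same = bitAt-cong f g f′ g hf (λ _ → refl) 1 b

-- A pair of runners unfolded into one: the edges of the runner α (entries uA, uA i 0 being the entry of the edge
-- joining both runners) are reversed and put below those of the runner β (entries uB), with flipped marks.

Entries : Set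
Entries = ℕ → ℕ → Maybe Bool

module Fold (o : ℕ) (cA s : ℕ → Bool) where

  -- the bits of the runner α before the letter suc i
  bitsA : Entries → ℕ → ℕ → Bool
  bitsA uA i n = bitAt (λ j → uA j n) (λ j → uA j (suc n)) 1 (cA n) i

  unfold : Entries → Entries → Entries
  unfold uA uB i y = if y ≤ᵇ o then flip (bitsA uA (pred i)) (uA i) (o ∸ y) else uB i (y ∸ o)

  -- the bits of the runner α, read off the unfolded runner v
  bitsV : Entries → ℕ → ℕ → Bool
  bitsV v i n = if suc n ≤ᵇ o then not (bitAt (λ j → v j (o ∸ suc n)) (λ j → v j (suc (o ∸ suc n))) 1 (s (o ∸ suc n)) i) else cA n

  reversed : Entries → ℕ → ℕ → Maybe Bool
  reversed v i n = v i (o ∸ n)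

  -- The joint edge is shared by the two runners, so `foldB` copies its mark from `foldA`. On the
  -- abacus this key fills the positions at both its ends, and neither of them binds its mark.
  foldA foldB : Entries → Entries
  foldA v i = unflip o (bitsV v (pred i)) (reversed v i)
  foldB v i zero = foldA v i 0
  foldB v i (suc e) = v i (o + suc e)

  unfold-left : ∀ uA uB i y n → y + n ≡ o → unfold uA uB i y ≡ flip (bitsA uA (pred i)) (uA i) n
  unfold-left uA uB i y n e with y ≤ᵇ o | proof (y ≤? o)
  ... | true | _ = cong (flip (bitsA uA (pred i)) (uA i)) (trans (cong (_∸ y) (sym e)) (m+n∸m≡n y n))
  ... | false | ofⁿ h = ⊥-elim (h (≤-trans (m≤m+n y n) (≤-reflexive e)))

  unfold-right : ∀ uA uB i e → unfold uA uB i (o + suc e) ≡ uB i (suc e)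
  unfold-right uA uB i e with o + suc e ≤ᵇ o | proof (o + suc e ≤? o)
  ... | true | ofʸ h = ⊥-elim (m+1+n≰m o h)
  ... | false | _ = cong (uB i) (m+n∸m≡n o (suc e))

  unfold-joint : ∀ uA uB i → unfold uA uB i (o + 0) ≡ flip (bitsA uA (pred i)) (uA i) 0
  unfold-joint uA uB i = unfold-left uA uB i (o + 0) 0 (trans (+-identityʳ (o + 0)) (+-identityʳ o))

module Unfold (m o : ℕ) (cA λA cB λB s t : ℕ → Bool)
  (s-right : ∀ e → s (o + e) ≡ cB e) (t-right : ∀ e → t (o + e) ≡ λB e)
  (s-left : ∀ y n → y + suc n ≡ o → s y ≡ not (cA n)) (t-left : ∀ y n → y + suc n ≡ o → t y ≡ not (λA n)) where

  open Fold o cA s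

  -- Left of o a position is dual to one of the runner α, and `flip` supplies the mark that
  -- `step-dual` demands. From o on the positions are those of β. Only the joint edge has got a new
  -- mark there, which is free because this edge fills the position o.
  unfold-history : ∀ uA uB → (∀ i → uA i 0 ≡ uB i 0) →
    (∀ n → History (λ i → uA i n) (λ i → uA i (suc n)) m (cA n) (λA n)) →
    (∀ e → History (λ i → uB i e) (λ i → uB i (suc e)) m (cB e) (λB e)) →
    ∀ y → History (λ i → unfold uA uB i y) (λ i → unfold uA uB i (suc y)) m (s y) (t y)
  unfold-history uA uB joint hA hB y with o ≤? y
  ... | yes o≤y = subst (λ y → History (λ i → unfold uA uB i y) (λ i → unfold uA uB i (suc y)) m (s y) (t y)) (m+[n∸m]≡n o≤y) (right′ (y ∸ o))
    where
    right′ : ∀ e → History (λ i → unfold uA uB i (o + e)) (λ i → unfold uA uB i (suc (o + e))) m (s (o + e)) (t (o + e))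
    right′ e = subst₂ (λ b b″ → History (λ i → unfold uA uB i (o + e)) (λ i → unfold uA uB i (suc (o + e))) m b b″) (sym (s-right e)) (sym (t-right e))
      (history-cong {f = λ i → uB i e} (history-≗ (λ _ _ _ → refl) (λ i _ _ → sym (trans (cong (unfold uA uB i) (sym (+-suc o e))) (unfold-right uA uB i e))) (hB e)) (moved e))
      where
      moved : ∀ e i → isJust (unfold uA uB i (o + e)) ≡ isJust (uB i e)
      moved zero i = trans (cong isJust (unfold-joint uA uB i)) (trans (flip-isJust (bitsA uA (pred i)) (uA i) 0) (cong isJust (joint i)))
      moved (suc e) i = cong isJust (unfold-right uA uB i e)
  ... | no o≰y = subst₂ (λ b b″ → History (λ i → unfold uA uB i y) (λ i → unfold uA uB i (suc y)) m b b″) (sym (s-left y n eq)) (sym (t-left y n eq))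
      (history-dual (hA n) (λ i → trans (cong isJust (unfold-left uA uB i y (suc n) eq)) (flip-isJust (bitsA uA (pred i)) (uA i) (suc n)))
        (λ i → trans (cong isJust (unfold-left uA uB i (suc y) n eq′)) (flip-isJust (bitsA uA (pred i)) (uA i) n))
        (λ i i< j j′ → trans (unfold-left uA uB (suc i) (suc y) n eq′)
          (flip-linked (bitsA uA i) (uA (suc i)) n (trans (flip-isJust (bitsA uA i) (uA (suc i)) n) j) (trans (flip-isJust (bitsA uA i) (uA (suc i)) (suc n)) j′))))
    where
    n : ℕ
    n = o ∸ suc y
    eq′ : suc y + n ≡ o
    eq′ = m+[n∸m]≡n (≰⇒> o≰y)
    eq : y + suc n ≡ o
    eq = trans (+-suc y n) eq′

  module _ (v : Entries) (v0 : ∀ i → isJust (v i 0) ≡ false) (v1 : ∀ i → isJust (v i 1) ≡ false)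
    (hv : ∀ y → 1 ≤ y → History (λ i → v i y) (λ i → v i (suc y)) m (s y) (t y))
    (far : ∀ n → o ≤ suc n → cA n ≡ λA n) where

    private
      reversed-far : ∀ i n → o ≤ n → isJust (reversed v i n) ≡ false
      reversed-far i n h = trans (cong (λ y → isJust (v i y)) (m≤n⇒m∸n≡0 h)) (v0 i)

      reversed-far′ : ∀ i n → o ≤ suc n → isJust (reversed v i n) ≡ false
      reversed-far′ i n h with o ≤? n
      ... | yes h′ = reversed-far i n h′
      ... | no h′ = trans (cong (λ y → isJust (v i y)) (trans (cong (_∸ n) (≤-antisym h (≰⇒> h′))) (trans (+-∸-assoc 1 {n} {n} ≤-refl) (cong suc (n∸n≡0 n))))) (v1 i)

      foldA-moved : ∀ i n → isJust (foldA v i n) ≡ isJust (reversed v i n)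
      foldA-moved i n = unflip-isJust o (bitsV v (pred i)) (reversed v i) n

      bitsV-near : ∀ i n → suc n ≤ o → bitsV v i n ≡ not (bitAt (λ j → v j (o ∸ suc n)) (λ j → v j (suc (o ∸ suc n))) 1 (s (o ∸ suc n)) i)
      bitsV-near i n h with suc n ≤ᵇ o | proof (suc n ≤? o)
      ... | true | _ = refl
      ... | false | ofⁿ h′ = ⊥-elim (h′ h)

      successor : ∀ n → suc n ≤ o → suc (o ∸ suc n) ≡ o ∸ n
      successor n h = sym (+-∸-assoc 1 h)

    foldA-history : ∀ n → History (λ i → foldA v i n) (λ i → foldA v i (suc n)) m (cA n) (λA n)
    foldA-history n with o ≤? suc n
    ... | yes h = subst (History _ _ m (cA n)) (far n h) (history-still (λ i → trans (foldA-moved i n) (reversed-far′ i n h)) (λ i → trans (foldA-moved i (suc n)) (reversed-far i (suc n) h)))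
    ... | no h = subst₂ (History _ _ m) (trans (cong not (s-left y n eq)) (not-involutive (cA n))) (trans (cong not (t-left y n eq)) (not-involutive (λA n)))
        (history-dual (hv y (m<n⇒0<n∸m (≰⇒> h)))
          (λ i → trans (foldA-moved i n) (cong (λ z → isJust (v i z)) (sym (successor n n<))))
          (λ i → foldA-moved i (suc n))
          (λ i i< j j′ → trans (unflip-linked o (bitsV v i) (reversed v (suc i)) n
              (trans (unflip-isJust o (bitsV v i) (reversed v (suc i)) n) (trans (cong (λ z → isJust (v (suc i) z)) (sym (successor n n<))) j′))
              (trans (unflip-isJust o (bitsV v i) (reversed v (suc i)) (suc n)) j))
            (cong just (bitsV-near i n n<))))
      where
      n< : suc n ≤ o
      n< = <⇒≤ (≰⇒> h)
      y : ℕ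
      y = o ∸ suc n
      eq : y + suc n ≡ o
      eq = m∸n+n≡m n<

    foldB-history : 1 ≤ o → ∀ e → History (λ i → foldB v i e) (λ i → foldB v i (suc e)) m (cB e) (λB e)
    foldB-history 1≤o e = subst₂ (History _ _ m) (s-right e) (t-right e)
      (history-cong {f = λ i → v i (o + e)} (history-≗ (λ _ _ _ → refl) (λ i _ _ → cong (v i) (sym (+-suc o e))) (hv (o + e) (≤-trans 1≤o (m≤m+n o e)))) (moved e))
      where
      moved : ∀ e i → isJust (foldB v i e) ≡ isJust (v i (o + e))
      moved zero i = trans (foldA-moved i 0) (cong (λ z → isJust (v i z)) (sym (+-identityʳ o)))
      moved (suc e) i = refl

    -- The bits depend on which entries are present and not on their marks, so those used by `flip`
    -- and those used by `unflip` are the same although they are computed from different entries.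
    bits-agree : ∀ i n → suc n ≤ o → bitsA (foldA v) i n ≡ bitsV v i n
    bits-agree i n n< = trans (cong (λ b → bitAt (λ j → foldA v j n) (λ j → foldA v j (suc n)) 1 b i) (sym (trans (cong not (s-left y n eq)) (not-involutive (cA n)))))
        (trans (bitAt-dual (λ j → v j y) (λ j → v j (suc y)) (λ j → foldA v j n) (λ j → foldA v j (suc n))
          (λ j → trans (foldA-moved j n) (cong (λ z → isJust (v j z)) (sym (successor n n<)))) (λ j → foldA-moved j (suc n)) 1 (s y) i)
          (sym (bitsV-near i n n<)))
      where
      y : ℕ
      y = o ∸ suc n
      eq : y + suc n ≡ o
      eq = m∸n+n≡m n<

    reversed-linked : ∀ i → i < m → Linked↓ (bitsV v i) (reversed v (suc i))
    reversed-linked i i< n j j′ with o ≤? suc n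
    ... | yes h = case trans (sym j′) (reversed-far (suc i) (suc n) h) of λ ()
    ... | no h = trans (cong (v (suc i)) (sym (successor n n<))) (trans (step-mark (proj₁ (hv (o ∸ suc n) (m<n⇒0<n∸m (≰⇒> h))) i i<) j′ (trans (cong (λ z → isJust (v (suc i) z)) (successor n n<)) j))
        (cong just (sym (trans (cong not (bitsV-near i n n<)) (not-involutive _)))))
      where
      n< : suc n ≤ o
      n< = <⇒≤ (≰⇒> h)

    -- The entries uA and uB are only required to agree with the folded ones pointwise, since they
    -- will be read off an assembled word. On the α side this is `flip-unflip`, with
    -- `reversed-linked` as its hypothesis.
    unfold-fold : ∀ uA uB → (∀ i n → uA i n ≡ foldA v i n) → (∀ i e → uB i (suc e) ≡ foldB v i (suc e)) →
      ∀ i → i < m → ∀ y → unfold uA uB (suc i) y ≡ v (suc i) y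
    unfold-fold uA uB eA eB i i< y with y ≤? o
    ... | yes h = trans (unfold-left uA uB (suc i) y n eq) (trans (flip-cong n)
          (trans (flip-unflip o (bitsV v i) (reversed v (suc i)) (reversed-far (suc i)) (reversed-linked i i<) n) (cong (v (suc i)) (trans (cong (_∸ n) (sym eq)) (m+n∸n≡m y n)))))
      where
      n : ℕ
      n = o ∸ y
      eq : y + n ≡ o
      eq = m+[n∸m]≡n h
      start-cong : ∀ n → start (uA (suc i)) n ≡ start (foldA v (suc i)) n
      start-cong zero = eA (suc i) 0
      start-cong (suc n) rewrite eA (suc i) n | eA (suc i) (suc n) | start-cong n = refl
      bitsA-cong : ∀ i n → bitsA uA i n ≡ bitsA (foldA v) i n
      bitsA-cong i n = bitAt-cong (λ j → foldA v j n) (λ j → foldA v j (suc n)) (λ j → uA j n) (λ j → uA j (suc n)) (λ j → cong isJust (eA j n)) (λ j → cong isJust (eA j (suc n))) 1 (cA n) i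
      flip-cong : ∀ n → flip (bitsA uA i) (uA (suc i)) n ≡ flip (bitsV v i) (foldA v (suc i)) n
      flip-cong n rewrite eA (suc i) n | eA (suc i) (suc n) | start-cong n with isJust (foldA v (suc i) n)
      ... | false = refl
      ... | true with isJust (foldA v (suc i) (suc n)) in eq
      ...   | false = refl
      ...   | true with o ≤? n
      ...     | yes o≤n = case trans (sym eq) (trans (foldA-moved (suc i) (suc n)) (reversed-far (suc i) (suc n) (m≤n⇒m≤1+n o≤n))) of λ ()
      ...     | no o≰n = cong (λ b → just (not b)) (trans (bitsA-cong i n) (bits-agree i n (≰⇒> o≰n)))
    ... | no h = trans (cong (unfold uA uB (suc i)) (sym eq)) (trans (unfold-right uA uB (suc i) (y ∸ suc o)) (trans (eB (suc i) (y ∸ suc o)) (cong (v (suc i)) eq)))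
      where
      eq : o + suc (y ∸ suc o) ≡ y
      eq = trans (+-suc o _) (m+[n∸m]≡n (≰⇒> h))

  -- The flip preserves which entries are present; these determine the bits, letter after letter,
  -- and the bits determine how to undo the flip.
  unfold-injective : ∀ uA uB uA′ uB′ L → (∀ i n → L ≤ n → isJust (uA i n) ≡ false) → (∀ i n → L ≤ n → isJust (uA′ i n) ≡ false) →
    (∀ n → History (λ i → uA i n) (λ i → uA i (suc n)) m (cA n) (λA n)) →
    (∀ n → History (λ i → uA′ i n) (λ i → uA′ i (suc n)) m (cA n) (λA n)) →
    L ≤ o → (∀ i → 1 ≤ i → i ≤ m → ∀ y → 1 ≤ y → unfold uA uB i y ≡ unfold uA′ uB′ i y) →
    ∀ i → i < m → (∀ n → uA (suc i) n ≡ uA′ (suc i) n) × (∀ e → uB (suc i) (suc e) ≡ uB′ (suc i) (suc e))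
  unfold-injective uA uB uA′ uB′ L far far′ hA hA′ L≤o same i i< = (λ n → trans (sym (recover uA far hA n)) (trans (unflip-cong n) (recover uA′ far′ hA′ n))) ,
    λ e → trans (sym (unfold-right uA uB (suc i) e)) (trans (same (suc i) (s≤s z≤n) i< (o + suc e) (≤-trans (s≤s z≤n) (m≤n+m (suc e) o))) (unfold-right uA′ uB′ (suc i) e))
    where
    recover : ∀ u → (∀ i n → L ≤ n → isJust (u i n) ≡ false) → (∀ n → History (λ i → u i n) (λ i → u i (suc n)) m (cA n) (λA n)) →
      ∀ n → unflip L (bitsA u i) (flip (bitsA u i) (u (suc i))) n ≡ u (suc i) n
    recover u far h = unflip-flip L (bitsA u i) (u (suc i)) (far (suc i)) (λ n j j′ → step-mark (proj₁ (h n) i i<) j j′)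
    flips : ∀ j → j < m → ∀ n → flip (bitsA uA j) (uA (suc j)) n ≡ flip (bitsA uA′ j) (uA′ (suc j)) n
    flips j j< n with n <? o
    ... | yes lt = trans (sym (unfold-left uA uB (suc j) (o ∸ n) n (m∸n+n≡m (<⇒≤ lt)))) (trans (same (suc j) (s≤s z≤n) j< (o ∸ n) (m<n⇒0<n∸m lt)) (unfold-left uA′ uB′ (suc j) (o ∸ n) n (m∸n+n≡m (<⇒≤ lt))))
    ... | no ge = trans (isJust-false (trans (flip-isJust (bitsA uA j) (uA (suc j)) n) (far (suc j) n (≤-trans L≤o (≮⇒≥ ge)))))
        (sym (isJust-false (trans (flip-isJust (bitsA uA′ j) (uA′ (suc j)) n) (far′ (suc j) n (≤-trans L≤o (≮⇒≥ ge))))))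
    moved : ∀ j → j < m → ∀ n → isJust (uA (suc j) n) ≡ isJust (uA′ (suc j) n)
    moved j j< n = trans (sym (flip-isJust (bitsA uA j) (uA (suc j)) n)) (trans (cong isJust (flips j j< n)) (flip-isJust (bitsA uA′ j) (uA′ (suc j)) n))
    bits : ∀ j → j ≤ m → ∀ n → bitsA uA j n ≡ bitsA uA′ j n
    bits zero _ n = refl
    bits (suc j) j< n rewrite bits j (<⇒≤ j<) n = after-cong (bitsA uA′ j n) (uA′ (suc j) n) (uA′ (suc j) (suc n)) (uA (suc j) n) (uA (suc j) (suc n)) (moved j j< n) (moved j j< (suc n))
    v v′ : ℕ → Maybe Bool
    v = flip (bitsA uA i) (uA (suc i))
    v′ = flip (bitsA uA′ i) (uA′ (suc i))
    end-cong : ∀ f n → end f v n ≡ end f v′ n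
    end-cong zero n = flips i i< n
    end-cong (suc f) n rewrite flips i i< (suc n) | end-cong f (suc n) | flips i i< n = refl
    unflip-cong : ∀ n → unflip L (bitsA uA i) v n ≡ unflip L (bitsA uA′ i) v′ n
    unflip-cong zero rewrite flips i i< 0 | end-cong L 0 = refl
    unflip-cong (suc n) rewrite flips i i< (suc n) | flips i i< n | bits i (<⇒≤ i<) n | end-cong (L ∸ suc n) (suc n) = refl

-- Words as functions from letters and keys to marks

is : Bool → Maybe Bool → Bool
is b nothing = false
is true (just b) = b
is false (just b) = not b

is⇒ : ∀ b {e} → is b e ≡ true → e ≡ just b
is⇒ true {just true} _ = refl
is⇒ false {just false} _ = refl

⇒is : ∀ b → is b (just b) ≡ true
⇒is true = refl
⇒is false = refl

wordOf : ℕ → ℕ → Entries → List Entry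
wordOf m K U = sift (λ e → is (marked (proj₁ e)) (U (idx (proj₁ e)) (proj₂ e))) (fullAlphabet m K)

module _ (m K : ℕ) (U : Entries) where

  wordOf-sorted : Sorted (wordOf m K U)
  wordOf-sorted = sift-sorted _ (fullAlphabet-sorted m K)

  ∈-wordOf⁻ : ∀ {l p} → (l , p) ∈ wordOf m K U → 1 ≤ idx l × idx l ≤ m × 1 ≤ p × p ≤ K × U (idx l) p ≡ just (marked l)
  ∈-wordOf⁻ {lab i b} {p} h with ∈-sift⁻ _ {xs = fullAlphabet m K} h
  ... | h′ , e = let (a , c , d , f) = ∈-fullAlphabet⁻ m K h′ in a , c , d , f , is⇒ b e

  ∈-wordOf⁺ : ∀ {i b p} → 1 ≤ i → i ≤ m → 1 ≤ p → p ≤ K → U i p ≡ just b → (lab i b , p) ∈ wordOf m K U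
  ∈-wordOf⁺ {i} {b} a c d f e = ∈-sift⁺ _ (∈-fullAlphabet⁺ m K a c d f) (trans (cong (is b) e) (⇒is b))

  wordOf-letters : Letters≤ m (wordOf m K U)
  wordOf-letters = All.tabulate λ h → let (a , b , _) = ∈-wordOf⁻ h in a , b

  wordOf-noDouble : NoDouble (wordOf m K U)
  wordOf-noDouble i p h h′ with trans (sym (proj₂ (proj₂ (proj₂ (proj₂ (∈-wordOf⁻ h)))))) (proj₂ (proj₂ (proj₂ (proj₂ (∈-wordOf⁻ h′)))))
  ... | ()

entry-true : ∀ ws {i p} → (lab i true , p) ∈ ws → entry (∈ᵇ ws) i p ≡ just true
entry-true ws h rewrite ∈⇒∈ᵇ ws h = refl

entry-false : ∀ ws {i p} → NoDouble ws → (lab i false , p) ∈ ws → entry (∈ᵇ ws) i p ≡ just false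
entry-false ws {i} {p} nd h with ∈ᵇ ws (lab i true , p) in eq
... | true = ⊥-elim (nd i p (∈ᵇ⇒∈ ws eq) h)
... | false rewrite ∈⇒∈ᵇ ws h = refl

entry-just : ∀ ws {i b p} → entry (∈ᵇ ws) i p ≡ just b → (lab i b , p) ∈ ws
entry-just ws {i} {b} {p} h with ∈ᵇ ws (lab i true , p) in eq
entry-just ws {i} {true} {p} refl | true = ∈ᵇ⇒∈ ws eq
... | false with ∈ᵇ ws (lab i false , p) in eq′
entry-just ws {i} {false} {p} refl | false | true = ∈ᵇ⇒∈ ws eq′

entry-∈ : ∀ ws {l p} → NoDouble ws → (l , p) ∈ ws → entry (∈ᵇ ws) (idx l) p ≡ just (marked l)
entry-∈ ws {lab i true} nd h = entry-true ws h
entry-∈ ws {lab i false} nd h = entry-false ws nd h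

entry-nothing : ∀ ws {i p} → (∀ b → (lab i b , p) ∉ ws) → entry (∈ᵇ ws) i p ≡ nothing
entry-nothing ws {i} {p} h with entry (∈ᵇ ws) i p in eq
... | nothing = refl
... | just b = ⊥-elim (h b (entry-just ws eq))

entry-wordOf : ∀ m K U → (∀ i p → p ≡ 0 ⊎ K < p → U i p ≡ nothing) → ∀ i → 1 ≤ i → i ≤ m → ∀ p → entry (∈ᵇ (wordOf m K U)) i p ≡ U i p
entry-wordOf m K U out i 1≤i i≤m p with U i p in eq
... | nothing = entry-nothing (wordOf m K U) λ b h → case trans (sym eq) (proj₂ (proj₂ (proj₂ (proj₂ (∈-wordOf⁻ m K U h))))) of λ ()
... | just b = entry-∈ (wordOf m K U) (wordOf-noDouble m K U) (∈-wordOf⁺ m K U 1≤i i≤m 1≤p p≤K eq)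
  where
  1≤p : 1 ≤ p
  1≤p = n≢0⇒n>0 λ z → case trans (sym eq) (out i p (inj₁ z)) of λ ()
  p≤K : p ≤ K
  p≤K = ≮⇒≥ λ z → case trans (sym eq) (out i p (inj₂ z)) of λ ()

wordOf-run : ∀ m K U → (∀ i p → p ≡ 0 ⊎ K < p → U i p ≡ nothing) → ∀ {I O b b″} → I < O →
  History (λ i → U i I) (λ i → U i O) m b b″ → Run I O b (wordOf m K U) b″
wordOf-run m K U out {I} {O} I<O h = history⇒run (wordOf-sorted m K U) (wordOf-letters m K U) (wordOf-noDouble m K U) I<O
  (history-≗ (λ i a b → sym (entry-wordOf m K U out i a b I)) (λ i a b → sym (entry-wordOf m K U out i a b O)) h)

word-extensional : ∀ {m ws ws′} → Sorted ws → Sorted ws′ → Letters≤ m ws → Letters≤ m ws′ → NoDouble ws → NoDouble ws′ →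
  (∀ i → 1 ≤ i → i ≤ m → ∀ p → entry (∈ᵇ ws) i p ≡ entry (∈ᵇ ws′) i p) → ws ≡ ws′
word-extensional {m} srt srt′ ls ls′ nd nd′ h = sorted-extensional srt srt′ (go ls nd h) (go ls′ nd′ λ i a b p → sym (h i a b p))
  where
  go : ∀ {ws ws′} → Letters≤ m ws → NoDouble ws → (∀ i → 1 ≤ i → i ≤ m → ∀ p → entry (∈ᵇ ws) i p ≡ entry (∈ᵇ ws′) i p) → ∀ {z} → z ∈ ws → z ∈ ws′
  go {ws} {ws′} ls nd h {l , p} z∈ = entry-just ws′ (trans (sym (h (idx l) (proj₁ (All.lookup ls z∈)) (proj₂ (All.lookup ls z∈)) p)) (entry-∈ ws nd z∈))

word₁-noDouble : ∀ {m s t ws} → Word₁ s t ws → Letters≤ m ws → NoDouble ws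
word₁-noDouble (srt , _ , keys , run) ls i p h h′ = run-no-double srt ls (n<1+n p) (run p (All.lookup keys h)) i h h′

word₁-history : ∀ {m s t ws} → Word₁ s t ws → Letters≤ m ws → ∀ y → 1 ≤ y →
  History (λ i → entry (∈ᵇ ws) i y) (λ i → entry (∈ᵇ ws) i (suc y)) m (s y) (t y)
word₁-history w@(srt , _ , _ , run) ls y 1≤y = run⇒history srt ls (word₁-noDouble w ls) (n<1+n y) (run y 1≤y)

-- The multiplicity of a letter is computed from its keys alone, because unfolding preserves the
-- presence of entries but not their marks. Without double entries the keys of one letter are
-- distinct.
keys : ℕ → List Entry → List ℕ
keys i ws = map proj₂ (filter (λ e → idx (proj₁ e) ≟ i) ws)

keys-length : ∀ i ws → length (keys i ws) ≡ count i ws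
keys-length i ws = trans (length-map proj₂ (filter (λ e → idx (proj₁ e) ≟ i) ws)) (sym (count-filter i ws))

∈-keys⁻ : ∀ i ws {p} → p ∈ keys i ws → ∃ λ b → (lab i b , p) ∈ ws
∈-keys⁻ i ws h with ∈-map⁻ proj₂ h
... | (lab j b , p) , h′ , refl with ∈-filter⁻ (λ e → idx (proj₁ e) ≟ i) {xs = ws} h′
...   | h″ , refl = b , h″

∈-keys⁺ : ∀ i ws {b p} → (lab i b , p) ∈ ws → p ∈ keys i ws
∈-keys⁺ i ws h = ∈-map⁺ proj₂ (∈-filter⁺ (λ e → idx (proj₁ e) ≟ i) h refl)

keys-unique : ∀ i {ws} → Sorted ws → NoDouble ws → Unique (keys i ws)
keys-unique i {ws} srt nd = unique-map proj₂ inj (AP.filter⁺ _ (sorted-unique srt))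
  where
  inj : ∀ {x y} → x ∈ filter (λ e → idx (proj₁ e) ≟ i) ws → y ∈ filter (λ e → idx (proj₁ e) ≟ i) ws → proj₂ x ≡ proj₂ y → x ≡ y
  inj {lab j b , p} {lab j′ b′ , p′} x∈ y∈ refl with ∈-filter⁻ (λ e → idx (proj₁ e) ≟ i) {xs = ws} x∈ | ∈-filter⁻ (λ e → idx (proj₁ e) ≟ i) {xs = ws} y∈
  inj {lab j true , p} {lab j′ true , p′} x∈ y∈ refl | x∈′ , refl | y∈′ , refl = refl
  inj {lab j false , p} {lab j′ false , p′} x∈ y∈ refl | x∈′ , refl | y∈′ , refl = refl
  inj {lab j true , p} {lab j′ false , p′} x∈ y∈ refl | x∈′ , refl | y∈′ , refl = ⊥-elim (nd _ _ x∈′ y∈′)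
  inj {lab j false , p} {lab j′ true , p′} x∈ y∈ refl | x∈′ , refl | y∈′ , refl = ⊥-elim (nd _ _ y∈′ x∈′)

-- Finite sums and the splitting of a list into classes

sumTo : ℕ → (ℕ → ℕ) → ℕ
sumTo zero f = f 0
sumTo (suc n) f = sumTo n f + f (suc n)

sumTo-0 : ∀ {n} {f : ℕ → ℕ} → (∀ j → j ≤ n → f j ≡ 0) → sumTo n f ≡ 0
sumTo-0 {zero} z = z 0 z≤n
sumTo-0 {suc n} z = cong₂ _+_ (sumTo-0 {n} λ j le → z j (m≤n⇒m≤1+n le)) (z (suc n) ≤-refl)

sumTo-cong : ∀ n {f g : ℕ → ℕ} → (∀ j → j ≤ n → f j ≡ g j) → sumTo n f ≡ sumTo n g
sumTo-cong zero h = h 0 z≤n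
sumTo-cong (suc n) h = cong₂ _+_ (sumTo-cong n λ j le → h j (m≤n⇒m≤1+n le)) (h (suc n) ≤-refl)

sumTo-+ : ∀ n (f g : ℕ → ℕ) → sumTo n (λ j → f j + g j) ≡ sumTo n f + sumTo n g
sumTo-+ zero f g = refl
sumTo-+ (suc n) f g = trans (cong (_+ (f (suc n) + g (suc n))) (sumTo-+ n f g))
  (lia (sumTo n f ∷ sumTo n g ∷ f (suc n) ∷ g (suc n) ∷ []) (λ a b c d → ⊢ a :+ b :+ (c :+ d) := a :+ c :+ (b :+ d)))

sumTo-≤ : ∀ n {f : ℕ → ℕ} j → j ≤ n → f j ≤ sumTo n f
sumTo-≤ zero zero z≤n = ≤-refl
sumTo-≤ (suc n) j h with j ≟ suc n
... | yes refl = m≤n+m _ _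
... | no ne = ≤-trans (sumTo-≤ n j (s≤s⁻¹ (≤∧≢⇒< h ne))) (m≤m+n _ _)

class : (ℕ → ℕ) → ℕ → List ℕ → List ℕ
class f j = filter (λ x → f x ≟ j)

length-classes : ∀ (f : ℕ → ℕ) n xs → (∀ {x} → x ∈ xs → f x ≤ n) → sumTo n (λ j → length (class f j xs)) ≡ length xs
length-classes f n [] _ = zeros n
  where
  zeros : ∀ n → sumTo n (λ _ → 0) ≡ 0
  zeros zero = refl
  zeros (suc n) = trans (+-identityʳ _) (zeros n)
length-classes f n (x ∷ xs) h = trans (sumTo-cong n (λ j _ → head j)) (trans (sumTo-+ n _ _) (cong₂ _+_ (one n (h (here refl))) (length-classes f n xs (λ z → h (there z)))))
  where
  δ : ℕ → ℕ
  δ j = if f x ≡ᵇ j then 1 else 0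
  head : ∀ j → length (class f j (x ∷ xs)) ≡ δ j + length (class f j xs)
  head j with f x ≡ᵇ j
  ... | true = refl
  ... | false = refl
  off : ∀ n → n < f x → sumTo n δ ≡ 0
  off zero lt with f x ≡ᵇ 0 | proof (f x ≟ 0)
  ... | true | ofʸ e = ⊥-elim (<⇒≢ lt (sym e))
  ... | false | _ = refl
  off (suc n) lt with off n (<⇒≤ lt) | f x ≡ᵇ suc n | proof (f x ≟ suc n)
  ... | _ | true | ofʸ e = ⊥-elim (<⇒≢ lt (sym e))
  ... | e | false | _ = trans (+-identityʳ _) e
  one : ∀ n → f x ≤ n → sumTo n δ ≡ 1
  one zero le with f x ≡ᵇ 0 | proof (f x ≟ 0)
  ... | true | _ = refl
  ... | false | ofⁿ ne = ⊥-elim (ne (n≤0⇒n≡0 le))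
  one (suc n) le with f x ≡ᵇ suc n | proof (f x ≟ suc n)
  ... | true | ofʸ e = cong (_+ 1) (off n (≤-reflexive (sym e)))
  ... | false | ofⁿ ne = trans (+-identityʳ _) (one n (s≤s⁻¹ (≤∧≢⇒< le ne)))

-- Positions of the k-abacus: multiples of k and pairs of opposite runners

module Positions (k : ℕ) .{{_ : NonZero k}} where

  1≤k : 1 ≤ k
  1≤k = >-nonZero⁻¹ k

  mod-runner : ∀ {r} n → r < k → (r + n * k) % k ≡ r
  mod-runner {r} n r<k = trans ([m+kn]%n≡m%n r n k) (m<n⇒m%n≡m r<k)

  div-runner : ∀ {r} n → r < k → (r + n * k) / k ≡ n
  div-runner {r} n r<k = trans (+-distrib-/-∣ʳ r (n∣m*n n {k})) (cong₂ _+_ (m<n⇒m/n≡0 r<k) (m*n/n≡m n k))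

  posA posB : ℕ → ℕ → ℕ
  posA j n = j + n * k
  posB j e = (k ∸ j) + e * k

  -- The runner k/2 is its own opposite and is listed on the side A only, which explains the strict
  -- inequality on the side B.
  data Position (x : ℕ) : Set where
    multiple : ∀ n → x ≡ n * k → Position x
    onA : ∀ j n → 1 ≤ j → j + j ≤ k → x ≡ posA j n → Position x
    onB : ∀ j e → 1 ≤ j → j + j < k → x ≡ posB j e → Position x

  position : ∀ x → Position x
  position x with x % k in eq | m≡m%n+[m/n]*n x k | m%n<n x k
  ... | zero | e | _ = multiple (x / k) e
  ... | suc r | e | r< with suc r + suc r ≤? k
  ...   | yes h = onA (suc r) (x / k) (s≤s z≤n) h e
  ...   | no h = onB (k ∸ suc r) (x / k) (m<n⇒0<n∸m r<)
      (lia (r ∷ k ∷ (k ∸ suc r) ∷ []) (λ r k d → k :< con 1 :+ r :+ (con 1 :+ r) :⇒ d :+ (con 1 :+ r) := k :⇒ ⊢ d :+ d :< k) (≰⇒> h) (m∸n+n≡m (<⇒≤ r<)))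
      (trans e (cong (_+ x / k * k) (sym (m∸[m∸n]≡n (<⇒≤ r<)))))

  half≤ : ∀ {j} → j ≤ k / 2 → j + j ≤ k
  half≤ {j} h = ≤-trans (≤-reflexive (trans (cong (j +_) (sym (+-identityʳ j))) (*-comm 2 j))) (≤-trans (*-monoˡ-≤ 2 h) (m/n*n≤m k 2))

  ≤half : ∀ {j} → j + j ≤ k → j ≤ k / 2
  ≤half {j} h = ≤-trans (≤-reflexive (sym (m*n/n≡m j 2))) (/-monoˡ-≤ 2 (≤-trans (≤-reflexive (trans (*-comm j 2) (cong (j +_) (+-identityʳ j)))) h))

  j<k : ∀ {j} → 1 ≤ j → j + j ≤ k → j < k
  j<k {j} 1≤j h = ≤-trans (+-monoˡ-≤ j 1≤j) h

  k∸j<k : ∀ {j} → 1 ≤ j → j ≤ k → k ∸ j < k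
  k∸j<k {j} 1≤j j≤k = lia (j ∷ k ∷ (k ∸ j) ∷ []) (λ j k d → d :+ j := k :⇒ con 1 :≤ j :⇒ ⊢ d :< k) (m∸n+n≡m j≤k) 1≤j

  module _ {j} (1≤j : 1 ≤ j) (2j≤k : j + j ≤ k) where

    posA-mod : ∀ n → posA j n % k ≡ j
    posA-mod n = mod-runner n (j<k 1≤j 2j≤k)

    posA-div : ∀ n → posA j n / k ≡ n
    posA-div n = div-runner n (j<k 1≤j 2j≤k)

    posB-mod : ∀ e → posB j e % k ≡ k ∸ j
    posB-mod e = mod-runner e (k∸j<k 1≤j (<⇒≤ (j<k 1≤j 2j≤k)))

    posB-div : ∀ e → posB j e / k ≡ e
    posB-div e = div-runner e (k∸j<k 1≤j (<⇒≤ (j<k 1≤j 2j≤k)))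

  posA-+k : ∀ j n → posA j n + k ≡ posA j (suc n)
  posA-+k j n = lia (j ∷ k ∷ n * k ∷ []) (λ j k x → ⊢ j :+ x :+ k := j :+ (k :+ x))

  posB-+k : ∀ j e → posB j e + k ≡ posB j (suc e)
  posB-+k j e = lia ((k ∸ j) ∷ k ∷ e * k ∷ []) (λ j k x → ⊢ j :+ x :+ k := j :+ (k :+ x))

<ᵇ-∸ : ∀ n a b → (n <ᵇ a ∸ b) ≡ (n + b <ᵇ a)
<ᵇ-∸ n a b with n <ᵇ a ∸ b | proof (n <? a ∸ b) | n + b <ᵇ a | proof (n + b <? a)
... | true | _ | true | _ = refl
... | false | _ | false | _ = refl
... | false | ofⁿ h | true | ofʸ g = ⊥-elim (h (m+n≤o⇒m≤o∸n (suc n) g))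
... | true | ofʸ g | false | ofⁿ h = ⊥-elim (h (≤-trans (+-monoˡ-≤ b g) (≤-reflexive (m∸n+n≡m {a} {b} (<⇒≤ (≰⇒> λ z → <⇒≱ g (≤-trans (≤-reflexive (m≤n⇒m∸n≡0 z)) z≤n)))))))

-- Conservation of beads

keyCount : ℕ → List Entry → ℕ
keyCount p [] = 0
keyCount p ((l , q) ∷ ws) = (if q ≡ᵇ p then 1 else 0) + keyCount p ws

keyCount-0 : ∀ {p} ws → (∀ {l} → (l , p) ∉ ws) → keyCount p ws ≡ 0
keyCount-0 [] _ = refl
keyCount-0 {p} ((l , q) ∷ ws) n with q ≡ᵇ p | proof (q ≟ p)
... | true | ofʸ refl = ⊥-elim (n (here refl))
... | false | _ = keyCount-0 ws (λ h → n (there h))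

run-balance : ∀ {I O b b″ ws} → I ≢ O → Run I O b ws b″ → bit b + keyCount I ws ≡ bit b″ + keyCount O ws
run-balance ne [] = refl
run-balance {I} {O} ne (_∷_ {p = p} v r) with p ≡ᵇ I | proof (p ≟ I) | p ≡ᵇ O | proof (p ≟ O) | run-balance ne r
run-balance ne (fill h ∷ r) | false | ofⁿ n | _ | _ | _ = ⊥-elim (n h)
run-balance ne (fill h ∷ r) | true | _ | true | ofʸ e | _ = ⊥-elim (ne (trans (sym h) e))
run-balance ne (fill h ∷ r) | true | _ | false | _ | ih = ih
run-balance ne (vacate n h ∷ r) | true | ofʸ e | _ | _ | _ = ⊥-elim (n e)
run-balance ne (vacate n h ∷ r) | false | _ | false | ofⁿ n′ | _ = ⊥-elim (n′ h)
run-balance ne (vacate n h ∷ r) | false | _ | true | _ | ih = trans (cong suc ih) (sym (+-suc _ _))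
run-balance ne (idle n n′ ∷ r) | true | ofʸ e | _ | _ | _ = ⊥-elim (n e)
run-balance ne (idle n n′ ∷ r) | false | _ | true | ofʸ e | _ = ⊥-elim (n′ e)
run-balance ne (idle n n′ ∷ r) | false | _ | false | _ | ih = ih

tot : (ℕ → Bool) → ℕ → ℕ → ℕ
tot r zero y = 0
tot r (suc n) y = bit (r y) + tot r n (suc y)

-- Here r and t are the bits before and after, `N y` counts the passages through the lower edge of
-- y, and `E y` the final beads from y on. The balances of single positions are added up, arranged
-- without subtraction.
tot-balance : ∀ (r t : ℕ → Bool) (E N : ℕ → ℕ) → (∀ y → 1 ≤ y → E y ≡ bit (t y) + E (suc y)) →
  (∀ y → 1 ≤ y → bit (r y) + N y ≡ bit (t y) + N (suc y)) → ∀ n y → 1 ≤ y → tot r n y + N y + E (y + n) ≡ E y + N (y + n)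
tot-balance r t E N hE hN zero y 1≤y rewrite +-identityʳ y = +-comm (N y) (E y)
tot-balance r t E N hE hN (suc n) y 1≤y rewrite +-suc y n =
  lia (bit (r y) ∷ bit (t y) ∷ tot r n (suc y) ∷ N y ∷ N (suc y) ∷ E y ∷ E (suc y) ∷ E (suc (y + n)) ∷ N (suc (y + n)) ∷ [])
    (λ br bt T N₀ N₁ E₀ E₁ E₂ N₂ → E₀ := bt :+ E₁ :⇒ br :+ N₀ := bt :+ N₁ :⇒ T :+ N₁ :+ E₂ := E₁ :+ N₂ :⇒ ⊢ br :+ T :+ N₀ :+ E₂ := E₀ :+ N₂)
    (hE y 1≤y) (hN y 1≤y) (tot-balance r t E N hE hN n (suc y) (s≤s z≤n))

module _ (r : ℕ → Bool) (down : ∀ y → 1 ≤ y → r (suc y) ≡ true → r y ≡ true) where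

  down-n : ∀ i y → 1 ≤ y → r (y + i) ≡ true → r y ≡ true
  down-n zero y _ e = subst (λ z → r z ≡ true) (+-identityʳ y) e
  down-n (suc i) y 1≤y e = down y 1≤y (down-n i (suc y) (s≤s z≤n) (subst (λ z → r z ≡ true) (+-suc y i) e))

  -- By `down` the beads are packed at the lower end, so that their total decides which positions
  -- are occupied; `tot-false` is the other half of this.
  tot-true : ∀ n y i → 1 ≤ y → i < n → r (y + i) ≡ true → suc i ≤ tot r n y
  tot-true (suc n) y i 1≤y i< e rewrite down-n i y 1≤y e = s≤s (go i i< e)
    where
    go : ∀ i → i < suc n → r (y + i) ≡ true → i ≤ tot r n (suc y)
    go zero _ _ = z≤n
    go (suc i) (s≤s i<) e = tot-true n (suc y) i (s≤s z≤n) i< (subst (λ z → r z ≡ true) (+-suc y i) e)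

  tot-none : ∀ n y → 1 ≤ y → r y ≡ false → tot r n y ≡ 0
  tot-none zero y _ _ = refl
  tot-none (suc n) y 1≤y e rewrite e = tot-none n (suc y) (s≤s z≤n) (go refl)
    where
    go : ∀ {b} → r (suc y) ≡ b → b ≡ false
    go {false} _ = refl
    go {true} h = trans (sym (down y 1≤y h)) e

  tot-false : ∀ n y i → 1 ≤ y → r (y + i) ≡ false → tot r n y ≤ i
  tot-false zero y i _ _ = z≤n
  tot-false (suc n) y zero 1≤y e = ≤-reflexive (tot-none (suc n) y 1≤y (subst (λ z → r z ≡ false) (+-identityʳ y) e))
  tot-false (suc n) y (suc i) 1≤y e = ≤-trans (+-mono-≤ (bit≤1 (r y)) (tot-false n (suc y) i (s≤s z≤n) (subst (λ z → r z ≡ false) (+-suc y i) e))) ≤-refl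

In-cases : ∀ {k x p} → In k x ≡ p → x ≡ p ⊎ (x + x ≤ k × k ∸ x ≡ p)
In-cases {k} {x} e with k <ᵇ x + x | proof (k <? x + x)
... | true | _ = inj₁ e
... | false | ofⁿ n = inj₂ (≮⇒≥ n , e)

-- Enumerating the sorted words over a finite alphabet

sublists : ∀ {A : Set} → List A → List (List A)
sublists [] = [] ∷ []
sublists (x ∷ xs) = map (x ∷_) (sublists xs) ++ sublists xs

∈-sublists⁻ : ∀ {A : Set} {xs ys : List A} → ys ∈ sublists xs → ∀ {z} → z ∈ ys → z ∈ xs
∈-sublists⁻ {xs = []} (here refl) z∈ = z∈
∈-sublists⁻ {xs = x ∷ xs} ys∈ z∈ with ∈-++⁻ (map (x ∷_) (sublists xs)) ys∈
... | inj₂ h = there (∈-sublists⁻ h z∈)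
... | inj₁ h with ∈-map⁻ (x ∷_) h
∈-sublists⁻ {xs = x ∷ xs} ys∈ (here refl) | inj₁ h | zs , zs∈ , refl = here refl
∈-sublists⁻ {xs = x ∷ xs} ys∈ (there z∈) | inj₁ h | zs , zs∈ , refl = there (∈-sublists⁻ zs∈ z∈)

[]∈sublists : ∀ {A : Set} (xs : List A) → [] ∈ sublists xs
[]∈sublists [] = here refl
[]∈sublists (x ∷ xs) = ∈-++⁺ʳ (map (x ∷_) (sublists xs)) ([]∈sublists xs)

∈-sublists⁺ : ∀ {xs ys} → Sorted xs → Sorted ys → (∀ {z} → z ∈ ys → z ∈ xs) → ys ∈ sublists xs
∈-sublists⁺ {xs} {[]} _ _ _ = []∈sublists xs
∈-sublists⁺ {[]} {y ∷ ys} _ _ h with h (here refl)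
... | ()
∈-sublists⁺ {x ∷ xs} {y ∷ ys} (rx ∷ sx) (ry ∷ sy) h with h (here refl)
... | here refl = ∈-++⁺ˡ (∈-map⁺ (x ∷_) (∈-sublists⁺ sx sy (λ z∈ → tail (h (there z∈)) (All.lookup ry z∈))))
  where
  tail : ∀ {z} → z ∈ x ∷ xs → x ≺ z → z ∈ xs
  tail (here refl) r = ⊥-elim (≺-irrefl r)
  tail (there q) _ = q
... | there y∈ = ∈-++⁺ʳ (map (x ∷_) (sublists xs)) (∈-sublists⁺ sx (ry ∷ sy) inside)
  where
  inside : ∀ {z} → z ∈ y ∷ ys → z ∈ xs
  inside (here refl) = y∈
  inside (there z∈) with h (there z∈)
  ... | there q = q
  ... | here refl = ⊥-elim (≺-asym (All.lookup rx y∈) (All.lookup ry z∈))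

sublists-unique : ∀ {A : Set} {xs : List A} → Unique xs → Unique (sublists xs)
sublists-unique [] = [] ∷ []
sublists-unique {xs = x ∷ xs} (x∉ ∷ u) = AP.++⁺ (unique-map (x ∷_) (λ { _ _ refl → refl }) (sublists-unique u)) (sublists-unique u)
  (All.tabulate λ a∈ → All.tabulate λ b∈ e → distinct a∈ b∈ e)
  where
  distinct : ∀ {a b} → a ∈ map (x ∷_) (sublists xs) → b ∈ sublists xs → a ≢ b
  distinct a∈ b∈ refl with ∈-map⁻ (x ∷_) a∈
  ... | zs , _ , refl = All.lookup x∉ (∈-sublists⁻ b∈ (here refl)) refl

toward? : ∀ b p q → Dec (Toward b p q)
toward? true p q = q <? p
toward? false p q = p <? q

_≺?_ : ∀ e f → Dec (e ≺ f)
(l , p) ≺? (l′ , p′) = (code l <? code l′) ⊎-dec ((l ≟ᴸ l′) ×-dec toward? (marked l) p p′)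

-- The decision may use that x belongs to xs. For words this bounds the letters and keys, and
-- reduces a condition on infinitely many positions to finitely many.
enumerate : ∀ {A : Set} {P : A → Set} (xs : List A) → Unique xs → (∀ x → x ∈ xs → Dec (P x)) → (∀ x → P x → x ∈ xs) →
  ∃ λ c → Enumerates P c
enumerate {A} {P} xs u P? all = length (pick′ xs P?) , record
  { elems = pick′ xs P? ; unique = unique′ xs u P? ; sound = λ x → sound′ xs P? ; complete = λ x p → complete′ xs P? (all x p) p ; size = refl }
  where
  pick′ : ∀ xs → (∀ x → x ∈ xs → Dec (P x)) → List A
  pick′ [] P? = []
  pick′ (x ∷ xs) P? with P? x (here refl)
  ... | yes _ = x ∷ pick′ xs (λ z h → P? z (there h))
  ... | no _ = pick′ xs (λ z h → P? z (there h))
  sub : ∀ xs P? {z} → z ∈ pick′ xs P? → z ∈ xs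
  sub (x ∷ xs) P? h with P? x (here refl)
  sub (x ∷ xs) P? (here refl) | yes _ = here refl
  sub (x ∷ xs) P? (there h) | yes _ = there (sub xs _ h)
  sub (x ∷ xs) P? h | no _ = there (sub xs _ h)
  unique′ : ∀ xs → Unique xs → ∀ P? → Unique (pick′ xs P?)
  unique′ [] [] P? = []
  unique′ (x ∷ xs) (x∉ ∷ u) P? with P? x (here refl)
  ... | yes _ = All.tabulate (λ z∈ → All.lookup x∉ (sub xs _ z∈)) ∷ unique′ xs u _
  ... | no _ = unique′ xs u _
  sound′ : ∀ xs P? {z} → z ∈ pick′ xs P? → P z
  sound′ (x ∷ xs) P? h with P? x (here refl)
  sound′ (x ∷ xs) P? (here refl) | yes p = p
  sound′ (x ∷ xs) P? (there h) | yes _ = sound′ xs _ h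
  sound′ (x ∷ xs) P? h | no _ = sound′ xs _ h
  complete′ : ∀ xs P? {z} → z ∈ xs → P z → z ∈ pick′ xs P?
  complete′ (x ∷ xs) P? (here refl) p with P? x (here refl)
  ... | yes _ = here refl
  ... | no n = ⊥-elim (n p)
  complete′ (x ∷ xs) P? (there h) p with P? x (here refl)
  ... | yes _ = there (complete′ xs _ h p)
  ... | no _ = complete′ xs _ h p

wAt-beyond : ∀ w i → length w < i → wAt w i ≡ 0
wAt-beyond w (suc i) (s≤s h) = go w i h
  where
  go : ∀ w i → length w ≤ i → wAt w (suc i) ≡ 0
  go [] i _ = refl
  go (x ∷ w) (suc i) (s≤s h) = go w i h

count-pos : ∀ {ws l p} → (l , p) ∈ ws → 1 ≤ count (idx l) ws
count-pos {ws = (l , p) ∷ ws} (here refl) with idx l ≡ᵇ idx l | proof (idx l ≟ idx l)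
... | true | _ = s≤s z≤n
... | false | ofⁿ n = ⊥-elim (n refl)
count-pos {ws = (l′ , p′) ∷ ws} {l} (there h) with idx l′ ≡ᵇ idx l
... | true = s≤s z≤n
... | false = count-pos h

-- A letter that occurs has a positive exponent, and the exponents beyond the length of w vanish.
weight⇒letters : ∀ w {ws} → All (λ e → 1 ≤ idx (proj₁ e)) ws → (∀ i → count i ws ≡ wAt w i) → Letters≤ (length w) ws
weight⇒letters w ls wt = All.tabulate λ {e} e∈ → All.lookup ls e∈ ,
  ≮⇒≥ λ lt → <⇒≱ (count-pos e∈) (≤-reflexive (trans (wt (idx (proj₁ e))) (wAt-beyond w (idx (proj₁ e)) lt)))

at : List Filling → ℕ → Filling
at fs j = fromMaybe [] (nth fs j)

at-extensional : ∀ fs gs → length fs ≡ length gs → (∀ j → j < length fs → at fs j ≡ at gs j) → fs ≡ gs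
at-extensional fs gs e h = nth-extensional fs gs e λ j lt → go (nth-defined fs j lt) (nth-defined gs j (≤-trans lt (≤-reflexive e))) (h j lt)
  where
  go : ∀ {a b : Maybe Filling} → (∃ λ x → a ≡ just x) → (∃ λ y → b ≡ just y) → fromMaybe [] a ≡ fromMaybe [] b → a ≡ b
  go (x , refl) (y , refl) refl = refl

at-applyUpTo : ∀ (f : ℕ → Filling) n j → j < n → at (applyUpTo f n) j ≡ f j
at-applyUpTo f n j lt = cong (fromMaybe []) (nth-applyUpTo f n j lt)

sumTo-front : ∀ n (f : ℕ → ℕ) → sumTo (suc n) f ≡ f 0 + sumTo n (f ∘ suc)
sumTo-front zero f = refl
sumTo-front (suc n) f = trans (cong (_+ f (suc (suc n))) (sumTo-front n f)) (+-assoc (f 0) _ _)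

countFs-sum : ∀ i n fs → length fs ≡ suc n → countFs i fs ≡ sumTo n (λ j → countF i (at fs j))
countFs-sum i zero (f ∷ []) _ = +-identityʳ _
countFs-sum i (suc n) (f ∷ fs) e = trans (cong (countF i f +_) (countFs-sum i n fs (suc-injective e))) (sym (sumTo-front n (λ j → countF i (at (f ∷ fs) j))))

qtabs⇒ : ∀ μ i fs → QTabs μ i fs → ∀ n → n < length fs → QTab (μ (i + n)) (at fs n)
qtabs⇒ μ i (f ∷ fs) (q , qs) zero _ = subst (λ z → QTab (μ z) f) (sym (+-identityʳ i)) q
qtabs⇒ μ i (f ∷ fs) (q , qs) (suc n) (s≤s h) = subst (λ z → QTab (μ z) (at fs n)) (sym (+-suc i n)) (qtabs⇒ μ (suc i) fs qs n h)

⇒qtabs : ∀ μ i fs → (∀ n → n < length fs → QTab (μ (i + n)) (at fs n)) → QTabs μ i fs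
⇒qtabs μ i [] h = tt
⇒qtabs μ i (f ∷ fs) h = subst (λ z → QTab (μ z) f) (+-identityʳ i) (h 0 (s≤s z≤n)) ,
  ⇒qtabs μ (suc i) fs λ n lt → subst (λ z → QTab (μ z) (at fs n)) (+-suc i n) (h (suc n) (s≤s lt))

-- The data of the theorem, and the runners of its abacus

record Setting : Set where
  field
    k : ℕ
    k≢0 : NonZero k
    la : List ℕ
    sla : StrictPartition la
    μ : ℕ → List ℕ
    hμ : ∀ i → 1 ≤ i → 2 * i < k → UnderlyingShape (abacus k {{k≢0}} la i) (abacus k {{k≢0}} la (k ∸ i)) (μ i)
    hμ′ : ∀ i → 1 ≤ i → 2 * i ≡ k → UnderlyingShape (abacus k {{k≢0}} la i) [] (μ i)
    w : List ℕ

module OfSetting (S : Setting) where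

  open Setting S

  instance
    k-nonZero : NonZero k
    k-nonZero = k≢0

  m : ℕ
  m = length w

  open Positions k public

  K : ℕ
  K = top la

  α β : ℕ → List ℕ
  α j = abacus k la j
  β j = if j + j <ᵇ k then α (k ∸ j) else []

  -- Beads on the runners r and k - r cancel in pairs with sum k, so the core keeps the excess of
  -- the larger runner. On r = k/2 nothing cancels, as two equal beads are not allowed, and the
  -- number to be subtracted is 0.
  opposite : ℕ → ℕ
  opposite r = if r + r ≡ᵇ k then 0 else length (α (k ∸ r))

  -- the k-core of la
  c : ℕ → Bool
  c x = if x % k ≡ᵇ 0 then false else (x / k <ᵇ length (α (x % k)) ∸ opposite (x % k))

  o : ℕ → ℕ
  o j = length (μ j) + length (α j) + K + 2

  -- The runner number 0 consists of the multiples of k. For j > 0 the formulas of `Folded` are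
  -- repeated, so that both agree by computation, while no condition on j is needed to state them.
  s t : ℕ → ℕ → Bool
  s zero y = false
  s j@(suc _) y = y ≤ᵇ length (μ j) + (K + 1 + length (β j))
  t zero y = occ (abacus k la k) y
  t j@(suc _) y = if o j ≤ᵇ y then occ (β j) (suc (y ∸ o j)) else not (occ (α j) (o j ∸ y))

  Tab : ℕ → Filling → Set
  Tab zero f = ShTab (abacus k la k) [] f
  Tab j@(suc _) f = QTab (μ j) f

  cA cB : ℕ → ℕ → Bool
  cA j n = c (posA j n)
  cB j e = if j + j <ᵇ k then c (posB j e) else false

  -- An edge is named by the position that its key fills; the joint edge, with key k - j, is counted
  -- on both sides. On the runner k/2 this key would be k/2, which is not allowed, so the path ends
  -- there.
  uA uB : Entries → ℕ → Entries
  uB G j i e = if j + j <ᵇ k then G i (posB j e) else nothing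
  uA G j i zero = uB G j i zero
  uA G j i (suc n) = G i (posA j (suc n))

  uB-pair : ∀ H j i e → j + j < k → uB H j i e ≡ H i (posB j e)
  uB-pair H j i e lt with j + j <ᵇ k | proof (j + j <? k)
  ... | true | _ = refl
  ... | false | ofⁿ n = ⊥-elim (n lt)

  uB-alone : ∀ H j i e → ¬ j + j < k → uB H j i e ≡ nothing
  uB-alone H j i e n with j + j <ᵇ k | proof (j + j <? k)
  ... | false | _ = refl
  ... | true | ofʸ lt = ⊥-elim (n lt)

  uB-cong : ∀ H H′ j {i} → (∀ p → H i p ≡ H′ i p) → ∀ e → uB H j i e ≡ uB H′ j i e
  uB-cong H H′ j eq e with j + j <ᵇ k
  ... | true = eq (posB j e)
  ... | false = refl

  -- the entries on the runner number j of the unfolded abacus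
  view : Entries → ℕ → Entries
  view G zero i y = G i (y * k)
  view G j@(suc _) = Fold.unfold (o j) (cA j) (s j) (uA G j) (uB G j)

  Admissible : Entries → Set
  Admissible G = (∀ i p → ¬ k < p + p → G i p ≡ nothing) ×
    (∀ x → 1 ≤ x → History (λ i → G i (In k x)) (λ i → G i (x + k)) m (c x) (occ la x))

  runner≤K : ∀ {i x} → 1 ≤ i → i ≤ k → x ∈ abacus k la i → x ≤ K
  runner≤K {i} 1≤i i≤k x∈ with Abacus.abacus-∈⁻ k sla 1≤i i≤k x∈
  ... | n , refl , h = ≤-trans (≤-trans (+-mono-≤ 1≤i (≤-trans (≤-reflexive (sym (*-identityʳ n))) (*-monoʳ-≤ n 1≤k))) ≤-refl) (∈⇒≤top (strict⇒decreasing sla) h)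

  top-runner : ∀ {i} → 1 ≤ i → i ≤ k → top (abacus k la i) ≤ K
  top-runner {i} 1≤i i≤k with abacus k la i in eq
  ... | [] = z≤n
  ... | x ∷ xs = runner≤K 1≤i i≤k (subst (x ∈_) (sym eq) (here refl))

  occ-0-runner : ∀ n → occ (abacus k la k) (suc n) ≡ occ la (suc n * k)
  occ-0-runner n = Abacus.occ-abacus k sla 1≤k ≤-refl n

  c-multiple : ∀ n → c (n * k) ≡ false
  c-multiple n = cong (λ r → if r ≡ᵇ 0 then false else (n * k / k <ᵇ length (α r) ∸ opposite r)) (m*n%n≡0 n k)

  module Runners (j₀ : ℕ) (2j≤k : suc j₀ + suc j₀ ≤ k) where

    j : ℕ
    j = suc j₀

    1≤j : 1 ≤ j
    1≤j = s≤s z≤n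

    j≤k : j ≤ k
    j≤k = <⇒≤ (j<k 1≤j 2j≤k)

    isA : StrictPartition (α j)
    isA = Abacus.abacus-strict k sla 1≤j j≤k

    occA : ∀ n → occ (α j) (suc n) ≡ occ la (posA j n)
    occA = Abacus.occ-abacus k sla 1≤j j≤k

    1≤k∸j : 1 ≤ k ∸ j
    1≤k∸j = m<n⇒0<n∸m (j<k 1≤j 2j≤k)

    -- It ties the value of `β j` to the test on j, so that one match settles both.
    data Kind : Bool → List ℕ → Set where
      pair  : j + j < k → Kind true (α (k ∸ j))
      alone : j + j ≡ k → Kind false []

    kind : Kind (j + j <ᵇ k) (β j)
    kind with j + j <ᵇ k | proof (j + j <? k)
    ... | true | ofʸ h = pair h
    ... | false | ofⁿ h = alone (≤-antisym 2j≤k (≮⇒≥ h))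

    isB : StrictPartition (β j)
    isB with j + j <ᵇ k | β j | kind
    ... | _ | _ | pair _ = Abacus.abacus-strict k sla 1≤k∸j (m∸n≤m k j)
    ... | _ | _ | alone _ = [] , []

    us : UnderlyingShape (α j) (β j) (μ j)
    us with j + j <ᵇ k | β j | kind
    ... | _ | _ | pair h = hμ j 1≤j (subst (λ z → j + z < k) (sym (+-identityʳ j)) h)
    ... | _ | _ | alone h = hμ′ j 1≤j (trans (cong (j +_) (+-identityʳ j)) h)

    a b : ℕ
    a = length (α j)
    b = length (β j)

    opposite-b : opposite j ≡ b
    opposite-b with j + j <ᵇ k | β j | kind | j + j ≡ᵇ k | proof (j + j ≟ k)
    ... | _ | _ | pair h | true | ofʸ e = ⊥-elim (<⇒≢ h e)
    ... | _ | _ | pair h | false | _ = refl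
    ... | _ | _ | alone h | true | _ = refl
    ... | _ | _ | alone h | false | ofⁿ n = ⊥-elim (n h)

    c-A : ∀ n → cA j n ≡ (n + b <ᵇ a)
    c-A n rewrite posA-mod 1≤j 2j≤k n | posA-div 1≤j 2j≤k n | opposite-b with j ≡ᵇ 0 | proof (j ≟ 0)
    ... | true | ofʸ e = ⊥-elim (<⇒≢ 1≤j (sym e))
    ... | false | _ = <ᵇ-∸ n a b

    c-B : ∀ e → cB j e ≡ (e + a <ᵇ b)
    c-B e with j + j <ᵇ k | β j | kind
    ... | _ | _ | alone _ = refl
    ... | _ | _ | pair h rewrite posB-mod 1≤j 2j≤k e | posB-div 1≤j 2j≤k e with k ∸ j ≡ᵇ 0 | proof (k ∸ j ≟ 0) | (k ∸ j) + (k ∸ j) ≡ᵇ k | proof ((k ∸ j) + (k ∸ j) ≟ k)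
    ...   | true | ofʸ z | _ | _ = ⊥-elim (<⇒≢ 1≤k∸j (sym z))
    ...   | false | _ | true | ofʸ z = ⊥-elim (lia (j ∷ k ∷ (k ∸ j) ∷ []) (λ j k d → j :+ j :< k :⇒ d :+ d := k :⇒ d :+ j := k :⇒ ⊢ :⊥) h z (m∸n+n≡m j≤k))
    ...   | false | _ | false | _ = trans (<ᵇ-∸ e (length (α (k ∸ j))) (length (α (k ∸ (k ∸ j))))) (cong (λ z → e + length (α z) <ᵇ length (α (k ∸ j))) (m∸[m∸n]≡n j≤k))

    module F = Folded isA isB us K (top-runner 1≤j j≤k)

    s-right : ∀ e → s j (o j + e) ≡ cB j e
    s-right e = trans (go (proof (o j + e ≤? length (μ j) + F.N)) (proof (e + a <? b))) (sym (c-B e))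
      where
      go : ∀ {x y} → Reflects (o j + e ≤ length (μ j) + F.N) x → Reflects (e + a < b) y → x ≡ y
      go (ofʸ h) (ofʸ g) = refl
      go (ofⁿ h) (ofⁿ g) = refl
      go (ofʸ h) (ofⁿ g) = ⊥-elim (g (lia (length (μ j) ∷ a ∷ b ∷ K ∷ e ∷ []) (λ l a b K e → l :+ a :+ K :+ con 2 :+ e :≤ l :+ (K :+ con 1 :+ b) :⇒ ⊢ e :+ a :< b) h))
      go (ofⁿ h) (ofʸ g) = ⊥-elim (h (lia (length (μ j) ∷ a ∷ b ∷ K ∷ e ∷ []) (λ l a b K e → e :+ a :< b :⇒ ⊢ l :+ a :+ K :+ con 2 :+ e :≤ l :+ (K :+ con 1 :+ b)) g))

    s-left : ∀ y n → y + suc n ≡ o j → s j y ≡ not (cA j n)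
    s-left y n eq = trans (go (proof (y ≤? length (μ j) + F.N)) (proof (n + b <? a))) (cong not (sym (c-A n)))
      where
      go : ∀ {x z} → Reflects (y ≤ length (μ j) + F.N) x → Reflects (n + b < a) z → x ≡ not z
      go (ofʸ h) (ofⁿ g) = refl
      go (ofⁿ h) (ofʸ g) = refl
      go (ofʸ h) (ofʸ g) = ⊥-elim (lia (length (μ j) ∷ a ∷ b ∷ K ∷ y ∷ n ∷ []) (λ l a b K y n → y :≤ l :+ (K :+ con 1 :+ b) :⇒ n :+ b :< a :⇒ y :+ (con 1 :+ n) := l :+ a :+ K :+ con 2 :⇒ ⊢ :⊥) h g eq)
      go (ofⁿ h) (ofⁿ g) = ⊥-elim (lia (length (μ j) ∷ a ∷ b ∷ K ∷ y ∷ n ∷ []) (λ l a b K y n → l :+ (K :+ con 1 :+ b) :< y :⇒ a :≤ n :+ b :⇒ y :+ (con 1 :+ n) := l :+ a :+ K :+ con 2 :⇒ ⊢ :⊥) (≰⇒> h) (≮⇒≥ g) eq)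

    module U = Unfold m (o j) (cA j) (λ n → occ (α j) (suc n)) (cB j) (λ e → occ (β j) (suc e)) (s j) (t j) s-right F.t-right s-left F.t-left

    encoding : Encoding (Tab j) (s j) (t j)
    encoding = F.folded-encoding

    -- All keys exceed N. In particular the key 1 does not occur; it would concern the position 0 of
    -- the path, about which the word says nothing.
    word-key : ∀ {ws l y} → Word₁ (s j) (t j) ws → (l , y) ∈ ws → 2 ≤ y
    word-key {y = y} w h = ≮⇒≥ λ lt → <⇒≢ (F.folded-moving w h) (F.low y 1≤y (≤-trans (s≤s⁻¹ lt) (≤-trans (m≤n+m 1 K) (m≤m+n (K + 1) b))))
      where
      1≤y : 1 ≤ y
      1≤y = All.lookup (proj₁ (proj₂ (proj₂ w))) h

    -- On the runner k/2 there is no β, hence no final bead from o on, and a key moves a bead only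
    -- where one ends up at or beyond it. This excludes the joint edge as well.
    word-alone : ∀ {ws l y} → j + j ≡ k → Word₁ (s j) (t j) ws → (l , y) ∈ ws → y < o j
    word-alone {y = y} e w h = ≰⇒> λ o≤y → <⇒≱ (≤-trans (s≤s z≤n) (F.folded-moving w h))
      (≤-trans (≤-reflexive (trans (cong F.ht (sym (m+[n∸m]≡n o≤y))) (F.ht-right (y ∸ o j)))) (≤-reflexive (empty (suc (y ∸ o j)))))
      where
      empty : ∀ d → cnt (β j) d ≡ 0
      empty d with j + j <ᵇ k | β j | kind
      ... | _ | _ | pair lt = ⊥-elim (<⇒≢ lt e)
      ... | _ | _ | alone _ = refl

    far : ∀ n → o j ≤ suc n → cA j n ≡ occ (α j) (suc n)
    far n h = trans (c-A n) (trans (go (proof (n + b <? a))) (sym (occ-top (strict⇒decreasing isA)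
        (≤-trans (s≤s (top-runner 1≤j j≤k)) (lia (length (μ j) ∷ a ∷ K ∷ n ∷ []) (λ l a K n → l :+ a :+ K :+ con 2 :≤ con 1 :+ n :⇒ ⊢ con 1 :+ K :≤ con 1 :+ n) h)))))
      where
      go : ∀ {x} → Reflects (n + b < a) x → x ≡ false
      go (ofⁿ _) = refl
      go (ofʸ g) = ⊥-elim (lia (length (μ j) ∷ a ∷ b ∷ K ∷ n ∷ []) (λ l a b K n → l :+ a :+ K :+ con 2 :≤ con 1 :+ n :⇒ n :+ b :< a :⇒ ⊢ :⊥) h g)

    In-A0 : In k (posA j 0) ≡ k ∸ j
    In-A0 = trans (cong (In k) (+-identityʳ j)) (In-small {k} {j} 2j≤k)

    In-A : ∀ n → In k (posA j (suc n)) ≡ posA j (suc n)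
    In-A n = In-big (lia (j₀ ∷ k ∷ n * k ∷ []) (λ j k x → ⊢ k :< con 1 :+ j :+ (k :+ x) :+ (con 1 :+ j :+ (k :+ x))))

    In-B : j + j < k → ∀ e → In k (posB j e) ≡ posB j e
    In-B h e = In-big (lia (j ∷ k ∷ (k ∸ j) ∷ e * k ∷ []) (λ j k d x → j :+ j :< k :⇒ d :+ j := k :⇒ ⊢ k :< d :+ x :+ (d :+ x)) h (m∸n+n≡m j≤k))

    HistoryA HistoryB : Entries → Set
    HistoryA G = ∀ n → History (λ i → uA G j i n) (λ i → uA G j i (suc n)) m (cA j n) (occ (α j) (suc n))
    HistoryB G = ∀ e → History (λ i → uB G j i e) (λ i → uB G j i (suc e)) m (cB j e) (occ (β j) (suc e))

    -- For a pair, both sides are the entry of the key k - j. On the runner k/2 that key is k/2 and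
    -- has no entry, by the bound on keys.
    joint : ∀ G → (∀ i p → ¬ k < p + p → G i p ≡ nothing) → ∀ i → G i (In k (posA j 0)) ≡ uA G j i 0
    joint G out i with j + j <ᵇ k | β j | kind
    ... | _ | _ | pair _ = cong (G i) (trans In-A0 (sym (+-identityʳ (k ∸ j))))
    ... | _ | _ | alone e = out i _ (subst (λ z → ¬ k < z + z) (sym (trans In-A0 k∸j≡j)) (λ h → <⇒≢ h (sym e)))
      where
      k∸j≡j : k ∸ j ≡ j
      k∸j≡j = trans (cong (_∸ j) (sym e)) (m+n∸m≡n j j)

    inA : ∀ G → (∀ i p → ¬ k < p + p → G i p ≡ nothing) → ∀ n i → G i (In k (posA j n)) ≡ uA G j i n
    inA G out zero i = joint G out i
    inA G out (suc n) i = cong (G i) (In-A n)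

    occB : j + j < k → ∀ e → occ (β j) (suc e) ≡ occ la (posB j e)
    occB h e with j + j <ᵇ k | β j | kind
    ... | _ | _ | pair _ = Abacus.occ-abacus k sla 1≤k∸j (m∸n≤m k j) e
    ... | _ | _ | alone e′ = ⊥-elim (<⇒≢ h e′)

    historyA : ∀ G → Admissible G → HistoryA G
    historyA G (out , h) n = subst (History _ _ m (cA j n)) (sym (occA n))
      (history-≗ (λ i _ _ → inA G out n i) (λ i _ _ → cong (G i) (posA-+k j n)) (h (posA j n) (≤-trans 1≤j (m≤m+n j _))))

    historyB : ∀ G → Admissible G → HistoryB G
    historyB G (out , h) e with j + j <ᵇ k | β j | kind | occB
    ... | _ | _ | alone _ | _ = history-still (λ _ → refl) (λ _ → refl)
    ... | _ | _ | pair lt | ob = subst (History _ _ m (c (posB j e))) (sym (ob lt e))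
      (history-≗ (λ i _ _ → cong (G i) (In-B lt e)) (λ i _ _ → cong (G i) (posB-+k j e)) (h (posB j e) (≤-trans 1≤k∸j (m≤m+n (k ∸ j) _))))

    unA : ∀ G → (∀ i p → ¬ k < p + p → G i p ≡ nothing) → HistoryA G → ∀ n →
      History (λ i → G i (In k (posA j n))) (λ i → G i (posA j n + k)) m (c (posA j n)) (occ la (posA j n))
    unA G out h n = subst (History _ _ m (cA j n)) (occA n)
      (history-≗ (λ i _ _ → sym (inA G out n i)) (λ i _ _ → cong (G i) (sym (posA-+k j n))) (h n))

    unB : ∀ G → HistoryB G → j + j < k → ∀ e →
      History (λ i → G i (In k (posB j e))) (λ i → G i (posB j e + k)) m (c (posB j e)) (occ la (posB j e))
    unB G h lt e with j + j <ᵇ k | β j | kind | occB | h e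
    ... | _ | _ | alone eq | _ | _ = ⊥-elim (<⇒≢ lt eq)
    ... | _ | _ | pair _ | ob | h′ = subst (History _ _ m (c (posB j e))) (ob lt e)
      (history-≗ (λ i _ _ → cong (G i) (sym (In-B lt e))) (λ i _ _ → cong (G i) (sym (posB-+k j e))) h′)

  History₀ : Entries → Set
  History₀ G = ∀ n → History (λ i → G i (suc n * k)) (λ i → G i (suc (suc n) * k)) m false (occ (abacus k la k) (suc n))

  In-multiple : ∀ n → In k (suc n * k) ≡ suc n * k
  In-multiple n = In-big (lia (k ∷ n * k ∷ []) (λ k x → con 1 :≤ k :⇒ ⊢ k :< k :+ x :+ (k :+ x)) 1≤k)

  history₀ : ∀ G → Admissible G → History₀ G
  history₀ G (_ , h) n = subst₂ (History _ _ m) (c-multiple (suc n)) (sym (occ-0-runner n))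
    (history-≗ (λ i _ _ → cong (G i) (In-multiple n)) (λ i _ _ → cong (G i) (+-comm (suc n * k) k)) (h (suc n * k) (≤-trans 1≤k (m≤m+n k _))))

  un₀ : ∀ G → History₀ G → ∀ n → History (λ i → G i (In k (suc n * k))) (λ i → G i (suc n * k + k)) m (c (suc n * k)) (occ la (suc n * k))
  un₀ G h n = subst₂ (History _ _ m) (sym (c-multiple (suc n))) (occ-0-runner n)
    (history-≗ (λ i _ _ → cong (G i) (sym (In-multiple n))) (λ i _ _ → cong (G i) (+-comm k (suc n * k))) (h n))

  admissible : ∀ G → (∀ i p → ¬ k < p + p → G i p ≡ nothing) → History₀ G →
    (∀ j₀ 2j≤k → Runners.HistoryA j₀ 2j≤k G × Runners.HistoryB j₀ 2j≤k G) → Admissible G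
  admissible G out h₀ h = out , go
    where
    go : ∀ x → 1 ≤ x → History (λ i → G i (In k x)) (λ i → G i (x + k)) m (c x) (occ la x)
    go x 1≤x with position x
    ... | multiple zero refl = ⊥-elim (<⇒≱ 1≤x z≤n)
    ... | multiple (suc n) refl = un₀ G h₀ n
    ... | onA (suc j₀) n _ 2j≤k refl = Runners.unA j₀ 2j≤k G out (proj₁ (h j₀ 2j≤k)) n
    ... | onB (suc j₀) e _ 2j<k refl = Runners.unB j₀ (<⇒≤ 2j<k) G (proj₂ (h j₀ (<⇒≤ 2j<k))) 2j<k e

  Word : List Entry → Set
  Word ws = Sorted ws × All (λ e → 1 ≤ idx (proj₁ e)) ws × All (λ e → k < proj₂ e + proj₂ e) ws ×
    (∀ x → 1 ≤ x → Run (In k x) (x + k) (c x) ws (occ la x))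

  x<x+k : ∀ x → x < x + k
  x<x+k x = ≤-trans (≤-reflexive (+-comm 1 x)) (+-monoʳ-≤ x 1≤k)

  In<Out : ∀ x → 1 ≤ x → In k x < x + k
  In<Out x 1≤x with k <ᵇ x + x
  ... | true = x<x+k x
  ... | false = ≤-trans (s≤s (m∸n≤m k x)) (+-monoˡ-≤ k 1≤x)

  positive : ∀ {p} → k < p + p → 1 ≤ p
  positive {p} h = lia (k ∷ p ∷ []) (λ k p → k :< p :+ p :⇒ ⊢ con 1 :≤ p) h

  word-noDouble : ∀ {ws} → Word ws → Letters≤ m ws → NoDouble ws
  word-noDouble {ws} (srt , _ , kys , run) ls i p h h′ = run-no-double srt ls (x<x+k p) (subst (λ I → Run I (p + k) (c p) ws (occ la p)) (In-big key) (run p (positive key))) i h h′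
    where
    key : k < p + p
    key = All.lookup kys h

  G : List Entry → Entries
  G ws i p = entry (∈ᵇ ws) i p

  word-admissible : ∀ {ws} → Word ws → Letters≤ m ws → Admissible (G ws)
  word-admissible {ws} w@(srt , _ , kys , run) ls = (λ i p n → entry-nothing ws λ b h → n (All.lookup kys h)) ,
    λ x 1≤x → run⇒history srt ls (word-noDouble w ls) (In<Out x 1≤x) (run x 1≤x)

  -- The largest key is never vacated, so it is a part of la.
  run-final : ∀ {I O b ws b″} → Run I O b ws b″ → (∀ {l p} → (l , p) ∈ ws → p ≢ O) → b ≡ true ⊎ (∃ λ l → (l , I) ∈ ws) → b″ ≡ true
  run-final [] nv (inj₁ e) = e
  run-final (fill refl ∷ r) nv _ = run-final r (λ h → nv (there h)) (inj₁ refl)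
  run-final (vacate _ e ∷ r) nv _ = ⊥-elim (nv (here refl) e)
  run-final (idle n _ ∷ r) nv (inj₁ e) = run-final r (λ h → nv (there h)) (inj₁ e)
  run-final (idle n _ ∷ r) nv (inj₂ (l , here refl)) = ⊥-elim (n refl)
  run-final (idle n _ ∷ r) nv (inj₂ (l , there h)) = run-final r (λ h → nv (there h)) (inj₂ (l , h))

  largest : ∀ e (ws : List Entry) → ∃ λ e′ → e′ ∈ e ∷ ws × (∀ {z} → z ∈ e ∷ ws → proj₂ z ≤ proj₂ e′)
  largest e [] = e , here refl , λ { (here refl) → ≤-refl }
  largest e (e₁ ∷ ws) with largest e₁ ws
  ... | e′ , h , mx with ≤-total (proj₂ e) (proj₂ e′)
  ...   | inj₁ le = e′ , there h , λ { (here refl) → le ; (there z) → mx z }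
  ...   | inj₂ ge = e , here refl , λ { (here refl) → ≤-refl ; (there z) → ≤-trans (mx z) ge }

  run-keys≤K : ∀ {ws} (b : ℕ → Bool) → All (λ e → k < proj₂ e + proj₂ e) ws → (∀ x → 1 ≤ x → Run (In k x) (x + k) (b x) ws (occ la x)) →
    ∀ {l p} → (l , p) ∈ ws → p ≤ K
  run-keys≤K {e ∷ ws} b kys run {l} {p} h with largest e ws
  ... | (l′ , P) , P∈ , mx = ≤-trans (mx h) (∈⇒≤top (strict⇒decreasing sla) (occ⇒∈ la
      (run-final (subst (λ I → Run I (P + k) (b P) (e ∷ ws) (occ la P)) (In-big key) (run P (positive key)))
        (λ z∈ z → <⇒≱ (x<x+k P) (≤-trans (≤-reflexive (sym z)) (mx z∈))) (inj₂ (l′ , P∈)))))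
    where
    key : k < P + P
    key = All.lookup kys P∈

  word-keys≤K : ∀ {ws} → Word ws → ∀ {l p} → (l , p) ∈ ws → p ≤ K
  word-keys≤K (_ , _ , kys , run) = run-keys≤K c kys run

  G-far : ∀ {ws} → Word ws → ∀ i p → K < p → G ws i p ≡ nothing
  G-far {ws} w i p lt = entry-nothing ws λ b h → <⇒≱ lt (word-keys≤K w h)

  n≤runner : ∀ r n → n ≤ r + n * k
  n≤runner r n = ≤-trans (≤-trans (≤-reflexive (sym (*-identityʳ n))) (*-monoʳ-≤ n 1≤k)) (m≤n+m (n * k) r)

  K<o : ∀ j → suc K < o j
  K<o j = lia (length (μ j) ∷ length (α j) ∷ K ∷ []) (λ l a K → ⊢ con 1 :+ K :< l :+ a :+ K :+ con 2)

  module _ {H : Entries} (out : ∀ i p → ¬ k < p + p → H i p ≡ nothing) (far : ∀ i p → K < p → H i p ≡ nothing) where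

    uB-far : ∀ j i e → K < e → isJust (uB H j i e) ≡ false
    uB-far j i e lt with j + j <ᵇ k
    ... | true = cong isJust (far i (posB j e) (≤-trans lt (n≤runner (k ∸ j) e)))
    ... | false = refl

    uA-far : ∀ j i n → K < n → isJust (uA H j i n) ≡ false
    uA-far j i (suc n) lt = cong isJust (far i (posA j (suc n)) (≤-trans lt (n≤runner j (suc n))))

    view-out : ∀ j i y → y ≡ 0 ⊎ o j + K < y → view H j i y ≡ nothing
    view-out zero i y (inj₁ refl) = out i 0 λ ()
    view-out zero i y (inj₂ lt) = far i (y * k) (≤-trans (s≤s (m≤n+m K (o 0))) (≤-trans lt (n≤runner 0 y)))
    view-out (suc j₀) i y (inj₁ refl) = isJust-false (trans (cong isJust (unfold-left (uA H (suc j₀)) (uB H (suc j₀)) i 0 (o (suc j₀)) refl))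
        (trans (flip-isJust (bitsA (uA H (suc j₀)) (pred i)) (uA H (suc j₀) i) (o (suc j₀))) (uA-far (suc j₀) i (o (suc j₀)) (≤-trans (n≤1+n _) (K<o (suc j₀))))))
      where open Fold (o (suc j₀)) (cA (suc j₀)) (s (suc j₀))
    view-out (suc j₀) i y (inj₂ lt) with y ≤ᵇ o (suc j₀) | proof (y ≤? o (suc j₀))
    ... | true | ofʸ h = ⊥-elim (<⇒≱ lt (≤-trans h (m≤m+n (o (suc j₀)) K)))
    ... | false | _ = isJust-false (uB-far (suc j₀) i (y ∸ o (suc j₀)) (m+n≤o⇒m≤o∸n (suc K) (≤-trans (≤-reflexive (cong suc (+-comm K (o (suc j₀))))) lt)))

    view-history : Admissible H → ∀ j → j ≤ k / 2 → ∀ y → 1 ≤ y → History (λ i → view H j i y) (λ i → view H j i (suc y)) m (s j y) (t j y)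
    view-history ad zero _ (suc n) _ = history₀ H ad n
    view-history ad (suc j₀) j≤ y _ = R.U.unfold-history (uA H (suc j₀)) (uB H (suc j₀)) (λ i → refl) (R.historyA H ad) (R.historyB H ad) y
      where
      module R = Runners j₀ (half≤ j≤)

    runner-word : Admissible H → ∀ j → j ≤ k / 2 → Word₁ (s j) (t j) (wordOf m (o j + K) (view H j))
    runner-word ad j j≤ = wordOf-sorted m _ (view H j) , All.map proj₁ (wordOf-letters m _ (view H j)) ,
      All.tabulate (λ h → proj₁ (proj₂ (proj₂ (∈-wordOf⁻ m _ (view H j) h)))) ,
      λ y 1≤y → wordOf-run m (o j + K) (view H j) (view-out j) (n<1+n y) (view-history ad j j≤ y 1≤y)

  view-injective : ∀ {H H′} → (∀ i p → ¬ k < p + p → H i p ≡ nothing) → (∀ i p → ¬ k < p + p → H′ i p ≡ nothing) →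
    (∀ i p → K < p → H i p ≡ nothing) → (∀ i p → K < p → H′ i p ≡ nothing) → Admissible H → Admissible H′ →
    (∀ j → j ≤ k / 2 → ∀ i → 1 ≤ i → i ≤ m → ∀ y → 1 ≤ y → view H j i y ≡ view H′ j i y) →
    ∀ i → 1 ≤ i → i ≤ m → ∀ p → H i p ≡ H′ i p
  view-injective {H} {H′} out out′ far far′ ad ad′ same (suc i) 1≤i i≤m p with k <? p + p
  ... | no n = trans (out (suc i) p n) (sym (out′ (suc i) p n))
  ... | yes key with position p
  ...   | multiple zero refl = ⊥-elim (<⇒≱ key z≤n)
  ...   | multiple (suc n) refl = same 0 z≤n (suc i) 1≤i i≤m (suc n) (s≤s z≤n)
  ...   | onA (suc j₀) zero _ 2j≤k refl = ⊥-elim (<⇒≱ key (≤-trans (≤-reflexive (cong₂ _+_ (+-identityʳ (suc j₀)) (+-identityʳ (suc j₀)))) 2j≤k))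
  ...   | onA (suc j₀) (suc n) _ 2j≤k refl = proj₁ (recover j₀ 2j≤k) (suc n)
    where
    recover : ∀ j₀ 2j≤k → (∀ n → uA H (suc j₀) (suc i) n ≡ uA H′ (suc j₀) (suc i) n) × (∀ e → uB H (suc j₀) (suc i) (suc e) ≡ uB H′ (suc j₀) (suc i) (suc e))
    recover j₀ 2j≤k = R.U.unfold-injective (uA H (suc j₀)) (uB H (suc j₀)) (uA H′ (suc j₀)) (uB H′ (suc j₀)) (suc K)
      (uA-far out far (suc j₀)) (uA-far out′ far′ (suc j₀)) (R.historyA H ad) (R.historyA H′ ad′) (≤-trans (n≤1+n _) (K<o (suc j₀)))
      (same (suc j₀) (≤half 2j≤k)) i i≤m
      where
      module R = Runners j₀ 2j≤k
  ...   | onB (suc j₀) e _ 2j<k refl = go e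
    where
    module R = Runners j₀ (<⇒≤ 2j<k)
    recover : (∀ n → uA H (suc j₀) (suc i) n ≡ uA H′ (suc j₀) (suc i) n) × (∀ e → uB H (suc j₀) (suc i) (suc e) ≡ uB H′ (suc j₀) (suc i) (suc e))
    recover = R.U.unfold-injective (uA H (suc j₀)) (uB H (suc j₀)) (uA H′ (suc j₀)) (uB H′ (suc j₀)) (suc K)
      (uA-far out far (suc j₀)) (uA-far out′ far′ (suc j₀)) (R.historyA H ad) (R.historyA H′ ad′) (≤-trans (n≤1+n _) (K<o (suc j₀)))
      (same (suc j₀) (≤half (<⇒≤ 2j<k))) i i≤m
    uB≡ : ∀ H e → uB H (suc j₀) (suc i) e ≡ H (suc i) (posB (suc j₀) e)
    uB≡ H e = uB-pair H (suc j₀) (suc i) e 2j<k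
    go : ∀ e → H (suc i) (posB (suc j₀) e) ≡ H′ (suc i) (posB (suc j₀) e)
    go zero = trans (sym (uB≡ H 0)) (trans (proj₁ recover 0) (uB≡ H′ 0))
    go (suc e) = trans (sym (uB≡ H (suc e))) (trans (proj₂ recover e) (uB≡ H′ (suc e)))

  -- Assembling the words of all runners into one word

  assemble : (ℕ → Entries) → Entries
  assemble v i p =
    if p % k ≡ᵇ 0 then v 0 i (p / k)
    else if p % k + p % k ≤ᵇ k then
      -- A key p ≤ k/2 moves nothing. The edge 0 of this runner is the joint one, whose entry is
      -- found under the key k - p.
      (if p / k ≡ᵇ 0 then nothing else Fold.foldA (o (p % k)) (cA (p % k)) (s (p % k)) (v (p % k)) i (p / k))
    else Fold.foldB (o (k ∸ p % k)) (cA (k ∸ p % k)) (s (k ∸ p % k)) (v (k ∸ p % k)) i (p / k)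

  assemble-0 : ∀ v i n → assemble v i (n * k) ≡ v 0 i n
  assemble-0 v i n = go (n * k % k) (n * k / k) (m*n%n≡0 n k) (m*n/n≡m n k)
    where
    go : ∀ r q → r ≡ 0 → q ≡ n → (if r ≡ᵇ 0 then v 0 i q else if r + r ≤ᵇ k then
      (if q ≡ᵇ 0 then nothing else Fold.foldA (o r) (cA r) (s r) (v r) i q)
      else Fold.foldB (o (k ∸ r)) (cA (k ∸ r)) (s (k ∸ r)) (v (k ∸ r)) i q) ≡ v 0 i n
    go _ _ refl refl = refl

  module _ (v : ℕ → Entries) (j₀ : ℕ) (2j≤k : suc j₀ + suc j₀ ≤ k) where
    private
      j : ℕ
      j = suc j₀

    assemble-A : ∀ i n → assemble v i (posA j n) ≡ (if n ≡ᵇ 0 then nothing else Fold.foldA (o j) (cA j) (s j) (v j) i n)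
    assemble-A i n = go (posA j n % k) (posA j n / k) (posA-mod (s≤s z≤n) 2j≤k n) (posA-div (s≤s z≤n) 2j≤k n)
      where
      go : ∀ r q → r ≡ j → q ≡ n → (if r ≡ᵇ 0 then v 0 i q else if r + r ≤ᵇ k then
        (if q ≡ᵇ 0 then nothing else Fold.foldA (o r) (cA r) (s r) (v r) i q)
        else Fold.foldB (o (k ∸ r)) (cA (k ∸ r)) (s (k ∸ r)) (v (k ∸ r)) i q) ≡ (if n ≡ᵇ 0 then nothing else Fold.foldA (o j) (cA j) (s j) (v j) i n)
      go _ _ refl refl with j + j ≤ᵇ k | proof (j + j ≤? k)
      ... | true | _ = refl
      ... | false | ofⁿ h = ⊥-elim (h 2j≤k)

    assemble-B : j + j < k → ∀ i e → assemble v i (posB j e) ≡ Fold.foldB (o j) (cA j) (s j) (v j) i e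
    assemble-B 2j<k i e = go (posB j e % k) (posB j e / k) (posB-mod (s≤s z≤n) 2j≤k e) (posB-div (s≤s z≤n) 2j≤k e)
      where
      j≤k : j ≤ k
      j≤k = ≤-trans (m≤m+n j j) 2j≤k
      finish : ∀ z → z ≡ j → Fold.foldB (o z) (cA z) (s z) (v z) i e ≡ Fold.foldB (o j) (cA j) (s j) (v j) i e
      finish _ refl = refl
      go : ∀ r q → r ≡ k ∸ j → q ≡ e → (if r ≡ᵇ 0 then v 0 i q else if r + r ≤ᵇ k then
        (if q ≡ᵇ 0 then nothing else Fold.foldA (o r) (cA r) (s r) (v r) i q)
        else Fold.foldB (o (k ∸ r)) (cA (k ∸ r)) (s (k ∸ r)) (v (k ∸ r)) i q) ≡ Fold.foldB (o j) (cA j) (s j) (v j) i e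
      go r _ eq refl with r ≡ᵇ 0 | proof (r ≟ 0) | r + r ≤ᵇ k | proof (r + r ≤? k)
      ... | true | ofʸ z | _ | _ = ⊥-elim (lia (j ∷ k ∷ (k ∸ j) ∷ r ∷ []) (λ j k d r → r := d :⇒ r := con 0 :⇒ d :+ j := k :⇒ j :+ j :< k :⇒ ⊢ :⊥) eq z (m∸n+n≡m j≤k) 2j<k)
      ... | false | _ | true | ofʸ z = ⊥-elim (lia (j ∷ k ∷ (k ∸ j) ∷ r ∷ []) (λ j k d r → r := d :⇒ r :+ r :≤ k :⇒ d :+ j := k :⇒ j :+ j :< k :⇒ ⊢ :⊥) eq z (m∸n+n≡m j≤k) 2j<k)
      ... | false | _ | false | _ = finish (k ∸ r) (trans (cong (k ∸_) eq) (m∸[m∸n]≡n j≤k))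

  h : ℕ
  h = k / 2

  Runnerwise : (ℕ → List Entry) → Set
  Runnerwise W = ∀ j → j ≤ h → Word₁ (s j) (t j) (W j) × Letters≤ m (W j)

  Linked-by : List Entry → (ℕ → List Entry) → Set
  Linked-by ws W = ∀ j → j ≤ h → ∀ i → 1 ≤ i → i ≤ m → ∀ y → 1 ≤ y → G (W j) i y ≡ view (G ws) j i y

  module Assembly (W : ℕ → List Entry) (rw : Runnerwise W) where

    v : ℕ → Entries
    v j = G (W j)

    U : Entries
    U = assemble v

    v-0 : ∀ j → j ≤ h → ∀ i → v j i 0 ≡ nothing
    v-0 j j≤ i = entry-nothing (W j) λ b e → case All.lookup (proj₁ (proj₂ (proj₂ (proj₁ (rw j j≤))))) e of λ ()

    module Piece (j₀ : ℕ) (2j≤k : suc j₀ + suc j₀ ≤ k) where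

      module R = Runners j₀ 2j≤k

      j : ℕ
      j = suc j₀

      j≤h : j ≤ h
      j≤h = ≤half 2j≤k

      word : Word₁ (s j) (t j) (W j)
      word = proj₁ (rw j j≤h)

      open Fold (o j) (cA j) (s j)

      v0 : ∀ i → isJust (v j i 0) ≡ false
      v0 i = cong isJust (v-0 j j≤h i)

      v1 : ∀ i → isJust (v j i 1) ≡ false
      v1 i = cong isJust (entry-nothing (W j) λ b e → <⇒≱ (R.word-key word e) ≤-refl)

      hv : ∀ y → 1 ≤ y → History (λ i → v j i y) (λ i → v j i (suc y)) m (s j y) (t j y)
      hv = word₁-history word (proj₂ (rw j j≤h))

      alone-nothing : j + j ≡ k → ∀ i e → v j i (o j + e) ≡ nothing
      alone-nothing eq i e = entry-nothing (W j) λ b q → <⇒≱ (R.word-alone eq word q) (m≤m+n (o j) e)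

      foldA-0 : j + j ≡ k → ∀ i → foldA (v j) i 0 ≡ nothing
      foldA-0 eq i = isJust-false (trans (unflip-isJust (o j) (bitsV (v j) (pred i)) (reversed (v j) i) 0)
        (cong isJust (trans (cong (v j i) (sym (+-identityʳ (o j)))) (alone-nothing eq i 0))))

      uB≡ : ∀ i e → uB U j i e ≡ foldB (v j) i e
      uB≡ i e = go (j + j <? k) e
        where
        go : Dec (j + j < k) → ∀ e → uB U j i e ≡ foldB (v j) i e
        go (yes lt) e = trans (uB-pair U j i e lt) (assemble-B v j₀ 2j≤k lt i e)
        go (no n) zero = trans (uB-alone U j i 0 n) (sym (foldA-0 (≤-antisym 2j≤k (≮⇒≥ n)) i))
        go (no n) (suc e) = trans (uB-alone U j i (suc e) n) (sym (alone-nothing (≤-antisym 2j≤k (≮⇒≥ n)) i (suc e)))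

      uA≡ : ∀ i n → uA U j i n ≡ foldA (v j) i n
      uA≡ i zero = uB≡ i 0
      uA≡ i (suc n) = assemble-A v j₀ 2j≤k i (suc n)

      historyA : R.HistoryA U
      historyA n = history-≗ (λ i _ _ → sym (uA≡ i n)) (λ i _ _ → sym (uA≡ i (suc n))) (R.U.foldA-history (v j) v0 v1 hv R.far n)

      historyB : R.HistoryB U
      historyB e = history-≗ (λ i _ _ → sym (uB≡ i e)) (λ i _ _ → sym (uB≡ i (suc e)))
        (R.U.foldB-history (v j) v0 v1 hv R.far (≤-trans (s≤s z≤n) (K<o j)) e)

      view≡ : ∀ H → (∀ i p → H i p ≡ U i p) → ∀ i → i < m → ∀ y → view H j (suc i) y ≡ v j (suc i) y
      view≡ H eq i i< y = R.U.unfold-fold (v j) v0 v1 hv R.far (uA H j) (uB H j)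
        (λ i n → trans (same-A i n) (uA≡ i n)) (λ i e → trans (same-B i (suc e)) (uB≡ i (suc e))) i i< y
        where
        same-B : ∀ i e → uB H j i e ≡ uB U j i e
        same-B i e = uB-cong H U j (eq i) e
        same-A : ∀ i n → uA H j i n ≡ uA U j i n
        same-A i zero = same-B i 0
        same-A i (suc n) = eq i _

    U-out : ∀ i p → ¬ k < p + p → U i p ≡ nothing
    U-out i p n with position p
    ... | multiple zero refl = trans (assemble-0 v i 0) (v-0 0 z≤n i)
    ... | multiple (suc q) refl = ⊥-elim (n (lia (k ∷ q * k ∷ []) (λ k x → con 1 :≤ k :⇒ ⊢ k :< k :+ x :+ (k :+ x)) 1≤k))
    ... | onA (suc j₀) zero _ 2j≤k refl = assemble-A v j₀ 2j≤k i 0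
    ... | onA (suc j₀) (suc q) _ 2j≤k refl = ⊥-elim (n (lia (j₀ ∷ k ∷ q * k ∷ []) (λ j k x → ⊢ k :< con 1 :+ j :+ (k :+ x) :+ (con 1 :+ j :+ (k :+ x)))))
    ... | onB j e _ 2j<k refl = ⊥-elim (n (lia (j ∷ k ∷ (k ∸ j) ∷ e * k ∷ []) (λ j k d x → j :+ j :< k :⇒ d :+ j := k :⇒ ⊢ k :< d :+ x :+ (d :+ x)) 2j<k (m∸n+n≡m (≤-trans (m≤m+n j j) (<⇒≤ 2j<k)))))

    U-admissible : Admissible U
    U-admissible = admissible U U-out
      (λ n → history-≗ (λ i _ _ → sym (assemble-0 v i (suc n))) (λ i _ _ → sym (assemble-0 v i (suc (suc n))))
        (word₁-history (proj₁ (rw 0 z≤n)) (proj₂ (rw 0 z≤n)) (suc n) (s≤s z≤n)))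
      (λ j₀ 2j≤k → Piece.historyA j₀ 2j≤k , Piece.historyB j₀ 2j≤k)

    U-nothing : ∀ i → (∀ j → j ≤ h → ∀ y → v j i y ≡ nothing) → ∀ p → U i p ≡ nothing
    U-nothing i z p with position p
    ... | multiple n refl = trans (assemble-0 v i n) (z 0 z≤n n)
    ... | onA (suc j₀) zero _ 2j≤k refl = assemble-A v j₀ 2j≤k i 0
    ... | onA (suc j₀) (suc n) _ 2j≤k refl = trans (assemble-A v j₀ 2j≤k i (suc n)) (isJust-false
        (trans (unflip-isJust (o (suc j₀)) (Fold.bitsV (o (suc j₀)) (cA (suc j₀)) (s (suc j₀)) (v (suc j₀)) (pred i)) (Fold.reversed (o (suc j₀)) (cA (suc j₀)) (s (suc j₀)) (v (suc j₀)) i) (suc n)) (cong isJust (z (suc j₀) (≤half 2j≤k) _))))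
    ... | onB (suc j₀) zero _ 2j<k refl = trans (assemble-B v j₀ (<⇒≤ 2j<k) 2j<k i 0) (isJust-false
        (trans (unflip-isJust (o (suc j₀)) (Fold.bitsV (o (suc j₀)) (cA (suc j₀)) (s (suc j₀)) (v (suc j₀)) (pred i)) (Fold.reversed (o (suc j₀)) (cA (suc j₀)) (s (suc j₀)) (v (suc j₀)) i) 0) (cong isJust (z (suc j₀) (≤half (<⇒≤ 2j<k)) _))))
    ... | onB (suc j₀) (suc e) _ 2j<k refl = trans (assemble-B v j₀ (<⇒≤ 2j<k) 2j<k i (suc e)) (z (suc j₀) (≤half (<⇒≤ 2j<k)) _)

    keysBound : ∀ n → ∃ λ Y → ∀ j → j ≤ n → ∀ {l y} → (l , y) ∈ W j → y ≤ Y
    keysBound zero with bound proj₂ (W 0)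
    ... | Y , b = Y , λ { zero z≤n e → All.lookup b e }
    keysBound (suc n) with keysBound n | bound proj₂ (W (suc n))
    ... | Y , b | Y′ , b′ = Y ⊔ Y′ , all
      where
      all : ∀ j → j ≤ suc n → ∀ {l y} → (l , y) ∈ W j → y ≤ Y ⊔ Y′
      all j j≤ e with j ≟ suc n
      ... | yes refl = ≤-trans (All.lookup b′ e) (m≤n⊔m Y Y′)
      ... | no ne = ≤-trans (b j (s≤s⁻¹ (≤∧≢⇒< j≤ ne)) e) (m≤m⊔n Y Y′)

    -- Z bounds the keys of all runner words and the lengths `o j` of all reversed parts. A key
    -- beyond K′ has a quotient greater than Z on its runner, so its entry vanishes.
    Z K′ : ℕ
    Z = proj₁ (keysBound h) + sumTo h o
    K′ = k + Z * k

    v-far : ∀ j → j ≤ h → ∀ i y → proj₁ (keysBound h) < y → v j i y ≡ nothing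
    v-far j j≤ i y lt = entry-nothing (W j) λ b e → <⇒≱ lt (proj₂ (keysBound h) j j≤ e)

    quotient : ∀ r n → r ≤ k → K′ < r + n * k → Z < n
    quotient r n r≤k lt = *-cancelʳ-< k Z n (+-cancelˡ-< k _ _ (≤-trans lt (+-monoˡ-≤ (n * k) r≤k)))

    U-far : ∀ i p → p ≡ 0 ⊎ K′ < p → U i p ≡ nothing
    U-far i p (inj₁ refl) = U-out i 0 λ ()
    U-far i p (inj₂ lt) with position p
    ... | multiple n refl = trans (assemble-0 v i n) (v-far 0 z≤n i n (≤-trans (s≤s (m≤m+n _ (sumTo h o))) (quotient 0 n z≤n lt)))
    ... | onA (suc j₀) zero _ 2j≤k refl = assemble-A v j₀ 2j≤k i 0
    ... | onA (suc j₀) (suc n) _ 2j≤k refl = trans (assemble-A v j₀ 2j≤k i (suc n)) (isJust-false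
        (trans (unflip-isJust (o (suc j₀)) (Fold.bitsV (o (suc j₀)) (cA (suc j₀)) (s (suc j₀)) (v (suc j₀)) (pred i)) (Fold.reversed (o (suc j₀)) (cA (suc j₀)) (s (suc j₀)) (v (suc j₀)) i) (suc n))
          (cong isJust (trans (cong (v (suc j₀) i) (m≤n⇒m∸n≡0 o≤n)) (v-0 (suc j₀) (≤half 2j≤k) i)))))
      where
      o≤n : o (suc j₀) ≤ suc n
      o≤n = ≤-trans (sumTo-≤ h {o} (suc j₀) (≤half 2j≤k)) (≤-trans (m≤n+m (sumTo h o) _) (<⇒≤ (quotient (suc j₀) (suc n) (<⇒≤ (j<k (s≤s z≤n) 2j≤k)) lt)))
    ... | onB (suc j₀) e _ 2j<k refl with e | quotient (k ∸ suc j₀) e (m∸n≤m k (suc j₀)) lt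
    ...   | suc e′ | Z<e = trans (assemble-B v j₀ (<⇒≤ 2j<k) 2j<k i (suc e′)) (v-far (suc j₀) (≤half (<⇒≤ 2j<k)) i _
            (≤-trans (≤-trans (s≤s (m≤m+n _ (sumTo h o))) Z<e) (m≤n+m (suc e′) (o (suc j₀)))))

    merged : List Entry
    merged = wordOf m K′ U

    merged-word : Word merged
    merged-word = wordOf-sorted m K′ U , All.map proj₁ (wordOf-letters m K′ U) ,
      All.tabulate (λ {e} e∈ → key (proj₂ e) (proj₂ (proj₂ (proj₂ (proj₂ (∈-wordOf⁻ m K′ U e∈)))))) ,
      λ x 1≤x → wordOf-run m K′ U U-far (In<Out x 1≤x) (proj₂ U-admissible x 1≤x)
      where
      key : ∀ p {i b} → U i p ≡ just b → k < p + p
      key p {i} e with k <? p + p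
      ... | yes lt = lt
      ... | no n = case trans (sym e) (U-out i p n) of λ ()

    G≡U : ∀ i p → G merged i p ≡ U i p
    G≡U i p with 1 ≤? i | i ≤? m
    ... | yes a | yes b = entry-wordOf m K′ U U-far i a b p
    ... | no n | _ = trans (entry-nothing merged λ b e → n (proj₁ (∈-wordOf⁻ m K′ U e)))
        (sym (U-nothing i (λ j j≤ y → entry-nothing (W j) λ b e → n (proj₁ (All.lookup (proj₂ (rw j j≤)) e))) p))
    ... | yes _ | no n = trans (entry-nothing merged λ b e → n (proj₁ (proj₂ (∈-wordOf⁻ m K′ U e))))
        (sym (U-nothing i (λ j j≤ y → entry-nothing (W j) λ b e → n (proj₂ (All.lookup (proj₂ (rw j j≤)) e))) p))

    merged-linked : Linked-by merged W
    merged-linked zero _ i _ _ y _ = sym (trans (G≡U i (y * k)) (assemble-0 v i y))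
    merged-linked (suc j₀) j≤ (suc i) _ i< y _ = sym (Piece.view≡ j₀ (half≤ j≤) (G merged) G≡U i i< y)

  -- The multiplicity of a letter as a sum over the runners

  cls : ℕ → ℕ
  cls p = if p % k + p % k ≤ᵇ k then p % k else k ∸ p % k

  cls-0 : ∀ n → cls (n * k) ≡ 0
  cls-0 n = go (n * k % k) (m*n%n≡0 n k)
    where
    go : ∀ r → r ≡ 0 → (if r + r ≤ᵇ k then r else k ∸ r) ≡ 0
    go _ refl = refl

  cls-A : ∀ {j} n → 1 ≤ j → j + j ≤ k → cls (posA j n) ≡ j
  cls-A {j} n 1≤j 2j≤k = go (posA j n % k) (posA-mod 1≤j 2j≤k n)
    where
    go : ∀ r → r ≡ j → (if r + r ≤ᵇ k then r else k ∸ r) ≡ j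
    go _ refl with j + j ≤ᵇ k | proof (j + j ≤? k)
    ... | true | _ = refl
    ... | false | ofⁿ n = ⊥-elim (n 2j≤k)

  cls-B : ∀ {j} e → 1 ≤ j → j + j < k → cls (posB j e) ≡ j
  cls-B {j} e 1≤j 2j<k = go (posB j e % k) (posB-mod 1≤j (<⇒≤ 2j<k) e)
    where
    j≤k : j ≤ k
    j≤k = ≤-trans (m≤m+n j j) (<⇒≤ 2j<k)
    go : ∀ r → r ≡ k ∸ j → (if r + r ≤ᵇ k then r else k ∸ r) ≡ j
    go r eq with r + r ≤ᵇ k | proof (r + r ≤? k)
    ... | true | ofʸ z = ⊥-elim (lia (j ∷ k ∷ (k ∸ j) ∷ r ∷ []) (λ j k d r → r := d :⇒ r :+ r :≤ k :⇒ d :+ j := k :⇒ j :+ j :< k :⇒ ⊢ :⊥) eq z (m∸n+n≡m j≤k) 2j<k)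
    ... | false | _ = trans (cong (k ∸_) eq) (m∸[m∸n]≡n j≤k)

  cls≤h : ∀ p → cls p ≤ h
  cls≤h p with position p
  ... | multiple n refl = ≤-trans (≤-reflexive (cls-0 n)) z≤n
  ... | onA j n 1≤j 2j≤k refl = ≤-trans (≤-reflexive (cls-A n 1≤j 2j≤k)) (≤half 2j≤k)
  ... | onB j e 1≤j 2j<k refl = ≤-trans (≤-reflexive (cls-B e 1≤j 2j<k)) (≤half (<⇒≤ 2j<k))

  -- The key on the abacus of the y-th edge of the path; the joint edge y = o belongs to the second
  -- case.
  keyAt : ℕ → ℕ → ℕ
  keyAt zero y = y * k
  keyAt j@(suc _) y = if y <ᵇ o j then posA j (o j ∸ y) else posB j (y ∸ o j)

  keys⇒just : ∀ i ws {p} → p ∈ keys i ws → isJust (G ws i p) ≡ true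
  keys⇒just i ws {p} p∈ with ∈-keys⁻ i ws p∈
  ... | true , e∈ rewrite ∈⇒∈ᵇ ws e∈ = refl
  ... | false , e∈ rewrite ∈⇒∈ᵇ ws e∈ with ∈ᵇ ws (lab i true , p)
  ...   | true = refl
  ...   | false = refl

  just⇒keys : ∀ i ws {p} → isJust (G ws i p) ≡ true → p ∈ keys i ws
  just⇒keys i ws {p} e with G ws i p in eq
  ... | just b = ∈-keys⁺ i ws (entry-just ws eq)

  module _ {ws W} (w : Word ws) (ls : Letters≤ m ws) (rw : Runnerwise W) (lk : Linked-by ws W) where

    module _ (i : ℕ) (1≤i : 1 ≤ i) (i≤m : i ≤ m) where

      runner-y≥1 : ∀ j → j ≤ h → ∀ {y} → y ∈ keys i (W j) → 1 ≤ y
      runner-y≥1 j j≤ y∈ with ∈-keys⁻ i (W j) y∈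
      ... | b , e∈ = All.lookup (proj₁ (proj₂ (proj₂ (proj₁ (rw j j≤))))) e∈

      runner-just : ∀ j → j ≤ h → ∀ {y} → y ∈ keys i (W j) → isJust (view (G ws) j i y) ≡ true
      runner-just j j≤ y∈ = trans (cong isJust (sym (lk j j≤ i 1≤i i≤m _ (runner-y≥1 j j≤ y∈)))) (keys⇒just i (W j) y∈)

      just-runner : ∀ j → j ≤ h → ∀ {y} → 1 ≤ y → isJust (view (G ws) j i y) ≡ true → y ∈ keys i (W j)
      just-runner j j≤ 1≤y e = just⇒keys i (W j) (trans (cong isJust (lk j j≤ i 1≤i i≤m _ 1≤y)) e)

      moved-left : ∀ j₀ y → y < o (suc j₀) → isJust (view (G ws) (suc j₀) i y) ≡ isJust (G ws i (posA (suc j₀) (o (suc j₀) ∸ y)))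
      moved-left j₀ y lt = trans (cong isJust (unfold-left (uA (G ws) (suc j₀)) (uB (G ws) (suc j₀)) i y n (m+[n∸m]≡n (<⇒≤ lt))))
          (trans (flip-isJust (bitsA (uA (G ws) (suc j₀)) (pred i)) (uA (G ws) (suc j₀) i) n) (go n (m<n⇒0<n∸m lt)))
        where
        open Fold (o (suc j₀)) (cA (suc j₀)) (s (suc j₀))
        n : ℕ
        n = o (suc j₀) ∸ y
        go : ∀ n → 1 ≤ n → isJust (uA (G ws) (suc j₀) i n) ≡ isJust (G ws i (posA (suc j₀) n))
        go (suc n) _ = refl

      moved-right : ∀ j₀ e → isJust (view (G ws) (suc j₀) i (o (suc j₀) + e)) ≡ isJust (uB (G ws) (suc j₀) i e)
      moved-right j₀ zero = trans (cong isJust (unfold-joint (uA (G ws) (suc j₀)) (uB (G ws) (suc j₀)) i)) (flip-isJust (bitsA (uA (G ws) (suc j₀)) (pred i)) (uA (G ws) (suc j₀) i) 0)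
        where open Fold (o (suc j₀)) (cA (suc j₀)) (s (suc j₀))
      moved-right j₀ (suc e) = cong isJust (unfold-right (uA (G ws) (suc j₀)) (uB (G ws) (suc j₀)) i e)
        where open Fold (o (suc j₀)) (cA (suc j₀)) (s (suc j₀))

      data Spot (j₀ y : ℕ) : Set where
        left′  : y < o (suc j₀) → keyAt (suc j₀) y ≡ posA (suc j₀) (o (suc j₀) ∸ y) → isJust (G ws i (posA (suc j₀) (o (suc j₀) ∸ y))) ≡ true → Spot j₀ y
        right′ : ∀ e → y ≡ o (suc j₀) + e → suc j₀ + suc j₀ < k → keyAt (suc j₀) y ≡ posB (suc j₀) e → isJust (G ws i (posB (suc j₀) e)) ≡ true → Spot j₀ y

      keyAt-left : ∀ j₀ y → y < o (suc j₀) → keyAt (suc j₀) y ≡ posA (suc j₀) (o (suc j₀) ∸ y)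
      keyAt-left j₀ y lt with y <ᵇ o (suc j₀) | proof (y <? o (suc j₀))
      ... | true | _ = refl
      ... | false | ofⁿ n = ⊥-elim (n lt)

      keyAt-right : ∀ j₀ e → keyAt (suc j₀) (o (suc j₀) + e) ≡ posB (suc j₀) e
      keyAt-right j₀ e with o (suc j₀) + e <ᵇ o (suc j₀) | proof (o (suc j₀) + e <? o (suc j₀))
      ... | true | ofʸ lt = ⊥-elim (<⇒≱ lt (m≤m+n _ e))
      ... | false | _ = cong (posB (suc j₀)) (m+n∸m≡n (o (suc j₀)) e)

      spot : ∀ j₀ → suc j₀ ≤ h → ∀ {y} → y ∈ keys i (W (suc j₀)) → Spot j₀ y
      spot j₀ j≤ {y} y∈ with y <? o (suc j₀)
      ... | yes lt = left′ lt (keyAt-left j₀ y lt) (trans (sym (moved-left j₀ y lt)) (runner-just (suc j₀) j≤ y∈))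
      ... | no ge = go (y ∸ o (suc j₀)) (sym (m+[n∸m]≡n (≮⇒≥ ge)))
        where
        go : ∀ e → y ≡ o (suc j₀) + e → Spot j₀ y
        go e refl = decide′ (trans (sym (moved-right j₀ e)) (runner-just (suc j₀) j≤ y∈))
          where
          decide′ : isJust (uB (G ws) (suc j₀) i e) ≡ true → Spot j₀ (o (suc j₀) + e)
          decide′ q = go′ (suc j₀ + suc j₀ <? k)
            where
            go′ : Dec (suc j₀ + suc j₀ < k) → Spot j₀ (o (suc j₀) + e)
            go′ (yes lt) = right′ e refl lt (keyAt-right j₀ e) (trans (cong isJust (sym (uB-pair (G ws) (suc j₀) i e lt))) q)
            go′ (no n) = case trans (sym q) (cong isJust (uB-alone (G ws) (suc j₀) i e n)) of λ ()

      into-class : ∀ j → j ≤ h → ∀ {y} → y ∈ keys i (W j) → keyAt j y ∈ keys i ws × cls (keyAt j y) ≡ j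
      into-class zero j≤ {y} y∈ = just⇒keys i ws (runner-just 0 j≤ y∈) , cls-0 y
      into-class (suc j₀) j≤ {y} y∈ with spot j₀ j≤ y∈
      ... | left′ lt e q = just⇒keys i ws (trans (cong (λ p → isJust (G ws i p)) e) q) , trans (cong cls e) (cls-A (o (suc j₀) ∸ y) (s≤s z≤n) (half≤ j≤))
      ... | right′ e′ _ lt e q = just⇒keys i ws (trans (cong (λ p → isJust (G ws i p)) e) q) , trans (cong cls e) (cls-B e′ (s≤s z≤n) lt)

      from-class : ∀ j → j ≤ h → ∀ {p} → p ∈ keys i ws → cls p ≡ j → ∃ λ y → y ∈ keys i (W j) × p ≡ keyAt j y
      from-class j j≤ {p} p∈ cl with ∈-keys⁻ i ws p∈ | position p
      ... | b , e∈ | multiple n refl with trans (sym cl) (cls-0 n)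
      ...   | refl = n , just-runner 0 j≤ (1≤n n (All.lookup (proj₁ (proj₂ (proj₂ w))) e∈)) (keys⇒just i ws p∈) , refl
        where
        1≤n : ∀ n → k < n * k + n * k → 1 ≤ n
        1≤n (suc n) _ = s≤s z≤n
      from-class j j≤ {p} p∈ cl | b , e∈ | onA (suc j₀) n 1≤j 2j≤k refl with trans (sym cl) (cls-A n 1≤j 2j≤k)
      ... | refl = o (suc j₀) ∸ n , just-runner (suc j₀) j≤ (m<n⇒0<n∸m n<o)
              (trans (moved-left j₀ (o (suc j₀) ∸ n) lt) (trans (cong (λ z → isJust (G ws i (posA (suc j₀) z))) back) (keys⇒just i ws p∈))) ,
              sym (trans (keyAt-left j₀ _ lt) (cong (posA (suc j₀)) back))
        where
        n<o : n < o (suc j₀)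
        n<o = ≤-trans (s≤s (≤-trans (n≤runner (suc j₀) n) (word-keys≤K w e∈))) (≤-trans (n≤1+n _) (K<o (suc j₀)))
        1≤n : ∀ n → k < posA (suc j₀) n + posA (suc j₀) n → 1 ≤ n
        1≤n zero lt = ⊥-elim (<⇒≱ lt (≤-trans (≤-reflexive (cong₂ _+_ (+-identityʳ (suc j₀)) (+-identityʳ (suc j₀)))) 2j≤k))
        1≤n (suc n) _ = s≤s z≤n
        lt : o (suc j₀) ∸ n < o (suc j₀)
        lt = ∸-monoʳ-< (1≤n n (All.lookup (proj₁ (proj₂ (proj₂ w))) e∈)) (<⇒≤ n<o)
        back : o (suc j₀) ∸ (o (suc j₀) ∸ n) ≡ n
        back = m∸[m∸n]≡n (<⇒≤ n<o)
      from-class j j≤ {p} p∈ cl | b , e∈ | onB (suc j₀) e 1≤j 2j<k refl with trans (sym cl) (cls-B e 1≤j 2j<k)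
      ... | refl = o (suc j₀) + e , just-runner (suc j₀) j≤ (≤-trans (≤-trans (s≤s z≤n) (K<o (suc j₀))) (m≤m+n _ e))
              (trans (moved-right j₀ e) (trans uB≡ (keys⇒just i ws p∈))) , sym (keyAt-right j₀ e)
        where
        uB≡ : isJust (uB (G ws) (suc j₀) i e) ≡ isJust (G ws i (posB (suc j₀) e))
        uB≡ = cong isJust (uB-pair (G ws) (suc j₀) i e 2j<k)

      A≢B : ∀ j₀ n x → suc j₀ + suc j₀ < k → posA (suc j₀) n ≢ posB (suc j₀) x
      A≢B j₀ n x 2j<k q = lia (suc j₀ ∷ k ∷ (k ∸ suc j₀) ∷ []) (λ j k d → j :+ j :< k :⇒ j := d :⇒ d :+ j := k :⇒ ⊢ :⊥) 2j<k
        (trans (sym (posA-mod (s≤s z≤n) (<⇒≤ 2j<k) n)) (trans (cong (_% k) q) (posB-mod (s≤s z≤n) (<⇒≤ 2j<k) x))) (m∸n+n≡m (<⇒≤ (j<k (s≤s z≤n) (<⇒≤ 2j<k))))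

      keyAt-injective : ∀ j → j ≤ h → ∀ {y y′} → y ∈ keys i (W j) → y′ ∈ keys i (W j) → keyAt j y ≡ keyAt j y′ → y ≡ y′
      keyAt-injective zero j≤ {y} {y′} _ _ e = *-cancelʳ-≡ y y′ k e
      keyAt-injective (suc j₀) j≤ {y} {y′} y∈ y∈′ e with spot j₀ j≤ y∈ | spot j₀ j≤ y∈′
      ... | left′ lt e₁ _ | left′ lt′ e₂ _ = ∸-cancelˡ-≡ (<⇒≤ lt) (<⇒≤ lt′) (trans (sym (posA-div (s≤s z≤n) (half≤ j≤) _)) (trans (cong (_/ k) (trans (sym e₁) (trans e e₂))) (posA-div (s≤s z≤n) (half≤ j≤) _)))
      ... | right′ x refl 2j<k e₁ _ | right′ x′ refl _ e₂ _ = cong (o (suc j₀) +_) (trans (sym (posB-div (s≤s z≤n) (half≤ j≤) x)) (trans (cong (_/ k) (trans (sym e₁) (trans e e₂))) (posB-div (s≤s z≤n) (half≤ j≤) x′)))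
      ... | left′ _ e₁ _ | right′ x _ 2j<k e₂ _ = ⊥-elim (A≢B j₀ (o (suc j₀) ∸ y) x 2j<k (trans (sym e₁) (trans e e₂)))
      ... | right′ x _ 2j<k e₁ _ | left′ _ e₂ _ = ⊥-elim (A≢B j₀ (o (suc j₀) ∸ y′) x 2j<k (trans (sym e₂) (trans (sym e) e₁)))

      runner-count : ∀ j → j ≤ h → length (class cls j (keys i ws)) ≡ count i (W j)
      runner-count j j≤ = trans (unique-length
          (AP.filter⁺ (λ x → cls x ≟ j) (keys-unique i (proj₁ w) (word-noDouble w ls)))
          (unique-map (keyAt j) (keyAt-injective j j≤) (keys-unique i (proj₁ (proj₁ (rw j j≤))) (word₁-noDouble (proj₁ (rw j j≤)) (proj₂ (rw j j≤)))))
          (λ p∈ → let (a , cl) = ∈-filter⁻ (λ x → cls x ≟ j) {xs = keys i ws} p∈ ; (y , y∈ , e) = from-class j j≤ a cl in subst (_∈ map (keyAt j) (keys i (W j))) (sym e) (∈-map⁺ (keyAt j) y∈))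
          (λ p∈ → let (y , y∈ , e) = ∈-map⁻ (keyAt j) p∈ ; (a , cl) = into-class j j≤ y∈ in subst (_∈ class cls j (keys i ws)) (sym e) (∈-filter⁺ (λ x → cls x ≟ j) a cl)))
        (trans (length-map (keyAt j) (keys i (W j))) (keys-length i (W j)))

    count-none : ∀ i {xs : List Entry} → (∀ {l p} → (l , p) ∈ xs → idx l ≢ i) → count i xs ≡ 0
    count-none i {[]} _ = refl
    count-none i {(l , p) ∷ xs} n with idx l ≡ᵇ i | proof (idx l ≟ i)
    ... | true | ofʸ e = ⊥-elim (n (here refl) e)
    ... | false | _ = count-none i {xs} (λ q → n (there q))

    -- Unfolding preserves the presence of entries, so `keyAt` matches the keys of each runner word
    -- with a class of the keys of ws. The classes exhaust all keys.
    total-count : ∀ i → count i ws ≡ sumTo h (λ j → count i (W j))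
    total-count i with 1 ≤? i | i ≤? m
    ... | yes a | yes b = trans (sym (keys-length i ws)) (trans (sym (length-classes cls h (keys i ws) (λ {p} _ → cls≤h p))) (sumTo-cong h (runner-count i a b)))
    ... | no n | _ = trans (count-none i λ {l} q e → n (subst (1 ≤_) e (proj₁ (All.lookup ls q))))
        (sym (sumTo-0 (λ j j≤ → count-none i λ {l} q e → n (subst (1 ≤_) e (proj₁ (All.lookup (proj₂ (rw j j≤)) q))))))
    ... | yes _ | no n = trans (count-none i λ {l} q e → n (subst (_≤ m) e (proj₂ (All.lookup ls q))))
        (sym (sumTo-0 (λ j j≤ → count-none i λ {l} q e → n (subst (_≤ m) e (proj₂ (All.lookup (proj₂ (rw j j≤)) q))))))

  -- The k-core: c is a core, and no other core leads to la

  open Tableaux {k} 1≤k {la} sla using (core⇒noBar; noBar⇒core)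

  C : ℕ
  C = suc (length la) * k

  c-far : ∀ x → C < x → c x ≡ false
  c-far x lt with x % k ≡ᵇ 0
  ... | true = refl
  ... | false = go (proof (x / k <? length (α (x % k)) ∸ opposite (x % k)))
    where
    L≤ : length la ≤ x / k
    L≤ = ≤-trans (≤-reflexive (sym (m*n/n≡m (length la) k))) (/-monoˡ-≤ k (≤-trans (m≤n+m (length la * k) k) (<⇒≤ lt)))
    len≤ : length (α (x % k)) ≤ length la
    len≤ = ≤-trans (≤-reflexive (length-map _ (filter (λ p → p % k ≟ (x % k) % k) la))) (length-filter (λ p → p % k ≟ (x % k) % k) la)
    go : ∀ {b} → Reflects (x / k < length (α (x % k)) ∸ opposite (x % k)) b → b ≡ false
    go (ofⁿ _) = refl
    go (ofʸ h) = ⊥-elim (<⇒≱ h (≤-trans (m∸n≤m _ (opposite (x % k))) (≤-trans len≤ L≤)))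

  bar-fill : ∀ {p s u} → Bar k p s u → ∀ x → 1 ≤ x → In k x ≡ p → u x ≡ true
  bar-fill (_ , B) x 1≤x e = go (act-view _ _ _ _ _ (B x 1≤x))
    where
    go : ∀ {a b} → ActView (In k x) (x + k) _ a b → b ≡ true
    go (fill _) = refl
    go (vacate n _) = ⊥-elim (n (sym e))
    go (idle n _) = ⊥-elim (n (sym e))

  bar-vacate : ∀ {p s u} → Bar k p s u → ∀ x → 1 ≤ x → x + k ≡ p → u x ≡ false
  bar-vacate (_ , B) x 1≤x e = go (act-view _ _ _ _ _ (B x 1≤x))
    where
    go : ∀ {a b} → ActView (In k x) (x + k) _ a b → b ≡ false
    go (fill h) = ⊥-elim (<⇒≢ (In<Out x 1≤x) (trans (sym h) (sym e)))
    go (vacate _ _) = refl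
    go (idle _ n) = ⊥-elim (n (sym e))

  1≤posA : ∀ j₀ n → 1 ≤ posA (suc j₀) n
  1≤posA j₀ n = s≤s z≤n

  <ᵇ-true : ∀ x y → (x <ᵇ y) ≡ true → x < y
  <ᵇ-true x y e = <ᵇ⇒< x y (subst T (sym e) tt)

  <ᵇ-false : ∀ x y → (x <ᵇ y) ≡ false → y ≤ x
  <ᵇ-false x y e = ≮⇒≥ λ h → subst T e (<⇒<ᵇ h)

  -- The beads of c are packed on every runner, so none can step back. One of a - b and b - a is
  -- truncated to 0, so opposite runners are not both occupied and no pair with sum k can be
  -- removed. Multiples of k do not occur.
  c-core : KCore k (fromBits c C)
  c-core = noBar⇒core (fromBits-strict c C) go
    where
    occ-c : ∀ x → 1 ≤ x → occ (fromBits c C) x ≡ c x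
    occ-c x 1≤x = occ-fromBits c C 1≤x (c-far x)
    go : ∀ p s → Bar k p s (occ (fromBits c C)) → ⊥
    go p s B = refute (position p)
      where
      full : ∀ x → 1 ≤ x → In k x ≡ p → c x ≡ true
      full x 1≤x e = trans (sym (occ-c x 1≤x)) (bar-fill {p} {s} B x 1≤x e)
      free : ∀ x → 1 ≤ x → x + k ≡ p → c x ≡ false
      free x 1≤x e = trans (sym (occ-c x 1≤x)) (bar-vacate {p} {s} B x 1≤x e)
      key : k < p + p
      key = proj₁ B
      refute : Position p → ⊥
      refute (multiple n refl) = case trans (sym (full (n * k) (positive key) (In-big key))) (c-multiple n) of λ ()
      refute (onA (suc j₀) zero _ 2j≤k refl) = <⇒≱ key (≤-trans (≤-reflexive (cong₂ _+_ (+-identityʳ (suc j₀)) (+-identityʳ (suc j₀)))) 2j≤k)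
      refute (onA (suc j₀) (suc n) _ 2j≤k refl) = <⇒≱ (≤-trans (n≤1+n _) (<ᵇ-true (suc n + R.b) R.a (trans (sym (R.c-A (suc n))) (full _ (1≤posA j₀ (suc n)) (In-big key)))))
          (<ᵇ-false (n + R.b) R.a (trans (sym (R.c-A n)) (free _ (1≤posA j₀ n) (posA-+k (suc j₀) n))))
        where module R = Runners j₀ 2j≤k
      refute (onB (suc j₀) e _ 2j<k refl) = descend e refl
        where
        module R = Runners j₀ (<⇒≤ 2j<k)
        cB≡ : ∀ e → c (posB (suc j₀) e) ≡ (e + R.a <ᵇ R.b)
        cB≡ e = trans (sym (uB′ e)) (R.c-B e)
          where
          uB′ : ∀ e → cB (suc j₀) e ≡ c (posB (suc j₀) e)
          uB′ e with suc j₀ + suc j₀ <ᵇ k | proof (suc j₀ + suc j₀ <? k)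
          ... | true | _ = refl
          ... | false | ofⁿ n = ⊥-elim (n 2j<k)
        1≤posB : ∀ e → 1 ≤ posB (suc j₀) e
        1≤posB e = ≤-trans R.1≤k∸j (m≤m+n _ _)
        descend : ∀ e → p ≡ posB (suc j₀) e → ⊥
        descend (suc e) q = <⇒≱ (≤-trans (n≤1+n _) (<ᵇ-true (suc e + R.a) R.b (trans (sym (cB≡ (suc e))) (full _ (1≤posB (suc e)) (trans (R.In-B 2j<k (suc e)) (sym q))))))
          (<ᵇ-false (e + R.a) R.b (trans (sym (cB≡ e)) (free _ (1≤posB e) (trans (posB-+k (suc j₀) e) (sym q)))))
        descend zero q = <⇒≱ (<ᵇ-true R.a R.b (trans (sym (cB≡ 0)) (full _ (1≤posB 0) (trans (R.In-B 2j<k 0) (sym q)))))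
          (≤-trans (m≤n+m _ _) (≤-trans (n≤1+n _) (<ᵇ-true R.b R.a (trans (sym (R.c-A 0)) (full _ (1≤posA j₀ 0) (trans R.In-A0 (trans (sym (+-identityʳ (k ∸ suc j₀))) (sym q))))))))

  module _ (ν : List ℕ) (ws : List Entry) (sν : StrictPartition ν) (core : KCore k ν) (kys : All (λ e → k < proj₂ e + proj₂ e) ws)
    (run : ∀ x → 1 ≤ x → Run (In k x) (x + k) (occ ν x) ws (occ la x)) where

    private
      N≡0 : ∀ {p} → K < p → keyCount p ws ≡ 0
      N≡0 lt = keyCount-0 ws λ h → <⇒≱ lt (run-keys≤K (occ ν) kys run h)

      balance : ∀ x → 1 ≤ x → bit (occ ν x) + keyCount (In k x) ws ≡ bit (occ la x) + keyCount (x + k) ws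
      balance x 1≤x = run-balance (<⇒≢ (In<Out x 1≤x)) (run x 1≤x)

      occ-far : ∀ x → K < x → occ la x ≡ false
      occ-far x lt = occ-top (strict⇒decreasing sla) lt

      bar-at : ∀ p → k ≤ p → occ ν p ≡ true → (∀ x → 1 ≤ x → x + k ≡ p → occ ν x ≡ false) → ⊥
      bar-at p k≤p full free = core⇒noBar sν core p (lia (k ∷ p ∷ []) (λ k p → k :≤ p :⇒ con 1 :≤ k :⇒ ⊢ k :< p :+ p) k≤p 1≤k)
        (λ x 1≤x e → trans (cong (occ ν) (same x 1≤x e)) full) free
        where
        same : ∀ x → 1 ≤ x → In k x ≡ p → x ≡ p
        same x 1≤x e with p ≟ x
        ... | yes q = sym q
        ... | no n = ⊥-elim (In-other 1≤x k≤p n (sym e))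

    -- A multiple of k that is a part could be lowered by k unless the preceding multiple is a part
    -- too; descending, one arrives at the part k, which can be removed altogether.
    core-multiple : ∀ n → occ ν (suc n * k) ≡ false
    core-multiple n = go n refl
      where
      go : ∀ n {b} → occ ν (suc n * k) ≡ b → b ≡ false
      go n {false} _ = refl
      go zero {true} e = ⊥-elim (bar-at (1 * k) (m≤m+n k 0) e λ x 1≤x q → ⊥-elim (<⇒≢ (+-monoˡ-≤ k 1≤x) (trans (sym (+-identityʳ k)) (sym q))))
      go (suc n) {true} e = ⊥-elim (bar-at (suc (suc n) * k) (m≤m+n k _) e λ x 1≤x q →
        trans (cong (occ ν) (+-cancelʳ-≡ k x (suc n * k) (trans q (+-comm k (suc n * k))))) (go n refl))

    module OnRunner (j₀ : ℕ) (2j≤k : suc j₀ + suc j₀ ≤ k) where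

      module R = Runners j₀ 2j≤k
      open R using (j; a; b; module F)

      -- The bits of the core ν on the unfolded path, to be compared with `s j`.
      r : ℕ → Bool
      r y = if o j ≤ᵇ y then (if j + j <ᵇ k then occ ν (posB j (y ∸ o j)) else false) else not (occ ν (posA j (o j ∸ suc y)))

      -- How often a bead crosses an edge of the path while the word is read, whatever the letters
      -- and marks.
      edge : ℕ → ℕ
      edge y = if o j ≤ᵇ y then (if j + j <ᵇ k then keyCount (posB j (y ∸ o j)) ws else 0) else keyCount (posA j (o j ∸ y)) ws

      bitB : ℕ → Bool
      bitB e = if j + j <ᵇ k then occ ν (posB j e) else false

      edgeB : ℕ → ℕ
      edgeB e = if j + j <ᵇ k then keyCount (posB j e) ws else 0

      r-right : ∀ e → r (o j + e) ≡ bitB e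
      r-right e with o j ≤ᵇ o j + e | proof (o j ≤? o j + e)
      ... | true | _ = cong bitB (m+n∸m≡n (o j) e)
      ... | false | ofⁿ n = ⊥-elim (n (m≤m+n (o j) e))

      edge-right : ∀ e → edge (o j + e) ≡ edgeB e
      edge-right e with o j ≤ᵇ o j + e | proof (o j ≤? o j + e)
      ... | true | _ = cong edgeB (m+n∸m≡n (o j) e)
      ... | false | ofⁿ n = ⊥-elim (n (m≤m+n (o j) e))

      r-left : ∀ y n → y + suc n ≡ o j → r y ≡ not (occ ν (posA j n))
      r-left y n e with o j ≤ᵇ y | proof (o j ≤? y)
      ... | true | ofʸ h = ⊥-elim (m+1+n≰m y (≤-trans (≤-reflexive e) h))
      ... | false | _ = cong (λ z → not (occ ν (posA j z))) (trans (cong (_∸ suc y) (trans (sym e) (+-suc y n))) (m+n∸m≡n y n))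

      edge-left : ∀ y n → y + suc n ≡ o j → edge y ≡ keyCount (posA j (suc n)) ws
      edge-left y n e with o j ≤ᵇ y | proof (o j ≤? y)
      ... | true | ofʸ h = ⊥-elim (m+1+n≰m y (≤-trans (≤-reflexive e) h))
      ... | false | _ = cong (λ z → keyCount (posA j z) ws) (trans (cong (_∸ y) (sym e)) (m+n∸m≡n y (suc n)))

      edge-joint : keyCount (In k (posA j 0)) ws ≡ edgeB 0
      edge-joint = go (j + j <? k)
        where
        go : Dec (j + j < k) → keyCount (In k (posA j 0)) ws ≡ edgeB 0
        go (yes lt) with j + j <ᵇ k | proof (j + j <? k)
        ... | true | _ = cong (λ p → keyCount p ws) (trans R.In-A0 (sym (+-identityʳ (k ∸ j))))
        ... | false | ofⁿ n = ⊥-elim (n lt)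
        go (no n) with j + j <ᵇ k | proof (j + j <? k)
        ... | true | ofʸ lt = ⊥-elim (n lt)
        ... | false | _ = keyCount-0 ws λ h → <⇒≱ (All.lookup kys h) (lia (j ∷ k ∷ (k ∸ j) ∷ In k (posA j 0) ∷ [])
              (λ j k d p → p := d :⇒ d :+ j := k :⇒ k :≤ j :+ j :⇒ ⊢ p :+ p :≤ k) R.In-A0 (m∸n+n≡m R.j≤k) (≮⇒≥ n))

      data Place (y : ℕ) : Set where
        right′ : ∀ e → y ≡ o j + e → Place y
        left′  : ∀ n → y + suc n ≡ o j → Place y

      place : ∀ y → Place y
      place y with o j ≤? y
      ... | yes h = right′ (y ∸ o j) (sym (m+[n∸m]≡n h))
      ... | no h = left′ (o j ∸ suc y) (trans (+-suc y _) (m+[n∸m]≡n (≰⇒> h)))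

      right-balance : ∀ e → bit (bitB e) + edgeB e ≡ bit (occ (β j) (suc e)) + edgeB (suc e)
      right-balance e with j + j <ᵇ k | β j | R.kind | R.occB
      ... | _ | _ | R.alone _ | _ = refl
      ... | _ | _ | R.pair lt | ob = subst₂ (λ p q → bit (occ ν (posB j e)) + keyCount p ws ≡ bit q + keyCount (posB j (suc e)) ws) (R.In-B lt e) (sym (ob lt e))
          (trans (balance (posB j e) (≤-trans R.1≤k∸j (m≤m+n _ _))) (cong (λ p → bit (occ la (posB j e)) + keyCount p ws) (posB-+k j e)))

      r-balance : ∀ y → 1 ≤ y → bit (r y) + edge y ≡ bit (t j y) + edge (suc y)
      r-balance y 1≤y with place y
      ... | right′ e refl = trans (cong₂ (λ x z → bit x + z) (r-right e) (edge-right e)) (trans (right-balance e)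
            (cong₂ (λ x z → bit x + z) (sym (F.t-right e)) (trans (sym (edge-right (suc e))) (cong edge (+-suc (o j) e)))))
      ... | left′ n eq = lia (bit (occ ν (posA j n)) ∷ bit (not (occ ν (posA j n))) ∷ bit (occ la (posA j n)) ∷ bit (not (occ la (posA j n))) ∷ bit (r y) ∷ bit (t j y) ∷ edge y ∷ edge (suc y) ∷ keyCount (In k (posA j n)) ws ∷ keyCount (posA j n + k) ws ∷ [])
            (λ x x′ z z′ ry ty e e′ I O → x :+ I := z :+ O :⇒ x′ :+ x := con 1 :⇒ z′ :+ z := con 1 :⇒ ry := x′ :⇒ ty := z′ :⇒ e := O :⇒ e′ := I :⇒ ⊢ ry :+ e := ty :+ e′)
            (balance (posA j n) (1≤posA j₀ n)) (bit-not (occ ν (posA j n))) (bit-not (occ la (posA j n))) (cong bit (r-left y n eq)) (cong bit (trans (F.t-left y n eq) (cong not (R.occA n))))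
            (trans (edge-left y n eq) (cong (λ p → keyCount p ws) (sym (posA-+k j n)))) (upper n eq)
        where
        upper : ∀ n → y + suc n ≡ o j → edge (suc y) ≡ keyCount (In k (posA j n)) ws
        upper zero eq = trans (cong edge (trans (+-comm 1 y) (trans eq (sym (+-identityʳ (o j)))))) (trans (edge-right 0) (sym edge-joint))
        upper (suc n) eq = trans (edge-left (suc y) n (trans (sym (+-suc y (suc n))) eq)) (cong (λ p → keyCount p ws) (sym (R.In-A n)))

      right-down : ∀ e → bitB (suc e) ≡ true → bitB e ≡ true
      right-down e with j + j <ᵇ k | proof (j + j <? k)
      ... | false | _ = λ ()
      ... | true | ofʸ lt = λ h → go h refl
        where
        go : occ ν (posB j (suc e)) ≡ true → ∀ {b} → occ ν (posB j e) ≡ b → b ≡ true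
        go h {true} _ = refl
        go h {false} q = ⊥-elim (bar-at (posB j (suc e)) (≤-trans (m≤m+n k (e * k)) (m≤n+m _ (k ∸ j))) h
          λ x 1≤x z → trans (cong (occ ν) (+-cancelʳ-≡ k x (posB j e) (trans z (sym (posB-+k j e))))) q)

      -- The beads j and k - j together would form a removable pair.
      joint-down : bitB 0 ≡ true → occ ν (posA j 0) ≡ false
      joint-down with j + j <ᵇ k | proof (j + j <? k)
      ... | false | _ = λ ()
      ... | true | ofʸ lt = λ h → go h refl
        where
        go : occ ν (posB j 0) ≡ true → ∀ {b} → occ ν (posA j 0) ≡ b → b ≡ false
        go h {false} _ = refl
        go h {true} q = ⊥-elim (core⇒noBar sν core (posB j 0)
          (lia (j ∷ k ∷ (k ∸ j) ∷ []) (λ j k d → j :+ j :< k :⇒ d :+ j := k :⇒ ⊢ k :< d :+ con 0 :+ (d :+ con 0)) lt (m∸n+n≡m R.j≤k))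
          full (λ x 1≤x z → ⊥-elim (<⇒≱ (k∸j<k R.1≤j R.j≤k) (≤-trans (m≤n+m k x) (≤-reflexive (trans z (+-identityʳ (k ∸ j))))))))
          where
          full : ∀ x → 1 ≤ x → In k x ≡ posB j 0 → occ ν x ≡ true
          full x 1≤x z with In-cases {k} {x} z
          ... | inj₁ w = trans (cong (occ ν) w) h
          ... | inj₂ (small , w) = trans (cong (occ ν) (lia (x ∷ (k ∸ x) ∷ j ∷ (k ∸ j) ∷ k ∷ []) (λ x d j e k → d :+ x := k :⇒ e :+ j := k :⇒ d := e :+ con 0 :⇒ ⊢ x := j :+ con 0)
                  (m∸n+n≡m (≤-trans (m≤m+n x x) small)) (m∸n+n≡m R.j≤k) w)) q

      left-down : ∀ n → occ ν (posA j n) ≡ false → occ ν (posA j (suc n)) ≡ false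
      left-down n h = go refl
        where
        go : ∀ {b} → occ ν (posA j (suc n)) ≡ b → b ≡ false
        go {false} _ = refl
        go {true} q = ⊥-elim (bar-at (posA j (suc n)) (≤-trans (m≤m+n k (n * k)) (m≤n+m _ j)) q
          λ x 1≤x z → trans (cong (occ ν) (+-cancelʳ-≡ k x (posA j n) (trans z (sym (posA-+k j n))))) h)

      r-down : ∀ y → 1 ≤ y → r (suc y) ≡ true → r y ≡ true
      r-down y 1≤y h with place y
      ... | right′ e refl = trans (r-right e) (right-down e (trans (sym (r-right (suc e))) (trans (cong r (+-suc (o j) e)) h)))
      ... | left′ zero eq = trans (r-left y 0 eq) (cong not (joint-down (trans (sym (r-right 0)) (trans (cong r (trans (+-identityʳ (o j)) (trans (sym eq) (+-comm y 1)))) h))))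
      ... | left′ (suc n) eq = trans (r-left y (suc n) eq) (cong not (left-down n (not-true (trans (sym (r-left (suc y) n (trans (sym (+-suc y (suc n))) eq))) h))))
        where
        not-true : ∀ {b} → not b ≡ true → b ≡ false
        not-true {false} _ = refl

      M : ℕ
      M = o j + K

      edge-1 : edge 1 ≡ 0
      edge-1 = trans (edge-left 1 n eq) (N≡0 (≤-trans (≤-trans (n<1+n K) (m≤n+m (suc K) (length (μ j) + a))) (≤-trans (≤-reflexive (+-suc _ K)) (n≤runner j (suc n)))))
        where
        n : ℕ
        n = length (μ j) + a + K
        eq : 1 + suc n ≡ o j
        eq = trans (+-comm 2 n) refl

      edge-far : ∀ e → K < e → edge (o j + e) ≡ 0
      edge-far e lt = trans (edge-right e) go
        where
        go : edgeB e ≡ 0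
        go with j + j <ᵇ k
        ... | true = N≡0 (≤-trans lt (n≤runner (k ∸ j) e))
        ... | false = refl

      top-β : top (β j) ≤ K
      top-β with j + j <ᵇ k | β j | R.kind
      ... | _ | _ | R.pair _ = top-runner R.1≤k∸j (m∸n≤m k j)
      ... | _ | _ | R.alone _ = z≤n

      ht-far : ∀ e → K ≤ e → F.ht (o j + e) ≡ 0
      ht-far e le = trans (F.ht-right e) (cnt-top (strict⇒decreasing R.isB) (s≤s (≤-trans top-β le)))

      -- No bead crosses the first edge or a distant one, so ν has as many beads on the path as la,
      -- and their number is known from `F.ht-1`.
      total-r : ∀ n → M ≤ n → tot r n 1 ≡ length (μ j) + F.N
      total-r n h = trans (sym (trans (cong₂ _+_ (trans (cong (tot r n 1 +_) edge-1) (+-identityʳ _)) far-ht) (+-identityʳ _)))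
          (trans (tot-balance r (t j) F.ht edge F.t-tail r-balance n 1 ≤-refl) (trans (cong₂ _+_ F.ht-1 far-edge) (+-identityʳ _)))
        where
        e : ℕ
        e = suc n ∸ o j
        eq : o j + e ≡ 1 + n
        eq = m+[n∸m]≡n (≤-trans (m≤m+n (o j) K) (≤-trans h (n≤1+n n)))
        K<e : K < e
        K<e = +-cancelˡ-< (o j) _ _ (≤-trans (s≤s h) (≤-reflexive (sym eq)))
        far-ht : F.ht (1 + n) ≡ 0
        far-ht = trans (cong F.ht (sym eq)) (ht-far e (<⇒≤ K<e))
        far-edge : edge (1 + n) ≡ 0
        far-edge = trans (cong edge (sym eq)) (edge-far e K<e)

      -- Both are initial segments with the same number of beads: the one by `r-down` and `total-r`,
      -- the other by definition.
      r≡s : ∀ y → 1 ≤ y → r y ≡ s j y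
      r≡s (suc i) _ = go refl (proof (suc i ≤? length (μ j) + F.N))
        where
        n : ℕ
        n = M + suc i
        go : ∀ {x z} → r (suc i) ≡ x → Reflects (suc i ≤ length (μ j) + F.N) z → x ≡ z
        go {true} _ (ofʸ _) = refl
        go {false} _ (ofⁿ _) = refl
        go {true} e (ofⁿ q) = ⊥-elim (q (≤-trans (tot-true r r-down n 1 i ≤-refl (m≤n+m (suc i) M) e) (≤-reflexive (total-r n (m≤m+n M _)))))
        go {false} e (ofʸ q) = ⊥-elim (<⇒≱ q (≤-trans (≤-reflexive (sym (total-r n (m≤m+n M _)))) (tot-false r r-down n 1 i ≤-refl e)))

      core-A : ∀ n → occ ν (posA j n) ≡ c (posA j n)
      core-A n with suc n <? o j
      ... | yes lt = not-injective′ (trans (sym (r-left y n eq)) (trans (r≡s y (m<n⇒0<n∸m lt)) (R.s-left y n eq)))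
        where
        y : ℕ
        y = o j ∸ suc n
        eq : y + suc n ≡ o j
        eq = m∸n+n≡m (<⇒≤ lt)
        not-injective′ : ∀ {x z} → not x ≡ not z → x ≡ z
        not-injective′ {true} {true} _ = refl
        not-injective′ {false} {false} _ = refl
      ... | no ge = trans (bit-injective (m+n≡0⇒m≡0 (bit (occ ν (posA j n))) (trans (balance (posA j n) (1≤posA j₀ n))
            (cong₂ _+_ (cong bit (occ-far (posA j n) K<A)) (N≡0 (≤-trans K<A (m≤m+n _ k))))))) (sym (trans (R.far n (≮⇒≥ ge)) (trans (R.occA n) (occ-far (posA j n) K<A))))
        where
        K<A : K < posA j n
        K<A = ≤-trans (s≤s⁻¹ (≤-trans (K<o j) (≮⇒≥ ge))) (n≤runner j n)

      core-B : j + j < k → ∀ e → occ ν (posB j e) ≡ c (posB j e)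
      core-B lt e = trans (sym (pick′ (λ e → occ ν (posB j e)))) (trans (sym (r-right e)) (trans (r≡s (o j + e) (≤-trans (≤-trans (s≤s z≤n) (K<o j)) (m≤m+n _ e)))
          (trans (R.s-right e) (pick′ (λ e → c (posB j e))))))
        where
        pick′ : ∀ (f : ℕ → Bool) → (if j + j <ᵇ k then f e else false) ≡ f e
        pick′ f with j + j <ᵇ k | proof (j + j <? k)
        ... | true | _ = refl
        ... | false | ofⁿ n = ⊥-elim (n lt)

    core≡c : ∀ x → 1 ≤ x → occ ν x ≡ c x
    core≡c x 1≤x with position x
    ... | multiple zero refl = ⊥-elim (<⇒≱ 1≤x z≤n)
    ... | multiple (suc n) refl = trans (core-multiple n) (sym (c-multiple (suc n)))
    ... | onA (suc j₀) n _ 2j≤k refl = OnRunner.core-A j₀ 2j≤k n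
    ... | onB (suc j₀) e _ 2j<k refl = OnRunner.core-B j₀ (<⇒≤ 2j<k) 2j<k e

  -- The correspondences of words with ribbon tableaux and with tuples of fillings

  WordW : List Entry → Set
  WordW ws = Word ws × (∀ i → count i ws ≡ wAt w i)

  words-tableaux : Correspondence WordW (RibbonTabW k la w)
  words-tableaux = Tableaux.words≅tableaux 1≤k sla c C c-far c-core (λ ν ws sν core kys run → core≡c ν ws sν core kys run) w

  encodings : ∀ j → j ≤ h → Encoding (Tab j) (s j) (t j)
  encodings zero _ = shifted-encoding (Abacus.abacus-strict k sla 1≤k ≤-refl)
  encodings (suc j₀) j≤ = Runners.encoding j₀ (half≤ j≤)

  Codes : ∀ j → j ≤ h → Filling → List Entry → Set
  Codes j j≤ = Encoding.Codes (encodings j j≤)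

  TabsW : List Filling → Set
  TabsW fs = length fs ≡ suc h × (∀ j → j ≤ h → Tab j (at fs j)) × (∀ i → countFs i fs ≡ wAt w i)

  product⇒tabs : ∀ fs → ProductTabW (abacus k la k) μ (k / 2) w fs → TabsW fs
  product⇒tabs _ (f0 , rest , refl , t0 , len , qs , wt) = cong suc len , tab , wt
    where
    tab : ∀ j → j ≤ h → Tab j (at (f0 ∷ rest) j)
    tab zero _ = t0
    tab (suc j) j≤ = qtabs⇒ μ 1 rest qs j (≤-trans j≤ (≤-reflexive (sym len)))

  tabs⇒product : ∀ fs → TabsW fs → ProductTabW (abacus k la k) μ (k / 2) w fs
  tabs⇒product (f0 ∷ rest) (len , tab , wt) = f0 , rest , refl , tab 0 z≤n , suc-injective len ,
    ⇒qtabs μ 1 rest (λ n lt → tab (suc n) (≤-trans lt (≤-reflexive (suc-injective len)))) , wt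

  Coded : List Entry → List Filling → (ℕ → List Entry) → Set
  Coded ws fs W = Runnerwise W × (∀ j (j≤ : j ≤ h) → Codes j j≤ (at fs j) (W j)) × Linked-by ws W

  word-letters : ∀ {ws} → WordW ws → Letters≤ m ws
  word-letters ((_ , ls , _) , wt) = weight⇒letters w ls wt

  total : ∀ ws → WordW ws → ∃ λ fs → TabsW fs × ∃ (Coded ws fs)
  total ws ww@(wd , wt) = fs , (length-applyUpTo f (suc h) , tab , weights) , W , rw , codes , linked
    where
    ls : Letters≤ m ws
    ls = word-letters ww
    ad : Admissible (G ws)
    ad = word-admissible wd ls
    W : ℕ → List Entry
    W j = wordOf m (o j + K) (view (G ws) j)
    rw : Runnerwise W
    rw j j≤ = runner-word (proj₁ ad) (G-far wd) ad j j≤ , wordOf-letters m (o j + K) (view (G ws) j)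
    linked : Linked-by ws W
    linked j j≤ i 1≤i i≤m y _ = entry-wordOf m (o j + K) (view (G ws) j) (view-out (proj₁ ad) (G-far wd) j) i 1≤i i≤m y
    -- The encoding of the runner j exists only for j ≤ h; the default filling beyond is never
    -- looked at.
    choose : ∀ j → Dec (j ≤ h) → Filling
    choose j (yes j≤) = proj₁ (Encoding.decode (encodings j j≤) (W j) (proj₁ (rw j j≤)))
    choose j (no _) = []
    f : ℕ → Filling
    f j = choose j (j ≤? h)
    fs : List Filling
    fs = applyUpTo f (suc h)
    chosen : ∀ j (j≤ : j ≤ h) → Tab j (f j) × Codes j j≤ (f j) (W j)
    chosen j j≤ = go (j ≤? h)
      where
      go : (d : Dec (j ≤ h)) → Tab j (choose j d) × Codes j j≤ (choose j d) (W j)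
      go (no n) = ⊥-elim (n j≤)
      -- The codes depend on the proof of j ≤ h, so the proof found by the test must be identified
      -- with the given one.
      go (yes p) = subst (λ q → Tab j (choose j (yes p)) × Codes j q (choose j (yes p)) (W j)) (≤-irrelevant p j≤)
        (proj₂ (Encoding.decode (encodings j p) (W j) (proj₁ (rw j p))))
    at-f : ∀ j → j ≤ h → at fs j ≡ f j
    at-f j j≤ = at-applyUpTo f (suc h) j (s≤s j≤)
    tab : ∀ j → j ≤ h → Tab j (at fs j)
    tab j j≤ = subst (Tab j) (sym (at-f j j≤)) (proj₁ (chosen j j≤))
    codes : ∀ j (j≤ : j ≤ h) → Codes j j≤ (at fs j) (W j)
    codes j j≤ = subst (λ g → Codes j j≤ g (W j)) (sym (at-f j j≤)) (proj₂ (chosen j j≤))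
    weights : ∀ i → countFs i fs ≡ wAt w i
    weights i = trans (countFs-sum i h fs (length-applyUpTo f (suc h))) (trans (sumTo-cong h λ j j≤ → Encoding.counts (encodings j j≤) (tab j j≤) (proj₁ (rw j j≤)) (codes j j≤) i)
      (trans (sym (total-count wd ls rw linked i)) (wt i)))

  cototal : ∀ fs → TabsW fs → ∃ λ ws → WordW ws × ∃ (Coded ws fs)
  cototal fs (len , tab , wt) = A.merged , (A.merged-word , weights) , W , rw , codes , A.merged-linked
    where
    choose : ∀ j → Dec (j ≤ h) → List Entry
    choose j (yes j≤) = proj₁ (Encoding.encode (encodings j j≤) (at fs j) (tab j j≤))
    choose j (no _) = []
    W : ℕ → List Entry
    W j = choose j (j ≤? h)
    chosen : ∀ j (j≤ : j ≤ h) → Word₁ (s j) (t j) (W j) × Codes j j≤ (at fs j) (W j)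
    chosen j j≤ = go (j ≤? h)
      where
      go : (d : Dec (j ≤ h)) → Word₁ (s j) (t j) (choose j d) × Codes j j≤ (at fs j) (choose j d)
      go (no n) = ⊥-elim (n j≤)
      go (yes p) rewrite ≤-irrelevant j≤ p = proj₂ (Encoding.encode (encodings j p) (at fs j) (tab j p))
    codes : ∀ j (j≤ : j ≤ h) → Codes j j≤ (at fs j) (W j)
    codes j j≤ = proj₂ (chosen j j≤)
    counts : ∀ i j → j ≤ h → countF i (at fs j) ≡ count i (W j)
    counts i j j≤ = Encoding.counts (encodings j j≤) (tab j j≤) (proj₁ (chosen j j≤)) (codes j j≤) i
    sums : ∀ i → sumTo h (λ j → count i (W j)) ≡ wAt w i
    sums i = trans (sym (sumTo-cong h (counts i))) (trans (sym (countFs-sum i h fs len)) (wt i))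
    rw : Runnerwise W
    -- A letter of a single factor contributes to the total weight, so it cannot exceed the length
    -- of w.
    rw j j≤ = proj₁ (chosen j j≤) , All.tabulate λ {e} e∈ → All.lookup (proj₁ (proj₂ (proj₁ (chosen j j≤)))) e∈ ,
      ≮⇒≥ λ lt → <⇒≱ (≤-trans (count-pos e∈) (sumTo-≤ h {λ j → count (idx (proj₁ e)) (W j)} j j≤)) (≤-reflexive (trans (sums (idx (proj₁ e))) (wAt-beyond w (idx (proj₁ e)) lt)))
    module A = Assembly W rw
    weights : ∀ i → count i A.merged ≡ wAt w i
    weights i = trans (total-count A.merged-word (wordOf-letters m A.K′ A.U) rw A.merged-linked i) (sums i)

  -- The link to ws fixes all entries with letters 1, ..., m and positive keys, and the words have
  -- no others.
  same-words : ∀ {ws W W′} → Runnerwise W → Runnerwise W′ → Linked-by ws W → Linked-by ws W′ → ∀ j → j ≤ h → W j ≡ W′ j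
  same-words {ws} {W} {W′} rw rw′ lk lk′ j j≤ = word-extensional (proj₁ (proj₁ (rw j j≤))) (proj₁ (proj₁ (rw′ j j≤))) (proj₂ (rw j j≤)) (proj₂ (rw′ j j≤))
      (word₁-noDouble (proj₁ (rw j j≤)) (proj₂ (rw j j≤))) (word₁-noDouble (proj₁ (rw′ j j≤)) (proj₂ (rw′ j j≤))) go
    where
    none : ∀ {V} → Runnerwise V → ∀ i → G (V j) i 0 ≡ nothing
    none {V} rv i = entry-nothing (V j) λ b e → case All.lookup (proj₁ (proj₂ (proj₂ (proj₁ (rv j j≤))))) e of λ ()
    go : ∀ i → 1 ≤ i → i ≤ m → ∀ p → G (W j) i p ≡ G (W′ j) i p
    go i a b zero = trans (none rw i) (sym (none rw′ i))
    go i a b (suc p) = trans (lk j j≤ i a b (suc p) (s≤s z≤n)) (sym (lk′ j j≤ i a b (suc p) (s≤s z≤n)))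

  words-tabs : Correspondence WordW (ProductTabW (abacus k la k) μ (k / 2) w)
  words-tabs = record
    { Rel = λ ws fs → ∃ (Coded ws fs)
    ; total = λ ws ww → let (fs , tb , r) = total ws ww in fs , tabs⇒product fs tb , r
    ; cototal = λ fs pr → cototal fs (product⇒tabs fs pr)
    ; functional = λ {ws} {fs} {fs′} ww pr pr′ r r′ → functional {ws} {fs} {fs′} (product⇒tabs fs pr) (product⇒tabs fs′ pr′) r r′
    ; injective = λ {ws} {ws′} {fs} ww ww′ pr r r′ → injective {ws} {ws′} {fs} ww ww′ (product⇒tabs fs pr) r r′
    }
    where
    functional : ∀ {ws fs fs′} → TabsW fs → TabsW fs′ → ∃ (Coded ws fs) → ∃ (Coded ws fs′) → fs ≡ fs′
    functional {ws} {fs} {fs′} (len , tab , _) (len′ , tab′ , _) (W , rw , cd , lk) (W′ , rw′ , cd′ , lk′) =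
      at-extensional fs fs′ (trans len (sym len′)) λ j lt → go j (s≤s⁻¹ (≤-trans lt (≤-reflexive len)))
      where
      go : ∀ j → j ≤ h → at fs j ≡ at fs′ j
      go j j≤ = Encoding.injective (encodings j j≤) (tab j j≤) (tab′ j j≤) (cd j j≤)
        (subst (Codes j j≤ (at fs′ j)) (sym (same-words {ws} rw rw′ lk lk′ j j≤)) (cd′ j j≤))
    injective : ∀ {ws ws′ fs} → WordW ws → WordW ws′ → TabsW fs → ∃ (Coded ws fs) → ∃ (Coded ws′ fs) → ws ≡ ws′
    injective {ws} {ws′} {fs} ww ww′ (len , tab , _) (W , rw , cd , lk) (W′ , rw′ , cd′ , lk′) =
      word-extensional (proj₁ wd) (proj₁ wd′) ls ls′ (word-noDouble wd ls) (word-noDouble wd′ ls′)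
        (view-injective (proj₁ ad) (proj₁ ad′) (G-far wd) (G-far wd′) ad ad′ λ j j≤ i a b y 1≤y →
          trans (sym (lk j j≤ i a b y 1≤y)) (trans (cong (λ V → G V i y) (same j j≤)) (lk′ j j≤ i a b y 1≤y)))
      where
      wd : Word ws
      wd = proj₁ ww
      wd′ : Word ws′
      wd′ = proj₁ ww′
      ls : Letters≤ m ws
      ls = word-letters ww
      ls′ : Letters≤ m ws′
      ls′ = word-letters ww′
      ad : Admissible (G ws)
      ad = word-admissible wd ls
      ad′ : Admissible (G ws′)
      ad′ = word-admissible wd′ ls′
      same : ∀ j → j ≤ h → W j ≡ W′ j
      same j j≤ = Encoding.functional (encodings j j≤) (tab j j≤) (proj₁ (rw j j≤)) (proj₁ (rw′ j j≤)) (cd j j≤) (cd′ j j≤)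

  -- Deciding and enumerating the words

  bounded? : ∀ {P : ℕ → Set} → (∀ x → Dec (P x)) → ∀ n → Dec (∀ x → x < n → P x)
  bounded? P? zero = yes λ _ ()
  bounded? {P} P? (suc n) with bounded? P? n | P? n
  ... | no f | _ = no λ g → f λ x lt → g x (m≤n⇒m≤1+n lt)
  ... | yes _ | no f = no λ g → f (g n ≤-refl)
  ... | yes f | yes p = yes go
    where
    go : ∀ x → x < suc n → P x
    go x lt with x ≟ n
    ... | yes refl = p
    ... | no ne = f x (≤∧≢⇒< (s≤s⁻¹ lt) ne)

  run-idle : ∀ {I O b} ws → (∀ {l p} → (l , p) ∈ ws → p ≢ I × p ≢ O) → Run I O b ws b
  run-idle [] _ = []
  run-idle ((l , p) ∷ ws) n = idle (proj₁ (n (here refl))) (proj₂ (n (here refl))) ∷ run-idle ws (λ q → n (there q))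

  letters-count : ∀ {ws} → Letters≤ m ws → ∀ i → i ≡ 0 ⊎ m < i → count i ws ≡ 0
  letters-count [] i _ = refl
  letters-count {(l , p) ∷ ws} ((a , b) ∷ ls) i out with idx l ≡ᵇ i | proof (idx l ≟ i)
  ... | false | _ = letters-count ls i out
  ... | true | ofʸ refl with out
  ...   | inj₁ z = ⊥-elim (<⇒≢ a (sym z))
  ...   | inj₂ z = ⊥-elim (<⇒≱ z b)

  -- Beyond X a position is too large for a part of la or of the core and for any key up to K;
  -- exceeding k, it is filled only by the key equal to itself. Its run is therefore idle.
  X : ℕ
  X = suc (K + k + C)

  word? : ∀ ws → ws ∈ sublists (fullAlphabet m K) → Dec (WordW ws)
  word? ws ws∈ = map′ to from (AllPairs.allPairs? _≺?_ ws ×-dec All.all? (λ e → 1 ≤? idx (proj₁ e)) ws ×-dec All.all? (λ e → k <? proj₂ e + proj₂ e) ws ×-dec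
      bounded? (λ x → run? (In k (suc x)) (suc x + k) (c (suc x)) ws (occ la (suc x))) X ×-dec bounded? (λ i → count i ws ≟ wAt w i) (suc m))
    where
    bounds : ∀ {l p} → (l , p) ∈ ws → 1 ≤ idx l × idx l ≤ m × 1 ≤ p × p ≤ K
    bounds e = ∈-fullAlphabet⁻ m K (∈-sublists⁻ ws∈ e)
    Checked : Set
    Checked = Sorted ws × All (λ e → 1 ≤ idx (proj₁ e)) ws × All (λ e → k < proj₂ e + proj₂ e) ws ×
      (∀ x → x < X → Run (In k (suc x)) (suc x + k) (c (suc x)) ws (occ la (suc x))) × (∀ i → i < suc m → count i ws ≡ wAt w i)
    from : WordW ws → Checked
    from ((srt , ls , kys , run) , wt) = srt , ls , kys , (λ x _ → run (suc x) (s≤s z≤n)) , λ i _ → wt i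
    to : Checked → WordW ws
    to (srt , ls , kys , run , wt) = (srt , ls , kys , runs) , weights
      where
      runs : ∀ x → 1 ≤ x → Run (In k x) (x + k) (c x) ws (occ la x)
      runs (suc x) _ with x <? X
      ... | yes lt = run x lt
      ... | no ge = subst₂ (λ a b → Run (In k (suc x)) (suc x + k) a ws b) (sym (c-far (suc x) C<x)) (sym (occ-top (strict⇒decreasing sla) K<x))
          (run-idle ws λ e → let p≤ = proj₂ (proj₂ (proj₂ (bounds e))) in
            (λ q → <⇒≱ K<x (≤-trans (≤-reflexive (sym (trans q (In-big big)))) p≤)) , (λ q → <⇒≱ K<x (≤-trans (m≤m+n (suc x) k) (≤-trans (≤-reflexive (sym q)) p≤))))
        where
        X≤x : X ≤ x
        X≤x = ≮⇒≥ ge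
        K<x : K < suc x
        K<x = s≤s (≤-trans (≤-trans (m≤m+n K k) (≤-trans (m≤m+n (K + k) C) (n≤1+n _))) X≤x)
        C<x : C < suc x
        C<x = s≤s (≤-trans (≤-trans (m≤n+m C (K + k)) (n≤1+n _)) X≤x)
        big : k < suc x + suc x
        big = ≤-trans (s≤s (≤-trans (≤-trans (m≤n+m k K) (≤-trans (m≤m+n (K + k) C) (n≤1+n _))) X≤x)) (m≤m+n (suc x) (suc x))
      weights : ∀ i → count i ws ≡ wAt w i
      weights i with i <? suc m
      ... | yes lt = wt i lt
      ... | no ge = trans (letters-count (All.tabulate λ e → proj₁ (bounds e) , proj₁ (proj₂ (bounds e))) i (inj₂ (≮⇒≥ ge))) (sym (wAt-beyond w i (≮⇒≥ ge)))

  words : ∃ λ n → Enumerates WordW n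
  words = enumerate (sublists (fullAlphabet m K)) (sublists-unique (sorted-unique (fullAlphabet-sorted m K))) word? complete
    where
    complete : ∀ ws → WordW ws → ws ∈ sublists (fullAlphabet m K)
    complete ws ww@(wd@(srt , _ , kys , _) , _) = ∈-sublists⁺ (fullAlphabet-sorted m K) srt λ e →
      ∈-fullAlphabet⁺ m K (proj₁ (All.lookup (word-letters ww) e)) (proj₂ (All.lookup (word-letters ww) e)) (positive (All.lookup kys e)) (word-keys≤K wd e)

mainTheorem3 : (k : ℕ) .{{_ : NonZero k}} (la : List ℕ) → StrictPartition la →
    (μ : ℕ → List ℕ) →
    (∀ i → 1 ≤ i → 2 * i < k → UnderlyingShape (abacus k la i) (abacus k la (k ∸ i)) (μ i)) →
    (∀ i → 1 ≤ i → 2 * i ≡ k → UnderlyingShape (abacus k la i) [] (μ i)) →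
    (w : List ℕ) →
    ∃[ c ] (Enumerates (RibbonTabW k la w) c × Enumerates (ProductTabW (abacus k la k) μ (k / 2) w) c)
mainTheorem3 k la sla μ hμ hμ′ w = proj₁ (words S) , transfer (words-tableaux S) (proj₂ (words S)) , transfer (words-tabs S) (proj₂ (words S))
  where
  open OfSetting using (words; words-tableaux; words-tabs)
  S : Setting
  -- The given instance is irrelevant and cannot be stored in a field; passing through 0 < k yields
  -- a relevant one.
  S = record { k = k ; k≢0 = >-nonZero (>-nonZero⁻¹ k) ; la = la ; sla = sla ; μ = μ ; hμ = hμ ; hμ′ = hμ′ ; w = w }
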